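{- Let $S$ and $T$ be semistandard shifted Young tableaux such that $T$ extends $S$, and let the modified shifted tableau switching transform $(S,T)$ into $(\widetilde{{}^ST},\widetilde{S_T})$. Then: (a) the modified shifted tableau switching transforms $(\widetilde{{}^ST},\widetilde{S_T})$ into $(S,T)$; (b) if $T$ is a modified LRS tableau, then so is $\widetilde{{}^ST}$; (c) if $S$ is a modified LRS tableau, then so is $\widetilde{S_T}$.
   Context: Shifted shapes: for a strict partition $\lambda$, $S(\lambda)=\{(i,j):1\le i\le\ell(\lambda),\ i\le j\le\lambda_i+i-1\}$ (matrix coordinates), main diagonal $\{(i,i)\}$, $\lambda/\mu=S(\lambda)\setminus S(\mu)$; $\lambda/\mu$ extends $\mu/\nu$ when $\nu\subseteq\mu\subseteq\lambda$; a filling extends another if its shape does. Letters $X=\{1'<1<2'<2<\cdots\}$; bold $\mathbf k$ means $k$ or $k'$. A shifted Young tableau (SYT): filling of a skew shifted shape by $X$, weakly increasing along rows and columns, each column with at most one unprimed $k$, each row with at most one $k'$; semistandard (SSYT) if no primed entry is on the main diagonal. $\max(T)$ is the largest $i$ such that $T$ contains $i$ or $i'$. The reading word $w(T)$ reads entries right to left in each row, starting from the top row. Lattice property: for a word $w=w_1\cdots w_n$ in $X$, let $\hat w$ be obtained by reading $w$ from right to left and replacing each $k$ by $(k+1)'$ and each $k'$ by $k$. Let $w\hat w=a_1\cdots a_{2n}$ and $m_i(j)$ the number of occurrences of the unprimed letter $i$ in $a_1\cdots a_j$ ($m_i(0)=0$). $w$ has the lattice property if for all $i\ge2$ and $0\le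 j<2n$, whenever $m_i(j)=m_{i-1}(j)$, $a_{j+1}$ is neither $i$ nor $i'$. A modified LRS tableau is an SSYT whose reading word has the lattice property. Switches on fillings with boxes labelled $\mathbf a$-boxes (entries $a,a'$) or $\mathbf b$-boxes (entries $b,b'$), at an $\mathbf a$-box $c=(i,j)$ with entry $\alpha$, $E=(i,j+1)$, $S'=(i+1,j)$ (entries move with labels): (S3) $j=i$, $E$ a $\mathbf b$-box with entry $b'$, $(i+1,i+1)$ a $\mathbf b$-box with entry $\beta$: new entries $\beta$ at $(i,i)$, $b$ at $(i,i+1)$ ($\mathbf b$-boxes), $\alpha$ at $(i+1,i+1)$. (S4) $j=i+1$, $\alpha=a$, $(i,i)$ an $\mathbf a$-box with entry $\alpha_0$, $S'=(i+1,i+1)$ a $\mathbf b$-box with entry $\beta$, $E$ not a $\mathbf b$-box: new entries $\beta$ at $(i,i)$, $a'$ at $(i,i+1)$, $\alpha_0$ at $(i+1,i+1)$. (S7) as (S4) but $E$ a $\mathbf b$-box with entry $b$ (unchanged). (S5) $E,S'$ both $\mathbf b$-boxes, $E$ entry $b'$: interchange $c,E$. (S6) $E,S'$ both $\mathbf b$-boxes, $E$ entry $b$, not (S7): interchange $c,S'$. (S1) only $E$ a $\mathbf b$-box, not (S3): interchange $c,E$. (S2) only $S'$ a $\mathbf b$-box, not (S4): interchange $c,S'$. Modified switches: (S1$'$) $c=(i,i)$ with entry $a$, $E$ the only $\mathbf b$-neighbor with entry $b'$, not case (S3): new entries $b$ at $(i,i)$, $a'$ at $(i,i+1)$. (S2$'$)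 $c$ has entry $a'$, $S'=(i+1,i+1)$ on the main diagonal with entry $b$ is the only $\mathbf b$-neighbor: new entries $b'$ at $c$, $a$ at $S'$. (S6$'$) $c$ has entry $a'$, $E$ has entry $b$, $S'=(i+1,i+1)$ on the main diagonal has entry $b$: new entries $b'$ at $c$, $b$ at $E$, $a$ at $S'$. Fully switched: no $\mathbf a$-box has a $\mathbf b$-box as east or south neighbor. $\Box(U)$: easternmost $\mathbf a$-box with entry $a$ having a $\mathbf b$-box as east or south neighbor, or if none, the southernmost such with entry $a'$. Modified shifted switching process on a pair: apply at $\Box(U)$ the applicable switch (a modified one in the configurations of (S1$'$), (S2$'$), (S6$'$), otherwise one of (S1)–(S7)) until fully switched. Modified shifted tableau switching of $(S,T)$, $T$ extending $S$: label boxes by $S$ or $T$; with $m=\max(S)$, $n=\max(T)$, for $i=m,\ldots,1$ and for each $i$, $j=1,\ldots,n$, apply in the current filling the modified shifted switching process to (current $S$-boxes with entries $\mathbf i$, current $T$-boxes with entries $\mathbf j$). The result is $(\widetilde{{}^ST},\widetilde{S_T})$, where $\widetilde{S_T}$ is the final filling of the $S$-labelled boxes and $\widetilde{{}^ST}$ that of the $T$-labelled boxes; components are treated independently. -}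

module Defs where

open import Data.Nat using (ℕ; zero; suc; _+_; _*_; _∸_; _≤_; _<_)
open import Data.Nat.Properties using (_≟_)
open import Data.Bool using (Bool; true; false; if_then_else_)
open import Data.Maybe using (Maybe; just; nothing; Is-just)
open import Data.List using (List; []; _∷_; length; _++_; reverse; map; upTo; concatMap; mapMaybe; take)
open import Data.List.Relation.Unary.Linked using (Linked)
open import Data.List.Relation.Unary.All using (All)
open import Data.Product using (Σ; _×_; _,_; proj₁; proj₂)
open import Data.Product.Properties using (≡-dec)
open import Data.Sum using (_⊎_)
open import Relation.Nullary using (¬_; does)
open import Relation.Binary.PropositionalEquality using (_≡_; _≢_)
open import Relation.Binary using (DecidableEquality)

-- Letters of the alphabet X = {1' < 1 < 2' < 2 < ...}
-- lt k false is the unprimed letter k, lt k true is the primed letter k'.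
-- (Genuine letters have k ≥ 1; this is imposed in the tableau conditions.)

record Letter : Set where
  constructor lt
  field
    val    : ℕ
    primed : Bool
open Letter public

unp : ℕ → Letter
unp k = lt k false

pr : ℕ → Letter
pr k = lt k true

rank : Letter → ℕ
rank (lt k false) = 2 * k
rank (lt k true)  = 2 * k ∸ 1

_≤L_ : Letter → Letter → Set
x ≤L y = rank x ≤ rank y

-- Boxes (matrix coordinates (row , column), 1-indexed) and shifted shapes

Box : Set
Box = ℕ × ℕ

row col : Box → ℕ
row = proj₁
col = proj₂

_≟B_ : DecidableEquality Box
_≟B_ = ≡-dec _≟_ _≟_

StrictPartition : List ℕ → Set
StrictPartition l = Linked (λ x y → y < x) l × All (λ x → 0 < x) l

-- λ_i (1-indexed); 0 beyond the length
part : List ℕ → ℕ → ℕ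
part []       _             = 0
part (x ∷ xs) zero          = 0
part (x ∷ xs) (suc zero)    = x
part (x ∷ xs) (suc (suc i)) = part xs (suc i)

InS : List ℕ → Box → Set
InS l (i , j) = (1 ≤ i) × (i ≤ length l) × (i ≤ j) × (j < part l i + i)

_⊆S_ : List ℕ → List ℕ → Set
μ ⊆S l = ∀ b → InS μ b → InS l b

InSkew : List ℕ → List ℕ → Box → Set
InSkew l μ b = InS l b × ¬ InS μ b

-- Fillings: partial maps from boxes to letters (finite support given by
-- a skew shifted shape).

Filling : Set
Filling = Box → Maybe Letter

HasShape : Filling → List ℕ → List ℕ → Set
HasShape F l μ = ∀ b → (Is-just (F b) → InSkew l μ b) × (InSkew l μ b → Is-just (F b))

IsSkewShiftedFilling : Filling → Set
IsSkewShiftedFilling F =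
  Σ (List ℕ) λ l → Σ (List ℕ) λ μ →
    StrictPartition l × StrictPartition μ × μ ⊆S l × HasShape F l μ

Extends : Filling → Filling → Set
Extends T S =
  Σ (List ℕ) λ l → Σ (List ℕ) λ μ → Σ (List ℕ) λ ν →
    StrictPartition l × StrictPartition μ × StrictPartition ν ×
    ν ⊆S μ × μ ⊆S l × HasShape S μ ν × HasShape T l μ

IsSYT : Filling → Set
IsSYT F =
  IsSkewShiftedFilling F ×
  (∀ b x → F b ≡ just x → 1 ≤ val x) ×
  (∀ i j j' x y → j < j' → F (i , j) ≡ just x → F (i , j') ≡ just y →
     (x ≤L y) × (primed x ≡ true → primed y ≡ true → val x ≢ val y)) ×
  (∀ i i' j x y → i < i' → F (i , j) ≡ just x → F (i' , j) ≡ just y →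
     (x ≤L y) × (primed x ≡ false → primed y ≡ false → val x ≢ val y))

IsSSYT : Filling → Set
IsSSYT F = IsSYT F × (∀ i x → F (i , i) ≡ just x → primed x ≡ false)

BoundedBy : ℕ → Filling → Set
BoundedBy N F = ∀ i j → Is-just (F (i , j)) → (i ≤ N) × (j ≤ N)

readingWord : ℕ → Filling → List Letter
readingWord N F =
  concatMap (λ i → mapMaybe (λ j → F (i , j)) (reverse (map suc (upTo N))))
            (map suc (upTo N))

hatLetter : Letter → Letter
hatLetter (lt k false) = pr (suc k)
hatLetter (lt k true)  = unp k

hat : List Letter → List Letter
hat w = map hatLetter (reverse w)

countU : ℕ → List Letter → ℕ
countU i [] = 0
countU i (lt k false ∷ xs) = (if does (k ≟ i) then 1 else 0) + countU i xs
countU i (lt k true  ∷ xs) = countU i xs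

nth : List Letter → ℕ → Maybe Letter
nth []       _       = nothing
nth (x ∷ xs) zero    = just x
nth (x ∷ xs) (suc n) = nth xs n

-- with a = w ŵ = a_1 ... a_{2n}, m_i(j) = countU i (take j a) and a_{j+1} = nth a j
LatticeProperty : List Letter → Set
LatticeProperty w =
  ∀ i j x → 2 ≤ i → j < length (w ++ hat w) →
    countU i (take j (w ++ hat w)) ≡ countU (i ∸ 1) (take j (w ++ hat w)) →
    nth (w ++ hat w) j ≡ just x → val x ≢ i

IsModifiedLRS : Filling → Set
IsModifiedLRS F = IsSSYT F × (∀ N → BoundedBy N F → LatticeProperty (readingWord N F))

data Label : Set where
  lS lT : Label

Cell : Set
Cell = Label × Letter

State : Set
State = Box → Maybe Cell

upd : Box → Maybe Cell → State → State
upd p v st q = if does (q ≟B p) then v else st q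

swapB : Box → Box → State → State
swapB c d st = upd c (st d) (upd d (st c) st)

ABox : ℕ → State → Box → Set
ABox a st p = Σ Letter λ x → (st p ≡ just (lS , x)) × (val x ≡ a)

BBox : ℕ → State → Box → Set
BBox b st p = Σ Letter λ x → (st p ≡ just (lT , x)) × (val x ≡ b)

east south : Box → Box
east  (i , j) = (i , suc j)
south (i , j) = (suc i , j)

diagSE : Box → Box
diagSE (i , j) = (suc i , suc i)

diagW : Box → Box
diagW (i , j) = (i , i)

OnDiag : Box → Set
OnDiag (i , j) = j ≡ i

RightOfDiag : Box → Set
RightOfDiag (i , j) = j ≡ suc i

module _ (a b : ℕ) (st : State) (c : Box) where

  S3conf : Set
  S3conf = OnDiag c × ABox a st c × (st (east c) ≡ just (lT , pr b)) × BBox b st (diagSE c)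

  S4conf : Set
  S4conf = RightOfDiag c × (st c ≡ just (lS , unp a)) × ABox a st (diagW c) ×
           BBox b st (south c) × ¬ BBox b st (east c)

  S7conf : Set
  S7conf = RightOfDiag c × (st c ≡ just (lS , unp a)) × ABox a st (diagW c) ×
           BBox b st (south c) × (st (east c) ≡ just (lT , unp b))

  S1'conf : Set
  S1'conf = OnDiag c × (st c ≡ just (lS , unp a)) × (st (east c) ≡ just (lT , pr b)) ×
            ¬ BBox b st (south c) × ¬ S3conf

  S2'conf : Set
  S2'conf = (st c ≡ just (lS , pr a)) × RightOfDiag c ×
            (st (south c) ≡ just (lT , unp b)) × ¬ BBox b st (east c)

  S6'conf : Set
  S6'conf = (st c ≡ just (lS , pr a)) × RightOfDiag c ×
            (st (east c) ≡ just (lT , unp b)) × (st (south c) ≡ just (lT , unp b))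

  ModConf : Set
  ModConf = S1'conf ⊎ S2'conf ⊎ S6'conf

-- One switch at the a-box c (the a-box c is assumed to be □(U)).
data Switch (a b : ℕ) (st : State) (c : Box) : State → Set where
  sw1' : S1'conf a b st c →
         Switch a b st c (upd c (just (lT , unp b)) (upd (east c) (just (lS , pr a)) st))
  sw2' : S2'conf a b st c →
         Switch a b st c (upd c (just (lT , pr b)) (upd (south c) (just (lS , unp a)) st))
  sw6' : S6'conf a b st c →
         Switch a b st c (upd c (just (lT , pr b)) (upd (south c) (just (lS , unp a)) st))
  sw3  : ¬ ModConf a b st c → S3conf a b st c →
         Switch a b st c (upd c (st (diagSE c)) (upd (east c) (just (lT , unp b))
                           (upd (diagSE c) (st c) st)))
  sw4  : ¬ ModConf a b st c → S4conf a b st c →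
         Switch a b st c (upd (diagW c) (st (south c)) (upd c (just (lS , pr a))
                           (upd (south c) (st (diagW c)) st)))
  sw7  : ¬ ModConf a b st c → S7conf a b st c →
         Switch a b st c (upd (diagW c) (st (south c)) (upd c (just (lS , pr a))
                           (upd (south c) (st (diagW c)) st)))
  sw5  : ¬ ModConf a b st c → (st (east c) ≡ just (lT , pr b)) → BBox b st (south c) →
         Switch a b st c (swapB c (east c) st)
  sw6  : ¬ ModConf a b st c → (st (east c) ≡ just (lT , unp b)) → BBox b st (south c) →
         ¬ S7conf a b st c →
         Switch a b st c (swapB c (south c) st)
  sw1  : ¬ ModConf a b st c → BBox b st (east c) → ¬ BBox b st (south c) →
         ¬ S3conf a b st c →
         Switch a b st c (swapB c (east c) st)
  sw2  : ¬ ModConf a b st c → BBox b st (south c) → ¬ BBox b st (east c) →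
         ¬ S4conf a b st c →
         Switch a b st c (swapB c (south c) st)

HasBNbr : ℕ → ℕ → State → Box → Set
HasBNbr a b st p = ABox a st p × (BBox b st (east p) ⊎ BBox b st (south p))

CandU CandP : ℕ → ℕ → State → Box → Set
CandU a b st p = (st p ≡ just (lS , unp a)) × HasBNbr a b st p
CandP a b st p = (st p ≡ just (lS , pr a)) × HasBNbr a b st p

IsBoxU : ℕ → ℕ → State → Box → Set
IsBoxU a b st c =
  (CandU a b st c × (∀ p → CandU a b st p → col p ≤ col c)) ⊎
  ((∀ p → ¬ CandU a b st p) × CandP a b st c × (∀ p → CandP a b st p → row p ≤ row c))

FullySwitched : ℕ → ℕ → State → Set
FullySwitched a b st = ∀ p → ¬ HasBNbr a b st p

data Process (a b : ℕ) : State → State → Set where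
  done : ∀ {st} → FullySwitched a b st → Process a b st st
  step : ∀ {st st' st'' c} → IsBoxU a b st c → Switch a b st c st' →
         Process a b st' st'' → Process a b st st''

data InnerLoop (i : ℕ) : ℕ → State → State → Set where
  inil  : ∀ {st} → InnerLoop i 0 st st
  isnoc : ∀ {n st st₁ st₂} → InnerLoop i n st st₁ → Process i (suc n) st₁ st₂ →
          InnerLoop i (suc n) st st₂

data OuterLoop (n : ℕ) : ℕ → State → State → Set where
  onil  : ∀ {st} → OuterLoop n 0 st st
  ocons : ∀ {m st st₁ st₂} → InnerLoop (suc m) n st st₁ → OuterLoop n m st₁ st₂ →
          OuterLoop n (suc m) st st₂

-- max(F) (0 when F is empty)
IsMax : Filling → ℕ → Set
IsMax F m = (∀ p x → F p ≡ just x → val x ≤ m) ×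
            (m ≡ 0 ⊎ Σ Box λ p → Σ Letter λ x → (F p ≡ just x) × (val x ≡ m))

labelAll : Filling → Filling → State
labelAll S T p with S p
... | just x  = just (lS , x)
... | nothing with T p
...   | just y  = just (lT , y)
...   | nothing = nothing

project : Label → State → Filling
project lS st p with st p
... | just (lS , x) = just x
... | _             = nothing
project lT st p with st p
... | just (lT , x) = just x
... | _             = nothing

MSTS : Filling → Filling → Filling → Filling → Set
MSTS S T T̃ S̃ =
  Σ ℕ λ m → Σ ℕ λ n → IsMax S m × IsMax T n ×
  Σ State λ st → OuterLoop n m (labelAll S T) st ×
    (∀ p → T̃ p ≡ project lT st p) × (∀ p → S̃ p ≡ project lS st p)

-- The passage of an 𝐚-strip through a 𝐛-strip is a growth diagram: its cells obey a local rule, and the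
-- switching process can only end in the outcome of that rule.  On boxes the rule is symmetric; the
-- primes of a strip are determined by its boxes up to a single prime, which is recovered from the diagonal
-- or from the total number of primes.  So switching two strips twice is the identity.  The procedure for
-- two tableaux is a rectangle of such cells, and its transpose is the procedure for the result: this
-- gives (a).
--
-- A word is read through the pair k, k+1 as a walk in ℕ × ℕ, and the lattice property says that the walk
-- ends at first coordinate 0 for every k.  For the k-strip and the (k+1)-strip, an 𝐚-box that moves through
-- them is a hole: each of its steps slides one or two letters into the hole, and this does not change the
-- walk of the reading word.  So T and its image have the same walks, which gives (b), and (c) follows
-- by looking at the reverse switching.

module Submission where

open import Data.List.Membership.Propositional.Properties
open import Data.Nat.Properties
open import Defs
open import Relation.Binary.PropositionalEquality
open import Data.Bool using (Bool; true; false; _∧_; _∨_; not; if_then_else_)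
open import Data.Empty using (⊥; ⊥-elim)
open import Data.List using (List; []; _∷_; _++_; _ʳ++_; map; reverse; length; concat; applyUpTo; filter; foldl; take; foldr; mapMaybe; concatMap; upTo)
open import Data.List.Membership.Propositional using (_∈_)
open import Data.List.Properties using (++-assoc; ++-identityʳ; reverse-map; reverse-involutive; ʳ++-defn; unfold-reverse; map-++; foldl-++; ++-cancelʳ; reverse-++; foldr-++; upTo-∷ʳ; map-upTo)
open import Data.List.Relation.Unary.All using (All; []; _∷_)
open import Data.List.Relation.Unary.AllPairs using (AllPairs; []; _∷_)
open import Data.List.Relation.Unary.Any using (Any; here; there; any?)
open import Data.List.Relation.Unary.Linked using (Linked; []; [-]; _∷_)
open import Data.List.Relation.Unary.Linked.Properties using (Linked⇒AllPairs; AllPairs⇒Linked)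
open import Data.Maybe using (Maybe; just; nothing; Is-just; maybe)
open import Data.Maybe.Properties using (just-injective)
open import Data.Nat using (ℕ; zero; suc; _+_; _∸_; _≤_; _<_; z≤n; s≤s; _*_)
open import Data.Nat.ListAction using (sum)
open import Data.Nat.Tactic.RingSolver using (solve-∀)
open import Data.Product using (Σ; _×_; _,_; proj₁; proj₂; ∃; ∃₂)
open import Data.Sum using (_⊎_; inj₁; inj₂)
open import Data.Unit using (⊤; tt)
open import Function using (_∘_; case_of_)
open import Relation.Binary.Definitions using (tri<; tri≈; tri>)
open import Relation.Nullary using (¬_; Dec; yes; no; does)
open import Relation.Nullary.Decidable using (dec-true; dec-false; _×-dec_)
import Data.List.Relation.Unary.All as All
open import Data.List.Relation.Unary.Any.Properties using () renaming (reverse⁺ to Any-reverse⁺; reverse⁻ to Any-reverse⁻)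
import Data.Bool
import Data.Maybe.Relation.Unary.Any
import Data.List.Relation.Unary.AllPairs.Properties as AllPairs
import Data.List.Relation.Unary.All.Properties as AllP
import Data.List.Relation.Unary.AllPairs as AP

-- What resists a uniform treatment is the diagonal. Away from it, entries travel with their labels.
-- At the diagonal a prime may pass from one strip to the other, (S3) loses one, and (S4), (S7)
-- create one. Moreover (S3) performs two cells of one row at once, while (S4) and (S7) join a cell
-- of one row to a cell of the next. Two flags of a cell record these events, and the simulation of
-- the process has to cross row boundaries accordingly. That □(U) is always the box moved next by
-- the diagram rests on standardization: if the boxes of one letter are listed with the primed ones
-- downwards and then the unprimed ones rightwards, □(U) is the last that can still move, and of two
-- 𝐛-neighbours the switch selects the earlier one. For the walks, the modified switches are
-- harmless for the following reason. The steps of k and k′ agree when the second coordinate is 0,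
-- those of k+1 and (k+1)′ when the first is 0. A strip meets the diagonal at most once, and when a
-- prime changes there, the strip has no letter in the rows below, so the coordinate in question is
-- still 0.

Marked : Set
Marked = Box × Bool

pos : Marked → Box
pos = proj₁

mark : Marked → Bool
mark = proj₂

-- Order ideals in the shifted quadrant and chains of addable boxes

Region : Set₁
Region = Box → Set

InQ : Region
InQ (i , j) = (1 ≤ i) × (i ≤ j)

infix 4 _⋖_ _≼_
infixl 5 _∪₁_

data _⋖_ : Box → Box → Set where
  E : ∀ {i j} → (i , j) ⋖ (i , suc j)
  S : ∀ {i j} → (i , j) ⋖ (suc i , j)

_≼_ : Box → Box → Set
(i , j) ≼ (i' , j') = (i ≤ i') × (j ≤ j')

⋖⇒≼ : ∀ {q p} → q ⋖ p → q ≼ p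
⋖⇒≼ E = ≤-refl , n≤1+n _
⋖⇒≼ S = n≤1+n _ , ≤-refl

_⋖?_ : ∀ q p → Dec (q ⋖ p)
(i , j) ⋖? (i' , j') with i' ≟ i | j' ≟ suc j
... | yes refl | yes refl = yes E
... | yes refl | no ¬b with i' ≟ suc i
...   | yes ()
...   | no _ = no λ { E → ¬b refl }
(i , j) ⋖? (i' , j') | no ¬a | _ with i' ≟ suc i | j' ≟ j
... | yes refl | yes refl = yes S
... | yes refl | no ¬b = no λ { S → ¬b refl }
... | no ¬b | _ = no λ { E → ¬a refl ; S → ¬b refl }

onDiag? : ∀ b → Dec (OnDiag b)
onDiag? (i , j) = j ≟ i

_∪₁_ : Region → Box → Region
(K ∪₁ x) q = K q ⊎ q ≡ x

Ideal : Region → Set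
Ideal K = ∀ {q p} → q ⋖ p → InQ q → K p → K q

Addable : Region → Box → Set
Addable K x = InQ x × ¬ K x × (∀ {q} → q ⋖ x → InQ q → K q)

infixr 5 _∷_
-- A standard filling of the boxes added to K, hence the standardization of all strips stacked on K.
-- Regions are arbitrary predicates, so that a box can be added without computing a new partition.
data Chain (K : Region) : List Marked → Set where
  []  : Chain K []
  _∷_ : ∀ {x L} → Addable K (pos x) → Chain (K ∪₁ pos x) L → Chain K (x ∷ L)

ideal-∪₁ : ∀ {K x} → Ideal K → Addable K x → Ideal (K ∪₁ x)
ideal-∪₁ ideal _ q⋖p inq (inj₁ p∈) = inj₁ (ideal q⋖p inq p∈)
ideal-∪₁ ideal (_ , _ , c) q⋖p inq (inj₂ refl) = inj₁ (c q⋖p inq)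

down-col : ∀ {K i} → Ideal K → 1 ≤ i → ∀ d {j} → i ≤ j → K (i , d + j) → K (i , j)
down-col ideal 1≤i zero i≤j k = k
down-col ideal 1≤i (suc d) {j} i≤j k =
  down-col ideal 1≤i d i≤j (ideal E (1≤i , ≤-trans i≤j (m≤n+m j d)) k)

down-row : ∀ {K j} → Ideal K → ∀ d {i} → 1 ≤ i → d + i ≤ j → K (d + i , j) → K (i , j)
down-row ideal zero 1≤i _ k = k
down-row ideal (suc d) {i} 1≤i le k =
  down-row ideal d 1≤i (<⇒≤ le) (ideal S (≤-trans 1≤i (m≤n+m i d) , <⇒≤ le) k)

-- The path runs north in the column of p and then west in the row of q. It stays in the quadrant i
-- ≤ j, which the path in the other order need not do.
down : ∀ {K q p} → Ideal K → InQ q → InQ p → q ≼ p → K p → K q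
down {K} {i , j} {i' , j'} ideal (1≤i , i≤j) (_ , i'≤j') (a , b) k =
  down-col ideal 1≤i (j' ∸ j) i≤j
    (subst (λ t → K (i , t)) (sym (m∸n+n≡m b))
      (down-row ideal (i' ∸ i) 1≤i (subst (_≤ j') (sym (m∸n+n≡m a)) i'≤j')
        (subst (λ t → K (t , j')) (sym (m∸n+n≡m a)) k)))

up-∉ : ∀ {K q p} → Ideal K → InQ q → InQ p → ¬ K q → q ≼ p → ¬ K p
up-∉ ideal inq inp q∉ q≼p p∈ = q∉ (down ideal inq inp q≼p p∈)

later-⋠ : ∀ {K z x} → Ideal K → Addable K z → Addable (K ∪₁ z) x → ¬ (x ≼ z)
later-⋠ ideal az (inx , x∉ , _) x≼z =
  x∉ (down (ideal-∪₁ ideal az) inx (proj₁ az) x≼z (inj₂ refl))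

sameRow⇒⋖ : ∀ {K i j j'} → Ideal K → Addable K (i , j) → Addable (K ∪₁ (i , j)) (i , j') →
            (i , j) ⋖ (i , j')
sameRow⇒⋖ {j = j} {j'} ideal az ax with <-≤-connex j j'
... | inj₂ j'≤j = ⊥-elim (later-⋠ ideal az ax (≤-refl , j'≤j))
sameRow⇒⋖ {i = i} {j} ideal az@((1≤i , i≤j) , z∉ , _) (_ , _ , c) | inj₁ (s≤s {n = k} j≤k)
  with c E (1≤i , ≤-trans i≤j j≤k)
... | inj₁ k∈ = ⊥-elim (up-∉ ideal (1≤i , i≤j) (1≤i , ≤-trans i≤j j≤k) z∉ (≤-refl , j≤k) k∈)
... | inj₂ refl = E

sameCol⇒⋖ : ∀ {K i i' j} → Ideal K → Addable K (i , j) → Addable (K ∪₁ (i , j)) (i' , j) →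
            (i , j) ⋖ (i' , j)
sameCol⇒⋖ {i = i} {i'} ideal az ax with <-≤-connex i i'
... | inj₂ i'≤i = ⊥-elim (later-⋠ ideal az ax (i'≤i , ≤-refl))
sameCol⇒⋖ {i = i} ideal az@((1≤i , i≤j) , z∉ , _) ((_ , x≤j) , _ , c) | inj₁ (s≤s {n = k} i≤k)
  with c S (≤-trans 1≤i i≤k , <⇒≤ x≤j)
... | inj₁ k∈ = ⊥-elim (up-∉ ideal (1≤i , i≤j) (≤-trans 1≤i i≤k , <⇒≤ x≤j) z∉ (i≤k , ≤-refl) k∈)
... | inj₂ refl = S

-- The corner needs its north neighbour (i, j+1), which lies beyond z and has not been added.
¬E⋖SE : ∀ {K i j} → Ideal K → Addable K (i , j) → Addable (K ∪₁ (i , j)) (suc i , j) →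
        ¬ Addable (K ∪₁ (i , j) ∪₁ (suc i , j)) (suc i , suc j)
¬E⋖SE ideal (inz@(1≤i , i≤j) , z∉ , _) _ (_ , _ , c) with c S (1≤i , m≤n⇒m≤1+n i≤j)
... | inj₁ (inj₁ k) = up-∉ ideal inz (1≤i , m≤n⇒m≤1+n i≤j) z∉ (≤-refl , n≤1+n _) k

-- The corner needs its west neighbour (i+1, j). For j = i this box lies outside the quadrant, and
-- the excluded sequence becomes possible: it is the configuration of (S3).
¬S⋖SE : ∀ {K i j} → Ideal K → Addable K (i , j) → Addable (K ∪₁ (i , j)) (i , suc j) →
        j ≢ i → ¬ Addable (K ∪₁ (i , j) ∪₁ (i , suc j)) (suc i , suc j)
¬S⋖SE {i = i} {j} ideal (inz@(1≤i , i≤j) , z∉ , _) _ j≢i (_ , _ , c)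
  with c E (s≤s z≤n , ≤∧≢⇒< i≤j (λ e → j≢i (sym e)))
... | inj₁ (inj₁ k) = up-∉ ideal inz (s≤s z≤n , ≤∧≢⇒< i≤j (λ e → j≢i (sym e))) z∉ (n≤1+n _ , ≤-refl) k

-- The local rule and the order of the boxes in a strip

-- The order of the boxes of one letter in the standardization: primed entries downwards, then
-- unprimed entries rightwards.
data PW : Marked → Marked → Set where
  tt : ∀ {x y} → row x < row y → PW (x , true) (y , true)
  tf : ∀ {x y} → PW (x , true) (y , false)
  ff : ∀ {x y} → col x < col y → PW (x , false) (y , false)

PW-trans : ∀ {x y z} → PW x y → PW y z → PW x z
PW-trans (tt a) (tt b) = tt (<-trans a b)
PW-trans (tt a) tf = tf
PW-trans tf (ff _) = tf
PW-trans (ff a) (ff b) = ff (<-trans a b)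

Diag0 : Marked → Set
Diag0 x = OnDiag (pos x) → mark x ≡ false

-- One cell of the growth diagram of an 𝐚-strip (row by row) against a 𝐛-strip: the box z of the
-- first strip meets the box x of the second, which gives x' and z'.  The flag m records that
-- (S4)/(S7) moved the preceding 𝐚-box, the flag f that the preceding cell of the row was of kind lv
-- (so that lv followed by en is (S3)).
data Cross (m f : Bool) : (z x x' z' : Marked) → Bool → Set where
  non : ∀ {z x ζ ξ} → ¬ (z ⋖ x) → ¬ (x ⋖ z) → Cross m f (z , ζ) (x , ξ) (x , ξ) (z , ζ) false
  mv  : ∀ {z x ζ ξ} → z ⋖ x → ¬ OnDiag z → ¬ OnDiag x →
        Cross m f (z , ζ) (x , ξ) (z , ξ) (x , ζ) false
  lv  : ∀ {i ξ ζ'} → ζ' ≡ m ∨ ξ →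
        Cross m f ((i , i) , false) ((i , suc i) , ξ) ((i , i) , false) ((i , suc i) , ζ') true
  en  : ∀ {i ζ ξ'} → ξ' ≡ not f ∧ ζ →
        Cross m f ((i , suc i) , ζ) ((suc i , suc i) , false) ((i , suc i) , ξ')
                 ((suc i , suc i) , false) false

data Row (m : Bool) : Bool → (z : Marked) (P P' : List Marked) (z' : Marked) → Set where
  []  : ∀ {f z} → Row m f z [] [] z
  _∷_ : ∀ {f z x x' z₁ g P P' z'} → Cross m f z x x' z₁ g → Row m g z₁ P P' z' →
        Row m f z (x ∷ P) (x' ∷ P') z'

Chain-resp : ∀ {K K'} L → (∀ {q} → K q → K' q) → (∀ {q} → K' q → K q) → Chain K L → Chain K' L
Chain-resp [] f g _ = []
Chain-resp (x ∷ L) f g ((inx , x∉ , c) ∷ ch) =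
  (inx , (λ k → x∉ (g k)) , (λ a b → f (c a b))) ∷
  Chain-resp L (λ { (inj₁ k) → inj₁ (f k) ; (inj₂ e) → inj₂ e })
               (λ { (inj₁ k) → inj₁ (g k) ; (inj₂ e) → inj₂ e }) ch

Chain-swap : ∀ {K z x L} → ¬ (pos z ⋖ pos x) → ¬ (pos x ⋖ pos z) → Chain K (z ∷ x ∷ L) → Chain K (x ∷ z ∷ L)
Chain-swap {K} {z , _} {x , _} {L} ¬zx ¬xz ((inz , z∉ , cz) ∷ (inx , x∉ , cx) ∷ ch) =
  (inx , (λ k → x∉ (inj₁ k)) , cx') ∷
  (inz , (λ { (inj₁ k) → z∉ k ; (inj₂ refl) → x∉ (inj₂ refl) }) , (λ a b → inj₁ (cz a b))) ∷
  Chain-resp L sw sw ch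
  where
  cx' : ∀ {q} → q ⋖ x → InQ q → K q
  cx' a b with cx a b
  ... | inj₁ k = k
  ... | inj₂ refl = ⊥-elim (¬zx a)
  sw : ∀ {a b q} → (K ∪₁ a ∪₁ b) q → (K ∪₁ b ∪₁ a) q
  sw (inj₁ (inj₁ k)) = inj₁ (inj₁ k)
  sw (inj₁ (inj₂ e)) = inj₂ e
  sw (inj₂ e) = inj₁ (inj₂ e)

cell-chain : ∀ {K m f z x x' z' g L} → Cross m f z x x' z' g → Chain K (z ∷ x ∷ L) → Chain K (x' ∷ z' ∷ L)
cell-chain (non a b) ch = Chain-swap a b ch
cell-chain (mv _ _ _) (a ∷ b ∷ ch) = a ∷ b ∷ ch
cell-chain (lv _) (a ∷ b ∷ ch) = a ∷ b ∷ ch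
cell-chain (en _) (a ∷ b ∷ ch) = a ∷ b ∷ ch

row-chain : ∀ {K m f z P P' z' L} → Row m f z P P' z' → Chain K (z ∷ P ++ L) → Chain K (P' ++ z' ∷ L)
row-chain [] ch = ch
row-chain (c ∷ r) ch with cell-chain c ch
... | a ∷ b = a ∷ row-chain r b

cell-diag0-P : ∀ {m f z x x' z' g} → Cross m f z x x' z' g → Diag0 x → Diag0 x'
cell-diag0-P (non _ _) d = d
cell-diag0-P (mv _ n _) _ = λ o → ⊥-elim (n o)
cell-diag0-P (lv _) _ = λ _ → refl
cell-diag0-P (en _) _ = λ o → ⊥-elim (1+n≢n o)

cell-diag0-z : ∀ {m f z x x' z' g} → Cross m f z x x' z' g → Diag0 z → Diag0 z'
cell-diag0-z (non _ _) d = d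
cell-diag0-z (mv _ _ n) _ = λ o → ⊥-elim (n o)
cell-diag0-z (lv _) _ = λ o → ⊥-elim (1+n≢n o)
cell-diag0-z (en _) _ = λ _ → refl

row-diag0-P : ∀ {m f z P P' z'} → Row m f z P P' z' → All Diag0 P → All Diag0 P'
row-diag0-P [] [] = []
row-diag0-P (c ∷ r) (d ∷ ds) = cell-diag0-P c d ∷ row-diag0-P r ds

row-diag0-z : ∀ {m f z P P' z'} → Row m f z P P' z' → Diag0 z → Diag0 z'
row-diag0-z [] d = d
row-diag0-z (c ∷ r) d = row-diag0-z r (cell-diag0-z c d)

chain-prefix : ∀ {K} L {M} → Chain K (L ++ M) → Chain K L
chain-prefix [] _ = []
chain-prefix (_ ∷ L) (a ∷ ch) = a ∷ chain-prefix L ch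

n≢1+n : ∀ {n : ℕ} → n ≢ suc n
n≢1+n ()

-- Three boxes added in succession admit only few combinations of cells. The flag handed from the
-- first cell to the second matters for `lv` followed by `en`: without it a primed box could come
-- after the unprimed (i, i).
PW-row : ∀ {K z x y x' y' m f g g' h h₂} → Ideal K → Chain K (z ∷ x ∷ y ∷ []) → PW x y →
         Cross m f z x x' h g → Cross m g h y y' h₂ g' → PW x' y'
PW-row ideal ch pw (non _ _) (non _ _) = pw
PW-row ideal (az ∷ ax ∷ _) (tt r) (non ¬zx _) (mv E _ _) = tt r
PW-row ideal (az ∷ ax ∷ _) (tt r) (non ¬zx _) (mv S _ _) =
  tt (≤∧≢⇒< (≤-pred r) λ { refl → ¬zx (sameRow⇒⋖ ideal az ax) })
PW-row ideal (az ∷ ax ∷ _) tf (non ¬zx _) (mv _ _ _) = tf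
PW-row ideal (az ∷ ax ∷ _) (ff c) (non ¬zx _) (mv E _ _) =
  ff (≤∧≢⇒< (≤-pred c) λ { refl → ¬zx (sameCol⇒⋖ ideal az ax) })
PW-row ideal (az ∷ ax ∷ _) (ff c) (non ¬zx _) (mv S _ _) = ff c
PW-row ideal (az ∷ ax ∷ _) (tt r) (non ¬zx _) (lv _) = tf
PW-row ideal (az ∷ ax ∷ _) tf (non ¬zx _) (lv _) = tf
PW-row ideal (az ∷ ax ∷ _) (ff c) (non ¬zx _) (lv _) =
  ff (≤∧≢⇒< (≤-pred c) λ { refl → ¬zx (sameCol⇒⋖ ideal az ax) })
PW-row ideal (az ∷ ax ∷ _) tf (non ¬zx _) (en {ξ' = false} _) = tf
PW-row ideal (az ∷ ax@((_ , r≤c) , _) ∷ ay ∷ _) tf (non ¬zx _) (en {i} {ξ' = true} _) =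
  tt (≤∧≢⇒<
    (≮⇒≥ λ i<r → later-⋠ (ideal-∪₁ ideal az) ax ay (i<r , ≤-trans i<r r≤c))
    λ { refl → ¬zx (sameRow⇒⋖ ideal az ax) })
PW-row ideal (az ∷ ax@((_ , r≤c) , _) ∷ _) (ff c) (non ¬zx _) (en _) =
  ⊥-elim (later-⋠ ideal az ax (≤-trans r≤c (≤-pred c) , m≤n⇒m≤1+n (≤-pred c)))
PW-row ideal ch (tt r) (mv zx _ _) (non _ _) = tt (≤-<-trans (proj₁ (⋖⇒≼ zx)) r)
PW-row ideal ch tf (mv zx _ _) (non _ _) = tf
PW-row ideal ch (ff c) (mv zx _ _) (non _ _) = ff (≤-<-trans (proj₂ (⋖⇒≼ zx)) c)
PW-row ideal ch (tt r) (mv S _ _) (mv S _ _) = tt ≤-refl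
PW-row ideal ch (tt r) (mv zx _ _) (mv E _ _) = ⊥-elim (<-irrefl refl r)
PW-row ideal (az ∷ ax ∷ ay ∷ _) (tt r) (mv E n _) (mv S _ _) = ⊥-elim (¬S⋖SE ideal az ax n ay)
PW-row ideal ch tf (mv _ _ _) (mv _ _ _) = tf
PW-row ideal ch (ff c) (mv E _ _) (mv E _ _) = ff ≤-refl
PW-row ideal ch (ff c) (mv _ _ _) (mv S _ _) = ⊥-elim (<-irrefl refl c)
PW-row ideal (az ∷ ax ∷ ay ∷ _) (ff c) (mv S _ _) (mv E _ _) = ⊥-elim (¬E⋖SE ideal az ax ay)
PW-row ideal ch pw (mv _ _ n) (lv _) = ⊥-elim (n refl)
PW-row ideal ch tf (mv _ _ _) (en {ξ' = false} _) = tf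
PW-row ideal ch tf (mv S _ _) (en {ξ' = true} _) = tt ≤-refl
PW-row ideal ch tf (mv E n _) (en {ξ' = true} _) = ⊥-elim (n refl)
PW-row ideal ch (ff c) (mv _ _ _) (en _) = ⊥-elim (<-irrefl refl c)
PW-row {y = (r , c) , _} ideal (az@((1≤i , _) , z∉ , _) ∷ ax ∷ ay@((_ , r≤c) , _) ∷ _) (tt i<r) (lv {i} _) (non ¬xy _)
  with down {p = r , c} (ideal-∪₁ (ideal-∪₁ (ideal-∪₁ ideal az) ax) ay) (s≤s z≤n , ≤-refl) (proj₁ ay)
            (i<r , ≤-trans i<r r≤c) (inj₂ refl)
... | inj₁ (inj₁ (inj₁ k)) = ⊥-elim (up-∉ ideal (proj₁ az) (s≤s z≤n , ≤-refl) z∉ (n≤1+n _ , n≤1+n _) k)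
... | inj₁ (inj₁ (inj₂ ()))
... | inj₁ (inj₂ ())
... | inj₂ refl = ⊥-elim (¬xy S)
PW-row {y = (r , c) , _} ideal (az ∷ ax ∷ ay@((_ , r≤c) , y∉ , _) ∷ _) tf (lv {i} _) (non ¬xy _) =
  ff (≰⇒> λ c≤i → y∉ (inj₁
    (down (ideal-∪₁ ideal az) (proj₁ ay) (proj₁ az) (≤-trans r≤c c≤i , c≤i) (inj₂ refl))))
PW-row ideal ch (ff c) (lv {i} _) (non _ _) = ff (≤-trans (n≤1+n _) c)
PW-row ideal ch (tt r) (lv _) (mv E _ _) = ⊥-elim (<-irrefl refl r)
PW-row ideal ch (tt r) (lv _) (mv S _ n) = ⊥-elim (n refl)
PW-row ideal ch tf (lv _) (mv _ _ _) = ff ≤-refl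
PW-row ideal ch (ff c) (lv _) (mv _ _ _) = ff ≤-refl
PW-row ideal ch pw (lv _) (en refl) = ff ≤-refl
PW-row ideal ch (ff c) (en {ξ' = true} _) (non _ _) = tf
PW-row ideal ch (ff c) (en {ξ' = false} _) (non _ _) = ff c
PW-row ideal ch (ff c) (en _) (mv _ n _) = ⊥-elim (n refl)
PW-row ideal (az ∷ ax ∷ ay ∷ _) (ff c) (en _) (lv _) = ⊥-elim (¬E⋖SE ideal az ax ay)

Enters : ∀ {m f z x x' z' g} → Cross m f z x x' z' g → Set
Enters (en _) = ⊤
Enters _      = ⊥

-- The later box w moves first, and z then meets what w has left behind. If w enters (i+1, i+1) and
-- z leaves (i, i) for (i, i+1), two unprimed boxes would end up in one column; the flag m, forced
-- by the last hypothesis, primes z'.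
PW-col : ∀ {K z w p p₁ w' p₂ z' m m' f f' g g'} → Ideal K → Chain K (z ∷ w ∷ p ∷ []) → PW z w →
         (c : Cross m' f' w p p₁ w' g') → Cross m f z p₁ p₂ z' g →
         (OnDiag (pos z) → Enters c → pos w' ≡ diagSE (pos z) → m ≡ true) → PW z' w'
PW-col ideal ch pw (non _ _) (non _ _) s4 = pw
PW-col ideal ch (tt r) (non _ _) (mv E _ _) s4 = tt r
PW-col ideal (az ∷ aw ∷ ap ∷ _) (tt r) (non ¬wp _) (mv S _ _) s4 =
  tt (≤∧≢⇒< r λ { refl → ¬wp (sameRow⇒⋖ (ideal-∪₁ ideal az) aw ap) })
PW-col ideal ch tf (non _ _) (mv _ _ _) s4 = tf
PW-col ideal ch (ff c) (non _ _) (mv S _ _) s4 = ff c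
PW-col ideal (az ∷ aw ∷ ap ∷ _) (ff c) (non ¬wp _) (mv E _ _) s4 =
  ff (≤∧≢⇒< c λ { refl → ¬wp (sameCol⇒⋖ (ideal-∪₁ ideal az) aw ap) })
PW-col ideal ch (ff c) (non _ _) (lv {ζ' = true} _) s4 = tf
PW-col ideal (az ∷ aw ∷ ap ∷ _) (ff c) (non ¬wp _) (lv {ζ' = false} _) s4 =
  ff (≤∧≢⇒< c λ { refl → ¬wp (sameCol⇒⋖ (ideal-∪₁ ideal az) aw ap) })
PW-col ideal (az ∷ aw@((_ , r≤c) , _) ∷ ap ∷ _) (tt r) (non ¬wp _) (en _) s4 =
  ⊥-elim (later-⋠ (ideal-∪₁ ideal az) aw ap (r , ≤-trans r r≤c))
PW-col {w = (r , c) , _} ideal (az ∷ aw@((_ , r≤c) , _) ∷ ap@(_ , p∉ , _) ∷ _) tf (non ¬wp _) (en {i} _) s4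
  with <-≤-connex (suc i) c
... | inj₁ l = ff l
... | inj₂ c≤ with <-≤-connex i r
...   | inj₂ r≤i = ⊥-elim (later-⋠ ideal az aw (r≤i , c≤))
...   | inj₁ i<r = ⊥-elim (later-⋠ (ideal-∪₁ ideal az) aw ap (i<r , ≤-trans i<r r≤c))
PW-col ideal ch (ff c) (non _ _) (en _) s4 = ff c
PW-col ideal ch (tt r) (mv wp _ _) (non _ _) s4 = tt (<-≤-trans r (proj₁ (⋖⇒≼ wp)))
PW-col ideal ch tf (mv wp _ _) (non _ _) s4 = tf
PW-col ideal ch (ff c) (mv wp _ _) (non _ _) s4 = ff (<-≤-trans c (proj₂ (⋖⇒≼ wp)))
PW-col ideal ch (tt r) (mv S _ _) (mv S _ _) s4 = tt ≤-refl
PW-col ideal ch (tt r) (mv _ _ _) (mv E _ _) s4 = ⊥-elim (<-irrefl refl r)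
PW-col ideal (az ∷ aw ∷ ap ∷ _) (tt r) (mv E _ _) (mv S _ _) s4 = ⊥-elim (¬E⋖SE ideal az aw ap)
PW-col ideal ch tf (mv _ _ _) (mv _ _ _) s4 = tf
PW-col ideal ch (ff c) (mv E _ _) (mv E _ _) s4 = ff ≤-refl
PW-col ideal ch (ff c) (mv _ _ _) (mv S _ _) s4 = ⊥-elim (<-irrefl refl c)
PW-col ideal (az ∷ aw ∷ ap ∷ _) (ff c) (mv S _ _) (mv E n _) s4 = ⊥-elim (¬S⋖SE ideal az aw n ap)
PW-col ideal ch (ff c) (mv _ _ _) (lv {ζ' = true} _) s4 = tf
PW-col ideal ch (ff c) (mv E _ _) (lv {ζ' = false} _) s4 = ff ≤-refl
PW-col ideal ch (ff c) (mv S _ n) (lv {ζ' = false} _) s4 = ⊥-elim (n refl)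
PW-col ideal ch pw (mv _ n _) (en _) s4 = ⊥-elim (n refl)
PW-col ideal ch tf (lv {ζ' = false} _) (non _ _) s4 = tf
PW-col {z = (r , c) , _} ideal (az@((_ , r≤c) , _) ∷ aw ∷ _) tf (lv {i} {ζ' = true} _) (non _ _) s4 =
  tt (≰⇒> λ i≤r → later-⋠ ideal az aw (i≤r , ≤-trans i≤r r≤c))
PW-col {z = (r , c) , _} ideal (az@(inz@(1≤r , r≤c) , z∉ , _) ∷ aw ∷ _) (ff (s≤s {n = n} c≤n)) (lv _) (non _ _) s4
  with proj₂ (proj₂ aw) S (≤-trans 1≤r (≤-trans r≤c c≤n) , n≤1+n n)
... | inj₁ k = ⊥-elim (up-∉ ideal inz (≤-trans 1≤r (≤-trans r≤c c≤n) , n≤1+n n) z∉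
                        (≤-trans r≤c c≤n , m≤n⇒m≤1+n c≤n) k)
... | inj₂ refl = ⊥-elim (<-irrefl refl c≤n)
PW-col ideal ch pw (lv _) (mv _ _ n) s4 = ⊥-elim (n refl)
PW-col ideal (az ∷ aw ∷ ap ∷ _) pw (lv _) (en _) s4 = ⊥-elim (¬E⋖SE ideal az aw ap)
PW-col ideal ch tf (en _) (non _ _) s4 = tf
PW-col ideal ch (ff c) (en _) (non _ _) s4 = ff c
PW-col ideal ch (tt r) (en _) (non _ _) s4 = tf
PW-col ideal ch (tt r) (en _) (mv _ _ _) s4 = tf
PW-col ideal ch tf (en _) (mv _ _ _) s4 = tf
PW-col ideal ch (ff c) (en _) (mv S _ _) s4 = ⊥-elim (<-irrefl refl c)
PW-col ideal (az ∷ aw ∷ ap ∷ _) (ff c) (en _) (mv E n _) s4 = ⊥-elim (¬S⋖SE ideal az aw n ap)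
PW-col ideal ch (ff c) (en _) (lv refl) s4 rewrite s4 refl _ refl = tf

row-Linked : ∀ {K m f z P P' z'} → Ideal K → Chain K (z ∷ P) → Linked PW P → Row m f z P P' z' → Linked PW P'
row-Linked ideal ch l [] = []
row-Linked ideal ch l (c ∷ []) = [-]
row-Linked ideal ch (pw ∷ l) (c ∷ c' ∷ r) with cell-chain c ch
... | a ∷ ch' = PW-row ideal (chain-prefix (_ ∷ _ ∷ _ ∷ []) ch) pw c c' ∷ row-Linked (ideal-∪₁ ideal a) ch' l (c' ∷ r)

row-PW : ∀ {K m f z P P' z'} → Ideal K → Chain K (z ∷ P) → AllPairs PW P → Row m f z P P' z' → AllPairs PW P'
row-PW ideal ch pw r = Linked⇒AllPairs PW-trans (row-Linked ideal ch (AllPairs⇒Linked pw) r)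

data Still (z : Marked) (P : List Marked) : (P' : List Marked) (z' : Marked) → Set where
  still : Still z P P z

row-still : ∀ {m f z P P' z'} → All (λ y → ¬ (pos z ⋖ pos y)) P → Row m f z P P' z' → Still z P P' z'
row-still [] [] = still
row-still (n ∷ ns) (non _ _ ∷ r) with row-still ns r
... | still = still
row-still (n ∷ ns) (mv a _ _ ∷ r) = ⊥-elim (n a)
row-still (n ∷ ns) (lv _ ∷ r) = ⊥-elim (n E)
row-still (n ∷ ns) (en _ ∷ r) = ⊥-elim (n S)

ff-tail : ∀ {x ys} → All (PW (x , false)) ys → All (λ y → mark y ≡ false) ys
ff-tail [] = []
ff-tail (ff _ ∷ ps) = refl ∷ ff-tail ps

-- Before (i+1, j) its north neighbour (i, j) has to be added, and both would lie in one column,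
-- whereas unprimed boxes of a strip come in strictly increasing columns.
southless : ∀ {K i j ys} → InQ (i , j) → ¬ K (i , j) → Chain K ys → All (λ y → mark y ≡ false) ys →
            AllPairs PW ys → All (λ y → pos y ≢ (suc i , j)) ys
southless inq k∉ [] [] [] = []
southless {K} {i} {j} {(y , _) ∷ ys} inq k∉ ((_ , _ , c) ∷ ch) (refl ∷ us) (pw ∷ pws) =
  (λ { refl → k∉ (c S inq) }) ∷ rest
  where
  colNe : ∀ {ys} → y ≡ (i , j) → All (PW (y , false)) ys → All (λ y → pos y ≢ (suc i , j)) ys
  colNe refl [] = []
  colNe refl (ff c ∷ ps) = (λ { refl → <-irrefl refl c }) ∷ colNe refl ps
  rest : All (λ y → pos y ≢ (suc i , j)) ys
  rest with y ≟B (i , j)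
  ... | yes e = colNe e pw
  ... | no ne = southless inq (λ { (inj₁ k) → k∉ k ; (inj₂ e) → ne (sym e) }) ch us pws

all-InQ : ∀ {K L} → Chain K L → All (InQ ∘ pos) L
all-InQ [] = []
all-InQ ((i , _) ∷ ch) = i ∷ all-InQ ch

-- A box that has entered the diagonal moves no further in its row. Its south neighbour is outside
-- the quadrant, and its east neighbour would need (i, i+2), which `southless` rules out.
stay : ∀ {K i ζ P} → Ideal K →
       Chain K (((i , suc i) , ζ) ∷ ((suc i , suc i) , false) ∷ P) →
       AllPairs PW (((suc i , suc i) , false) ∷ P) →
       All (λ y → ¬ ((suc i , suc i) ⋖ pos y)) P
stay {K} {i} {P = P} ideal ((inz@(1≤i , _) , z∉ , _) ∷ ax ∷ ch) (pw ∷ pws) =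
  All.zipWith (λ { (a , b) E → a refl ; (a , b) S → <-irrefl refl (proj₂ b) })
    (southless (1≤i , m≤n⇒m≤1+n (n≤1+n i)) k∉ ch (ff-tail pw) pws , all-InQ ch)
  where
  k∉ : ¬ (K ∪₁ (i , suc i) ∪₁ (suc i , suc i)) (i , suc (suc i))
  k∉ (inj₁ (inj₁ k)) = up-∉ ideal inz (1≤i , m≤n⇒m≤1+n (n≤1+n i)) z∉ (≤-refl , n≤1+n _) k
  k∉ (inj₁ (inj₂ ()))
  k∉ (inj₂ ())

lv′ : ∀ {m f i ζ ξ} → ζ ≡ false →
      Cross m f ((i , i) , ζ) ((i , suc i) , ξ) ((i , i) , false) ((i , suc i) , m ∨ ξ) true
lv′ refl = lv refl

en′ : ∀ {m f i ζ ξ} → ξ ≡ false →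
      Cross m f ((i , suc i) , ζ) ((suc i , suc i) , ξ) ((i , suc i) , not f ∧ ζ) ((suc i , suc i) , false) false
en′ refl = en refl

row-exists : ∀ {K} m f {z P} → Ideal K → Chain K (z ∷ P) → Diag0 z → All Diag0 P →
             ∃₂ λ P' z' → Row m f z P P' z'
row-exists m f ideal ch dz [] = [] , _ , []
row-exists {K} m f {z , ζ} {(x , ξ) ∷ P} ideal ch@(az ∷ ax ∷ _) dz (dx ∷ dP) = go (z ⋖? x) (onDiag? z) (onDiag? x)
  where
  cont : ∀ {x' z' g} → Cross m f (z , ζ) (x , ξ) x' z' g →
         ∃₂ λ P' z' → Row m f (z , ζ) ((x , ξ) ∷ P) P' z'
  cont c with cell-chain c ch
  ... | a ∷ ch' with row-exists m _ (ideal-∪₁ ideal a) ch' (cell-diag0-z c dz) dP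
  ...   | _ , _ , r = _ , _ , c ∷ r
  go : Dec (z ⋖ x) → Dec (OnDiag z) → Dec (OnDiag x) → ∃₂ λ P' z' → Row m f (z , ζ) ((x , ξ) ∷ P) P' z'
  go (no ¬zx) _ _ = cont (non ¬zx (λ xz → later-⋠ ideal az ax (⋖⇒≼ xz)))
  go (yes E) (yes refl) _ = cont (lv′ (dz refl))
  go (yes S) (yes refl) _ = ⊥-elim (<-irrefl refl (proj₂ (proj₁ ax)))
  go (yes E) (no _) (yes refl) = ⊥-elim (<-irrefl refl (proj₂ (proj₁ az)))
  go (yes S) (no _) (yes refl) = cont (en′ (dx refl))
  go (yes a) (no n) (no n') = cont (mv a n n')

-- The grid of an 𝐚-strip against a 𝐛-strip

infixl 5 _⊕_
_⊕_ : Region → List Marked → Region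
K ⊕ [] = K
K ⊕ (z ∷ Z) = (K ⊕ Z) ∪₁ pos z

data RChain (K : Region) : List Marked → Set where
  []  : RChain K []
  _∷_ : ∀ {z Z} → Addable (K ⊕ Z) (pos z) → RChain K Z → RChain K (z ∷ Z)

unzip : ∀ {K} Z {L} → Chain K (Z ʳ++ L) → RChain K Z × Chain (K ⊕ Z) L
unzip [] ch = [] , ch
unzip (z ∷ Z) ch with unzip Z ch
... | rc , a ∷ ch' = a ∷ rc , ch'

rezip : ∀ {K Z L} → RChain K Z → Chain (K ⊕ Z) L → Chain K (Z ʳ++ L)
rezip [] ch = ch
rezip (a ∷ rc) ch = rezip rc (a ∷ ch)

ideal-⊕ : ∀ {K Z} → Ideal K → RChain K Z → Ideal (K ⊕ Z)
ideal-⊕ ideal [] = ideal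
ideal-⊕ {K} ideal (a ∷ rc) = ideal-∪₁ (ideal-⊕ {K} ideal rc) a

-- Detects (S4) and (S7) after the fact. Successive boxes of a strip are never (i, i) and (i+1,
-- i+1), so if z is at (i, i) and the box moved before it now stands at (i+1, i+1), that box has
-- entered there from (i, i+1).
follows : Marked → List Marked → Bool
follows z [] = false
follows z (w ∷ _) = does (onDiag? (pos z)) ∧ does (pos w ≟B diagSE (pos z))

-- Z lists the boxes of the 𝐚-strip that have not moved yet, in reverse order; D those that have.
data Grid : (Z P D P' A' : List Marked) → Set where
  []  : ∀ {P D} → Grid [] P D P D
  _∷_ : ∀ {z Z P P₁ z' D P' A'} → Row (follows z D) false z P P₁ z' → Grid Z P₁ (z' ∷ D) P' A' →
        Grid (z ∷ Z) P D P' A'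

record Facts (K : Region) (Z P D : List Marked) : Set where
  field
    ideal : Ideal K
    rc    : RChain K Z
    ch    : Chain (K ⊕ Z) (P ++ D)
    pwZ   : AllPairs (λ x y → PW y x) Z
    pwP   : AllPairs PW P
    dZ    : All Diag0 Z
    dP    : All Diag0 P
    dD    : All Diag0 D

module _ {K z Z P D} (F : Facts K (z ∷ Z) P D) where
  open Facts F

  facts-chain : Chain (K ⊕ Z) (z ∷ P ++ D)
  facts-chain with rc
  ... | a ∷ _ = a ∷ ch

  facts-ideal : Ideal (K ⊕ Z)
  facts-ideal with rc
  ... | _ ∷ rc' = ideal-⊕ ideal rc'

  facts-row : ∀ {m P₁ z'} → Row m false z P P₁ z' → Facts K Z P₁ (z' ∷ D)
  facts-row r = record
    { ideal = ideal
    ; rc = case rc of λ { (_ ∷ rc') → rc' }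
    ; ch = row-chain r facts-chain
    ; pwZ = case pwZ of λ { (_ ∷ p) → p }
    ; pwP = row-PW facts-ideal (chain-prefix (z ∷ P) facts-chain) pwP r
    ; dZ = All.tail dZ
    ; dP = row-diag0-P r dP
    ; dD = row-diag0-z r (All.head dZ) ∷ dD
    }

grid-exists : ∀ {K Z P D} → Facts K Z P D → ∃₂ λ P' A' → Grid Z P D P' A'
grid-exists {Z = []} F = _ , _ , []
grid-exists {Z = z ∷ Z} {P} {D} F
  with row-exists (follows z D) false (facts-ideal F) (chain-prefix (z ∷ P) (facts-chain F))
         (All.head (Facts.dZ F)) (Facts.dP F)
... | _ , _ , r with grid-exists (facts-row F r)
...   | _ , _ , g = _ , _ , r ∷ g

grid-facts : ∀ {K Z P D P' A'} → Facts K Z P D → Grid Z P D P' A' → Facts K [] P' A'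
grid-facts F [] = F
grid-facts F (r ∷ g) = grid-facts (facts-row F r) g

¬diag-consecutive : ∀ {K i} → Ideal K → Addable K (i , i) → ¬ Addable (K ∪₁ (i , i)) (suc i , suc i)
¬diag-consecutive ideal (inz@(1≤i , _) , z∉ , _) (_ , _ , c) with c S (1≤i , n≤1+n _)
... | inj₁ k = up-∉ ideal inz (1≤i , n≤1+n _) z∉ (≤-refl , n≤1+n _) k

chain-last : ∀ {K} L {M} → Ideal K → Chain K (L ++ M) → Σ Region λ K' → Ideal K' × Chain K' M
chain-last [] ideal ch = _ , ideal , ch
chain-last (_ ∷ L) ideal (a ∷ ch) = chain-last L (ideal-∪₁ ideal a) ch

row-chain₀ : ∀ {K m f z P P' z'} → Row m f z P P' z' → Chain K (z ∷ P) → Chain K (P' ++ z' ∷ [])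
row-chain₀ {z = z} {P} r ch = row-chain r (subst (λ L → Chain _ (z ∷ L)) (sym (++-identityʳ P)) ch)

-- `follows` sees only where w ends its row, while `PW-col` asks for the box of w right after the
-- cell. By `stay` nothing moves after an entry, so the two agree.
rows-PW : ∀ {K z w P P₁ P₂ w' z' m m' f f'} → Ideal K → Chain K (z ∷ w ∷ P) → AllPairs PW P →
          PW z w → Row m' f' w P P₁ w' → Row m f z P₁ P₂ z' →
          (OnDiag (pos z) → pos w' ≡ diagSE (pos z) → m ≡ true) → PW z' w'
rows-PW ideal ch pws pw [] [] s4 = pw
rows-PW {K} {z} {w} {p ∷ P} {p₁ ∷ P₁} {p₂ ∷ P₂} {w'} {z'} {m} ideal ch@(az ∷ chw) pws pw (c ∷ r) (d ∷ e) s4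
  with cell-chain c chw
... | a₁ ∷ ch₁ with cell-chain d (az ∷ a₁ ∷ ch₁)
...   | a₂ ∷ ch₂ =
  rows-PW (ideal-∪₁ ideal a₂) ch₂ (case pws of λ { (_ ∷ q) → q })
    (PW-col ideal (chain-prefix (_ ∷ _ ∷ _ ∷ []) ch) pw c d (s4-col c r pws chw)) r e
    (s4-next d e
      (chain-prefix (z ∷ p₁ ∷ P₁) (az ∷ a₁ ∷ row-chain₀ r ch₁))
      (row-PW (ideal-∪₁ ideal az) chw pws (c ∷ r))
      (chain-last P₂ (ideal-∪₁ ideal a₂)
        (row-chain-last e r ch₂)))
  where
  s4-col : ∀ {m' f w w₁ p p₁ P P₁ g} (c : Cross m' f w p p₁ w₁ g) → Row m' g w₁ P P₁ w' → AllPairs PW (p ∷ P) →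
           Chain (K ∪₁ pos z) (w ∷ p ∷ P) → OnDiag (pos z) → Enters c → pos w₁ ≡ diagSE (pos z) → m ≡ true
  s4-col (en _) r pws ch dz _ e with row-still (stay (ideal-∪₁ ideal az) ch pws) r
  ... | still = s4 dz e
  row-chain-last : ∀ {K z w P P₁ P₂ w' z' m m' f f'} → Row m f z P₁ P₂ z' → Row m' f' w P P₁ w' →
                   Chain K (z ∷ w ∷ P) → Chain K (P₂ ++ z' ∷ w' ∷ [])
  row-chain-last e r (a ∷ ch) = row-chain e (a ∷ row-chain₀ r ch)
  s4-next : ∀ {f z₁ g} (d : Cross m f z p₁ p₂ z₁ g) → Row m g z₁ P₁ P₂ z' → Chain K (z ∷ p₁ ∷ P₁) →
            AllPairs PW (p₁ ∷ P₁) → (Σ Region λ K' → Ideal K' × Chain K' (z' ∷ w' ∷ [])) →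
            OnDiag (pos z₁) → pos w' ≡ diagSE (pos z₁) → m ≡ true
  s4-next (non _ _) e ch pws last dz eq = s4 dz eq
  s4-next (mv _ _ n) e ch pws last dz eq = ⊥-elim (n dz)
  s4-next (lv _) e ch pws last dz eq = ⊥-elim (1+n≢n dz)
  s4-next (en _) e ch pws (K' , ideal' , (a ∷ b ∷ [])) dz eq with row-still (stay ideal ch pws) e
  ... | still = ⊥-elim (¬diag-consecutive ideal' a (subst (Addable _) eq b))

follows-true : ∀ z w D → OnDiag (pos z) → pos w ≡ diagSE (pos z) → follows z (w ∷ D) ≡ true
follows-true z w D d e
  rewrite dec-true (onDiag? (pos z)) d | dec-true (pos w ≟B diagSE (pos z)) e = refl

-- w is the last box that has moved, P₀ is the 𝐛-strip before its move.
grid-Linked : ∀ {K Z w P₀ P D w' P' A' m} → Facts K (w ∷ Z) P₀ D → Row m false w P₀ P w' →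
              Linked PW (w' ∷ D) → Grid Z P (w' ∷ D) P' A' → Linked PW A'
grid-Linked F r l [] = l
grid-Linked {Z = z ∷ Z} {w} {P₀} {P} {D} {w'} F r l (s ∷ g) =
  grid-Linked (facts-row F r) s (pw ∷ l) g
  where
  pw : PW _ w'
  pw with Facts.rc F | Facts.pwZ F
  ... | a ∷ b ∷ rc | (q ∷ _) ∷ _ =
    rows-PW (ideal-⊕ (Facts.ideal F) rc) (b ∷ a ∷ chain-prefix P₀ (Facts.ch F)) (Facts.pwP F)
      q r s (follows-true z w' D)

grid-PW : ∀ {K Z P P' A'} → Facts K Z P [] → Grid Z P [] P' A' → AllPairs PW A'
grid-PW F [] = []
grid-PW F (r ∷ g) = Linked⇒AllPairs PW-trans (grid-Linked F r [-] g)

-- Forgetting the primes makes the local rule symmetric, and with it the growth diagrams below.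
data Swap : (z x x' z' : Box) → Set where
  adj : ∀ {z x} → z ⋖ x → Swap z x z x
  non : ∀ {z x} → ¬ (z ⋖ x) → ¬ (x ⋖ z) → Swap z x x z

data BoxRow : (z : Box) (ps ps' : List Box) (z' : Box) → Set where
  []  : ∀ {z} → BoxRow z [] [] z
  _∷_ : ∀ {z p p' z₁ ps ps' z'} → Swap z p p' z₁ → BoxRow z₁ ps ps' z' → BoxRow z (p ∷ ps) (p' ∷ ps') z'

data BoxGrid : (zs ps ps' zs' : List Box) → Set where
  []  : ∀ {ps} → BoxGrid [] ps ps []
  snoc : ∀ {z zs ps ps₁ ps' zs' z'} → BoxGrid zs ps ps₁ zs' → BoxRow z ps₁ ps' z' →
        BoxGrid (z ∷ zs) ps ps' (z' ∷ zs')

Swap-sym : ∀ {z x x' z'} → Swap z x x' z' → Swap x' z' z x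
Swap-sym (adj a) = adj a
Swap-sym (non a b) = non b a

Swap-det : ∀ {z x x' z' x″ z″} → Swap z x x' z' → Swap z x x″ z″ → x' ≡ x″ × z' ≡ z″
Swap-det (adj _) (adj _) = refl , refl
Swap-det (adj a) (non b _) = ⊥-elim (b a)
Swap-det (non b _) (adj a) = ⊥-elim (b a)
Swap-det (non _ _) (non _ _) = refl , refl

BoxRow-det : ∀ {z p p' z' p″ z″} → BoxRow z p p' z' → BoxRow z p p″ z″ → p' ≡ p″ × z' ≡ z″
BoxRow-det [] [] = refl , refl
BoxRow-det (c ∷ r) (d ∷ s) with Swap-det c d
... | refl , refl with BoxRow-det r s
...   | refl , refl = refl , refl

BoxGrid-det : ∀ {z p p' z' p″ z″} → BoxGrid z p p' z' → BoxGrid z p p″ z″ → p' ≡ p″ × z' ≡ z″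
BoxGrid-det [] [] = refl , refl
BoxGrid-det (snoc g r) (snoc h s) with BoxGrid-det g h
... | refl , refl with BoxRow-det r s
...   | refl , refl = refl , refl

split-column : ∀ {zs p ps qs zs″} → BoxGrid zs (p ∷ ps) qs zs″ →
               Σ Box λ p' → Σ (List Box) λ ps' → Σ (List Box) λ zs' →
               qs ≡ p' ∷ ps' × BoxRow p' zs' zs p × BoxGrid zs' ps ps' zs″
split-column [] = _ , _ , _ , refl , [] , []
split-column (snoc g r) with split-column g
split-column (snoc g (c ∷ r)) | _ , _ , _ , refl , col , g' =
  _ , _ , _ , refl , Swap-sym c ∷ col , snoc g' r

-- The first column of the grid, read backwards, is the last row of the inverse grid.
BoxGrid-sym : ∀ {zs ps ps' zs'} → BoxGrid zs ps ps' zs' → BoxGrid ps' zs' zs ps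
BoxGrid-sym {ps = []} g with empty g
  where
  empty : ∀ {zs ps' zs'} → BoxGrid zs [] ps' zs' → ps' ≡ [] × zs' ≡ zs
  empty [] = refl , refl
  empty (snoc g r) with empty g
  empty (snoc g []) | refl , refl = refl , refl
... | refl , refl = []
BoxGrid-sym {ps = _ ∷ _} g with split-column g
... | _ , _ , _ , refl , col , g' = snoc (BoxGrid-sym g') col

boxes : List Marked → List Box
boxes = map pos

cross-swap : ∀ {m f z x x' z' g} → Cross m f z x x' z' g → Swap (pos z) (pos x) (pos x') (pos z')
cross-swap (non a b) = non a b
cross-swap (mv a _ _) = adj a
cross-swap (lv _) = adj E
cross-swap (en _) = adj S

row-boxes : ∀ {m f z P P' z'} → Row m f z P P' z' → BoxRow (pos z) (boxes P) (boxes P') (pos z')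
row-boxes [] = []
row-boxes (c ∷ r) = cross-swap c ∷ row-boxes r

grid-boxes : ∀ {Z P D P' A' zs ps} → Grid Z P D P' A' → BoxGrid zs ps (boxes P) (boxes D) →
             BoxGrid (boxes Z ʳ++ zs) ps (boxes P') (boxes A')
grid-boxes [] h = h
grid-boxes (r ∷ g) h = grid-boxes g (snoc h (row-boxes r))

reverse-ʳ++ : ∀ {X : Set} (xs ys : List X) → reverse xs ʳ++ ys ≡ xs ++ ys
reverse-ʳ++ xs ys = trans (ʳ++-defn (reverse xs)) (cong (_++ ys) (reverse-involutive xs))

reverse-boxes : ∀ A → boxes (reverse A) ʳ++ [] ≡ boxes A
reverse-boxes A = trans (cong (_ʳ++ []) (reverse-map pos A)) (trans (reverse-ʳ++ (boxes A) []) (++-identityʳ (boxes A)))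

-- Recovering the primes, and involutivity for two strips

bit : Bool → ℕ
bit true = 1
bit false = 0

primes : List Marked → ℕ
primes [] = 0
primes (x ∷ L) = bit (mark x) + primes L

primes-ff : ∀ {x L} → All (PW (x , false)) L → primes L ≡ 0
primes-ff [] = refl
primes-ff (ff _ ∷ ps) = primes-ff ps

all-ff-unique : ∀ {x y L M} → All (PW (x , false)) L → All (PW (y , false)) M → boxes L ≡ boxes M → L ≡ M
all-ff-unique [] [] e = refl
all-ff-unique {L = (a , _) ∷ _} {(b , _) ∷ _} (ff _ ∷ ps) (ff _ ∷ qs) e with a | b | e
... | a | b | e' with cong (λ { [] → a ; (t ∷ _) → t }) e' | cong (λ { [] → [] ; (_ ∷ t) → t }) e'
...   | refl | e″ = cong (_ ∷_) (all-ff-unique ps qs e″)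

boxes-inj : ∀ {x y L M} → boxes (x ∷ L) ≡ boxes (y ∷ M) → pos x ≡ pos y × boxes L ≡ boxes M
boxes-inj e = cong (λ { [] → (0 , 0) ; (t ∷ _) → t }) e , cong (λ { [] → [] ; (_ ∷ t) → t }) e

-- In the order `PW` the primed boxes form an initial segment, so only its length is open.
primes-unique : ∀ L M → AllPairs PW L → AllPairs PW M → boxes L ≡ boxes M → primes L ≡ primes M → L ≡ M
primes-unique [] [] _ _ _ _ = refl
primes-unique ((x , ξ) ∷ L) ((y , η) ∷ M) (p ∷ ps) (q ∷ qs) e c with boxes-inj {x , ξ} {y , η} {L} {M} e
primes-unique ((x , true) ∷ L) ((_ , true) ∷ M) (p ∷ ps) (q ∷ qs) e c | refl , e' =
  cong (_ ∷_) (primes-unique L M ps qs e' (suc-injective c))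
primes-unique ((x , false) ∷ L) ((_ , false) ∷ M) (p ∷ ps) (q ∷ qs) e c | refl , e' =
  cong (_ ∷_) (primes-unique L M ps qs e' c)
primes-unique ((x , true) ∷ L) ((_ , false) ∷ M) (p ∷ ps) (q ∷ qs) e c | refl , e' with trans c (primes-ff q)
... | ()
primes-unique ((x , false) ∷ L) ((_ , true) ∷ M) (p ∷ ps) (q ∷ qs) e c | refl , e' with trans (sym c) (primes-ff p)
... | ()

HasDiag : List Marked → Set
HasDiag = Any (λ e → OnDiag (pos e))

-- An unprimed x would be followed by unprimed boxes only. A later diagonal box (i+1, i+1) would
-- then, by `southless`, lack its north neighbour (i, i+1). Hence all boxes before the diagonal one
-- are primed, and all after it are unprimed.
before-diag : ∀ {K x ξ L} → Ideal K → Chain K ((x , ξ) ∷ L) → AllPairs PW ((x , ξ) ∷ L) → All Diag0 L →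
              HasDiag L → ξ ≡ true
before-diag {ξ = true} _ _ _ _ _ = refl
before-diag {K} {r , c} {false} {L} ideal (ax@((1≤r , r≤c) , x∉ , _) ∷ ch) (p ∷ ps) dL h =
  ⊥-elim (go h p (λ i r≤i c≤i c≢ → southless (1≤i r≤i , n≤1+n i) (k∉ r≤i c≤i) ch (ff-tail p) ps))
  where
  1≤i : ∀ {i} → r ≤ i → 1 ≤ i
  1≤i = ≤-trans 1≤r
  k∉ : ∀ {i} → r ≤ i → c ≤ i → ¬ (K ∪₁ (r , c)) (i , suc i)
  k∉ r≤i c≤i (inj₁ k) = up-∉ ideal (1≤r , r≤c) (1≤i r≤i , n≤1+n _) x∉ (r≤i , m≤n⇒m≤1+n c≤i) k
  k∉ r≤i c≤i (inj₂ refl) = <-irrefl refl c≤i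
  go : ∀ {M} → HasDiag M → All (PW ((r , c) , false)) M →
       (∀ i → r ≤ i → c ≤ i → c ≢ suc i → All (λ y → pos y ≢ (suc i , suc i)) M) → ⊥
  go (here refl) (ff {y = suc i , _} (s≤s c≤i) ∷ _) all with all i (≤-trans r≤c c≤i) c≤i (λ { refl → <-irrefl refl c≤i })
  ... | n ∷ _ = n refl
  go (there h) (_ ∷ ps) all = go h ps (λ i a b e → All.tail (all i a b e))

diag-unique : ∀ {K} L M → Ideal K → Chain K L → Chain K M → AllPairs PW L → AllPairs PW M → All Diag0 L → All Diag0 M →
              boxes L ≡ boxes M → HasDiag L → L ≡ M
diag-unique ((x , ξ) ∷ L) ((y , η) ∷ M) ideal cl cm (p ∷ ps) (q ∷ qs) (d ∷ ds) (e ∷ es) eq h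
  with boxes-inj {x , ξ} {y , η} {L} {M} eq
diag-unique ((x , ξ) ∷ L) ((_ , η) ∷ M) ideal cl cm (p ∷ ps) (q ∷ qs) (d ∷ ds) (e ∷ es) eq (here o) | refl , eq'
  with d o | e o
... | refl | refl = cong (_ ∷_) (all-ff-unique p q eq')
diag-unique ((x , ξ) ∷ L) ((_ , η) ∷ M) ideal cl@(a ∷ cl') cm@(_ ∷ cm') (p ∷ ps) (q ∷ qs) (d ∷ ds) (e ∷ es) eq (there h) | refl , eq'
  with before-diag ideal cl (p ∷ ps) ds h | before-diag ideal cm (q ∷ qs) es (transport L M eq' h)
  where
  transport : ∀ L M → boxes L ≡ boxes M → HasDiag L → HasDiag M
  transport (x ∷ L) (y ∷ M) e (here o) with boxes-inj {x} {y} {L} {M} e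
  ... | refl , _ = here o
  transport (x ∷ L) (y ∷ M) e (there h) with boxes-inj {x} {y} {L} {M} e
  ... | _ , e' = there (transport L M e' h)
... | refl | refl = cong (_ ∷_) (diag-unique L M (ideal-∪₁ ideal a) cl' cm' ps qs ds es eq' h)

at-most-one-diag : ∀ {K} L → Ideal K → Chain K L → AllPairs PW L → All Diag0 L → HasDiag L →
                   Σ Box λ d → All (λ e → OnDiag (pos e) → pos e ≡ d) L
at-most-one-diag ((x , ξ) ∷ L) ideal ch@(a ∷ ch') (p ∷ ps) (d ∷ ds) h with any? (λ e → onDiag? (pos e)) L
... | yes h' with before-diag ideal ch (p ∷ ps) ds h'
...   | refl with at-most-one-diag L (ideal-∪₁ ideal a) ch' ps ds h'
...     | b , al = b , (λ o → case d o of λ ()) ∷ al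
at-most-one-diag ((x , ξ) ∷ L) ideal ch@(a ∷ ch') (p ∷ ps) (d ∷ ds) h | no n =
  x , (λ _ → refl) ∷ none L n
  where
  none : ∀ L → ¬ HasDiag L → All (λ e → OnDiag (pos e) → pos e ≡ x) L
  none [] _ = []
  none (y ∷ L) n = (λ o → ⊥-elim (n (here o))) ∷ none L (λ h → n (there h))

module _ {Q : Region} where

  AllQ : List Marked → Set
  AllQ = All (λ e → Q (pos e))

  cross-Q : ∀ {m f z x x' z' g} → Cross m f z x x' z' g → Q (pos z) → Q (pos x) → Q (pos x') × Q (pos z')
  cross-Q (non _ _) a b = b , a
  cross-Q (mv _ _ _) a b = a , b
  cross-Q (lv _) a b = a , b
  cross-Q (en _) a b = a , b

  row-Q : ∀ {m f z P P' z'} → Row m f z P P' z' → Q (pos z) → AllQ P → AllQ P' × Q (pos z')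
  row-Q [] a [] = [] , a
  row-Q (c ∷ r) a (b ∷ bs) with cross-Q c a b
  ... | b' , a' with row-Q r a' bs
  ...   | bs' , a″ = (b' ∷ bs') , a″

  grid-Q : ∀ {Z P D P' A'} → Grid Z P D P' A' → AllQ Z → AllQ P → AllQ D → AllQ P' × AllQ A'
  grid-Q [] _ p d = p , d
  grid-Q (r ∷ g) (z ∷ zs) p d with row-Q r z p
  ... | p' , z' = grid-Q g zs p' (z' ∷ d)

cross-primes-nodiag : ∀ {m f z x x' z' g} → Cross m f z x x' z' g → ¬ OnDiag (pos z) → ¬ OnDiag (pos x) →
                      mark z' ≡ mark z × mark x' ≡ mark x
cross-primes-nodiag (non _ _) _ _ = refl , refl
cross-primes-nodiag (mv _ _ _) _ _ = refl , refl
cross-primes-nodiag (lv _) n _ = ⊥-elim (n refl)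
cross-primes-nodiag (en _) _ n = ⊥-elim (n refl)

NoDiag : List Marked → Set
NoDiag = AllQ {λ b → ¬ OnDiag b}

row-primes-nodiag : ∀ {m f z P P' z'} → Row m f z P P' z' → ¬ OnDiag (pos z) → NoDiag P →
                    mark z' ≡ mark z × primes P' ≡ primes P
row-primes-nodiag [] _ _ = refl , refl
row-primes-nodiag (c ∷ r) nz (n ∷ ns) with cross-primes-nodiag c nz n
... | ez , ex with row-primes-nodiag r (proj₂ (cross-Q {λ b → ¬ OnDiag b} c nz n)) ns
...   | ez' , eP = trans ez' ez , cong₂ _+_ (cong bit ex) eP

grid-primes-nodiag : ∀ {Z P D P' A'} → Grid Z P D P' A' → NoDiag Z → NoDiag P →
                     primes P' ≡ primes P × primes A' ≡ primes Z + primes D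
grid-primes-nodiag [] _ _ = refl , refl
grid-primes-nodiag {z ∷ Z} {D = D} (_∷_ {z' = z'} r g) (nz ∷ nZ) nP with row-primes-nodiag r nz nP
... | ez , eP with grid-primes-nodiag g nZ (proj₁ (row-Q {λ b → ¬ OnDiag b} r nz nP))
...   | eP' , eA = trans eP' eP , trans eA (trans (cong (λ t → primes Z + (bit t + primes D)) ez)
                    (rearrange (bit (mark z)) (primes Z) (primes D)))
  where
  rearrange : ∀ a b c → b + (a + c) ≡ (a + b) + c
  rearrange = solve-∀

-- (S3), (S4) and (S7) involve two diagonal boxes, (i, i) and (i+1, i+1). With d as the only
-- diagonal box of both strips they cannot occur, and every other cell preserves the total number of
-- primes. `JustLeft` rules out (S3) and `follows-false` the other two.
OneDiag : Box → Region
OneDiag d b = OnDiag b → b ≡ d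

JustLeft : Box → Box → Bool → Set
JustLeft d z true = Σ ℕ λ i → z ≡ (i , suc i) × (i , i) ≡ d
JustLeft d z false = ⊤

cross-primes : ∀ {d f z x x' z' g} → Cross false f z x x' z' g → OneDiag d (pos z) → OneDiag d (pos x) →
               JustLeft d (pos z) f →
               (bit (mark x') + bit (mark z') ≡ bit (mark z) + bit (mark x)) × JustLeft d (pos z') g
cross-primes {z = z} {x} (non _ _) _ _ _ = +-comm (bit (mark x)) (bit (mark z)) , _
cross-primes {z = z} {x} (mv _ _ _) _ _ _ = +-comm (bit (mark x)) (bit (mark z)) , _
cross-primes (lv refl) oz ox j = refl , (_ , refl , oz refl)
cross-primes {f = false} (en refl) oz ox j = refl , _
cross-primes {f = true} (en e) oz ox (_ , refl , eq) with trans eq (sym (ox refl))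
... | ()

row-primes : ∀ {d f z P P' z'} → Row false f z P P' z' → OneDiag d (pos z) → AllQ {OneDiag d} P →
             JustLeft d (pos z) f → primes P' + bit (mark z') ≡ bit (mark z) + primes P
row-primes [] _ _ _ = sym (+-identityʳ _)
row-primes {d} (_∷_ {z = z} {x} {x'} {z₁} {P = P} {P'} {z'} c r) oz (ox ∷ os) j
  with cross-primes c oz ox j | proj₂ (cross-Q {OneDiag d} c oz ox)
... | e , j' | o' with row-primes r o' os j'
...   | e' = trans (+-assoc (bit (mark x')) (primes P') (bit (mark z')))
      (trans (cong (bit (mark x') +_) e')
      (trans (sym (+-assoc (bit (mark x')) (bit (mark z₁)) (primes P)))
      (trans (cong (_+ primes P) e) (+-assoc (bit (mark z)) (bit (mark x)) (primes P)))))

follows-false : ∀ {d} z D → OneDiag d (pos z) → AllQ {OneDiag d} D → follows z D ≡ false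
follows-false z [] _ _ = refl
follows-false z (w ∷ D) oz (ow ∷ _) =
  dec-false (onDiag? (pos z) ×-dec (pos w ≟B diagSE (pos z)))
    λ { (o , refl) → n≢1+n (cong proj₁ (trans (oz o) (sym (ow refl)))) }

grid-primes : ∀ {d Z P D P' A'} → Grid Z P D P' A' → AllQ {OneDiag d} Z → AllQ {OneDiag d} P → AllQ {OneDiag d} D →
              primes P' + primes A' ≡ primes Z + primes P + primes D
grid-primes [] _ _ _ = refl
grid-primes {d} {z ∷ Z} {P} {D} {P'} {A'} (_∷_ {P₁ = P₁} {z' = z'} r g) (oz ∷ oZ) oP oD
  with row-Q {OneDiag d} r oz oP
... | oP' , oz' = trans (grid-primes g oZ oP' (oz' ∷ oD))
      (trans (l₁ (primes Z) (primes P₁) (bit (mark z')) (primes D))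
      (trans (cong (λ t → primes Z + t + primes D) (row-primes (subst (λ m → Row m false z P P₁ z') (follows-false z D oz oD) r) oz oP _))
             (l₂ (primes Z) (bit (mark z)) (primes P) (primes D))))
  where
  l₁ : ∀ a b c d → a + b + (c + d) ≡ a + (b + c) + d
  l₁ = solve-∀
  l₂ : ∀ a b c d → a + (b + c) + d ≡ b + a + c + d
  l₂ = solve-∀

primes-ʳ++ : ∀ A B → primes (A ʳ++ B) ≡ primes A + primes B
primes-ʳ++ [] B = refl
primes-ʳ++ (x ∷ A) B = trans (primes-ʳ++ A (x ∷ B)) (l (primes A) (bit (mark x)) (primes B))
  where
  l : ∀ a b c → a + (b + c) ≡ b + a + c
  l = solve-∀

primes-reverse : ∀ A → primes (reverse A) ≡ primes A
primes-reverse A = trans (primes-ʳ++ A []) (+-identityʳ _)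

AllQ-ʳ++ : ∀ {Q : Marked → Set} A {B} → All Q A → All Q B → All Q (A ʳ++ B)
AllQ-ʳ++ [] _ b = b
AllQ-ʳ++ (x ∷ A) (a ∷ as) b = AllQ-ʳ++ A as (a ∷ b)

AllPairs-ʳ++ : ∀ {R : Marked → Marked → Set} A {B} → AllPairs R A → AllPairs (λ x y → R y x) B →
               All (λ y → All (λ b → R b y) B) A → AllPairs (λ x y → R y x) (A ʳ++ B)
AllPairs-ʳ++ [] _ b _ = b
AllPairs-ʳ++ (x ∷ A) (a ∷ as) b (c ∷ cs) =
  AllPairs-ʳ++ A as (c ∷ b) (All.zipWith (λ { (p , q) → p ∷ q }) (a , cs))

-- A pair of one-letter tableaux, the second extending the first.
record Strips (K : Region) (A B : List Marked) : Set where
  field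
    ideal : Ideal K
    chain : Chain K (A ++ B)
    pwA   : AllPairs PW A
    pwB   : AllPairs PW B
    dA    : All Diag0 A
    dB    : All Diag0 B

strips⇒facts : ∀ {K A B} → Strips K A B → Facts K (reverse A) B []
strips⇒facts {K} {A} {B} s = record
  { ideal = ideal
  ; rc = proj₁ split
  ; ch = subst (Chain _) (sym (++-identityʳ B)) (proj₂ split)
  ; pwZ = AllPairs-ʳ++ A pwA [] (All.universal (λ _ → []) A)
  ; pwP = pwB
  ; dZ = AllQ-ʳ++ A dA []
  ; dP = dB
  ; dD = []
  }
  where
  open Strips s
  split : RChain K (reverse A) × Chain (K ⊕ reverse A) B
  split = unzip (reverse A) (subst (Chain K) (sym (reverse-ʳ++ A B)) chain)

Switched : (A B B' A' : List Marked) → Set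
Switched A B B' A' = Grid (reverse A) B [] B' A'

switched-strips : ∀ {K A B B' A'} → Strips K A B → Switched A B B' A' → Strips K B' A'
switched-strips s g with grid-facts (strips⇒facts s) g
... | F = record
  { ideal = Facts.ideal F ; chain = Facts.ch F ; pwA = Facts.pwP F ; pwB = grid-PW (strips⇒facts s) g
  ; dA = Facts.dP F ; dB = Facts.dD F }

switched-boxes : ∀ {A B B' A'} → Switched A B B' A' → BoxGrid (boxes A) (boxes B) (boxes B') (boxes A')
switched-boxes {A} {B} {B'} {A'} g =
  subst (λ t → BoxGrid t (boxes B) (boxes B') (boxes A')) (reverse-boxes A) (grid-boxes g [])

strips-split : ∀ {K A B} → Strips K A B → Chain K A × Ideal (K ⊕ reverse A) × Chain (K ⊕ reverse A) B
strips-split {A = A} {B} s with strips⇒facts s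
... | F = chain-prefix A (Strips.chain s) , ideal-⊕ (Strips.ideal s) (Facts.rc F) ,
          subst (Chain _) (++-identityʳ B) (Facts.ch F)

⊕-cong : ∀ {K} Z Z' → boxes Z ≡ boxes Z' → ∀ {q} → (K ⊕ Z) q → (K ⊕ Z') q
⊕-cong [] [] e k = k
⊕-cong (x ∷ Z) (y ∷ Z') e k with boxes-inj {x} {y} {Z} {Z'} e
⊕-cong (x ∷ Z) (y ∷ Z') e (inj₁ k) | refl , e' = inj₁ (⊕-cong Z Z' e' k)
⊕-cong (x ∷ Z) (y ∷ Z') e (inj₂ k) | refl , e' = inj₂ k

boxes-reverse : ∀ A A' → boxes A ≡ boxes A' → boxes (reverse A) ≡ boxes (reverse A')
boxes-reverse A A' e = trans (reverse-map pos A) (trans (cong reverse e) (sym (reverse-map pos A')))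

reverse-Q : ∀ {Q : Region} A → AllQ {Q} A → AllQ {Q} (reverse A)
reverse-Q A a = AllQ-ʳ++ A a []

noDiag : ∀ A → ¬ HasDiag A → NoDiag A
noDiag [] n = []
noDiag (x ∷ A) n = (λ o → n (here o)) ∷ noDiag A (λ h → n (there h))

OneDiag-nodiag : ∀ {d A} → NoDiag A → AllQ {OneDiag d} A
OneDiag-nodiag = All.map (λ n o → ⊥-elim (n o))

switched-primes : ∀ {d A B B' A'} → Switched A B B' A' → AllQ {OneDiag d} A → AllQ {OneDiag d} B →
                  primes B' + primes A' ≡ primes A + primes B
switched-primes {d} {A} {B} g a b =
  trans (grid-primes g (reverse-Q {OneDiag d} A a) b [])
        (trans (+-identityʳ _) (cong (_+ primes B) (primes-reverse A)))

-- The boxes are recovered by the symmetry of the local rule.  The primes are recovered because the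
-- standardization leaves only the prime of the last primed-or-first-unprimed box free: it is absent
-- in a strip that meets the diagonal, and the total number of primes is preserved when at most one
-- of the strips does so.
switched-involutive : ∀ {K A B B' A' A″ B″} → Strips K A B → Switched A B B' A' → Switched B' A' A″ B″ →
                      A″ ≡ A × B″ ≡ B
switched-involutive {K} {A} {B} {B'} {A'} {A″} {B″} s g h =
  go (any? (λ e → onDiag? (pos e)) A) (any? (λ e → onDiag? (pos e)) B)
  where
  s' : Strips K B' A'
  s' = switched-strips s g
  s″ : Strips K A″ B″
  s″ = switched-strips s' h
  module S = Strips s
  module S″ = Strips s″
  det : boxes A″ ≡ boxes A × boxes B″ ≡ boxes B
  det = BoxGrid-det (switched-boxes h) (BoxGrid-sym (switched-boxes g))
  eA : boxes A ≡ boxes A″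
  eA = sym (proj₁ det)
  eB : boxes B ≡ boxes B″
  eB = sym (proj₂ det)
  A-diag : HasDiag A → A ≡ A″
  A-diag = diag-unique A A″ S.ideal (proj₁ (strips-split s)) (proj₁ (strips-split s″)) S.pwA S″.pwA S.dA S″.dA eA
  B-diag : HasDiag B → B ≡ B″
  B-diag = diag-unique B B″ (proj₁ (proj₂ (strips-split s))) (proj₂ (proj₂ (strips-split s)))
    (Chain-resp B″ (⊕-cong (reverse A″) (reverse A) (boxes-reverse A″ A (proj₁ det)))
                   (⊕-cong (reverse A) (reverse A″) (boxes-reverse A A″ eA))
                   (proj₂ (proj₂ (strips-split s″))))
    S.pwB S″.pwB S.dB S″.dB eB
  module _ {d} (a : AllQ {OneDiag d} A) (b : AllQ {OneDiag d} B) where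
    total : primes A″ + primes B″ ≡ primes A + primes B
    total with grid-Q {OneDiag d} g (reverse-Q {OneDiag d} A a) b []
    ... | b' , a' = trans (switched-primes {d} h b' a')
                          (switched-primes {d} g a b)
  go : Dec (HasDiag A) → Dec (HasDiag B) → A″ ≡ A × B″ ≡ B
  go (yes da) (yes db) = sym (A-diag da) , sym (B-diag db)
  go (yes da) (no nb) with A-diag da | at-most-one-diag A S.ideal (proj₁ (strips-split s)) S.pwA S.dA da
  ... | refl | d , o = refl , sym (primes-unique B B″ S.pwB S″.pwB eB
    (sym (+-cancelˡ-≡ (primes A) _ _ (total {d} o (OneDiag-nodiag {d} (noDiag B nb))))))
  go (no na) (yes db)
    with B-diag db | at-most-one-diag B (proj₁ (proj₂ (strips-split s))) (proj₂ (proj₂ (strips-split s))) S.pwB S.dB db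
  ... | refl | d , o = sym (primes-unique A A″ S.pwA S″.pwA eA
    (sym (+-cancelʳ-≡ (primes B) _ _ (total {d} (OneDiag-nodiag {d} (noDiag A na)) o)))) , refl
  go (no na) (no nb)
    with grid-primes-nodiag g (reverse-Q {λ b → ¬ OnDiag b} A (noDiag A na)) (noDiag B nb)
       | grid-Q {λ b → ¬ OnDiag b} g (reverse-Q {λ b → ¬ OnDiag b} A (noDiag A na)) (noDiag B nb) []
  ... | eB' , eA' | nB' , nA' with grid-primes-nodiag h (reverse-Q {λ b → ¬ OnDiag b} B' nB') nA'
  ...   | eA″ , eB″ =
    sym (primes-unique A A″ S.pwA S″.pwA eA
      (sym (trans eA″ (trans eA' (trans (+-identityʳ _) (primes-reverse A)))))) ,
    sym (primes-unique B B″ S.pwB S″.pwB eB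
      (sym (trans eB″ (trans (+-identityʳ _) (trans (primes-reverse B') eB')))))

-- The switching process on two strips

-- The unmodified switches sorted by the 𝐛-neighbours of c, which makes the alternatives visibly
-- exclusive. (S3) belongs to `onlyE` because the south neighbour of a diagonal box is no 𝐛-box.
data Plain (a b : ℕ) (st : State) (c : Box) (st' : State) : Set where
  onlyE : BBox b st (east c) → ¬ BBox b st (south c) →
          (S3conf a b st c × st' ≡ upd c (st (diagSE c)) (upd (east c) (just (lT , unp b)) (upd (diagSE c) (st c) st)) ⊎
           ¬ S3conf a b st c × st' ≡ swapB c (east c) st) → Plain a b st c st'
  onlyS : BBox b st (south c) → ¬ BBox b st (east c) →
          (S4conf a b st c × st' ≡ upd (diagW c) (st (south c)) (upd c (just (lS , pr a)) (upd (south c) (st (diagW c)) st)) ⊎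
           ¬ S4conf a b st c × st' ≡ swapB c (south c) st) → Plain a b st c st'
  bothU : BBox b st (south c) → st (east c) ≡ just (lT , unp b) →
          (S7conf a b st c × st' ≡ upd (diagW c) (st (south c)) (upd c (just (lS , pr a)) (upd (south c) (st (diagW c)) st)) ⊎
           ¬ S7conf a b st c × st' ≡ swapB c (south c) st) → Plain a b st c st'
  bothP : BBox b st (south c) → st (east c) ≡ just (lT , pr b) → st' ≡ swapB c (east c) st → Plain a b st c st'

data Modified (a b : ℕ) (st : State) (c : Box) (st' : State) : Set where
  m1 : ¬ BBox b st (south c) → st' ≡ upd c (just (lT , unp b)) (upd (east c) (just (lS , pr a)) st) →
       Modified a b st c st'
  m26 : BBox b st (south c) → st' ≡ upd c (just (lT , pr b)) (upd (south c) (just (lS , unp a)) st) →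
        Modified a b st c st'

module _ {a b : ℕ} {st : State} {c : Box} where

  switch-view : ∀ {st'} → (OnDiag c → ¬ BBox b st (south c)) → Switch a b st c st' →
                (ModConf a b st c × Modified a b st c st') ⊎ (¬ ModConf a b st c × Plain a b st c st')
  switch-view _ (sw1' x@(_ , _ , _ , n , _)) = inj₁ (inj₁ x , m1 n refl)
  switch-view _ (sw2' x@(_ , _ , s , _)) = inj₁ (inj₂ (inj₁ x) , m26 (_ , s , refl) refl)
  switch-view _ (sw6' x@(_ , _ , _ , s)) = inj₁ (inj₂ (inj₂ x) , m26 (_ , s , refl) refl)
  switch-view d (sw3 n x@(o , _ , e , _)) = inj₂ (n , onlyE (_ , e , refl) (d o) (inj₁ (x , refl)))
  switch-view _ (sw4 n x@(_ , _ , _ , s , ne)) = inj₂ (n , onlyS s ne (inj₁ (x , refl)))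
  switch-view _ (sw7 n x@(_ , _ , _ , s , e)) = inj₂ (n , bothU s e (inj₁ (x , refl)))
  switch-view _ (sw5 n e s) = inj₂ (n , bothP s e refl)
  switch-view _ (sw6 n e s n7) = inj₂ (n , bothU s e (inj₂ (n7 , refl)))
  switch-view _ (sw1 n e ns n3) = inj₂ (n , onlyE e ns (inj₂ (n3 , refl)))
  switch-view _ (sw2 n s ne n4) = inj₂ (n , onlyS s ne (inj₂ (n4 , refl)))

  pick : ∀ {X : Set} {s t u v : State} → (X × s ≡ u ⊎ ¬ X × s ≡ v) → (X × t ≡ u ⊎ ¬ X × t ≡ v) → s ≡ t
  pick (inj₁ (_ , refl)) (inj₁ (_ , refl)) = refl
  pick (inj₁ (x , _)) (inj₂ (n , _)) = ⊥-elim (n x)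
  pick (inj₂ (n , _)) (inj₁ (x , _)) = ⊥-elim (n x)
  pick (inj₂ (_ , refl)) (inj₂ (_ , refl)) = refl

  plain-det : ∀ {s t} → Plain a b st c s → Plain a b st c t → s ≡ t
  plain-det (onlyE _ _ x) (onlyE _ _ y) = pick x y
  plain-det (onlyE _ n _) (onlyS s _ _) = ⊥-elim (n s)
  plain-det (onlyE _ n _) (bothU s _ _) = ⊥-elim (n s)
  plain-det (onlyE _ n _) (bothP s _ _) = ⊥-elim (n s)
  plain-det (onlyS s _ _) (onlyE _ n _) = ⊥-elim (n s)
  plain-det (onlyS _ _ x) (onlyS _ _ y) = pick x y
  plain-det (onlyS _ n _) (bothU _ e _) = ⊥-elim (n (_ , e , refl))
  plain-det (onlyS _ n _) (bothP _ e _) = ⊥-elim (n (_ , e , refl))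
  plain-det (bothU s _ _) (onlyE _ n _) = ⊥-elim (n s)
  plain-det (bothU _ e _) (onlyS _ n _) = ⊥-elim (n (_ , e , refl))
  plain-det (bothU _ _ x) (bothU _ _ y) = pick x y
  plain-det (bothU _ e _) (bothP _ e' _) = case trans (sym e) e' of λ ()
  plain-det (bothP s _ _) (onlyE _ n _) = ⊥-elim (n s)
  plain-det (bothP _ e _) (onlyS _ n _) = ⊥-elim (n (_ , e , refl))
  plain-det (bothP _ e _) (bothU _ e' _) = case trans (sym e) e' of λ ()
  plain-det (bothP _ _ refl) (bothP _ _ refl) = refl

  modified-det : ∀ {s t} → Modified a b st c s → Modified a b st c t → s ≡ t
  modified-det (m1 _ refl) (m1 _ refl) = refl
  modified-det (m1 n _) (m26 s _) = ⊥-elim (n s)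
  modified-det (m26 s _) (m1 n _) = ⊥-elim (n s)
  modified-det (m26 _ refl) (m26 _ refl) = refl

  switch-det : ∀ {s t} → (OnDiag c → ¬ BBox b st (south c)) → Switch a b st c s → Switch a b st c t → s ≡ t
  switch-det d x y with switch-view d x | switch-view d y
  ... | inj₁ (_ , p) | inj₁ (_ , q) = modified-det p q
  ... | inj₁ (m , _) | inj₂ (n , _) = ⊥-elim (n m)
  ... | inj₂ (n , _) | inj₁ (m , _) = ⊥-elim (n m)
  ... | inj₂ (_ , p) | inj₂ (_ , q) = plain-det p q

-- Total correctness is needed in both halves: the given run has to be analysed, and for the reverse
-- procedure a run has to be produced.
Outcome : ℕ → ℕ → State → (State → Set) → Set
Outcome a b st Q = Σ State (Process a b st) × (∀ st' → Process a b st st' → Q st')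

outcome-step : ∀ {a b st c st' Q} → IsBoxU a b st c → (∀ c' → IsBoxU a b st c' → c' ≡ c) →
               (OnDiag c → ¬ BBox b st (south c)) → HasBNbr a b st c → Switch a b st c st' →
               Outcome a b st' Q → Outcome a b st Q
outcome-step {a} {b} {st} {c} {st'} {Q} u uniq d nb sw ((_ , p) , all) = (_ , step u sw p) , inv
  where
  inv : ∀ s → Process a b st s → Q s
  inv s (done fs) = ⊥-elim (fs c nb)
  inv s (step {c = c'} u' sw' p') with uniq c' u'
  ... | refl with switch-det d sw' sw
  ...   | refl = all s p'

upd-same : ∀ p v st → upd p v st p ≡ v
upd-same p v st rewrite dec-true (p ≟B p) refl = refl

upd-other : ∀ p v st {q} → q ≢ p → upd p v st q ≡ st q
upd-other p v st {q} n rewrite dec-false (q ≟B p) n = refl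

Other : ℕ → ℕ → Cell → Set
Other a b (l , x) = ¬ (l ≡ lS × val x ≡ a) × ¬ (l ≡ lT × val x ≡ b)

module _ (a b : ℕ) (st₀ : State) (MA MB : Marked → Set) where

  -- The clause `isO` is a frame condition: cells that belong to neither strip keep the content they
  -- had in the initial state `st₀`.
  data Content (q : Box) : Cell → Set where
    isA : ∀ {ζ} → MA (q , ζ) → Content q (lS , lt a ζ)
    isB : ∀ {ζ} → MB (q , ζ) → Content q (lT , lt b ζ)
    isO : ∀ {v} → Other a b v → st₀ q ≡ just v → Content q v

  record Rep (st : State) : Set where
    field
      sound : ∀ {q v} → st q ≡ just v → Content q v
      cover : ∀ {q v} → Content q v → st q ≡ just v

module _ {a b : ℕ} {st₀ : State} {MA MB : Marked → Set} {st : State} (R : Rep a b st₀ MA MB st) where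
  open Rep R

  atA : ∀ {q ζ} → st q ≡ just (lS , lt a ζ) → MA (q , ζ)
  atA e with sound e
  ... | isA m = m
  ... | isO (n , _) _ = ⊥-elim (n (refl , refl))

  atB : ∀ {q ζ} → st q ≡ just (lT , lt b ζ) → MB (q , ζ)
  atB e with sound e
  ... | isB m = m
  ... | isO (_ , n) _ = ⊥-elim (n (refl , refl))

  rep-resp : ∀ {MA' MB'} → (∀ {e} → MA e → MA' e) → (∀ {e} → MA' e → MA e) →
             (∀ {e} → MB e → MB' e) → (∀ {e} → MB' e → MB e) → Rep a b st₀ MA' MB' st
  rep-resp f g h k = record
    { sound = λ e → case sound e of λ { (isA m) → isA (f m) ; (isB m) → isB (h m) ; (isO o e') → isO o e' }
    ; cover = λ { (isA m) → cover (isA (g m)) ; (isB m) → cover (isB (k m)) ; (isO o e) → cover (isO o e) } }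

  rep-swap : ∀ {st' p q ζ ξ ζ' ξ'} → MA (p , ζ) → MB (q , ξ) →
             st' p ≡ just (lT , lt b ξ') → st' q ≡ just (lS , lt a ζ') →
             (∀ {r} → r ≢ p → r ≢ q → st' r ≡ st r) →
             Rep a b st₀ (λ e → (MA e × pos e ≢ p) ⊎ e ≡ (q , ζ')) (λ e → (MB e × pos e ≢ q) ⊎ e ≡ (p , ξ')) st'
  rep-swap {st'} {p} {q} {ζ} {ξ} {ζ'} {ξ'} mA mB ep eq er = record { sound = so ; cover = co }
    where
    MA' MB' : Marked → Set
    MA' e = (MA e × pos e ≢ p) ⊎ e ≡ (q , ζ')
    MB' e = (MB e × pos e ≢ q) ⊎ e ≡ (p , ξ')
    so : ∀ {r v} → st' r ≡ just v → Content a b st₀ MA' MB' r v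
    so {r} e with r ≟B p | r ≟B q
    ... | yes refl | _ with just-injective (trans (sym e) ep)
    ...   | refl = isB (inj₂ refl)
    so {r} e | no _ | yes refl with just-injective (trans (sym e) eq)
    ...   | refl = isA (inj₂ refl)
    so {r} e | no np | no nq with sound (trans (sym (er np nq)) e)
    ...   | isA m = isA (inj₁ (m , np))
    ...   | isB m = isB (inj₁ (m , nq))
    ...   | isO o e' = isO o e'
    sp : st p ≡ just (lS , lt a ζ)
    sp = cover (isA mA)
    sq : st q ≡ just (lT , lt b ξ)
    sq = cover (isB mB)
    co : ∀ {r v} → Content a b st₀ MA' MB' r v → st' r ≡ just v
    co (isA (inj₂ refl)) = eq
    co (isB (inj₂ refl)) = ep
    co (isA (inj₁ (m , np))) =
      trans (er np (λ { refl → case trans (sym sq) (cover (isA m)) of λ () })) (cover (isA m))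
    co (isB (inj₁ (m , nq))) =
      trans (er (λ { refl → case trans (sym sp) (cover (isB m)) of λ () }) nq) (cover (isB m))
    co (isO (nA , nB) e) =
      trans (er (λ { refl → case trans (sym sp) (cover (isO (nA , nB) e)) of λ { refl → nA (refl , refl) } })
                (λ { refl → case trans (sym sq) (cover (isO (nA , nB) e)) of λ { refl → nB (refl , refl) } }))
            (cover (isO (nA , nB) e))

bBox? : ∀ b st q → Dec (BBox b st q)
bBox? b st q with st q
... | nothing = no λ ()
... | just (lS , x) = no λ { (_ , () , _) }
... | just (lT , x) with val x ≟ b
...   | yes e = yes (x , refl , e)
...   | no n = no λ { (_ , refl , e) → n e }

chain-∉ : ∀ {K L e} → Chain K L → e ∈ L → InQ (pos e) × ¬ K (pos e)
chain-∉ ((i , n , _) ∷ _) (here refl) = i , n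
chain-∉ (_ ∷ ch) (there m) with chain-∉ ch m
... | i , n = i , λ k → n (inj₁ k)

chain-noback : ∀ {K} L {M d q} → Ideal K → Chain K (L ++ M) → d ∈ M → K q ⊎ Σ Bool (λ ξ → (q , ξ) ∈ L) →
               ¬ (pos d ⋖ q)
chain-noback [] ideal ch m (inj₁ k) d⋖q with chain-∉ ch m
... | i , n = n (ideal d⋖q i k)
chain-noback (x ∷ L) ideal (a ∷ ch) m (inj₁ k) = chain-noback L (ideal-∪₁ ideal a) ch m (inj₁ (inj₁ k))
chain-noback (x ∷ L) ideal (a ∷ ch) m (inj₂ (_ , here refl)) = chain-noback L (ideal-∪₁ ideal a) ch m (inj₁ (inj₂ refl))
chain-noback (x ∷ L) ideal (a ∷ ch) m (inj₂ (ξ , there i)) = chain-noback L (ideal-∪₁ ideal a) ch m (inj₂ (ξ , i))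

∈-ʳ++⁺ˡ : ∀ {e} P {L : List Marked} → e ∈ P → e ∈ P ʳ++ L
∈-ʳ++⁺ʳ : ∀ {e} P {L : List Marked} → e ∈ L → e ∈ P ʳ++ L
∈-ʳ++⁺ˡ (x ∷ P) (here refl) = ∈-ʳ++⁺ʳ P (here refl)
∈-ʳ++⁺ˡ (x ∷ P) (there m) = ∈-ʳ++⁺ˡ P m
∈-ʳ++⁺ʳ [] m = m
∈-ʳ++⁺ʳ (x ∷ P) m = ∈-ʳ++⁺ʳ P (there m)

∈-ʳ++⁻ : ∀ {e} P {L : List Marked} → e ∈ P ʳ++ L → e ∈ P ⊎ e ∈ L
∈-ʳ++⁻ [] m = inj₂ m
∈-ʳ++⁻ (x ∷ P) m with ∈-ʳ++⁻ P m
... | inj₁ i = inj₁ (there i)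
... | inj₂ (here refl) = inj₁ (here refl)
... | inj₂ (there i) = inj₂ i

AllPairs-suffix : ∀ {R : Marked → Marked → Set} P {L} → AllPairs R (P ʳ++ L) → AllPairs R L
AllPairs-suffix [] p = p
AllPairs-suffix (x ∷ P) p with AllPairs-suffix P p
... | _ ∷ q = q

All-suffix : ∀ {R : Marked → Set} P {L} → All R (P ʳ++ L) → All R L
All-suffix [] p = p
All-suffix (x ∷ P) p = All.tail (All-suffix P p)

PW-true : ∀ {x c} → PW x (c , true) → mark x ≡ true × row (pos x) < row c
PW-true (tt r) = refl , r

PW-moveE : ∀ {e i j ζ} → PW e ((i , j) , ζ) → PW e ((i , suc j) , ζ)
PW-moveE (tt r) = tt r
PW-moveE tf = tf
PW-moveE (ff c) = ff (m≤n⇒m≤1+n c)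

PW-moveS : ∀ {e i j ζ} → PW e ((i , j) , ζ) → PW e ((suc i , j) , ζ)
PW-moveS (tt r) = tt (m≤n⇒m≤1+n r)
PW-moveS tf = tf
PW-moveS (ff c) = ff c

-- The situation in the middle of a row: the 𝐚-box c has passed P₁ (in reverse order) and P₂ is
-- still ahead; Z are the 𝐚-boxes (in reverse order) that move after c, and D those that have moved.
record Inv (K : Region) (Z : List Marked) (c : Marked) (P₁ P₂ D : List Marked) : Set where
  field
    ideal : Ideal K
    chain : Chain K (c ∷ P₂ ++ D)
    inZ   : ∀ {e} → e ∈ Z → K (pos e)
    inP₁  : ∀ {e} → e ∈ P₁ → K (pos e)
    pwP₂  : AllPairs PW P₂
    pwZ   : AllPairs (λ x y → PW y x) Z
    before : All (λ e → PW e c) Z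
    beforeDiag : OnDiag (pos c) → All (λ e → mark e ≡ true × row (pos e) < row (pos c)) Z
    dc    : Diag0 c
    dP₂   : All Diag0 P₂
    dZ    : All Diag0 Z
    noS4  : ∀ {z Z'} → Z ≡ z ∷ Z' → OnDiag (pos z) → pos c ≢ diagSE (pos z)

cross-mono : ∀ {m f z x x' z' g e} → Cross m f z x x' z' g → (OnDiag (pos z) → mark e ≡ true × row (pos e) < row (pos z)) →
             PW e z → PW e z'
cross-mono (non _ _) _ p = p
cross-mono (mv E _ _) _ p = PW-moveE p
cross-mono (mv S _ _) _ p = PW-moveS p
cross-mono {e = _ , _} (lv {ζ' = true} _) d p with d refl
... | refl , r = tt r
cross-mono (lv {ζ' = false} _) _ p = PW-moveE p
cross-mono (en _) _ (tt r) = tf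
cross-mono (en _) _ tf = tf
cross-mono (en _) _ (ff c) = ff c

-- An entry into the diagonal is excluded: `beforeDiag` and `noS4` may fail after it, and by `stay`
-- the row has no further move then.
inv-step : ∀ {K Z c x P₁ P₂ D m f x' c' g} → Inv K Z c P₁ (x ∷ P₂) D → (k : Cross m f c x x' c' g) → ¬ Enters k →
           Inv (K ∪₁ pos x') Z c' (x' ∷ P₁) P₂ D
inv-step {K} {Z} {c} {x} {x' = x'} {c'} I k n with cell-chain k (Inv.chain I)
... | a ∷ ch = record
  { ideal = ideal-∪₁ ideal a
  ; chain = ch
  ; inZ = λ m → inj₁ (inZ m)
  ; inP₁ = λ { (here refl) → inj₂ refl ; (there m) → inj₁ (inP₁ m) }
  ; pwP₂ = case pwP₂ of λ { (_ ∷ p) → p }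
  ; pwZ = pwZ
  ; before = All.tabulate (λ m → cross-mono k (λ d → All.lookup (beforeDiag d) m) (All.lookup before m))
  ; beforeDiag = bd k n
  ; dc = cell-diag0-z k dc
  ; dP₂ = All.tail dP₂
  ; dZ = dZ
  ; noS4 = s4 k n
  }
  where
  open Inv I
  bd : ∀ {m f x x' c' g} (k : Cross m f c x x' c' g) → ¬ Enters k → OnDiag (pos c') →
       All (λ e → mark e ≡ true × row (pos e) < row (pos c')) Z
  bd (non _ _) _ d = beforeDiag d
  bd (mv _ _ n) _ d = ⊥-elim (n d)
  bd (lv _) _ d = ⊥-elim (1+n≢n d)
  bd (en _) n d = ⊥-elim (n _)
  s4 : ∀ {m f x x' c' g} (k : Cross m f c x x' c' g) → ¬ Enters k →
       ∀ {z Z'} → Z ≡ z ∷ Z' → OnDiag (pos z) → pos c' ≢ diagSE (pos z)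
  s4 (non _ _) _ e d q = noS4 e d q
  s4 (mv _ _ n) _ e d refl = n refl
  s4 (lv _) _ e d ()
  s4 (en _) n e d q = n _

All-reverse-order : ∀ {K z Z} → RChain K (z ∷ Z) → Ideal K → AllPairs (λ x y → PW y x) (z ∷ Z) → All Diag0 (z ∷ Z) →
                    OnDiag (pos z) → All (λ e → mark e ≡ true × row (pos e) < row (pos z)) Z
All-reverse-order {Z = []} _ _ _ _ _ = []
All-reverse-order {K} {z = z} {(y , υ) ∷ Z} (a ∷ b ∷ rc) ideal ((p ∷ ps) ∷ (q ∷ qs)) (dz ∷ dZ) o
  with before-diag (ideal-⊕ ideal rc) (b ∷ a ∷ []) ((p ∷ []) ∷ [] ∷ []) (dz ∷ []) (here o)
... | refl = (refl , y<z) ∷ All.map (λ r → proj₁ (PW-true r) , <-trans (proj₂ (PW-true r)) y<z) q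
  where
  y<z : row y < row (pos z)
  y<z = ≰⇒> λ z≤y → later-⋠ (ideal-⊕ ideal rc) b a
    (z≤y , ≤-trans (≤-reflexive o) (≤-trans z≤y (proj₂ (proj₁ b))))

⊕-∈ : ∀ {K Z e} → e ∈ Z → (K ⊕ Z) (pos e)
⊕-∈ (here refl) = inj₂ refl
⊕-∈ (there m) = inj₁ (⊕-∈ m)

-- P₁ are boxes of the other strip that z does not meet, so z can be moved past them.
record Skipped (K : Region) (z : Marked) (P₁ Q D : List Marked) : Set₁ where
  field
    K'    : Region
    sub   : ∀ {q} → K q → K' q
    ideal : Ideal K'
    inP₁  : ∀ {e} → e ∈ P₁ → K' (pos e)
    chain : Chain K' (z ∷ Q ++ D)

skip : ∀ {K z D} P₁ Q → Ideal K → Chain K (z ∷ (P₁ ʳ++ Q) ++ D) → (∀ {e} → e ∈ P₁ → ¬ (pos z ⋖ pos e)) →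
       Skipped K z P₁ Q D
skip [] Q ideal ch n = record { K' = _ ; sub = λ k → k ; ideal = ideal ; inP₁ = λ () ; chain = ch }
skip {z = z} (y ∷ P₁) Q ideal ch n with skip P₁ (y ∷ Q) ideal ch (λ m → n (there m))
... | s with Skipped.chain s
...   | az ∷ ay ∷ ch' with Chain-swap {z = z} {y} (n (here refl)) (λ yz → later-⋠ (Skipped.ideal s) az ay (⋖⇒≼ yz)) (az ∷ ay ∷ ch')
...     | a ∷ ch″ = record
  { K' = Skipped.K' s ∪₁ pos y
  ; sub = λ k → inj₁ (Skipped.sub s k)
  ; ideal = ideal-∪₁ (Skipped.ideal s) a
  ; inP₁ = λ { (here refl) → inj₂ refl ; (there m) → inj₁ (Skipped.inP₁ s m) }
  ; chain = ch″ }

-- Serves (S4) and (S7): these make the first move of the next row prematurely, and the cells of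
-- that row up to this move have to be of kind `non`.
skip-row : ∀ {m z R z'} P₁ Q → Row m false z (P₁ ʳ++ Q) R z' → (∀ {e} → e ∈ P₁ → ¬ (pos z ⋖ pos e)) →
           ∃ λ Q' → R ≡ P₁ ʳ++ Q' × Row m false z Q Q' z'
skip-row [] Q r n = _ , refl , r
skip-row (y ∷ P₁) Q r n with skip-row P₁ (y ∷ Q) r (λ m → n (there m))
... | _ , refl , non _ _ ∷ r' = _ , refl , r'
... | _ , refl , mv a _ _ ∷ _ = ⊥-elim (n (here refl) a)
... | _ , refl , lv _ ∷ _ = ⊥-elim (n (here refl) E)
... | _ , refl , en _ ∷ _ = ⊥-elim (n (here refl) S)

inv-start : ∀ {K z Z P₁ Q D} (F : Facts K (z ∷ Z) (P₁ ʳ++ Q) D) (s : Skipped (K ⊕ Z) z P₁ Q D) →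
            Inv (Skipped.K' s) Z z P₁ Q D
inv-start {K} {z} {Z} {P₁} F s = record
  { ideal = Skipped.ideal s
  ; chain = Skipped.chain s
  ; inZ = λ m → Skipped.sub s (⊕-∈ {K} m)
  ; inP₁ = Skipped.inP₁ s
  ; pwP₂ = AllPairs-suffix P₁ (Facts.pwP F)
  ; pwZ = case Facts.pwZ F of λ { (_ ∷ p) → p }
  ; before = case Facts.pwZ F of λ { (p ∷ _) → p }
  ; beforeDiag = All-reverse-order (Facts.rc F) (Facts.ideal F) (Facts.pwZ F) (Facts.dZ F)
  ; dc = All.head (Facts.dZ F)
  ; dP₂ = All-suffix P₁ (Facts.dP F)
  ; dZ = All.tail (Facts.dZ F)
  ; noS4 = s4 (Facts.rc F)
  }
  where
  s4 : ∀ {Z} → RChain K (z ∷ Z) → ∀ {y Z'} → Z ≡ y ∷ Z' → OnDiag (pos y) → pos z ≢ diagSE (pos y)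
  s4 (a ∷ b ∷ rc) refl refl refl = ¬diag-consecutive (ideal-⊕ (Facts.ideal F) rc) b a

-- Every run of the process ends in the outcome of the grid

module Simulation (a b : ℕ) (st₀ : State) where

  Shows : (Z D P₁ P₂ : List Marked) → State → Set
  Shows Z D P₁ P₂ = Rep a b st₀ (λ e → e ∈ Z ⊎ e ∈ D) (λ e → e ∈ P₁ ⊎ e ∈ P₂)

  infix 4 _⇝_
  -- Quantifying over the postcondition keeps the outcome of the whole grid out of the single moves.
  _⇝_ : State → State → Set₁
  st ⇝ st' = ∀ {Q} → Outcome a b st' Q → Outcome a b st Q

  module _ {K Z c P₁ P₂ D st} (I : Inv K Z c P₁ P₂ D) (R : Shows Z (c ∷ D) P₁ P₂ st) where
    open Inv I

    c∉ : ¬ K (pos c)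
    c∉ = case chain of λ { ((_ , n , _) ∷ _) → n }

    c-inq : InQ (pos c)
    c-inq = case chain of λ { ((i , _ , _) ∷ _) → i }

    ahead : ∀ {q ξ} → pos c ⋖ q → st q ≡ just (lT , lt b ξ) → (q , ξ) ∈ P₂
    ahead c⋖q e with atB R e
    ... | inj₁ m = ⊥-elim (c∉ (ideal c⋖q c-inq (inP₁ m)))
    ... | inj₂ m = m

    ahead-inq : ∀ {e} → e ∈ P₂ → InQ (pos e) × ¬ (K ∪₁ pos c) (pos e)
    ahead-inq m with chain
    ... | _ ∷ ch = chain-∉ ch (∈-++⁺ˡ m)

    showA : st (pos c) ≡ just (lS , lt a (mark c))
    showA = Rep.cover R (isA (inj₂ (here refl)))

    showB : ∀ {q ξ} → (q , ξ) ∈ P₂ → st q ≡ just (lT , lt b ξ)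
    showB m = Rep.cover R (isB (inj₂ m))

    bNbr-done : ∀ {d} → d ∈ D → ¬ HasBNbr a b st (pos d)
    bNbr-done {d} m (_ , nb) = go nb
      where
      ch' : Chain K ((c ∷ P₂) ++ D)
      ch' = chain
      contra : ∀ {q} → pos d ⋖ q → BBox b st q → ⊥
      contra d⋖q (lt _ ξ , e , refl) with atB R e
      ... | inj₁ i = chain-noback (c ∷ P₂) ideal ch' m (inj₁ (inP₁ i)) d⋖q
      ... | inj₂ i = chain-noback (c ∷ P₂) ideal ch' m (inj₂ (_ , there i)) d⋖q
      go : BBox b st (east (pos d)) ⊎ BBox b st (south (pos d)) → ⊥
      go (inj₁ x) = contra E x
      go (inj₂ x) = contra S x

    HasNbr : Set
    HasNbr = BBox b st (east (pos c)) ⊎ BBox b st (south (pos c))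

    hasBNbr : HasNbr → HasBNbr a b st (pos c)
    hasBNbr nb = (_ , showA , refl) , nb

    private
      candU : ∀ {p} → CandU a b st p → (p , false) ∈ Z ⊎ (p , false) ≡ c
      candU (e , nb) with atA R e
      ... | inj₁ m = inj₁ m
      ... | inj₂ (here e') = inj₂ e'
      ... | inj₂ (there m) = ⊥-elim (bNbr-done m nb)

      candP : ∀ {p} → CandP a b st p → (p , true) ∈ Z ⊎ (p , true) ≡ c
      candP (e , nb) with atA R e
      ... | inj₁ m = inj₁ m
      ... | inj₂ (here e') = inj₂ e'
      ... | inj₂ (there m) = ⊥-elim (bNbr-done m nb)

    -- Boxes that have moved have no 𝐛-neighbour left, so the candidates are c and the waiting boxes
    -- Z, all before c in `PW`. Read from its end, this order lists the easternmost unprimed box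
    -- first and, after the unprimed ones, the southernmost primed one, exactly as the rule for □(U)
    -- does.
    boxU : HasNbr → IsBoxU a b st (pos c)
    boxU nb = go c refl showA (hasBNbr nb)
      where
      go : ∀ c' → c' ≡ c → st (pos c') ≡ just (lS , lt a (mark c')) → HasBNbr a b st (pos c') → IsBoxU a b st (pos c')
      go (p , false) e s nb = inj₁ ((s , nb) , below)
        where
        below : ∀ q → CandU a b st q → col q ≤ col p
        below q cu with candU cu
        ... | inj₂ e' = ≤-reflexive (cong (λ t → col (pos t)) (trans e' (sym e)))
        ... | inj₁ m with subst (PW _) (sym e) (All.lookup before m)
        ...   | ff l = <⇒≤ l
      go (p , true) e s nb = inj₂ (none , (s , nb) , below)
        where
        none : ∀ q → ¬ CandU a b st q
        none q cu with candU cu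
        ... | inj₂ e' = case trans e' (sym e) of λ ()
        ... | inj₁ m with subst (PW _) (sym e) (All.lookup before m)
        ...   | ()
        below : ∀ q → CandP a b st q → row q ≤ row p
        below q cp with candP cp
        ... | inj₂ e' = ≤-reflexive (cong (λ t → row (pos t)) (trans e' (sym e)))
        ... | inj₁ m with subst (PW _) (sym e) (All.lookup before m)
        ...   | tt l = <⇒≤ l

    boxU-unique : HasNbr → ∀ p → IsBoxU a b st p → p ≡ pos c
    boxU-unique nb p u = go c refl showA (hasBNbr nb) u
      where
      go : ∀ c' → c' ≡ c → st (pos c') ≡ just (lS , lt a (mark c')) → HasBNbr a b st (pos c') → IsBoxU a b st p → p ≡ pos c
      go c' e s nb (inj₁ (cu , max)) with candU cu
      ... | inj₂ e' = cong pos e'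
      go (q , false) e s nb (inj₁ (cu , max)) | inj₁ m with subst (PW _) (sym e) (All.lookup before m)
      ... | ff l = ⊥-elim (<⇒≱ l (max q (s , nb)))
      go (q , true) e s nb (inj₁ (cu , max)) | inj₁ m with subst (PW _) (sym e) (All.lookup before m)
      ... | ()
      go c' e s nb (inj₂ (none , cp , max)) with candP cp
      ... | inj₂ e' = cong pos e'
      go (q , false) e s nb (inj₂ (none , cp , max)) | inj₁ m = ⊥-elim (none q (s , nb))
      go (q , true) e s nb (inj₂ (none , cp , max)) | inj₁ m with subst (PW _) (sym e) (All.lookup before m)
      ... | tt l = ⊥-elim (<⇒≱ l (max q (s , nb)))

    noSouth : OnDiag (pos c) → ¬ BBox b st (south (pos c))
    noSouth refl (lt _ _ , e , refl) = <-irrefl refl (proj₂ (proj₁ (ahead-inq (ahead S e))))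

    switch : ∀ {st'} → HasNbr → Switch a b st (pos c) st' → st ⇝ st'
    switch nb sw = outcome-step (boxU nb) (boxU-unique nb) noSouth (hasBNbr nb) sw

  chain-tail : ∀ {K x L} → Chain K (x ∷ L) → Chain (K ∪₁ pos x) L
  chain-tail (_ ∷ ch) = ch

  chain-distinct : ∀ {K x L e} → Chain K (x ∷ L) → e ∈ L → pos e ≢ pos x
  chain-distinct (_ ∷ ch) m e = proj₂ (chain-∉ ch m) (inj₂ e)

  shows-step : ∀ {K Z c x P₁ P₂ D st st' ζ' ξ'} → Inv K Z c P₁ (x ∷ P₂) D → Shows Z (c ∷ D) P₁ (x ∷ P₂) st →
               st' (pos c) ≡ just (lT , lt b ξ') → st' (pos x) ≡ just (lS , lt a ζ') →
               (∀ {r} → r ≢ pos c → r ≢ pos x → st' r ≡ st r) →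
               Shows Z ((pos x , ζ') ∷ D) ((pos c , ξ') ∷ P₁) P₂ st'
  shows-step {K} {Z} {c} {x} {P₁} {P₂} {D} I R ec ex er =
    rep-resp (rep-swap R (inj₂ (here refl)) (inj₂ (here refl)) ec ex er)
      (λ { (inj₁ (inj₁ m , _)) → inj₁ m ; (inj₁ (inj₂ (here refl) , n)) → ⊥-elim (n refl)
         ; (inj₁ (inj₂ (there m) , _)) → inj₂ (there m) ; (inj₂ refl) → inj₂ (here refl) })
      (λ { (inj₁ m) → inj₁ (inj₁ m , λ e → c∉ I R (subst K e (Inv.inZ I m)))
         ; (inj₂ (here refl)) → inj₂ refl
         ; (inj₂ (there m)) → inj₁ (inj₂ (there m) , chain-distinct (Inv.chain I) (∈-++⁺ʳ (x ∷ P₂) m)) })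
      (λ { (inj₁ (inj₁ m , _)) → inj₁ (there m) ; (inj₁ (inj₂ (here refl) , n)) → ⊥-elim (n refl)
         ; (inj₁ (inj₂ (there m) , _)) → inj₂ m ; (inj₂ refl) → inj₁ (here refl) })
      (λ { (inj₁ (here refl)) → inj₂ refl
         ; (inj₁ (there m)) → inj₁ (inj₁ m , λ e → proj₂ (ahead-inq I R (here refl)) (inj₁ (subst K e (Inv.inP₁ I m))))
         ; (inj₂ m) → inj₁ (inj₂ (there m) , chain-distinct (chain-tail (Inv.chain I)) (∈-++⁺ˡ m)) })

  shows-non : ∀ {Z c x P₁ P₂ D st} → Shows Z (c ∷ D) P₁ (x ∷ P₂) st → Shows Z (c ∷ D) (x ∷ P₁) P₂ st
  shows-non R = rep-resp R (λ m → m) (λ m → m)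
    (λ { (inj₁ m) → inj₁ (there m) ; (inj₂ (here e)) → inj₁ (here e) ; (inj₂ (there m)) → inj₂ m })
    (λ { (inj₁ (here e)) → inj₂ (here e) ; (inj₁ (there m)) → inj₁ m ; (inj₂ m) → inj₂ (there m) })

  shows-end : ∀ {Z D P₁ P₂ st} → Shows Z D P₁ P₂ st → Shows Z D [] (P₁ ʳ++ P₂) st
  shows-end {P₁ = P₁} R = rep-resp R (λ m → m) (λ m → m)
    (λ { (inj₁ m) → inj₂ (∈-ʳ++⁺ˡ P₁ m) ; (inj₂ m) → inj₂ (∈-ʳ++⁺ʳ P₁ m) })
    (λ { (inj₁ ()) ; (inj₂ m) → ∈-ʳ++⁻ P₁ m })

  shows-next : ∀ {z Z D P₁ P₂ st} → Shows (z ∷ Z) D P₁ P₂ st → Shows Z (z ∷ D) P₁ P₂ st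
  shows-next R = rep-resp R
    (λ { (inj₁ (here e)) → inj₂ (here e) ; (inj₁ (there m)) → inj₁ m ; (inj₂ m) → inj₂ (there m) })
    (λ { (inj₁ m) → inj₁ (there m) ; (inj₂ (here e)) → inj₁ (here e) ; (inj₂ (there m)) → inj₂ m })
    (λ m → m) (λ m → m)

  Moved : (st : State) (Z : List Marked) (c x : Marked) (P₁ P₂ D : List Marked) (x' c' : Marked) → Set₁
  Moved st Z c x P₁ P₂ D x' c' = Σ State λ st' → (st ⇝ st') × Shows Z (c' ∷ D) (x' ∷ P₁) P₂ st'

  upd₂-1 : ∀ p v q w st → upd p v (upd q w st) p ≡ v
  upd₂-1 p v q w st = upd-same p v (upd q w st)

  upd₂-2 : ∀ p v q w st → q ≢ p → upd p v (upd q w st) q ≡ w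
  upd₂-2 p v q w st n = trans (upd-other p v (upd q w st) n) (upd-same q w st)

  upd₂-3 : ∀ p v q w st {r} → r ≢ p → r ≢ q → upd p v (upd q w st) r ≡ st r
  upd₂-3 p v q w st np nq = trans (upd-other p v (upd q w st) np) (upd-other q w st nq)

  moved : ∀ {K Z c x P₁ P₂ D st ζ' ξ' v w} → Inv K Z c P₁ (x ∷ P₂) D → (R : Shows Z (c ∷ D) P₁ (x ∷ P₂) st) →
          v ≡ just (lT , lt b ξ') → w ≡ just (lS , lt a ζ') → st ⇝ upd (pos c) v (upd (pos x) w st) →
          Moved st Z c x P₁ P₂ D (pos c , ξ') (pos x , ζ')
  moved {c = c} {x} {st = st} {v = v} {w} I R ev ew s =
    _ , (λ {Q} → s {Q}) ,
    shows-step I R (trans (upd₂-1 (pos c) v (pos x) w st) ev)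
      (trans (upd₂-2 (pos c) v (pos x) w st (λ e → proj₂ (ahead-inq I R (here refl)) (inj₂ e))) ew)
      (upd₂-3 (pos c) v (pos x) w st)

  module _ {K : Region} {Z : List Marked} {i j : ℕ} {ζ ξ : Bool} {P₁ P₂ D : List Marked} {st : State} where

    -- If the south neighbour is a 𝐛-box too, it comes after x in `PW`. For an unprimed x in the
    -- next column this is impossible, so x is primed and (S5) applies. In `move-S` the east
    -- neighbour comes later and must be unprimed, which is (S6).
    move-E : (I : Inv K Z ((i , j) , ζ) P₁ (((i , suc j) , ξ) ∷ P₂) D) →
             Shows Z (((i , j) , ζ) ∷ D) P₁ (((i , suc j) , ξ) ∷ P₂) st → ¬ OnDiag (i , j) →
             Moved st Z ((i , j) , ζ) ((i , suc j) , ξ) P₁ P₂ D ((i , j) , ξ) ((i , suc j) , ζ)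
    move-E I R nd with bBox? b st (suc i , j)
    ... | no ns = moved I R eE (showA I R) (λ {Q} → switch I R (inj₁ bE)
                    (sw1 (λ { (inj₁ (o , _)) → nd o ; (inj₂ (inj₁ (_ , _ , _ , n))) → n bE
                            ; (inj₂ (inj₂ (_ , _ , _ , e))) → ns (_ , e , refl) })
                         bE ns (λ { (o , _) → nd o })) {Q})
      where
      eE : st (i , suc j) ≡ just (lT , lt b ξ)
      eE = showB I R (here refl)
      bE : BBox b st (i , suc j)
      bE = _ , eE , refl
    ... | yes bS@(lt _ η , eS , refl) with ahead I R S eS | showB I R (here refl)
    ...   | there m | eE with All.lookup (case Inv.pwP₂ I of λ { (p ∷ _) → p }) m
    ...     | ff l = ⊥-elim (<⇒≱ l (n≤1+n _))
    ...     | tt _ = moved I R eE (showA I R) (λ {Q} → switch I R (inj₂ bS)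
                    (sw5 (λ { (inj₁ (o , _)) → nd o ; (inj₂ (inj₁ (_ , _ , _ , n))) → n (_ , eE , refl)
                            ; (inj₂ (inj₂ (_ , _ , e , _))) → case trans (sym eE) e of λ () })
                         eE bS) {Q})
    ...     | tf = moved I R eE (showA I R) (λ {Q} → switch I R (inj₂ bS)
                    (sw5 (λ { (inj₁ (o , _)) → nd o ; (inj₂ (inj₁ (_ , _ , _ , n))) → n (_ , eE , refl)
                            ; (inj₂ (inj₂ (_ , _ , e , _))) → case trans (sym eE) e of λ () })
                         eE bS) {Q})

    move-S : (I : Inv K Z ((i , j) , ζ) P₁ (((suc i , j) , ξ) ∷ P₂) D) →
             Shows Z (((i , j) , ζ) ∷ D) P₁ (((suc i , j) , ξ) ∷ P₂) st → ¬ OnDiag (i , j) → ¬ OnDiag (suc i , j) →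
             Moved st Z ((i , j) , ζ) ((suc i , j) , ξ) P₁ P₂ D ((i , j) , ξ) ((suc i , j) , ζ)
    move-S I R nd nd' with bBox? b st (i , suc j)
    ... | no ne = moved I R eS (showA I R) (λ {Q} → switch I R (inj₂ bS)
                    (sw2 (λ { (inj₁ (o , _)) → nd o ; (inj₂ (inj₁ (_ , o , _))) → nd' o
                            ; (inj₂ (inj₂ (_ , o , _))) → nd' o })
                         bS ne (λ { (o , _) → nd' o })) {Q})
      where
      eS : st (suc i , j) ≡ just (lT , lt b ξ)
      eS = showB I R (here refl)
      bS : BBox b st (suc i , j)
      bS = _ , eS , refl
    ... | yes (lt _ η , eE , refl) with ahead I R E eE | showB I R (here refl)
    ...   | there m | eS with All.lookup (case Inv.pwP₂ I of λ { (p ∷ _) → p }) m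
    ...     | tt l = ⊥-elim (<⇒≱ l (n≤1+n _))
    ...     | ff _ = moved I R eS (showA I R) (λ {Q} → switch I R (inj₂ (_ , eS , refl))
                    (sw6 (λ { (inj₁ (o , _)) → nd o ; (inj₂ (inj₁ (_ , o , _))) → nd' o
                            ; (inj₂ (inj₂ (_ , o , _))) → nd' o })
                         eE (_ , eS , refl) (λ { (o , _) → nd' o })) {Q})
    ...     | tf = moved I R eS (showA I R) (λ {Q} → switch I R (inj₂ (_ , eS , refl))
                    (sw6 (λ { (inj₁ (o , _)) → nd o ; (inj₂ (inj₁ (_ , o , _))) → nd' o
                            ; (inj₂ (inj₂ (_ , o , _))) → nd' o })
                         eE (_ , eS , refl) (λ { (o , _) → nd' o })) {Q})

  module _ {K : Region} {Z : List Marked} {i : ℕ} {P₁ P₂ D : List Marked} {st : State} where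

    leave-unprimed : (I : Inv K Z ((i , i) , false) P₁ (((i , suc i) , false) ∷ P₂) D) →
             Shows Z (((i , i) , false) ∷ D) P₁ (((i , suc i) , false) ∷ P₂) st →
             Moved st Z ((i , i) , false) ((i , suc i) , false) P₁ P₂ D ((i , i) , false) ((i , suc i) , false)
    leave-unprimed I R = moved I R eE (showA I R) (λ {Q} → switch I R (inj₁ (_ , eE , refl))
        (sw1 (λ { (inj₁ (_ , _ , e , _)) → case trans (sym eE) e of λ ()
                ; (inj₂ (inj₁ (e , _))) → case trans (sym (showA I R)) e of λ ()
                ; (inj₂ (inj₂ (e , _))) → case trans (sym (showA I R)) e of λ () })
             (_ , eE , refl) (noSouth I R refl) (λ { (_ , _ , e , _) → case trans (sym eE) e of λ () })) {Q})
      where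
      eE : st (i , suc i) ≡ just (lT , lt b false)
      eE = showB I R (here refl)

    leave-primed : (I : Inv K Z ((i , i) , false) P₁ (((i , suc i) , true) ∷ P₂) D) →
             Shows Z (((i , i) , false) ∷ D) P₁ (((i , suc i) , true) ∷ P₂) st →
             ¬ BBox b st (suc i , suc i) →
             Moved st Z ((i , i) , false) ((i , suc i) , true) P₁ P₂ D ((i , i) , false) ((i , suc i) , true)
    leave-primed I R nd = moved I R refl refl (λ {Q} → switch I R (inj₁ (_ , eE , refl))
        (sw1' (refl , showA I R , eE , noSouth I R refl , λ { (_ , _ , _ , x) → nd x })) {Q})
      where
      eE : st (i , suc i) ≡ just (lT , lt b true)
      eE = showB I R (here refl)

    -- The entry of the second switched box in (S3) passes through the intermediate state in which
    -- only the first one has been switched.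
    leave-enter : (I : Inv K Z ((i , i) , false) P₁ (((i , suc i) , true) ∷ ((suc i , suc i) , false) ∷ P₂) D) →
             Shows Z (((i , i) , false) ∷ D) P₁ (((i , suc i) , true) ∷ ((suc i , suc i) , false) ∷ P₂) st →
             Σ State λ st' → (st ⇝ st') ×
               Shows Z (((suc i , suc i) , false) ∷ D) (((i , suc i) , false) ∷ ((i , i) , false) ∷ P₁) P₂ st'
    leave-enter I R = st' , (λ {Q} → switch I R (inj₁ (_ , eE , refl))
        (sw3 (λ { (inj₁ (_ , _ , _ , _ , n)) → n conf
                ; (inj₂ (inj₁ (e , _))) → case trans (sym (showA I R)) e of λ ()
                ; (inj₂ (inj₂ (e , _))) → case trans (sym (showA I R)) e of λ () }) conf) {Q}) ,
      shows-step I₁ R₁ x→ d→ o→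
      where
      c x d : Box
      c = (i , i)
      x = (i , suc i)
      d = (suc i , suc i)
      eE : st x ≡ just (lT , lt b true)
      eE = showB I R (here refl)
      eD : st d ≡ just (lT , lt b false)
      eD = showB I R (there (here refl))
      conf : S3conf a b st c
      conf = refl , (_ , showA I R , refl) , eE , (_ , eD , refl)
      st₁ st₂ st₃ st' : State
      st₁ = upd c (just (lT , lt b false)) (upd x (just (lS , lt a true)) st)
      st₃ = upd d (st c) st
      st₂ = upd x (just (lT , unp b)) st₃
      st' = upd c (st d) st₂
      x≢c : x ≢ c
      x≢c ()
      d≢c : d ≢ c
      d≢c ()
      d≢x : d ≢ x
      d≢x ()
      R₁ : Shows Z ((x , true) ∷ D) ((c , false) ∷ P₁) ((d , false) ∷ P₂) st₁
      R₁ = shows-step I R (upd₂-1 c _ x _ st) (upd₂-2 c _ x _ st x≢c) (upd₂-3 c _ x _ st)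
      I₁ : Inv (K ∪₁ c) Z (x , true) ((c , false) ∷ P₁) ((d , false) ∷ P₂) D
      I₁ = inv-step I (lv {m = false} {f = false} refl) (λ ())
      x→ : st' x ≡ just (lT , lt b false)
      x→ = trans (upd-other c (st d) st₂ x≢c) (upd-same x (just (lT , unp b)) st₃)
      d→ : st' d ≡ just (lS , lt a false)
      d→ = trans (upd-other c (st d) st₂ d≢c)
             (trans (upd-other x (just (lT , unp b)) st₃ d≢x) (trans (upd-same d (st c) st) (showA I R)))
      o→ : ∀ {r} → r ≢ x → r ≢ d → st' r ≡ st₁ r
      o→ {r} nx nd = cases (r ≟B c)
        where
        cases : Dec (r ≡ c) → st' r ≡ st₁ r
        cases (yes refl) = trans (upd-same c (st d) st₂)
                      (trans eD (sym (upd-same c (just (lT , lt b false)) (upd x (just (lS , lt a true)) st))))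
        cases (no nc) = trans (upd-other c (st d) st₂ nc) (trans (upd-other x (just (lT , unp b)) st₃ nx) (trans (upd-other d (st c) st nd)
                    (sym (upd₂-3 c _ x _ st nc nx))))

    module _ {ζ} (I : Inv K Z ((i , suc i) , ζ) P₁ (((suc i , suc i) , false) ∷ P₂) D)
             (R : Shows Z (((i , suc i) , ζ) ∷ D) P₁ (((suc i , suc i) , false) ∷ P₂) st) where

      private
        eS : st (suc i , suc i) ≡ just (lT , lt b false)
        eS = showB I R (here refl)
        bS : BBox b st (suc i , suc i)
        bS = _ , eS , refl

      eastU : BBox b st (i , suc (suc i)) → st (i , suc (suc i)) ≡ just (lT , lt b false)
      eastU (lt _ η , eE , refl) with ahead I R E eE
      ... | there m with All.lookup (case Inv.pwP₂ I of λ { (p ∷ _) → p }) m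
      ...   | ff _ = eE

    enter-primed : (I : Inv K Z ((i , suc i) , true) P₁ (((suc i , suc i) , false) ∷ P₂) D) →
             Shows Z (((i , suc i) , true) ∷ D) P₁ (((suc i , suc i) , false) ∷ P₂) st →
             Moved st Z ((i , suc i) , true) ((suc i , suc i) , false) P₁ P₂ D ((i , suc i) , true) ((suc i , suc i) , false)
    enter-primed I R with showB I R (here refl) | bBox? b st (i , suc (suc i))
    ... | eS | no ne = moved I R refl refl (λ {Q} → switch I R (inj₂ (_ , eS , refl))
                         (sw2' (showA I R , refl , eS , ne)) {Q})
    ... | eS | yes e = moved I R refl refl (λ {Q} → switch I R (inj₂ (_ , eS , refl))
                         (sw6' (showA I R , refl , eastU I R e , eS)) {Q})

    enter-unprimed : (I : Inv K Z ((i , suc i) , false) P₁ (((suc i , suc i) , false) ∷ P₂) D) →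
             Shows Z (((i , suc i) , false) ∷ D) P₁ (((suc i , suc i) , false) ∷ P₂) st →
             ¬ ABox a st (i , i) →
             Moved st Z ((i , suc i) , false) ((suc i , suc i) , false) P₁ P₂ D ((i , suc i) , false) ((suc i , suc i) , false)
    enter-unprimed I R nw = moved I R eS (showA I R) (λ {Q} → go (bBox? b st (i , suc (suc i))) {Q})
      where
      eS : st (suc i , suc i) ≡ just (lT , lt b false)
      eS = showB I R (here refl)
      nm : ¬ ModConf a b st (i , suc i)
      nm (inj₁ (o , _)) = 1+n≢n o
      nm (inj₂ (inj₁ (e , _))) = case trans (sym (showA I R)) e of λ ()
      nm (inj₂ (inj₂ (e , _))) = case trans (sym (showA I R)) e of λ ()
      go : Dec (BBox b st (i , suc (suc i))) → st ⇝ swapB (i , suc i) (suc i , suc i) st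
      go (no ne) = switch I R (inj₂ (_ , eS , refl)) (sw2 nm (_ , eS , refl) ne (λ { (_ , _ , w , _) → nw w }))
      go (yes e) = switch I R (inj₂ (_ , eS , refl))
        (sw6 nm (eastU I R e) (_ , eS , refl) (λ { (_ , _ , w , _) → nw w }))

  shows-non⁻¹ : ∀ {Z x P₁ P₂ D st} → Shows Z D (x ∷ P₁) P₂ st → Shows Z D P₁ (x ∷ P₂) st
  shows-non⁻¹ R = rep-resp R (λ m → m) (λ m → m)
    (λ { (inj₁ (here e)) → inj₂ (here e) ; (inj₁ (there m)) → inj₁ m ; (inj₂ m) → inj₂ (there m) })
    (λ { (inj₁ m) → inj₁ (there m) ; (inj₂ (here e)) → inj₁ (here e) ; (inj₂ (there m)) → inj₂ m })

  -- (S4) and (S7) make the entering move of c together with the leaving move of the next 𝐚-box. The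
  -- state `st₁`, in which only c has moved, does not occur in the run; it splits the switch into
  -- two applications of `shows-step`.
  enter-leave : ∀ {K K₁ Z i P₁ P₂ D st} →
    Inv K (((i , i) , false) ∷ Z) ((i , suc i) , false) P₁ (((suc i , suc i) , false) ∷ P₂) D →
    Inv K₁ Z ((i , i) , false) P₁ (((i , suc i) , false) ∷ P₂) (((suc i , suc i) , false) ∷ D) →
    Shows (((i , i) , false) ∷ Z) (((i , suc i) , false) ∷ D) P₁ (((suc i , suc i) , false) ∷ P₂) st →
    Σ State λ st' → (st ⇝ st') ×
      Shows Z (((i , suc i) , true) ∷ ((suc i , suc i) , false) ∷ D) (((i , i) , false) ∷ P₁) P₂ st'
  enter-leave {Z = Z} {i} {P₁} {P₂} {D} {st} I I₁ R = st' , (λ {Q} → go (bBox? b st (i , suc (suc i))) {Q}) ,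
    shows-step I₁ (shows-non⁻¹ (shows-next R₁)) w→ c→ o→
    where
    w c d : Box
    w = (i , i)
    c = (i , suc i)
    d = (suc i , suc i)
    st₁ st₂ st₃ st' : State
    st₁ = upd c (just (lT , lt b false)) (upd d (just (lS , lt a false)) st)
    st₃ = upd d (st w) st
    st₂ = upd c (just (lS , pr a)) st₃
    st' = upd w (st d) st₂
    eD : st d ≡ just (lT , lt b false)
    eD = showB I R (here refl)
    eW : st w ≡ just (lS , lt a false)
    eW = Rep.cover R (isA (inj₁ (here refl)))
    nm : ¬ ModConf a b st c
    nm (inj₁ (o , _)) = 1+n≢n o
    nm (inj₂ (inj₁ (e , _))) = case trans (sym (showA I R)) e of λ ()
    nm (inj₂ (inj₂ (e , _))) = case trans (sym (showA I R)) e of λ ()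
    go : Dec (BBox b st (i , suc (suc i))) → st ⇝ st'
    go (no ne) = switch I R (inj₂ (_ , eD , refl))
      (sw4 nm (refl , showA I R , (_ , eW , refl) , (_ , eD , refl) , ne))
    go (yes e) = switch I R (inj₂ (_ , eD , refl))
      (sw7 nm (refl , showA I R , (_ , eW , refl) , (_ , eD , refl) , eastU I R e))
    c≢w : c ≢ w
    c≢w ()
    d≢c : d ≢ c
    d≢c ()
    d≢w : d ≢ w
    d≢w ()
    R₁ : Shows (((i , i) , false) ∷ Z) ((d , false) ∷ D) ((c , false) ∷ P₁) P₂ st₁
    R₁ = shows-step I R (upd₂-1 c _ d _ st) (upd₂-2 c _ d _ st d≢c) (upd₂-3 c _ d _ st)
    w→ : st' w ≡ just (lT , lt b false)
    w→ = trans (upd-same w (st d) st₂) eD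
    c→ : st' c ≡ just (lS , lt a true)
    c→ = trans (upd-other w (st d) st₂ c≢w) (upd-same c (just (lS , pr a)) st₃)
    o→ : ∀ {r} → r ≢ w → r ≢ c → st' r ≡ st₁ r
    o→ {r} nw nc = trans (upd-other w (st d) st₂ nw) (trans (upd-other c (just (lS , pr a)) st₃ nc) (cases (r ≟B d)))
      where
      cases : Dec (r ≡ d) → st₃ r ≡ st₁ r
      cases (yes refl) = trans (upd-same d (st w) st) (trans eW (sym (upd₂-2 c _ d _ st d≢c)))
      cases (no nd) = trans (upd-other d (st w) st nd) (sym (upd₂-3 c _ d _ st nc nd))

  Unfollowed : List Marked → List Marked → Set
  Unfollowed Z D = ∀ {z Z'} → Z ≡ z ∷ Z' → follows z D ≡ false

  unfollowed : ∀ Z c D → (∀ {z Z'} → Z ≡ z ∷ Z' → OnDiag (pos z) → pos c ≢ diagSE (pos z)) → Unfollowed Z (c ∷ D)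
  unfollowed Z c D n {z} e =
    dec-false (onDiag? (pos z) ×-dec (pos c ≟B diagSE (pos z))) λ { (o , e') → n e o e' }

  -- In (S3) the box (i+1, i+1) has to follow (i, i+1) immediately. A primed y in between would lie
  -- beyond (i+1, i+1), an unprimed one would have column at most i and lie weakly north-west of (i,
  -- i).
  next-is-diag : ∀ {K Z i P₁ y P₂ D ξ} → Inv K Z ((i , i) , false) P₁ (((i , suc i) , true) ∷ y ∷ P₂) D →
                 ¬ ((suc i , suc i) , ξ) ∈ P₂
  next-is-diag {i = i} {y = (r , k) , _} I m with Inv.chain I | Inv.pwP₂ I
  ... | ac ∷ ax ∷ ay@((_ , r≤k) , y∉ , _) ∷ ch | (p ∷ _) ∷ (q ∷ _) with chain-∉ ch (∈-++⁺ˡ m) | p | All.lookup q m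
  ...   | inq , n | tt i<r | _ =
    n (down (ideal-∪₁ (ideal-∪₁ (ideal-∪₁ (Inv.ideal I) ac) ax) ay) inq (proj₁ ay) (i<r , ≤-trans i<r r≤k) (inj₂ refl))
  ...   | _ | tf | ff k<i =
    y∉ (inj₁ (down (ideal-∪₁ (Inv.ideal I) ac) (proj₁ ay) (proj₁ ac) (≤-trans r≤k (≤-pred k<i) , ≤-pred k<i) (inj₂ refl)))

  chainRow : ∀ {K Z c P₁ P₂ D} → Inv K Z c P₁ P₂ D → Chain K (c ∷ P₂)
  chainRow {c = c} {P₂ = P₂} I = chain-prefix (c ∷ P₂) (Inv.chain I)

  west-∉ : ∀ {K Z i ζ ζ' P₁ P₂ D} → Inv K Z ((i , suc i) , ζ) P₁ P₂ D → ¬ ((i , i) , ζ') ∈ D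
  west-∉ {P₂ = P₂} I m with Inv.chain I
  ... | a ∷ ch with chain-∉ ch (∈-++⁺ʳ P₂ m)
  ...   | inq , n = n (down (ideal-∪₁ (Inv.ideal I) a) inq (proj₁ a) (≤-refl , n≤1+n _) (inj₂ refl))

  -- The remaining grid is an argument because a switch may consume two cells, even across the end
  -- of a row. The hypothesis on m holds since a row with this flag is resumed only after
  -- `enter-leave` has done its `lv`; the one on f holds since `lv` followed by `en` is done as (S3)
  -- in one go.
  simRow : ∀ {K K' Z m f c P₁ P₂ P₂' c' D P A st} → Grid Z (P₁ ʳ++ P₂') (c' ∷ D) P A → Row m f c P₂ P₂' c' →
           Facts K Z (P₁ ʳ++ P₂') (c' ∷ D) → Inv K' Z c P₁ P₂ D → (OnDiag (pos c) → m ≡ false) →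
           (f ≡ true → ∀ ξ → ¬ (south (pos c) , ξ) ∈ P₂) → Shows Z (c ∷ D) P₁ P₂ st →
           Outcome a b st (Shows [] A [] P)
  simStart : ∀ {K Z D P P' A st} → Grid Z P D P' A → Facts K Z P D → Unfollowed Z D → Shows Z D [] P st →
             Outcome a b st (Shows [] A [] P')

  simStart {D = D} {P} {st = st} [] F _ R = (_ , done fs) , λ { _ (done _) → R ; _ (step {c = c} (inj₁ ((_ , nb) , _)) _ _) → ⊥-elim (fs c nb)
                                       ; _ (step {c = c} (inj₂ (_ , (_ , nb) , _)) _ _) → ⊥-elim (fs c nb) }
    where
    fs : FullySwitched a b st
    fs p ((lt _ ζ , e , refl) , nb) with atA R e
    ... | inj₂ m = nbr nb
      where
      contra : ∀ {q} → p ⋖ q → ¬ BBox b st q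
      contra p⋖q (lt _ ξ , e' , refl) with atB R e'
      ... | inj₂ i = chain-noback P (Facts.ideal F) (Facts.ch F) m (inj₂ (_ , i)) p⋖q
      nbr : ¬ (BBox b st (east p) ⊎ BBox b st (south p))
      nbr (inj₁ x) = contra E x
      nbr (inj₂ x) = contra S x
  simStart {Z = z ∷ Z} {D} {P} {st = st} (_∷_ {z' = z'} r g) F nf R =
    simRow g r (facts-row F r) (inv-start F (skip [] P (facts-ideal F) (facts-chain F) λ ()))
      (λ _ → nf refl) (λ ()) (shows-next R)

  simRow {Z = Z} {c = c} {D = D} g [] F I mf s3 R = simStart g F (unfollowed Z c D (Inv.noS4 I)) (shows-end R)
  simRow g (k@(non _ _) ∷ r) F I mf s3 R = simRow g r F (inv-step I k λ ()) mf (λ ()) (shows-non R)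
  simRow g (k@(mv E n n') ∷ r) F I mf s3 R with move-E I R n
  ... | _ , s , R' = s (simRow g r F (inv-step I k λ ()) (λ o → ⊥-elim (n' o)) (λ ()) R')
  simRow g (k@(mv S n n') ∷ r) F I mf s3 R with move-S I R n n'
  ... | _ , s , R' = s (simRow g r F (inv-step I k λ ()) (λ o → ⊥-elim (n' o)) (λ ()) R')
  simRow g (lv {ξ = false} e ∷ r) F I mf s3 R with mf refl
  simRow g (lv {ξ = false} refl ∷ r) F I mf s3 R | refl with leave-unprimed I R
  ... | _ , s , R' = s (simRow g r F (inv-step I (lv {m = false} {f = false} refl) λ ()) (λ ())
      (λ _ ξ m → case All.lookup (case Inv.pwP₂ I of λ { (p ∷ _) → p }) m of λ { (ff l) → <-irrefl refl l }) R')
  simRow g (lv {ξ = true} e ∷ r) F I mf s3 R with mf refl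
  simRow {st = st} g (lv {i} {ξ = true} refl ∷ r) F I mf s3 R | refl with bBox? b st (suc i , suc i)
  ... | no nb with leave-primed I R nb
  ...   | _ , s , R' = s (simRow g r F (inv-step I (lv {m = false} {f = false} refl) λ ()) (λ ())
                          (λ _ ξ m → nb (_ , showB I R (there m) , refl)) R')
  simRow g (lv {i} {ξ = true} refl ∷ r) F I mf s3 R | refl | yes (lt _ η , e , refl) with atB R e
  ... | inj₁ m = ⊥-elim (up-∉ (Inv.ideal I) (c-inq I R) (s≤s z≤n , ≤-refl) (c∉ I R) (n≤1+n _ , n≤1+n _) (Inv.inP₁ I m))
  simRow g (lv {i} refl ∷ non n _ ∷ r) F I mf s3 R | refl | yes (lt _ η , e , refl) | inj₂ (there (here refl)) = ⊥-elim (n S)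
  simRow g (lv {i} refl ∷ mv _ _ n ∷ r) F I mf s3 R | refl | yes (lt _ η , e , refl) | inj₂ (there (here refl)) = ⊥-elim (n refl)
  simRow g (lv {i} refl ∷ k ∷ r) F I mf s3 R | refl | yes (lt _ η , e , refl) | inj₂ (there (there m)) =
    ⊥-elim (next-is-diag I m)
  simRow {Z = Z} {P₁ = P₁} {D = D} g (lv {i} refl ∷ en refl ∷ r) F I mf s3 R | refl | yes (lt _ η , e , refl) | inj₂ (there (here refl))
    with leave-enter I R | inv-step I (lv {m = false} {f = false} refl) (λ ())
  ... | _ , s , R' | I' with row-still (stay (Inv.ideal I') (chainRow I') (Inv.pwP₂ I')) r
  ...   | still = s (simStart g F (unfollowed Z ((suc i , suc i) , false) D nf) (shows-end {P₁ = _ ∷ _ ∷ P₁} R'))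
    where
    nf : ∀ {z Z'} → Z ≡ z ∷ Z' → OnDiag (pos z) → (suc i , suc i) ≢ diagSE (pos z)
    nf refl refl refl = c∉ I R (Inv.inZ I (here refl))
  simRow {f = true} g (en e ∷ r) F I mf s3 R = ⊥-elim (s3 refl _ (here refl))
  simRow {Z = Z} {f = false} {P₁ = P₁} {D = D} g (en {i} {ζ = true} refl ∷ r) F I mf s3 R
    with enter-primed I R | row-still (stay (Inv.ideal I) (chainRow I) (Inv.pwP₂ I)) r
  ... | _ , s , R' | still = s (simStart g F (unfollowed Z ((suc i , suc i) , false) D nf) (shows-end {P₁ = _ ∷ P₁} R'))
    where
    nf : ∀ {z Z'} → Z ≡ z ∷ Z' → OnDiag (pos z) → (suc i , suc i) ≢ diagSE (pos z)
    nf refl refl refl with All.head (Inv.before I) | All.head (Inv.dZ I) refl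
    ... | tt _ | ()
  simRow {Z = []} {f = false} {P₁ = P₁} {st = st} g (en {i} {ζ = false} refl ∷ r) F I mf s3 R
    with enter-unprimed I R nw | row-still (stay (Inv.ideal I) (chainRow I) (Inv.pwP₂ I)) r
    where
    nw : ¬ ABox a st (i , i)
    nw (lt _ _ , e , refl) with atA R e
    ... | inj₂ (there m) = west-∉ I m
  ... | _ , s , R' | still = s (simStart g F (λ ()) (shows-end {P₁ = _ ∷ P₁} R'))
  simRow {Z = z ∷ Z} {f = false} {P₁ = P₁} {P₂ = _ ∷ P₂} {D = D} {st = st} g (en {i} {ζ = false} refl ∷ r) F I mf s3 R
    with row-still (stay (Inv.ideal I) (chainRow I) (Inv.pwP₂ I)) r | pos z ≟B (i , i)
  simRow {Z = z ∷ Z} {f = false} {P₁ = P₁} {P₂ = _ ∷ P₂} {D = D} {st = st} g (en {i} {ζ = false} refl ∷ r) F I mf s3 R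
      | still | no n with enter-unprimed I R nw
    where
    nw : ¬ ABox a st (i , i)
    nw (lt _ _ , e , refl) with atA R e
    ... | inj₂ (there m) = west-∉ I m
    ... | inj₁ (here refl) = n refl
    ... | inj₁ (there m) with All.lookup (Inv.dZ I) (there m) refl | All.lookup (case Inv.pwZ I of λ { (p ∷ _) → p }) m | All.head (Inv.before I)
    ...   | refl | ff l | ff l' = <⇒≱ l (≤-pred l')
  ... | _ , s , R' = s (simStart g F (unfollowed (z ∷ Z) ((suc i , suc i) , false) D nf) (shows-end {P₁ = _ ∷ P₁} R'))
    where
    nf : ∀ {y Z'} → z ∷ Z ≡ y ∷ Z' → OnDiag (pos y) → (suc i , suc i) ≢ diagSE (pos y)
    nf refl refl refl = n refl
  simRow {Z = (z , ζ) ∷ Z} {f = false} {P₁ = P₁} {P₂ = _ ∷ P₂} {D = D} {A = A} {st} (_∷_ {P₁ = R'} {z' = z'} r₁ g) (en {i} {ζ = false} refl ∷ r) F I mf s3 R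
      | still | yes refl with All.head (Inv.dZ I) refl
  -- The next 𝐚-box is (i, i), its row has the flag m, and nothing in P₁ touches it. So the first
  -- box that it meets is (i, i+1), and its leaving cell is the second half of (S4) or (S7).
  ... | refl with skip-row P₁ (((i , suc i) , false) ∷ P₂) (subst (λ m → Row m false ((i , i) , false) (P₁ ʳ++ (((i , suc i) , false) ∷ P₂)) R' z') fw r₁) nP₁
    where
    fw : follows ((i , i) , false) (((suc i , suc i) , false) ∷ D) ≡ true
    fw = follows-true ((i , i) , false) ((suc i , suc i) , false) D refl refl
    nP₁ : ∀ {e} → e ∈ P₁ → ¬ ((i , i) ⋖ pos e)
    nP₁ m E = c∉ I R (Inv.inP₁ I m)
    nP₁ m S = <-irrefl refl (proj₂ (proj₁ (chain-∉ (Facts.ch F) (∈-++⁺ˡ (∈-ʳ++⁺ˡ P₁ m)))))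
  ... | _ , refl , non n _ ∷ _ = ⊥-elim (n E)
  ... | _ , refl , mv _ n _ ∷ _ = ⊥-elim (n refl)
  ... | _ , refl , lv refl ∷ r₂
    with inv-start F (skip P₁ (((i , suc i) , false) ∷ P₂) (facts-ideal F) (facts-chain F) nP₁)
    where
    nP₁ : ∀ {e} → e ∈ P₁ → ¬ ((i , i) ⋖ pos e)
    nP₁ m E = c∉ I R (Inv.inP₁ I m)
    nP₁ m S = <-irrefl refl (proj₂ (proj₁ (chain-∉ (Facts.ch F) (∈-++⁺ˡ (∈-ʳ++⁺ˡ P₁ m)))))
  ... | I₁ with enter-leave I I₁ R
  ...   | _ , s , R″ = s (simRow g r₂ (facts-row F r₁) (inv-step I₁ (lv {m = true} {f = false} refl) λ ()) (λ ())
                            (λ _ ξ m → chain-distinct (chain-tail (chainRow I)) m refl) R″)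

-- The loops over the letters

Family : Set
Family = ℕ → List Marked

infixl 6 _[_≔_]
_[_≔_] : Family → ℕ → List Marked → Family
(X [ i ≔ L ]) k = if does (k ≟ i) then L else X k

≔-same : ∀ X i L → (X [ i ≔ L ]) i ≡ L
≔-same X i L rewrite dec-true (i ≟ i) refl = refl

≔-other : ∀ X {i} L {k} → k ≢ i → (X [ i ≔ L ]) k ≡ X k
≔-other X {i} L {k} n rewrite dec-false (k ≟ i) n = refl

InRange : ℕ → ℕ → Set
InRange m k = 1 ≤ k × k ≤ m

-- st is the superposition of the 𝐢-strips SA i (1 ≤ i ≤ m) and the 𝐣-strips TB j (1 ≤ j ≤ n).
record Whole (m n : ℕ) (SA TB : Family) (st : State) : Set where
  field
    soundS : ∀ {q k ζ} → st q ≡ just (lS , lt k ζ) → InRange m k × (q , ζ) ∈ SA k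
    coverS : ∀ {q k ζ} → InRange m k → (q , ζ) ∈ SA k → st q ≡ just (lS , lt k ζ)
    soundT : ∀ {q k ζ} → st q ≡ just (lT , lt k ζ) → InRange n k × (q , ζ) ∈ TB k
    coverT : ∀ {q k ζ} → InRange n k → (q , ζ) ∈ TB k → st q ≡ just (lT , lt k ζ)

AgreeTo : ℕ → Family → Family → Set
AgreeTo m X Y = ∀ {k} → InRange m k → X k ≡ Y k

whole-resp : ∀ {m n SA SA' TB TB' st} → AgreeTo m SA SA' → AgreeTo n TB TB' → Whole m n SA TB st → Whole m n SA' TB' st
whole-resp f g W = record
  { soundS = λ e → let (r , i) = Whole.soundS W e in r , subst (_ ∈_) (f r) i
  ; coverS = λ r i → Whole.coverS W r (subst (_ ∈_) (sym (f r)) i)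
  ; soundT = λ e → let (r , i) = Whole.soundT W e in r , subst (_ ∈_) (g r) i
  ; coverT = λ r i → Whole.coverT W r (subst (_ ∈_) (sym (g r)) i) }

record SwitchCell (A B B' A' : List Marked) : Set₁ where
  constructor cell
  field
    {region} : Region
    strips   : Strips region A B
    switched : Switched A B B' A'

-- Some grid exists for the switched pair in any case; involutivity identifies its outcome with the
-- original strips.
cell-sym : ∀ {A B B' A'} → SwitchCell A B B' A' → SwitchCell B' A' A B
cell-sym (cell s g) with grid-exists (strips⇒facts (switched-strips s g))
... | _ , _ , h with switched-involutive s g h
...   | refl , refl = cell (switched-strips s g) h

∈-reverse : ∀ {e} {A : List Marked} → e ∈ reverse A ⊎ e ∈ [] → e ∈ A
∈-reverse (inj₁ m) = Any-reverse⁻ m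

process-cell : ∀ {m n i j SA TB A B B' A' st} → InRange m i → InRange n j → SA i ≡ A → TB j ≡ B →
               SwitchCell A B B' A' → Whole m n SA TB st →
               Outcome i j st (Whole m n (SA [ i ≔ A' ]) (TB [ j ≔ B' ]))
process-cell {m} {n} {i} {j} {SA} {TB} {A} {B} {B'} {A'} {st} ri rj refl refl (cell s g) W =
  proj₁ out , λ st' p → final (proj₂ out st' p)
  where
  open Simulation i j st
  open Whole W
  start : Shows (reverse A) [] [] B st
  start = record { sound = so ; cover = co }
    where
    so : ∀ {q v} → st q ≡ just v → Content i j st (λ e → e ∈ reverse A ⊎ e ∈ []) (λ e → e ∈ [] ⊎ e ∈ B) q v
    so {q} {lS , lt k ζ} e with k ≟ i
    ... | yes refl = isA (inj₁ (Any-reverse⁺ (proj₂ (soundS e))))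
    ... | no n = isO ((λ { (_ , e) → n e }) , λ { (() , _) }) e
    so {q} {lT , lt k ζ} e with k ≟ j
    ... | yes refl = isB (inj₂ (proj₂ (soundT e)))
    ... | no n = isO ((λ { (() , _) }) , (λ { (_ , e) → n e })) e
    co : ∀ {q v} → Content i j st (λ e → e ∈ reverse A ⊎ e ∈ []) (λ e → e ∈ [] ⊎ e ∈ B) q v → st q ≡ just v
    co (isA x) = coverS ri (∈-reverse x)
    co (isB (inj₂ x)) = coverT rj x
    co (isO _ e) = e
  out : Outcome i j st (Shows [] A' [] B')
  out = simStart g (strips⇒facts s) (λ _ → refl) start
  final : ∀ {st'} → Shows [] A' [] B' st' → Whole m n (SA [ i ≔ A' ]) (TB [ j ≔ B' ]) st'
  final {st'} R = record { soundS = sS ; coverS = cS ; soundT = sT ; coverT = cT }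
    where
    sS : ∀ {q k ζ} → st' q ≡ just (lS , lt k ζ) → InRange m k × (q , ζ) ∈ (SA [ i ≔ A' ]) k
    sS e with Rep.sound R e
    ... | isA (inj₂ x) = ri , subst (_ ∈_) (sym (≔-same SA i A')) x
    ... | isO (n , _) e' = proj₁ (soundS e') , subst (_ ∈_) (sym (≔-other SA A' (λ k≡i → n (refl , k≡i)))) (proj₂ (soundS e'))
    cS : ∀ {q k ζ} → InRange m k → (q , ζ) ∈ (SA [ i ≔ A' ]) k → st' q ≡ just (lS , lt k ζ)
    cS {k = k} r x with k ≟ i
    ... | yes refl = Rep.cover R (isA (inj₂ (subst (_ ∈_) (≔-same SA i A') x)))
    ... | no n = Rep.cover R (isO ((λ { (_ , e) → n e }) , λ { (() , _) })
                                  (coverS r (subst (_ ∈_) (≔-other SA A' n) x)))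
    sT : ∀ {q k ζ} → st' q ≡ just (lT , lt k ζ) → InRange n k × (q , ζ) ∈ (TB [ j ≔ B' ]) k
    sT e with Rep.sound R e
    ... | isB (inj₂ x) = rj , subst (_ ∈_) (sym (≔-same TB j B')) x
    ... | isO (_ , n) e' = proj₁ (soundT e') , subst (_ ∈_) (sym (≔-other TB B' (λ k≡j → n (refl , k≡j)))) (proj₂ (soundT e'))
    cT : ∀ {q k ζ} → InRange n k → (q , ζ) ∈ (TB [ j ≔ B' ]) k → st' q ≡ just (lT , lt k ζ)
    cT {k = k} r x with k ≟ j
    ... | yes refl = Rep.cover R (isB (inj₂ (subst (_ ∈_) (≔-same TB j B') x)))
    ... | no n = Rep.cover R (isO ((λ { (() , _) }) , (λ { (_ , e) → n e }))
                                  (coverT r (subst (_ ∈_) (≔-other TB B' n) x)))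

data Cols (TB TB' : Family) (A : List Marked) : ℕ → List Marked → Set₁ where
  []  : Cols TB TB' A 0 A
  _∷_ : ∀ {n A₁ A'} → Cols TB TB' A n A₁ → SwitchCell A₁ (TB (suc n)) (TB' (suc n)) A' → Cols TB TB' A (suc n) A'

data Rows (n : ℕ) (SA SA' : Family) : (TB : Family) (m : ℕ) (TB' : Family) → Set₁ where
  []  : ∀ {TB TB'} → AgreeTo n TB TB' → Rows n SA SA' TB 0 TB'
  _∷_ : ∀ {m TB TB₁ TB'} → Cols TB TB₁ (SA (suc m)) n (SA' (suc m)) → Rows n SA SA' TB₁ m TB' →
        Rows n SA SA' TB (suc m) TB'

mix : Family → Family → ℕ → Family
mix X Y zero = X
mix X Y (suc n) = mix X Y n [ suc n ≔ Y (suc n) ]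

mix-beyond : ∀ X Y n {k} → n < k → mix X Y n k ≡ X k
mix-beyond X Y zero _ = refl
mix-beyond X Y (suc n) l = trans (≔-other (mix X Y n) _ (λ { refl → <-irrefl refl l })) (mix-beyond X Y n (<-trans ≤-refl l))

mix-within : ∀ X Y n → AgreeTo n (mix X Y n) Y
mix-within X Y zero (s≤s _ , ())
mix-within X Y (suc n) {k} (l , u) with k ≟ suc n
... | yes refl = ≔-same (mix X Y n) (suc n) (Y (suc n))
... | no ne = trans (≔-other (mix X Y n) _ ne) (mix-within X Y n (l , ≤-pred (≤∧≢⇒< u ne)))

replay-cols : ∀ {m n i SA TB TB' A A' st} k → k ≤ n → InRange m i → Cols TB TB' A k A' → SA i ≡ A →
              Whole m n SA TB st →
              Σ State (InnerLoop i k st) ×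
              (∀ st' → InnerLoop i k st st' → Whole m n (SA [ i ≔ A' ]) (mix TB TB' k) st')
replay-cols {i = i} {SA} {A = A} zero _ _ [] refl W =
  (_ , inil) , λ { _ inil → whole-resp (λ {k} _ → sym (self k)) (λ _ → refl) W }
  where
  self : ∀ k → (SA [ i ≔ A ]) k ≡ SA k
  self k with k ≟ i
  ... | yes refl = ≔-same SA i A
  ... | no n = ≔-other SA A n
replay-cols {m} {n} {i} {SA} {TB} {TB'} {A' = A'} (suc k) k<n ri (_∷_ {A₁ = A₁} c x) e W
  with replay-cols k (<⇒≤ k<n) ri c e W
... | (st₁ , p₁) , all₁ = (_ , isnoc p₁ (proj₂ (proj₁ (next (all₁ st₁ p₁))))) ,
                          λ { st' (isnoc q₁ q₂) → whole-resp (λ {k'} _ → twice k') (λ _ → refl) (proj₂ (next (all₁ _ q₁)) st' q₂) }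
  where
  next : ∀ {st} → Whole m n (SA [ i ≔ A₁ ]) (mix TB TB' k) st →
         Outcome i (suc k) st (Whole m n ((SA [ i ≔ A₁ ]) [ i ≔ A' ]) (mix TB TB' (suc k)))
  next = process-cell ri (s≤s z≤n , k<n) (≔-same SA i A₁) (mix-beyond TB TB' k ≤-refl) x
  twice : ∀ k' → ((SA [ i ≔ A₁ ]) [ i ≔ A' ]) k' ≡ (SA [ i ≔ A' ]) k'
  twice k' with k' ≟ i
  ... | yes refl = trans (≔-same (SA [ i ≔ A₁ ]) i A') (sym (≔-same SA i A'))
  ... | no ne = trans (≔-other (SA [ i ≔ A₁ ]) A' ne) (trans (≔-other SA A₁ ne) (sym (≔-other SA A' ne)))

replay-rows : ∀ {M n SA SA' TB TB' st} m → m ≤ M → Rows n SA SA' TB m TB' → ∀ {SB} → AgreeTo m SB SA →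
              (∀ {k} → m < k → k ≤ M → SB k ≡ SA' k) → Whole M n SB TB st →
              Σ State (OuterLoop n m st) ×
              (∀ st' → OuterLoop n m st st' → Whole M n SA' TB' st')
replay-rows zero _ ([] f) g h W =
  (_ , onil) , λ { _ onil → whole-resp (λ { (l , u) → h l u }) f W }
replay-rows {M} {n} {SA} {SA'} {TB} {TB'} (suc m) m<M (_∷_ {TB₁ = TB₁} c r) {SB} g h W
  with replay-cols {i = suc m} n ≤-refl (s≤s z≤n , m<M) c (g (s≤s z≤n , ≤-refl)) W
... | (st₁ , p₁) , all₁ = (_ , ocons p₁ (proj₂ (proj₁ (next (all₁ st₁ p₁))))) ,
                          λ { st' (ocons q₁ q₂) → proj₂ (next (all₁ _ q₁)) st' q₂ }
  where
  next : ∀ {st} → Whole M n (SB [ suc m ≔ SA' (suc m) ]) (mix TB TB₁ n) st →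
         Σ State (OuterLoop n m st) × (∀ st' → OuterLoop n m st st' → Whole M n SA' TB' st')
  next W₁ = replay-rows m (<⇒≤ m<M) r
    (λ { (l , u) → trans (≔-other SB _ (λ e → <-irrefl e (s≤s u))) (g (l , m≤n⇒m≤1+n u)) })
    above (whole-resp (λ _ → refl) (mix-within TB TB₁ n) W₁)
    where
    above : ∀ {k} → m < k → k ≤ M → (SB [ suc m ≔ SA' (suc m) ]) k ≡ SA' k
    above {k} l u with k ≟ suc m
    ... | yes refl = ≔-same SB (suc m) _
    ... | no ne = trans (≔-other SB _ ne) (h (≤∧≢⇒< l (λ e → ne (sym e))) u)

-- Existence and transposition of the rectangle of cells

stack : Family → ℕ → List Marked → List Marked
stack X zero R = R
stack X (suc n) R = stack X n (X (suc n) ++ R)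

stack-cong : ∀ {X Y} n {R} → AgreeTo n X Y → stack X n R ≡ stack Y n R
stack-cong zero f = refl
stack-cong {X} {Y} (suc n) {R} f rewrite f {suc n} (s≤s z≤n , ≤-refl) =
  stack-cong n (λ { (l , u) → f (l , m≤n⇒m≤1+n u) })

Good : List Marked → Set
Good L = AllPairs PW L × All Diag0 L

-- A chain whose final part may be exchanged for any other chain over the same region. This carries
-- a switch of two strips over to the chain of all strips.
record Context (K : Region) (C : List Marked → List Marked) (Q : List Marked) : Set₁ where
  field
    K'    : Region
    ideal : Ideal K'
    here′ : Chain K' Q
    plug  : ∀ {Q'} → Chain K' Q' → Chain K (C Q')

context-++ : ∀ {K} L {Q} → Ideal K → Chain K (L ++ Q) → Context K (L ++_) Q
context-++ [] ideal ch = record { K' = _ ; ideal = ideal ; here′ = ch ; plug = λ c → c }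
context-++ (x ∷ L) ideal (a ∷ ch) with context-++ L (ideal-∪₁ ideal a) ch
... | c = record { K' = Context.K' c ; ideal = Context.ideal c ; here′ = Context.here′ c
                 ; plug = λ q → a ∷ Context.plug c q }

context : ∀ {K X} n {Q} → Ideal K → Chain K (stack X n Q) → Context K (stack X n) Q
context zero ideal ch = record { K' = _ ; ideal = ideal ; here′ = ch ; plug = λ c → c }
context {X = X} (suc n) ideal ch with context n ideal ch
... | c with context-++ (X (suc n)) (Context.ideal c) (Context.here′ c)
...   | d = record { K' = Context.K' d ; ideal = Context.ideal d ; here′ = Context.here′ d
                   ; plug = λ q → Context.plug c (Context.plug d q) }

grid-chain : ∀ {K Z P D P' A' R} → Grid Z P D P' A' → RChain K Z → Chain (K ⊕ Z) (P ++ D ++ R) →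
             Chain K (P' ++ A' ++ R)
grid-chain [] rc ch = ch
grid-chain (r ∷ g) (a ∷ rc) ch = grid-chain g rc (row-chain r (a ∷ ch))

switched-chain : ∀ {K A B B' A' R} → Switched A B B' A' → Chain K (A ++ B ++ R) → Chain K (B' ++ A' ++ R)
switched-chain {A = A} {B} {R = R} g ch with unzip (reverse A) (subst (Chain _) (sym (reverse-ʳ++ A (B ++ R))) ch)
... | rc , ch' = grid-chain g rc ch'

cols-chain : ∀ {K TB TB' A A'} n {R} → Ideal K → Cols TB TB' A n A' → Chain K (A ++ stack TB n R) →
             Chain K (stack TB' n (A' ++ R))
cols-chain zero ideal [] ch = ch
cols-chain (suc n) ideal (_∷_ {A₁ = A₁} c (cell _ g)) ch with context n ideal (cols-chain n ideal c ch)
... | k = Context.plug k (switched-chain {A = A₁} g (Context.here′ k))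

rows-chain : ∀ {K n SA SA' TB TB'} m {R} → Ideal K → Rows n SA SA' TB m TB' → Chain K (stack SA m (stack TB n R)) →
             Chain K (stack TB' n (stack SA' m R))
rows-chain {n = n} zero ideal ([] f) ch = subst (Chain _) (stack-cong n f) ch
rows-chain {n = n} (suc m) ideal (c ∷ r) ch with context m ideal ch
... | k = rows-chain m ideal r (Context.plug k (cols-chain n (Context.ideal k) c (Context.here′ k)))

cols-cong : ∀ {TB TB' TB″ A A'} n → AgreeTo n TB' TB″ → Cols TB TB' A n A' → Cols TB TB″ A n A'
cols-cong zero f [] = []
cols-cong (suc n) f (c ∷ x) =
  cols-cong n (λ { (l , u) → f (l , m≤n⇒m≤1+n u) }) c ∷ subst (λ B → SwitchCell _ _ B _) (f (s≤s z≤n , ≤-refl)) x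

rows-cong : ∀ {n SA SA' SA″ TB TB'} m → AgreeTo m SA' SA″ → Rows n SA SA' TB m TB' → Rows n SA SA″ TB m TB'
rows-cong zero f ([] g) = [] g
rows-cong {n} (suc m) f (c ∷ r) =
  subst (Cols _ _ _ n) (f (s≤s z≤n , ≤-refl)) c ∷ rows-cong m (λ { (l , u) → f (l , m≤n⇒m≤1+n u) }) r

≔-agree : ∀ X L n → AgreeTo n X (X [ suc n ≔ L ])
≔-agree X L n (_ , u) = sym (≔-other X L (λ e → <-irrefl e (s≤s u)))

cell-good : ∀ {A B B' A'} → SwitchCell A B B' A' → Good B' × Good A'
cell-good (cell s g) with switched-strips s g
... | s' = (Strips.pwA s' , Strips.dA s') , (Strips.pwB s' , Strips.dB s')

cols-good : ∀ {TB TB' A A'} n → Cols TB TB' A n A' → Good A → (∀ {k} → InRange n k → Good (TB' k)) × Good A'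
cols-good zero [] gA = (λ { (s≤s _ , ()) }) , gA
cols-good {TB' = TB'} (suc n) (c ∷ x) gA with cell-good x | cols-good n c gA
... | gB , gA' | gs , _ = all , gA'
  where
  all : ∀ {k} → InRange (suc n) k → Good (TB' k)
  all {k} (l , u) with k ≟ suc n
  ... | yes refl = gB
  ... | no ne = gs (l , ≤-pred (≤∧≢⇒< u ne))

cols-exist : ∀ {K TB A} n {R} → Ideal K → Good A → (∀ {k} → InRange n k → Good (TB k)) → Chain K (A ++ stack TB n R) →
             Σ Family λ TB' → Σ (List Marked) λ A' → Cols TB TB' A n A'
cols-exist {TB = TB} zero ideal gA gT ch = TB , _ , []
cols-exist {TB = TB} {A} (suc n) {R} ideal gA gT ch
  with cols-exist n ideal gA (λ { (l , u) → gT (l , m≤n⇒m≤1+n u) }) ch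
... | TB' , A₁ , c with context n ideal (cols-chain n ideal c ch) | proj₂ (cols-good n c gA) | gT (s≤s z≤n , ≤-refl)
...   | k | pA , dA | pB , dB = found (grid-exists (strips⇒facts s))
  where
  s : Strips (Context.K' k) A₁ (TB (suc n))
  s = record { ideal = Context.ideal k
             ; chain = chain-prefix (A₁ ++ TB (suc n)) (subst (Chain _) (sym (++-assoc A₁ (TB (suc n)) R)) (Context.here′ k))
             ; pwA = pA ; pwB = pB ; dA = dA ; dB = dB }
  found : ∃₂ (Grid (reverse A₁) (TB (suc n)) []) → _
  found (B' , A' , g) = TB' [ suc n ≔ B' ] , A' ,
    cols-cong n (≔-agree TB' B' n) c ∷ subst (λ B → SwitchCell A₁ (TB (suc n)) B A') (sym (≔-same TB' (suc n) B')) (cell s g)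

rows-exist : ∀ {K n SA TB} m {R} → Ideal K → (∀ {k} → InRange m k → Good (SA k)) → (∀ {k} → InRange n k → Good (TB k)) →
             Chain K (stack SA m (stack TB n R)) → Σ Family λ SA' → Σ Family λ TB' → Rows n SA SA' TB m TB'
rows-exist {SA = SA} {TB} zero ideal gS gT ch = SA , TB , [] (λ _ → refl)
rows-exist {n = n} (suc m) ideal gS gT ch with context m ideal ch
... | k with cols-exist n (Context.ideal k) (gS (s≤s z≤n , ≤-refl)) gT (Context.here′ k)
...   | TB₁ , A' , c
  with rows-exist m ideal (λ { (l , u) → gS (l , m≤n⇒m≤1+n u) }) (proj₁ (cols-good n c (gS (s≤s z≤n , ≤-refl))))
         (Context.plug k (cols-chain n (Context.ideal k) c (Context.here′ k)))
...     | SA' , TB' , r = SA' [ suc m ≔ A' ] , TB' ,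
  subst (Cols _ _ _ n) (sym (≔-same SA' (suc m) A')) c ∷ rows-cong m (≔-agree SA' A' m) r

-- The transposed loop starts with the largest letter of its first tableau, so its first row is the
-- last column of the rectangle, with every cell inverted by `cell-sym` and in the opposite order.
last-column : ∀ {n SA SA' TB TB'} m → Rows (suc n) SA SA' TB m TB' →
              Σ Family λ SA₁ → Rows n SA SA₁ TB m TB' × Cols SA' SA₁ (TB' (suc n)) m (TB (suc n))
last-column {n} {SA' = SA'} {TB} {TB'} zero ([] f) =
  SA' , [] (λ { (l , u) → f (l , m≤n⇒m≤1+n u) }) , subst (Cols SA' SA' (TB' (suc n)) 0) (sym (f (s≤s z≤n , ≤-refl))) []
last-column {n} {SA} {SA'} {TB} {TB'} (suc m) (_∷_ {TB₁ = TB₁} (_∷_ {A₁ = A₁} c x) r) with last-column m r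
... | SA₁ , r' , c' = SA₁ [ suc m ≔ A₁ ] ,
  subst (Cols TB TB₁ (SA (suc m)) n) (sym (≔-same SA₁ (suc m) A₁)) c ∷ rows-cong m (≔-agree SA₁ A₁ m) r' ,
  cols-cong m (≔-agree SA₁ A₁ m) c' ∷
    subst (λ Y → SwitchCell (TB₁ (suc n)) (SA' (suc m)) Y (TB (suc n))) (sym (≔-same SA₁ (suc m) A₁)) (cell-sym x)

rows-transpose : ∀ {n SA SA' TB TB'} m → Rows n SA SA' TB m TB' → Rows m TB' TB SA' n SA
rows-transpose {zero} m r = [] (same m r)
  where
  same : ∀ {SA SA' TB TB'} m → Rows 0 SA SA' TB m TB' → AgreeTo m SA' SA
  cols₀ : ∀ {TB TB' A A'} → Cols TB TB' A 0 A' → A' ≡ A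
  cols₀ [] = refl
  same zero _ (s≤s _ , ())
  same (suc m) (c ∷ r) {k} (l , u) with k ≟ suc m
  ... | yes refl = cols₀ c
  ... | no ne = same m r (l , ≤-pred (≤∧≢⇒< u ne))
rows-transpose {suc n} m r with last-column m r
... | SA₁ , r' , c = c ∷ rows-transpose m r'

row-length : ∀ {m f z P P' z'} → Row m f z P P' z' → length P' ≡ length P
row-length [] = refl
row-length (_ ∷ r) = cong suc (row-length r)

grid-length : ∀ {Z P D P' A'} → Grid Z P D P' A' → length P' ≡ length P
grid-length [] = refl
grid-length (r ∷ g) = trans (grid-length g) (row-length r)

cols-length : ∀ {TB TB' A A'} n → Cols TB TB' A n A' → ∀ {k} → InRange n k → length (TB' k) ≡ length (TB k)
cols-length zero _ (s≤s _ , ())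
cols-length (suc n) (c ∷ cell _ g) {k} (l , u) with k ≟ suc n
... | yes refl = grid-length g
... | no ne = cols-length n c (l , ≤-pred (≤∧≢⇒< u ne))

rows-length : ∀ {n SA SA' TB TB'} m → Rows n SA SA' TB m TB' → ∀ {k} → InRange n k → length (TB' k) ≡ length (TB k)
rows-length zero ([] f) r = cong length (sym (f r))
rows-length {n} (suc m) (c ∷ rs) r = trans (rows-length m rs r) (cols-length n c r)

-- Tableaux as families of strips

module _ {X : Set} (f : ℕ → ℕ → X) (M : ℕ) where

  sweep : List X
  sweep = concat (applyUpTo (λ i → applyUpTo (λ j → f (suc i) (suc j)) M) M)

  ∈-sweep : ∀ {i j} → InRange M i → InRange M j → f i j ∈ sweep
  ∈-sweep {suc i} {suc j} (_ , i≤) (_ , j≤) = ∈-concat⁺′ (∈-applyUpTo⁺ _ j≤) (∈-applyUpTo⁺ _ i≤)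

  sweep-pairs : ∀ {R : X → X → Set} → (∀ {i j i' j'} → i < i' ⊎ (i ≡ i' × j < j') → R (f i j) (f i' j')) →
                AllPairs R sweep
  sweep-pairs r = AllPairs.concat⁺
    (AllP.applyUpTo⁺₁ _ M λ _ → AllPairs.applyUpTo⁺₁ _ M λ l _ → r (inj₂ (refl , s≤s l)))
    (AllPairs.applyUpTo⁺₁ _ M λ l _ → AllP.applyUpTo⁺₁ _ M λ _ → AllP.applyUpTo⁺₁ _ M λ _ → r (inj₁ (s≤s l)))

pairs-with : ∀ {X : Set} {R R' : X → X → Set} {P : X → Set} {xs} → AllPairs R xs → All P xs →
             (∀ {x y} → P x → P y → R x y → R' x y) → AllPairs R' xs
pairs-with [] [] f = []
pairs-with (r ∷ rs) (p ∷ ps) f = All.zipWith (λ { (q , s) → f p q s }) (ps , r) ∷ pairs-with rs ps f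

letter? : ∀ (F : Filling) x p → Dec (F p ≡ just x)
letter? F (lt k ζ) p with F p
... | nothing = no λ ()
... | just (lt k' ζ') with k' ≟ k | ζ' Data.Bool.≟ ζ
...   | yes refl | yes refl = yes refl
...   | no n | _ = no λ { refl → n refl }
...   | yes _ | no n = no λ { refl → n refl }

module _ (F : Filling) (M : ℕ) where

  -- Primed boxes are collected row by row and unprimed ones column by column, so that the strips
  -- come out sorted by `PW`.
  primed-boxes unprimed-boxes : ℕ → List Box
  primed-boxes k = filter (letter? F (pr k)) (sweep _,_ M)
  unprimed-boxes k = filter (letter? F (unp k)) (sweep (λ j i → i , j) M)

  strips-of : Family
  strips-of k = map (_, true) (primed-boxes k) ++ map (_, false) (unprimed-boxes k)

  strips-of⁻ : ∀ {p ζ} k → (p , ζ) ∈ strips-of k → F p ≡ just (lt k ζ)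
  strips-of⁻ k m with ∈-++⁻ (map (_, true) (primed-boxes k)) m
  ... | inj₁ m' with ∈-map⁻ (_, true) m'
  ...   | _ , m″ , refl = proj₂ (∈-filter⁻ (letter? F (pr k)) {xs = sweep _,_ M} m″)
  strips-of⁻ k m | inj₂ m' with ∈-map⁻ (_, false) m'
  ...   | _ , m″ , refl = proj₂ (∈-filter⁻ (letter? F (unp k)) {xs = sweep (λ j i → i , j) M} m″)

  strips-of⁺ : ∀ {i j ζ k} → InRange M i → InRange M j → F (i , j) ≡ just (lt k ζ) → ((i , j) , ζ) ∈ strips-of k
  strips-of⁺ {ζ = true} {k} ri rj e =
    ∈-++⁺ˡ (∈-map⁺ (_, true) (∈-filter⁺ (letter? F (pr k)) (∈-sweep _,_ M ri rj) e))
  strips-of⁺ {ζ = false} {k} ri rj e =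
    ∈-++⁺ʳ (map (_, true) (primed-boxes k))
      (∈-map⁺ (_, false) (∈-filter⁺ (letter? F (unp k)) (∈-sweep (λ j i → i , j) M rj ri) e))

  strips-of-good : IsSSYT F → ∀ k → Good (strips-of k)
  strips-of-good ((_ , _ , rows , cols) , diag) k =
    AllPairs.++⁺ (AllPairs.map⁺ prim) (AllPairs.map⁺ unpr)
      (AllP.map⁺ (All.universal (λ _ → AllP.map⁺ (All.universal (λ _ → tf) _)) _)) ,
    All.tabulate (λ m o → d (strips-of⁻ k m) o)
    where
    prim : AllPairs (λ x y → PW (x , true) (y , true)) (primed-boxes k)
    prim = pairs-with
      (AllPairs.filter⁺ (letter? F (pr k)) (sweep-pairs _,_ M {λ p q → row p < row q ⊎ (row p ≡ row q × col p < col q)} λ x → x))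
      (AllP.all-filter (letter? F (pr k)) (sweep _,_ M))
      λ { p q (inj₁ l) → tt l ; p q (inj₂ (refl , l)) → ⊥-elim (proj₂ (rows _ _ _ _ _ l p q) refl refl refl) }
    unpr : AllPairs (λ x y → PW (x , false) (y , false)) (unprimed-boxes k)
    unpr = pairs-with
      (AllPairs.filter⁺ (letter? F (unp k)) (sweep-pairs (λ j i → i , j) M {λ p q → col p < col q ⊎ (col p ≡ col q × row p < row q)} λ x → x))
      (AllP.all-filter (letter? F (unp k)) (sweep (λ j i → i , j) M))
      λ { p q (inj₁ l) → ff l ; p q (inj₂ (refl , l)) → ⊥-elim (proj₂ (cols _ _ _ _ _ l p q) refl refl refl) }
    d : ∀ {p ζ} → F p ≡ just (lt k ζ) → OnDiag p → ζ ≡ false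
    d {i , _} e refl = diag i _ e

record Lists (n : ℕ) (X : Family) (F : Filling) : Set where
  field
    sound : ∀ {p k ζ} → F p ≡ just (lt k ζ) → InRange n k × (p , ζ) ∈ X k
    cover : ∀ {p k ζ} → InRange n k → (p , ζ) ∈ X k → F p ≡ just (lt k ζ)

part≤sum : ∀ l i → part l i ≤ sum l
part≤sum [] i = z≤n
part≤sum (x ∷ l) zero = z≤n
part≤sum (x ∷ l) (suc zero) = m≤m+n x (sum l)
part≤sum (x ∷ l) (suc (suc i)) = ≤-trans (part≤sum l (suc i)) (m≤n+m (sum l) x)

size : List ℕ → ℕ
size l = sum l + length l

InS-bound : ∀ l {i j} → InS l (i , j) → InRange (size l) i × InRange (size l) j
InS-bound l {i} {j} (1≤i , i≤ , i≤j , j<) =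
  (1≤i , ≤-trans i≤j j≤) , (≤-trans 1≤i i≤j , j≤)
  where
  j≤ : j ≤ size l
  j≤ = ≤-trans (<⇒≤ j<) (+-mono-≤ (part≤sum l i) i≤)

lists-of : ∀ {F n l μ} → IsSSYT F → HasShape F l μ → IsMax F n → Lists n (strips-of F (size l)) F
lists-of {F} {n} {l} ((_ , pos≥1 , _) , _) sh (max , _) = record { sound = so ; cover = λ {_} {k} _ → strips-of⁻ F (size l) k }
  where
  so : ∀ {p k ζ} → F p ≡ just (lt k ζ) → InRange n k × (p , ζ) ∈ strips-of F (size l) k
  so {i , j} e with InS-bound l (proj₁ (proj₁ (sh (i , j)) (subst Is-just (sym e) (Data.Maybe.Relation.Unary.Any.just _))))
  ... | ri , rj = (pos≥1 _ _ e , max _ _ e) , strips-of⁺ F (size l) ri rj e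

part-decreasing : ∀ {l} i → StrictPartition l → suc (suc i) ≤ length l → part l (suc (suc i)) < part l (suc i)
part-decreasing {x ∷ y ∷ l} zero (p ∷ _ , _) _ = p
part-decreasing {x ∷ y ∷ l} (suc i) (_ ∷ ps , _ ∷ qs) (s≤s le) = part-decreasing i (ps , qs) le
part-decreasing {x ∷ []} zero _ (s≤s ())

InS-ideal : ∀ {l} → StrictPartition l → Ideal (InS l)
InS-ideal sp E (1≤i , i≤j) (_ , i≤ , _ , j<) = 1≤i , i≤ , i≤j , <-trans ≤-refl j<
InS-ideal {l} sp (S {suc i} {j}) (1≤i , i≤j) (_ , i≤ , _ , j<) = 1≤i , <⇒≤ i≤ , i≤j ,
  <-≤-trans j< (subst (_≤ part l (suc i) + suc i) (sym (+-suc (part l (suc (suc i))) (suc i)))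
                 (+-monoˡ-≤ (suc i) (part-decreasing i sp i≤)))

InS? : ∀ l b → Dec (InS l b)
InS? l (i , j) = (1 ≤? i) ×-dec (i ≤? length l) ×-dec (i ≤? j) ×-dec (j <? part l i + i)

Later : Marked → Marked → Set
Later e f = ¬ (pos f ≼ pos e)

NotBefore : Marked → Marked → Set
NotBefore e f = pos e ≢ pos f × ¬ (pos f ⋖ pos e)

chain-later : ∀ {K L} → Ideal K → Chain K L → AllPairs Later L
chain-later ideal [] = []
chain-later {K} ideal (_∷_ {x} {L} a ch) =
  All.tabulate (λ m l → let (i , n) = chain-∉ ch m in n (down (ideal-∪₁ ideal a) i (proj₁ a) l (inj₂ refl))) ∷
  chain-later (ideal-∪₁ ideal a) ch

mkChain : ∀ L {K} → (∀ {e} → e ∈ L → InQ (pos e) × ¬ K (pos e)) →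
          (∀ {e q} → e ∈ L → q ⋖ pos e → InQ q → K q ⊎ Σ Bool λ ζ → (q , ζ) ∈ L) →
          AllPairs NotBefore L → Chain K L
mkChain [] f g [] = []
mkChain (x ∷ L) {K} f g (n ∷ ns) =
  (proj₁ (f (here refl)) , proj₂ (f (here refl)) , closed) ∷
  mkChain L
    (λ m → proj₁ (f (there m)) , λ { (inj₁ k) → proj₂ (f (there m)) k ; (inj₂ e) → proj₁ (All.lookup n m) (sym e) })
    (λ m a i → case g (there m) a i of λ { (inj₁ k) → inj₁ (inj₁ k) ; (inj₂ (_ , here refl)) → inj₁ (inj₂ refl)
                                         ; (inj₂ (ζ , there m')) → inj₂ (ζ , m') })
    ns
  where
  closed : ∀ {q} → q ⋖ pos x → InQ q → K q
  closed a i with g (here refl) a i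
  ... | inj₁ k = k
  closed () i | inj₂ (_ , here refl)
  ... | inj₂ (_ , there m) = ⊥-elim (proj₂ (All.lookup n m) a)

stack-∈⁺ : ∀ {X e R} n → e ∈ R → e ∈ stack X n R
stack-∈⁺ zero m = m
stack-∈⁺ {X} (suc n) m = stack-∈⁺ n (∈-++⁺ʳ (X (suc n)) m)

stack-∈ : ∀ {X e k R} n → InRange n k → e ∈ X k → e ∈ stack X n R
stack-∈ zero (s≤s _ , ()) _
stack-∈ {X} {k = k} (suc n) (l , u) m with k ≟ suc n
... | yes refl = stack-∈⁺ n (∈-++⁺ˡ m)
... | no ne = stack-∈ n (l , ≤-pred (≤∧≢⇒< u ne)) m

stack-∈⁻ : ∀ {X e R} n → e ∈ stack X n R → (∃ λ k → InRange n k × e ∈ X k) ⊎ e ∈ R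
stack-∈⁻ zero m = inj₂ m
stack-∈⁻ {X} (suc n) m with stack-∈⁻ n m
... | inj₁ (k , (l , u) , m') = inj₁ (k , (l , m≤n⇒m≤1+n u) , m')
... | inj₂ m' with ∈-++⁻ (X (suc n)) m'
...   | inj₁ m″ = inj₁ (suc n , (s≤s z≤n , ≤-refl) , m″)
...   | inj₂ m″ = inj₂ m″

stack-pairs : ∀ {Q : Marked → Marked → Set} {X R} n → (∀ {k} → InRange n k → AllPairs Q (X k)) →
              (∀ {k k' e f} → InRange n k → InRange n k' → k < k' → e ∈ X k → f ∈ X k' → Q e f) →
              AllPairs Q R → (∀ {k e} → InRange n k → e ∈ X k → All (Q e) R) → AllPairs Q (stack X n R)
stack-pairs zero _ _ r _ = r
stack-pairs {X = X} (suc n) b c r cr = stack-pairs n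
  (λ { (l , u) → b (l , m≤n⇒m≤1+n u) })
  (λ { (l , u) (l' , u') → c (l , m≤n⇒m≤1+n u) (l' , m≤n⇒m≤1+n u') })
  (AllPairs.++⁺ (b (s≤s z≤n , ≤-refl)) r (All.tabulate (cr (s≤s z≤n , ≤-refl))))
  (λ { (l , u) m → AllP.++⁺ (All.tabulate (λ m' → c (l , m≤n⇒m≤1+n u) (s≤s z≤n , ≤-refl) (s≤s u) m m')) (cr (l , m≤n⇒m≤1+n u) m) })

pairs-++⁻ : ∀ {Q : Marked → Marked → Set} L {R} → AllPairs Q (L ++ R) →
            AllPairs Q L × AllPairs Q R × (∀ {e f} → e ∈ L → f ∈ R → Q e f)
pairs-++⁻ [] r = [] , r , λ ()
pairs-++⁻ {Q} (x ∷ L) (p ∷ ps) with pairs-++⁻ L ps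
... | a , b , c = AllP.++⁻ˡ L p ∷ a , b , λ { (here refl) m → All.lookup (AllP.++⁻ʳ L p) m ; (there m') m → c m' m }

stack-pairs⁻ : ∀ {Q : Marked → Marked → Set} {X R} n → AllPairs Q (stack X n R) →
               (∀ {k} → InRange n k → AllPairs Q (X k)) × AllPairs Q R ×
               (∀ {k k' e f} → InRange n k → InRange n k' → k < k' → e ∈ X k → f ∈ X k' → Q e f) ×
               (∀ {k e f} → InRange n k → e ∈ X k → f ∈ R → Q e f)
stack-pairs⁻ zero r = (λ { (s≤s _ , ()) }) , r , (λ { (s≤s _ , ()) }) , λ { (s≤s _ , ()) }
stack-pairs⁻ {Q} {X} (suc n) r with stack-pairs⁻ n r
... | b , r' , c , cr with pairs-++⁻ (X (suc n)) r'
...   | b' , r″ , c' = b₁ , r″ , c₁ , cr₁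
  where
  b₁ : ∀ {k} → InRange (suc n) k → AllPairs Q (X k)
  b₁ {k} (l , u) with k ≟ suc n
  ... | yes refl = b'
  ... | no ne = b (l , ≤-pred (≤∧≢⇒< u ne))
  c₁ : ∀ {k k' e f} → InRange (suc n) k → InRange (suc n) k' → k < k' → e ∈ X k → f ∈ X k' → Q e f
  c₁ {k} {k'} (l , u) (l' , u') k<k' m m' with k' ≟ suc n
  ... | yes refl = cr (l , ≤-pred k<k') m (∈-++⁺ˡ m')
  ... | no ne = c (l , ≤-trans (<⇒≤ k<k') (≤-pred (≤∧≢⇒< u' ne))) (l' , ≤-pred (≤∧≢⇒< u' ne)) k<k' m m'
  cr₁ : ∀ {k e f} → InRange (suc n) k → e ∈ X k → f ∈ _ → Q e f
  cr₁ {k} (l , u) m m' with k ≟ suc n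
  ... | yes refl = c' m m'
  ... | no ne = cr (l , ≤-pred (≤∧≢⇒< u ne)) m (∈-++⁺ʳ (X (suc n)) m')

double-mono : ∀ {k k'} → k ≤ k' → 2 * k ≤ 2 * k'
double-mono = *-monoʳ-≤ 2

rank-upper : ∀ k ζ → rank (lt k ζ) ≤ 2 * k
rank-upper k false = ≤-refl
rank-upper k true = m∸n≤m (2 * k) 1

rank-lower : ∀ k ζ → 2 * k ∸ 1 ≤ rank (lt k ζ)
rank-lower k false = m∸n≤m (2 * k) 1
rank-lower k true = ≤-refl

rank-< : ∀ {k k'} ζ ζ' → k < k' → rank (lt k ζ) < rank (lt k' ζ')
rank-< {k} {k'} ζ ζ' l = ≤-trans (s≤s (rank-upper k ζ)) (≤-trans step₁ (rank-lower k' ζ'))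
  where
  step₁ : suc (2 * k) ≤ 2 * k' ∸ 1
  step₁ = ≤-trans (≤-reflexive (cong suc refl))
            (≤-trans (≤-reflexive (sym (cong (_∸ 1) (*-suc 2 k)))) (∸-monoˡ-≤ 1 (double-mono l)))

rank-primed : ∀ {k} → 1 ≤ k → rank (pr k) < rank (unp k)
rank-primed {suc k} _ rewrite +-suc k (k + 0) = ≤-refl

⊕-∈⁻ : ∀ {K q} Z → (K ⊕ Z) q → K q ⊎ Σ Bool λ ζ → (q , ζ) ∈ Z
⊕-∈⁻ [] k = inj₁ k
⊕-∈⁻ {K} (z ∷ Z) (inj₁ k) with ⊕-∈⁻ {K} Z k
... | inj₁ k' = inj₁ k'
... | inj₂ (ζ , m) = inj₂ (ζ , there m)
⊕-∈⁻ (z ∷ Z) (inj₂ refl) = inj₂ (_ , here refl)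

⊕-base : ∀ {K q} Z → K q → (K ⊕ Z) q
⊕-base [] k = k
⊕-base (z ∷ Z) k = inj₁ (⊕-base Z k)

is-just⁺ : ∀ {X : Set} {m : Maybe X} {x} → m ≡ just x → Is-just m
is-just⁺ refl = Data.Maybe.Relation.Unary.Any.just _

is-just⁻ : ∀ {X : Set} {m : Maybe X} → Is-just m → ∃ λ x → m ≡ just x
is-just⁻ {m = just x} _ = x , refl

module _ {F l μ n X} (ss : IsSSYT F) (sl : StrictPartition l) (sh : HasShape F l μ)
         (L : Lists n X F) (good : ∀ {k} → InRange n k → Good (X k)) where

  private
    rows : ∀ i j j' x y → j < j' → F (i , j) ≡ just x → F (i , j') ≡ just y →
           (x ≤L y) × (primed x ≡ true → primed y ≡ true → val x ≢ val y)
    rows = proj₁ (proj₂ (proj₂ (proj₁ ss)))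
    cols : ∀ i i' j x y → i < i' → F (i , j) ≡ just x → F (i' , j) ≡ just y →
           (x ≤L y) × (primed x ≡ false → primed y ≡ false → val x ≢ val y)
    cols = proj₂ (proj₂ (proj₂ (proj₁ ss)))

    adjacent-≤ : ∀ {p q x y} → p ⋖ q → F p ≡ just x → F q ≡ just y → x ≤L y
    adjacent-≤ E a b = proj₁ (rows _ _ _ _ _ ≤-refl a b)
    adjacent-≤ S a b = proj₁ (cols _ _ _ _ _ ≤-refl a b)

    at : ∀ {k e} → InRange n k → e ∈ X k → F (pos e) ≡ just (lt k (mark e))
    at = Lists.cover L

    block : ∀ {k e f} → 1 ≤ k → F (pos e) ≡ just (lt k (mark e)) → F (pos f) ≡ just (lt k (mark f)) → PW e f → NotBefore e f
    block 1≤k a b (tt r) = (λ { refl → <-irrefl refl r }) , λ { E → <-irrefl refl r ; S → <⇒≱ r (n≤1+n _) }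
    block 1≤k a b tf = (λ { refl → case trans (sym a) b of λ () }) , λ c → <⇒≱ (rank-primed 1≤k) (adjacent-≤ c b a)
    block 1≤k a b (ff r) = (λ { refl → <-irrefl refl r }) , λ { S → <-irrefl refl r ; E → <⇒≱ r (n≤1+n _) }

    cross : ∀ {k k' e f} → InRange n k → InRange n k' → k < k' → e ∈ X k → f ∈ X k' → NotBefore e f
    cross {e = _ , ζ} {_ , ζ'} r r' l m m' =
      (λ { refl → case trans (sym (at r m)) (at r' m') of λ { refl → <-irrefl refl l } }) ,
      λ c → <⇒≱ (rank-< ζ ζ' l) (adjacent-≤ c (at r' m') (at r m))

    inSkew : ∀ {e} → e ∈ stack X n [] → InSkew l μ (pos e)
    inSkew m with stack-∈⁻ n m
    ... | inj₁ (k , r , m') = proj₁ (sh _) (is-just⁺ (at r m'))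

  listed : ∀ {q} → InSkew l μ q → Σ Bool λ ζ → (q , ζ) ∈ stack X n []
  listed i with is-just⁻ (proj₂ (sh _) i)
  ... | lt k ζ , e with Lists.sound L e
  ...   | r , m = ζ , stack-∈ n r m

  -- The standardization of the tableau, letters in increasing order and each letter in the order
  -- `PW`. Since entries weakly increase between neighbours, no box is added before its west or
  -- north neighbour.
  filling-chain : Chain (InS μ) (stack X n [])
  filling-chain = mkChain (stack X n [])
    (λ m → let ((1≤i , _ , i≤j , _) , ∉) = inSkew m in (1≤i , i≤j) , ∉)
    closed
    (stack-pairs n (λ r → pairs-with (proj₁ (good r)) (All.tabulate (at r)) (λ a b → block (proj₁ r) a b))
      cross [] (λ _ _ → []))
    where
    closed : ∀ {e q} → e ∈ stack X n [] → q ⋖ pos e → InQ q → InS μ q ⊎ Σ Bool λ ζ → (q , ζ) ∈ stack X n []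
    closed {q = q} m c i with InS? μ q
    ... | yes k = inj₁ k
    ... | no ∉ = inj₂ (listed (InS-ideal sl c i (proj₁ (inSkew m)) , ∉))

  filling-region : μ ⊆S l → ∀ {q} → ((InS μ ⊕ reverse (stack X n [])) q → InS l q) ×
                                    (InS l q → (InS μ ⊕ reverse (stack X n [])) q)
  filling-region sub {q} = to , from
    where
    to : (InS μ ⊕ reverse (stack X n [])) q → InS l q
    to k with ⊕-∈⁻ {InS μ} (reverse (stack X n [])) k
    ... | inj₁ k' = sub q k'
    ... | inj₂ (_ , m) = proj₁ (inSkew (Any-reverse⁻ m))
    from : InS l q → (InS μ ⊕ reverse (stack X n [])) q
    from k with InS? μ q
    ... | yes k' = ⊕-base {InS μ} (reverse (stack X n [])) k'
    ... | no ∉ = ⊕-∈ {InS μ} (Any-reverse⁺ (proj₂ (listed (k , ∉))))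

stack-++ : ∀ {X} n R → stack X n R ≡ stack X n [] ++ R
stack-++ zero R = refl
stack-++ {X} (suc n) R = trans (stack-++ n (X (suc n) ++ R))
  (trans (cong (λ t → stack X n [] ++ t ++ R) (sym (++-identityʳ (X (suc n)))))
  (trans (sym (++-assoc (stack X n []) (X (suc n) ++ []) R)) (cong (_++ R) (sym (stack-++ n (X (suc n) ++ []))))))

chain-++ : ∀ {K K'} A {B} → Chain K A → Chain K' B → (∀ {q} → (K ⊕ reverse A) q → K' q) → (∀ {q} → K' q → (K ⊕ reverse A) q) →
           Chain K (A ++ B)
chain-++ {K} A {B} a b f g =
  subst (Chain K) (reverse-ʳ++ A B)
    (rezip (proj₁ (unzip (reverse A) (subst (Chain K) (sym (trans (reverse-ʳ++ A []) (++-identityʳ A))) a))) (Chain-resp B g f b))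

-- From chains back to strict partitions and tableaux

addRow : ℕ → List ℕ → List ℕ
addRow zero [] = 1 ∷ []
addRow zero (x ∷ l) = suc x ∷ l
addRow (suc r) [] = []
addRow (suc r) (x ∷ l) = x ∷ addRow r l

addRow-same : ∀ r l → r ≤ length l → part (addRow r l) (suc r) ≡ suc (part l (suc r))
addRow-same zero [] _ = refl
addRow-same zero (x ∷ l) _ = refl
addRow-same (suc r) (x ∷ l) (s≤s le) = addRow-same r l le

addRow-other : ∀ r l i → r ≤ length l → i ≢ suc r → part (addRow r l) i ≡ part l i
addRow-other zero [] zero _ _ = refl
addRow-other zero (x ∷ l) zero _ _ = refl
addRow-other zero l (suc zero) _ n = ⊥-elim (n refl)
addRow-other zero [] (suc (suc i)) _ n = refl
addRow-other zero (x ∷ l) (suc (suc i)) _ n = refl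
addRow-other (suc r) (x ∷ l) zero _ _ = refl
addRow-other (suc r) (x ∷ l) (suc zero) _ _ = refl
addRow-other (suc r) (x ∷ l) (suc (suc i)) (s≤s le) n = addRow-other r l (suc i) le (λ e → n (cong suc e))

addRow-strict : ∀ r l → r ≤ length l → (∀ s → r ≡ suc s → suc (part l (suc r)) < part l (suc s)) →
                StrictPartition l → StrictPartition (addRow r l)
addRow-strict zero [] _ _ _ = [-] , s≤s z≤n ∷ []
addRow-strict zero (x ∷ []) _ _ _ = [-] , s≤s z≤n ∷ []
addRow-strict zero (x ∷ y ∷ l) _ _ (p ∷ ps , q ∷ qs) = m≤n⇒m≤1+n p ∷ ps , s≤s z≤n ∷ qs
addRow-strict (suc zero) (x ∷ []) _ h (_ , q ∷ _) = h 0 refl ∷ [-] , q ∷ s≤s z≤n ∷ []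
addRow-strict (suc zero) (x ∷ y ∷ l) (s≤s le) h (p ∷ ps , q ∷ qs)
  with addRow-strict zero (y ∷ l) z≤n (λ _ ()) (ps , qs)
... | ps' , qs' = h 0 refl ∷ ps' , q ∷ qs'
addRow-strict (suc (suc r)) (x ∷ y ∷ l) (s≤s le) h (p ∷ ps , q ∷ qs)
  with addRow-strict (suc r) (y ∷ l) le (λ { s refl → h (suc s) refl }) (ps , qs)
... | ps' , qs' = p ∷ ps' , q ∷ qs'
addRow-strict (suc (suc r)) (x ∷ []) (s≤s ()) _ _

part-length : ∀ l i → 0 < part l (suc i) → suc i ≤ length l
part-length (x ∷ l) zero _ = s≤s z≤n
part-length (x ∷ l) (suc i) p = s≤s (part-length l i p)

InS⁺ : ∀ l {i j} → 1 ≤ i → i ≤ j → j < part l i + i → InS l (i , j)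
InS⁺ l {suc i} 1≤i i≤j j< = 1≤i , part-length l i (+-cancelʳ-< (suc i) 0 _ (≤-<-trans i≤j j<)) , i≤j , j<

record Extension (ν : List ℕ) (New : Region) : Set where
  field
    shape  : List ℕ
    strict : StrictPartition shape
    to     : ∀ {q} → InS shape q → InS ν q ⊎ New q
    from   : ∀ {q} → InS ν q ⊎ New q → InS shape q

-- The west neighbour, or the diagonal, puts the box at the end of its row; the north neighbour
-- makes the row above long enough for the parts to stay strictly decreasing.
add-box : ∀ {ν x} → StrictPartition ν → Addable (InS ν) x → Extension ν (_≡ x)
add-box {ν} {suc r , j} sν ((1≤i , i≤j) , ∉ , c) = record
  { shape = addRow r ν ; strict = addRow-strict r ν r≤ north sν ; to = to ; from = from }
  where
  r≤ : r ≤ length ν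
  r≤ = above r i≤j c
    where
    above : ∀ r → suc r ≤ j → (∀ {q} → q ⋖ (suc r , j) → InQ q → InS ν q) → r ≤ length ν
    above zero _ _ = z≤n
    above (suc s) i≤j c = proj₁ (proj₂ (c S (s≤s z≤n , ≤-trans (n≤1+n _) i≤j)))
  j≥ : part ν (suc r) + suc r ≤ j
  j≥ = ≮⇒≥ λ j< → ∉ (InS⁺ ν 1≤i i≤j j<)
  west : ∀ j → suc r ≤ j → part ν (suc r) + suc r ≤ j → (∀ {q} → q ⋖ (suc r , j) → InQ q → InS ν q) → j ≡ part ν (suc r) + suc r
  west (suc j) i≤j j≥ c with m≤n⇒m<n∨m≡n i≤j
  ... | inj₁ i<j = ≤-antisym (proj₂ (proj₂ (proj₂ (c E (1≤i , ≤-pred i<j))))) j≥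
  ... | inj₂ refl = ≤-antisym (m≤n+m (suc r) (part ν (suc r))) j≥
  j≡ : j ≡ part ν (suc r) + suc r
  j≡ = west j i≤j j≥ c
  north : ∀ s → r ≡ suc s → suc (part ν (suc r)) < part ν (suc s)
  north s refl with proj₂ (proj₂ (proj₂ (c S (s≤s z≤n , ≤-trans (n≤1+n _) i≤j))))
  ... | j< = +-cancelʳ-< (suc s) _ _ (subst (_< part ν (suc s) + suc s) (trans j≡ (+-suc (part ν (suc (suc s))) (suc s))) j<)
  to : ∀ {q} → InS (addRow r ν) q → InS ν q ⊎ q ≡ (suc r , j)
  to {i , k} (1≤i' , _ , i≤k , k<) with i ≟ suc r
  ... | no ne = inj₁ (InS⁺ ν 1≤i' i≤k (subst (λ t → k < t + i) (addRow-other r ν i r≤ ne) k<))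
  ... | yes refl with m≤n⇒m<n∨m≡n (≤-pred (subst (λ t → k < t + suc r) (addRow-same r ν r≤) k<))
  ...   | inj₁ k<' = inj₁ (InS⁺ ν 1≤i' i≤k k<')
  ...   | inj₂ e = inj₂ (cong (suc r ,_) (trans e (sym j≡)))
  from : ∀ {q} → InS ν q ⊎ q ≡ (suc r , j) → InS (addRow r ν) q
  from (inj₂ refl) = InS⁺ (addRow r ν) 1≤i i≤j
    (subst (λ t → j < t + suc r) (sym (addRow-same r ν r≤)) (s≤s (≤-reflexive j≡)))
  from {i , k} (inj₁ (1≤i' , _ , i≤k , k<)) with i ≟ suc r
  ... | no ne = InS⁺ (addRow r ν) 1≤i' i≤k (subst (λ t → k < t + i) (sym (addRow-other r ν i r≤ ne)) k<)
  ... | yes refl = InS⁺ (addRow r ν) 1≤i' i≤k (subst (λ t → k < t + suc r) (sym (addRow-same r ν r≤)) (m≤n⇒m≤1+n k<))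

At : List Marked → Region
At L q = Σ Bool λ ζ → (q , ζ) ∈ L

chain-shape : ∀ {ν} L → StrictPartition ν → Chain (InS ν) L → Extension ν (At L)
chain-shape {ν} [] sν [] = record { shape = ν ; strict = sν ; to = inj₁ ; from = λ { (inj₁ k) → k ; (inj₂ (_ , ())) } }
chain-shape {ν} ((x , ξ) ∷ L) sν (a ∷ ch) with add-box sν a
... | e with chain-shape L (Extension.strict e) (Chain-resp L (Extension.from e) (Extension.to e) ch)
...   | f = record
  { shape = Extension.shape f ; strict = Extension.strict f
  ; to = λ k → case Extension.to f k of λ
      { (inj₁ k') → case Extension.to e k' of λ { (inj₁ k″) → inj₁ k″ ; (inj₂ refl) → inj₂ (ξ , here refl) }
      ; (inj₂ (ζ , m)) → inj₂ (ζ , there m) }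
  ; from = λ { (inj₁ k) → Extension.from f (inj₁ (Extension.from e (inj₁ k)))
             ; (inj₂ (_ , here refl)) → Extension.from f (inj₁ (Extension.from e (inj₂ refl)))
             ; (inj₂ (ζ , there m)) → Extension.from f (inj₂ (ζ , m)) } }

pairs-compare : ∀ {R : Marked → Marked → Set} {L e f} → AllPairs R L → e ∈ L → f ∈ L → e ≡ f ⊎ R e f ⊎ R f e
pairs-compare (p ∷ ps) (here refl) (here refl) = inj₁ refl
pairs-compare (p ∷ ps) (here refl) (there m) = inj₂ (inj₁ (All.lookup p m))
pairs-compare (p ∷ ps) (there m) (here refl) = inj₂ (inj₂ (All.lookup p m))
pairs-compare (p ∷ ps) (there m) (there m') = pairs-compare ps m m'

module _ {K n X R} (ideal : Ideal K) (good : ∀ {k} → InRange n k → Good (X k)) (ch : Chain K (stack X n R)) where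

  -- A box weakly south-east of another is added after it. This gives the row and column conditions
  -- of the tableau back from the chain.
  stack-order : ∀ {k k' e f} → InRange n k → InRange n k' → e ∈ X k → f ∈ X k' → pos e ≼ pos f → pos e ≢ pos f →
                k < k' ⊎ (k ≡ k' × PW e f)
  stack-order {k} {k'} r r' m m' le ne with stack-pairs⁻ n (chain-later ideal ch) | <-cmp k k'
  ... | _ | tri< l _ _ = inj₁ l
  ... | _ , _ , c , _ | tri> _ _ l = ⊥-elim (c r' r l m' m le)
  ... | b , _ | tri≈ _ refl _ with pairs-compare (AP.zip (proj₁ (good r) , b r)) m m'
  ...   | inj₁ refl = ⊥-elim (ne refl)
  ...   | inj₂ (inj₁ (pw , _)) = inj₂ (refl , pw)
  ...   | inj₂ (inj₂ (_ , lat)) = ⊥-elim (lat le)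

good-≤ : ∀ {k e f} → 1 ≤ k → PW e f → lt k (mark e) ≤L lt k (mark f)
good-≤ _ (tt _) = ≤-refl
good-≤ 1≤k tf = <⇒≤ (rank-primed 1≤k)
good-≤ _ (ff _) = ≤-refl

module _ {ν n X F} (sν : StrictPartition ν) (L : Lists n X F) (good : ∀ {k} → InRange n k → Good (X k))
         (ch : Chain (InS ν) (stack X n [])) where

  extension : Extension ν (At (stack X n []))
  extension = chain-shape (stack X n []) sν ch

  open Extension extension

  private
    order : ∀ {p q x y} → F p ≡ just x → F q ≡ just y → p ≼ q → p ≢ q →
            val x < val y ⊎ (val x ≡ val y × PW (p , primed x) (q , primed y))
    order {x = lt k ζ} {lt k' ζ'} a b le ne with Lists.sound L a | Lists.sound L b
    ... | r , m | r' , m' = stack-order (InS-ideal sν) good ch r r' m m' le ne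

    rows : ∀ i j j' x y → j < j' → F (i , j) ≡ just x → F (i , j') ≡ just y →
           (x ≤L y) × (primed x ≡ true → primed y ≡ true → val x ≢ val y)
    rows i j j' (lt k ζ) (lt k' ζ') l a b with order a b (≤-refl , <⇒≤ l) (λ { refl → <-irrefl refl l })
    ... | inj₁ k<k' = <⇒≤ (rank-< ζ ζ' k<k') , λ _ _ e → <⇒≢ k<k' e
    ... | inj₂ (refl , tt r) = ⊥-elim (<-irrefl refl r)
    ... | inj₂ (refl , tf) = good-≤ (proj₁ (proj₁ (Lists.sound L a))) (tf {(i , j)} {(i , j')}) , λ _ ()
    ... | inj₂ (refl , ff c) = ≤-refl , λ ()

    cols : ∀ i i' j x y → i < i' → F (i , j) ≡ just x → F (i' , j) ≡ just y →
           (x ≤L y) × (primed x ≡ false → primed y ≡ false → val x ≢ val y)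
    cols i i' j (lt k ζ) (lt k' ζ') l a b with order a b (<⇒≤ l , ≤-refl) (λ { refl → <-irrefl refl l })
    ... | inj₁ k<k' = <⇒≤ (rank-< ζ ζ' k<k') , λ _ _ e → <⇒≢ k<k' e
    ... | inj₂ (refl , tt r) = ≤-refl , λ ()
    ... | inj₂ (refl , tf) = good-≤ (proj₁ (proj₁ (Lists.sound L a))) (tf {(i , j)} {(i' , j)}) , λ ()
    ... | inj₂ (refl , ff c) = ⊥-elim (<-irrefl refl c)

  lists-shape : HasShape F shape ν
  lists-shape b = to′ , from′
    where
    to′ : Is-just (F b) → InSkew shape ν b
    to′ j with is-just⁻ j
    ... | lt k ζ , e with Lists.sound L e
    ...   | r , m = from (inj₂ (ζ , stack-∈ n r m)) , proj₂ (chain-∉ ch (stack-∈ n r m))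
    from′ : InSkew shape ν b → Is-just (F b)
    from′ (i , ∉) with to i
    ... | inj₁ k = ⊥-elim (∉ k)
    ... | inj₂ (ζ , m) with stack-∈⁻ n m
    ...   | inj₁ (k , r , m') = is-just⁺ (Lists.cover L r m')

  lists-SSYT : IsSSYT F
  lists-SSYT = ((shape , ν , strict , sν , (λ b i → from (inj₁ i)) , lists-shape) ,
                (λ { p (lt k ζ) e → proj₁ (proj₁ (Lists.sound L e)) }) , rows , cols) , diag
    where
    diag : ∀ i x → F (i , i) ≡ just x → primed x ≡ false
    diag i (lt k ζ) e with Lists.sound L e
    ... | r , m = All.lookup (proj₂ (good r)) m refl

rows-good : ∀ {n SA SA' TB TB'} m → Rows n SA SA' TB m TB' → (∀ {k} → InRange m k → Good (SA k)) →
            (∀ {k} → InRange n k → Good (TB k)) → ∀ {k} → InRange n k → Good (TB' k)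
rows-good zero ([] f) gS gT r = subst Good (f r) (gT r)
rows-good {n} (suc m) (c ∷ rs) gS gT =
  rows-good m rs (λ { (l , u) → gS (l , m≤n⇒m≤1+n u) }) (proj₁ (cols-good n c (gS (s≤s z≤n , ≤-refl))))

rows-goodS : ∀ {n SA SA' TB TB'} m → Rows n SA SA' TB m TB' → (∀ {k} → InRange m k → Good (SA k)) →
             (∀ {k} → InRange n k → Good (TB k)) → ∀ {k} → InRange m k → Good (SA' k)
rows-goodS zero _ gS gT (s≤s _ , ())
rows-goodS {n} {SA' = SA'} (suc m) (c ∷ rs) gS gT {k} (l , u) with cols-good n c (gS (s≤s z≤n , ≤-refl)) | k ≟ suc m
... | _ , g | yes refl = g
... | g , _ | no ne = rows-goodS m rs (λ { (l , u) → gS (l , m≤n⇒m≤1+n u) }) g (l , ≤-pred (≤∧≢⇒< u ne))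

labelAll-S : ∀ {U V p x} → U p ≡ just x → labelAll U V p ≡ just (lS , x)
labelAll-S {U} {p = p} e with U p
labelAll-S refl | just _ = refl

labelAll-T : ∀ {U V p x} → U p ≡ nothing → V p ≡ just x → labelAll U V p ≡ just (lT , x)
labelAll-T {U} {V} {p} e e' with U p
labelAll-T {U} {V} {p} refl e' | nothing with V p
labelAll-T refl refl | nothing | just _ = refl

labelAll⁻ : ∀ {U V p l x} → labelAll U V p ≡ just (l , x) →
            (l ≡ lS × U p ≡ just x) ⊎ (l ≡ lT × V p ≡ just x)
labelAll⁻ {U} {V} {p} e with U p
labelAll⁻ {U} {V} {p} refl | just _ = inj₁ (refl , refl)
... | nothing with V p
labelAll⁻ {U} {V} {p} refl | nothing | just _ = inj₂ (refl , refl)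

project-S : ∀ {st p x} → project lS st p ≡ just x → st p ≡ just (lS , x)
project-S {st} {p} e with st p
project-S refl | just (lS , _) = refl

project-T : ∀ {st p x} → project lT st p ≡ just x → st p ≡ just (lT , x)
project-T {st} {p} e with st p
project-T refl | just (lT , _) = refl

project-S⁺ : ∀ {st p x} → st p ≡ just (lS , x) → project lS st p ≡ just x
project-S⁺ {st} {p} e with st p
project-S⁺ refl | just _ = refl

project-T⁺ : ∀ {st p x} → st p ≡ just (lT , x) → project lT st p ≡ just x
project-T⁺ {st} {p} e with st p
project-T⁺ refl | just _ = refl

maybe-ext : ∀ {X : Set} {a b : Maybe X} → (∀ {x} → a ≡ just x → b ≡ just x) → (∀ {x} → b ≡ just x → a ≡ just x) → a ≡ b
maybe-ext {a = just x} f g = sym (f refl)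
maybe-ext {a = nothing} {nothing} f g = refl
maybe-ext {a = nothing} {just x} f g = g refl

whole-label : ∀ {m n SA TB U V} → Lists m SA U → Lists n TB V → (∀ {p x y} → U p ≡ just x → ¬ V p ≡ just y) →
              Whole m n SA TB (labelAll U V)
whole-label {m} {n} {SA} {TB} {U} {V} LS LT dis = record
  { soundS = λ {q} e → case labelAll⁻ {U} {V} {q} e of λ { (inj₁ (_ , e')) → Lists.sound LS e' ; (inj₂ (() , _)) }
  ; coverS = λ {q} r i → labelAll-S {U} {V} {q} (Lists.cover LS r i)
  ; soundT = λ {q} e → case labelAll⁻ {U} {V} {q} e of λ { (inj₁ (() , _)) ; (inj₂ (_ , e')) → Lists.sound LT e' }
  ; coverT = λ {q} r i → labelAll-T {U} {V} {q} (empty q (Lists.cover LT r i)) (Lists.cover LT r i) }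
  where
  empty : ∀ q {y} → V q ≡ just y → U q ≡ nothing
  empty q e with U q in eq
  ... | nothing = refl
  ... | just x = ⊥-elim (dis eq e)

lists-S : ∀ {m n SA TB st F} → Whole m n SA TB st → (∀ p → F p ≡ project lS st p) → Lists m SA F
lists-S {st = st} W f = record
  { sound = λ {p} e → Whole.soundS W (project-S {st} (trans (sym (f p)) e))
  ; cover = λ {p} r i → trans (f p) (project-S⁺ {st} (Whole.coverS W r i)) }

lists-T : ∀ {m n SA TB st F} → Whole m n SA TB st → (∀ p → F p ≡ project lT st p) → Lists n TB F
lists-T {st = st} W f = record
  { sound = λ {p} e → Whole.soundT W (project-T {st} (trans (sym (f p)) e))
  ; cover = λ {p} r i → trans (f p) (project-T⁺ {st} (Whole.coverT W r i)) }

lists-unique : ∀ {n X F G} → Lists n X F → Lists n X G → ∀ p → F p ≡ G p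
lists-unique LF LG p = maybe-ext (λ { {lt k ζ} e → let (r , m) = Lists.sound LF e in Lists.cover LG r m })
                                 (λ { {lt k ζ} e → let (r , m) = Lists.sound LG e in Lists.cover LF r m })

-- The loop bounds of the reverse procedure are the maxima of the new tableaux. The largest letter
-- cannot disappear because every strip keeps its number of boxes.
lists-max : ∀ {n X X' F G} → Lists n X F → Lists n X' G → (∀ {k} → InRange n k → length (X' k) ≡ length (X k)) →
            IsMax F n → IsMax G n
lists-max {n} {X} {X'} {F} {G} LF LG len (_ , top) = (λ { p (lt k ζ) e → proj₂ (proj₁ (Lists.sound LG e)) }) , top′ top
  where
  inhabited : ∀ {L L' : List Marked} {e} → length L' ≡ length L → e ∈ L → ∃ λ e' → e' ∈ L'
  inhabited {L' = []} eq (here _) = case eq of λ ()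
  inhabited {L' = []} eq (there _) = case eq of λ ()
  inhabited {L' = x ∷ _} eq _ = x , here refl
  top′ : (n ≡ 0 ⊎ Σ Box λ p → Σ Letter λ x → (F p ≡ just x) × (val x ≡ n)) →
         n ≡ 0 ⊎ Σ Box λ p → Σ Letter λ x → (G p ≡ just x) × (val x ≡ n)
  top′ (inj₁ z) = inj₁ z
  top′ (inj₂ (p , lt k ζ , e , refl)) with Lists.sound LF e
  ... | r , m with inhabited (len r) m
  ...   | (q , ζ') , m' = inj₂ (q , lt k ζ' , Lists.cover LG r m' , refl)

-- The rectangle of a given run together with the reverse run. Applied to the reverse run itself,
-- the same construction yields the statement about the other tableau.
record Switching (S T T̃ S̃ : Filling) : Set₁ where
  field
    {ν}         : List ℕ
    sν          : StrictPartition ν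
    {m n}       : ℕ
    {SA TB}     : Family
    {SA' TB'}   : Family
    listsS      : Lists m SA S
    listsT      : Lists n TB T
    listsT̃      : Lists n TB' T̃
    listsS̃      : Lists m SA' S̃
    rows        : Rows n SA SA' TB m TB'
    chain       : Chain (InS ν) (stack SA m (stack TB n []))
    goodS       : ∀ {k} → InRange m k → Good (SA k)
    goodT       : ∀ {k} → InRange n k → Good (TB k)
    reverse-MSTS : MSTS T̃ S̃ S T

switching : ∀ {S T T̃ S̃} → IsSSYT S → IsSSYT T → Extends T S → MSTS S T T̃ S̃ → Switching S T T̃ S̃
switching {U} {V} {Ṽ} {Ũ} sS sT (l , μ , ν , sl , sμ , sν , ν⊆μ , μ⊆l , shS , shT)
          (m , n , maxS , maxT , st , loop , fT , fS)
  = go (rows-exist m (InS-ideal sν) (λ {k} _ → goodS k) (λ {k} _ → goodT k) ch)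
  where
  SA TB : Family
  SA = strips-of U (size μ)
  TB = strips-of V (size l)
  LS : Lists m SA U
  LS = lists-of {l = μ} {ν} sS shS maxS
  LT : Lists n TB V
  LT = lists-of {l = l} {μ} sT shT maxT
  goodS : ∀ k → Good (SA k)
  goodS = strips-of-good U (size μ) sS
  goodT : ∀ k → Good (TB k)
  goodT = strips-of-good V (size l) sT
  region : ∀ {q} → ((InS ν ⊕ reverse (stack SA m [])) q → InS μ q) × (InS μ q → (InS ν ⊕ reverse (stack SA m [])) q)
  region = filling-region {l = μ} {ν} {m} {SA} sS sμ shS LS (λ {k} _ → goodS k) ν⊆μ
  ch : Chain (InS ν) (stack SA m (stack TB n []))
  ch = subst (Chain _) (sym (stack-++ m (stack TB n [])))
         (chain-++ (stack SA m []) (filling-chain {l = μ} {ν} {m} {SA} sS sμ shS LS (λ {k} _ → goodS k))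
                   (filling-chain {l = l} {μ} {n} {TB} sT sl shT LT (λ {k} _ → goodT k)) (proj₁ region) (proj₂ region))
  W₀ : Whole m n SA TB (labelAll U V)
  W₀ = whole-label LS LT λ {p} e e' →
         proj₂ (proj₁ (shT p) (is-just⁺ e')) (proj₁ (proj₁ (shS p) (is-just⁺ e)))
  go : (Σ Family λ SA' → Σ Family λ TB' → Rows n SA SA' TB m TB') → Switching U V Ṽ Ũ
  go (SA' , TB' , R) = record
    { sν = sν ; listsS = LS ; listsT = LT ; listsT̃ = LṼ ; listsS̃ = LŨ ; rows = R ; chain = ch
    ; goodS = λ {k} _ → goodS k ; goodT = λ {k} _ → goodT k
    ; reverse-MSTS = n , m , lists-max LT LṼ (rows-length m R) maxT ,
        lists-max LS LŨ (λ r → sym (rows-length n R⁻ r)) maxS ,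
        proj₁ (proj₁ back) , proj₂ (proj₁ back) ,
        lists-unique LS (lists-T W₂ (λ _ → refl)) , lists-unique LT (lists-S W₂ (λ _ → refl)) }
    where
    W : Whole m n SA' TB' st
    W = proj₂ (replay-rows m ≤-refl R (λ _ → refl) (λ l u → ⊥-elim (<⇒≱ l u)) W₀) st loop
    LṼ : Lists n TB' Ṽ
    LṼ = lists-T W fT
    LŨ : Lists m SA' Ũ
    LŨ = lists-S W fS
    R⁻ : Rows m TB' TB SA' n SA
    R⁻ = rows-transpose m R
    W₁ : Whole n m TB' SA' (labelAll Ṽ Ũ)
    W₁ = whole-label LṼ LŨ λ {p} e e' →
           case trans (sym (project-T {st} (trans (sym (fT p)) e))) (project-S {st} (trans (sym (fS p)) e')) of λ ()
    back : Σ State (OuterLoop m n (labelAll Ṽ Ũ)) × _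
    back = replay-rows n ≤-refl R⁻ (λ _ → refl) (λ l u → ⊥-elim (<⇒≱ l u)) W₁
    W₂ : Whole n m TB SA (proj₁ (proj₁ back))
    W₂ = proj₂ back _ (proj₂ (proj₁ back))

module _ {S T T̃ S̃} (D : Switching S T T̃ S̃) where
  open Switching D

  private
    ideal : Ideal (InS ν)
    ideal = InS-ideal sν
    goodT̃ : ∀ {k} → InRange n k → Good (TB' k)
    goodT̃ = rows-good m rows goodS goodT
    ch' : Chain (InS ν) (stack TB' n (stack SA' m []))
    ch' = rows-chain m ideal rows chain
    chT̃ : Chain (InS ν) (stack TB' n [])
    chT̃ = chain-prefix (stack TB' n []) (subst (Chain _) (stack-++ n (stack SA' m [])) ch')

  switching-T̃ : IsSSYT T̃
  switching-T̃ = lists-SSYT sν listsT̃ goodT̃ chT̃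

  private
    e : Extension ν (At (stack TB' n []))
    e = extension sν listsT̃ goodT̃ chT̃
    module Ext = Extension e
    goodS̃ : ∀ {k} → InRange m k → Good (SA' k)
    goodS̃ = rows-goodS m rows goodS goodT
    chS̃ : Chain (InS Ext.shape) (stack SA' m [])
    chS̃ = Chain-resp _ to from (proj₂ (unzip (reverse (stack TB' n []))
            (subst (Chain _) (trans (stack-++ n (stack SA' m [])) (sym (reverse-ʳ++ (stack TB' n []) _))) ch')))
      where
      to : ∀ {q} → (InS ν ⊕ reverse (stack TB' n [])) q → InS Ext.shape q
      to k with ⊕-∈⁻ {InS ν} (reverse (stack TB' n [])) k
      ... | inj₁ k' = Ext.from (inj₁ k')
      ... | inj₂ (ζ , m) = Ext.from (inj₂ (ζ , Any-reverse⁻ m))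
      from : ∀ {q} → InS Ext.shape q → (InS ν ⊕ reverse (stack TB' n [])) q
      from k with Ext.to k
      ... | inj₁ k' = ⊕-base {InS ν} (reverse (stack TB' n [])) k'
      ... | inj₂ (ζ , m) = ⊕-∈ {InS ν} (Any-reverse⁺ m)

  switching-S̃ : IsSSYT S̃
  switching-S̃ = lists-SSYT Ext.strict listsS̃ goodS̃ chS̃

  switching-extends : Extends S̃ T̃
  switching-extends = Extension.shape f , Ext.shape , ν , Extension.strict f , Ext.strict , sν ,
    (λ b i → Ext.from (inj₁ i)) , (λ b i → Extension.from f (inj₁ i)) ,
    lists-shape sν listsT̃ goodT̃ chT̃ , lists-shape Ext.strict listsS̃ goodS̃ chS̃
    where
    f : Extension Ext.shape (At (stack SA' m []))
    f = extension Ext.strict listsS̃ goodS̃ chS̃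

-- The lattice property of words

-- bb ζ and cc ζ are the letters k and k+1 (primed if ζ) of a fixed pair of consecutive values.
data Sym : Set where
  bb cc : Bool → Sym

Walk : Set
Walk = ℕ × ℕ

-- For a word u, let δ be the number of k minus the number of k+1 met so far.  The word u û can be
-- read without violating the lattice property iff δ ≥ x at its beginning, and then δ - x + y is the
-- value at its end, where (x , y) is the walk of u read from right to left.
walk₁ : Sym → Walk → Walk
walk₁ (bb false) (suc x , suc y) = x , suc y
walk₁ (bb false) (zero  , y)     = zero , suc y
walk₁ (bb false) (suc x , zero)  = suc x , 1
walk₁ (bb true)  (x , y)         = x , suc y
walk₁ (cc false) (x , y)         = suc x , y
walk₁ (cc true)  (suc x , suc y) = suc x , y
walk₁ (cc true)  (zero  , y)     = 1 , y
walk₁ (cc true)  (suc x , zero)  = suc (suc x) , zero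

walk : List Sym → Walk → Walk
walk w σ = foldl (λ τ v → walk₁ v τ) σ w

walk-ccs : ∀ {R x y} → All (_≡ false) R → walk (map cc R) (x , y) ≡ (length R + x , y)
walk-ccs [] = refl
walk-ccs {_ ∷ R} {x} {y} (refl ∷ f) = trans (walk-ccs f) (cong (_, y) (+-suc (length R) x))

-- R: the letters k+1 to the right of a letter k in one row; R': the letters above them.
data Stack : List Bool → List Sym → Set where
  []   : ∀ {R'} → Stack [] R'
  _∷_  : ∀ ζ {R R'} → Stack R R' → Stack (ζ ∷ R) (bb false ∷ R')
  last : ∀ ζ {R'} → Stack (ζ ∷ []) (cc true ∷ R')

-- The second walk arrives at first coordinate 0 one letter before the first does. There the next
-- letter, k or (k+1)′, acts differently on the two by exactly their difference.
merge₁ : ∀ {ζ R R' t} → Stack (ζ ∷ R) R' → walk R' (suc (length R) , suc (suc t)) ≡ walk R' (length R , suc t)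
merge₁ (ζ ∷ []) = refl
merge₁ (ζ ∷ s@(_ ∷ _)) = merge₁ s
merge₁ (ζ ∷ s@(last _)) = merge₁ s
merge₁ (last ζ) = refl

merge₂ : ∀ {ζ R R' n} → Stack (ζ ∷ R) R' → walk R' (n , 0) ≡ walk R' (suc n , 1)
merge₂ {n = zero} (ζ ∷ _) = refl
merge₂ {n = suc n} (ζ ∷ _) = refl
merge₂ {n = zero} (last _) = refl
merge₂ {n = suc n} (last _) = refl

module _ {R : List Bool} {R' : List Sym} (f : All (_≡ false) R) where

  private
    shift : ∀ x y → walk (map cc R) (suc x , y) ≡ (suc (length R + x) , y)
    shift x y = trans (walk-ccs f) (cong (_, y) (+-suc (length R) x))

    shift₀ : ∀ y → walk (map cc R) (1 , y) ≡ (suc (length R) , y)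
    shift₀ y = trans (shift 0 y) (cong (λ t → suc t , y) (+-identityʳ _))

  -- A letter k that moves up passes the letters k+1 to its right. As steps of a walk these do not
  -- commute in general; the discrepancy vanishes once the row above has been read, hence the
  -- `walk R'` on both sides.
  stack-bb₁ : ∀ ζ → Stack (ζ ∷ R) R' → ∀ σ →
              walk R' (walk (map cc (ζ ∷ R)) (walk₁ (bb false) σ)) ≡ walk R' (walk₁ (bb false) (walk (map cc (ζ ∷ R)) σ))
  stack-bb₁ false s (zero , zero) rewrite shift₀ 1 | shift₀ 0 = refl
  stack-bb₁ false s (suc x , zero) rewrite shift (suc x) 1 | shift (suc x) 0 = refl
  stack-bb₁ false s (suc x , suc y) rewrite shift x (suc y) | shift (suc x) (suc y) | +-suc (length R) x = refl
  stack-bb₁ false s (zero , suc y) rewrite shift₀ (suc (suc y)) | shift₀ (suc y) = merge₁ s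
  stack-bb₁ true s (zero , zero) rewrite shift₀ 1 | shift₀ 0 = refl
  stack-bb₁ true s (zero , suc y) rewrite shift₀ (suc (suc y)) | shift₀ (suc y) = merge₁ s
  stack-bb₁ true s (suc x , zero) rewrite shift x 0 | shift (suc x) 0 | +-suc (length R) x = merge₂ s
  stack-bb₁ true s (suc zero , suc zero) rewrite shift₀ 1 | shift₀ 0 = refl
  stack-bb₁ true s (suc (suc x) , suc zero) rewrite shift x 0 | shift (suc x) 0 | +-suc (length R) x = merge₂ s
  stack-bb₁ true s (suc zero , suc (suc y)) rewrite shift₀ (suc (suc y)) | shift₀ (suc y) = merge₁ s
  stack-bb₁ true s (suc (suc x) , suc (suc y)) rewrite shift x (suc y) | shift (suc x) (suc y) | +-suc (length R) x = refl

data Flags : List Bool → Set where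
  []  : Flags []
  _∷_ : ∀ ζ {R} → All (_≡ false) R → Flags (ζ ∷ R)

stack-bb : ∀ {R R'} → Flags R → Stack R R' → ∀ σ →
           walk R' (walk (map cc R) (walk₁ (bb false) σ)) ≡ walk R' (walk₁ (bb false) (walk (map cc R) σ))
stack-bb [] s σ = refl
stack-bb (ζ ∷ f) s σ = stack-bb₁ f ζ s σ

Ascended : Walk → Set
Ascended (x , y) = 1 ≤ y

bb-ascends : ∀ ζ σ → Ascended (walk₁ (bb ζ) σ)
bb-ascends false (zero , y) = s≤s z≤n
bb-ascends false (suc x , zero) = s≤s z≤n
bb-ascends false (suc x , suc y) = s≤s z≤n
bb-ascends true σ = s≤s z≤n

-- At second coordinate 0 the letter (k+1)′ raises the first coordinate instead of lowering the
-- second, so a preceding k′ would make a difference.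
cc-bb′ : ∀ ζ σ → Ascended σ → walk₁ (cc ζ) (walk₁ (bb true) σ) ≡ walk₁ (bb true) (walk₁ (cc ζ) σ)
cc-bb′ false σ _ = refl
cc-bb′ true (zero , y) _ = refl
cc-bb′ true (suc x , suc y) _ = refl

ccs-bb′ : ∀ {R} → Flags R → ∀ σ → Ascended σ →
          walk (map cc R) (walk₁ (bb true) σ) ≡ walk₁ (bb true) (walk (map cc R) σ)
ccs-bb′ [] σ a = refl
ccs-bb′ (ζ ∷ f) σ a rewrite cc-bb′ ζ σ a = all f (walk₁ (cc ζ) σ)
  where
  all : ∀ {R} → All (_≡ false) R → ∀ σ → walk (map cc R) (walk₁ (bb true) σ) ≡ walk₁ (bb true) (walk (map cc R) σ)
  all [] σ = refl
  all (refl ∷ f) σ = all f (walk₁ (cc false) σ)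

bb-at-0 : ∀ ζ x → walk₁ (bb ζ) (x , 0) ≡ (x , 1)
bb-at-0 false zero = refl
bb-at-0 false (suc x) = refl
bb-at-0 true x = refl

ccs-at-0 : ∀ R x → proj₂ (walk (map cc R) (x , 0)) ≡ 0
ccs-at-0 [] x = refl
ccs-at-0 (false ∷ R) x = ccs-at-0 R (suc x)
ccs-at-0 (true ∷ R) zero = ccs-at-0 R 1
ccs-at-0 (true ∷ R) (suc x) = ccs-at-0 R (suc (suc x))

bb-free : ∀ ζ η σ → proj₂ σ ≡ 0 → walk₁ (bb ζ) σ ≡ walk₁ (bb η) σ
bb-free ζ η (x , .0) refl = trans (bb-at-0 ζ x) (sym (bb-at-0 η x))

cc-free : ∀ ζ η σ → proj₁ σ ≡ 0 → walk₁ (cc ζ) σ ≡ walk₁ (cc η) σ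
cc-free false false σ _ = refl
cc-free false true (.0 , y) refl = refl
cc-free true false (.0 , y) refl = refl
cc-free true true σ _ = refl

stack-bb-at-0 : ∀ {R R'} → Flags R → Stack R R' → ∀ ζ η σ → proj₂ σ ≡ 0 →
                walk R' (walk (map cc R) (walk₁ (bb ζ) σ)) ≡ walk R' (walk₁ (bb η) (walk (map cc R) σ))
stack-bb-at-0 {R} {R'} f s ζ η σ@(x , .0) refl = trans (cong (λ t → walk R' (walk (map cc R) t)) (bb-free ζ false σ refl))
  (trans (stack-bb f s σ) (cong (walk R') (bb-free false η (walk (map cc R) σ) (ccs-at-0 R x))))

stack-move : ∀ {R R'} → Flags R → Stack R R' → ∀ ζ σ →
             walk R' (walk (map cc R) (walk₁ (bb ζ) σ)) ≡ walk R' (walk₁ (bb ζ) (walk (map cc R) σ))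
stack-move f s false σ = stack-bb f s σ
stack-move f s true σ@(x , zero) = stack-bb-at-0 f s true true σ refl
stack-move {R' = R'} f s true σ@(x , suc y) = cong (walk R') (ccs-bb′ f σ (s≤s z≤n))

bb-bb′ : ∀ σ → Ascended σ → walk₁ (bb true) (walk₁ (bb false) σ) ≡ walk₁ (bb false) (walk₁ (bb true) σ)
bb-bb′ (zero , suc y) _ = refl
bb-bb′ (suc x , suc y) _ = refl

stack-move′ : ∀ {R R'} → Flags R → Stack R R' → ∀ σ → Ascended σ →
              walk R' (walk₁ (bb true) (walk (map cc R) (walk₁ (bb false) σ))) ≡
              walk R' (walk₁ (bb false) (walk₁ (bb true) (walk (map cc R) σ)))
stack-move′ {R} {R'} f s σ a =
  trans (cong (walk R') (sym (ccs-bb′ f (walk₁ (bb false) σ) (bb-ascends false σ))))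
  (trans (cong (λ t → walk R' (walk (map cc R) t)) (bb-bb′ σ a))
  (trans (stack-bb f s (walk₁ (bb true) σ))
         (cong (λ t → walk R' (walk₁ (bb false) t)) (ccs-bb′ f σ a))))

stack-S3-0 : ∀ {R R'} → Flags R → Stack R R' →
             walk R' (walk₁ (bb true) (walk (map cc R) (walk₁ (bb false) (0 , 0)))) ≡
             walk R' (walk₁ (bb false) (walk₁ (bb false) (walk (map cc R) (0 , 0))))
stack-S3-0 [] s = refl
stack-S3-0 {_ ∷ R} (ζ ∷ f) s
  rewrite cc-free ζ false (0 , 0) refl | cc-free ζ false (0 , 1) refl
        | walk-ccs {x = 1} {0} f | walk-ccs {x = 1} {1} f | +-suc (length R) 0 | +-identityʳ (length R) = merge₁ s

stack-S3-1 : ∀ {R R'} → All (_≡ false) R → ∀ x →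
             walk R' (walk₁ (bb true) (walk (map cc (true ∷ R)) (walk₁ (bb false) (suc x , 0)))) ≡
             walk R' (walk₁ (bb false) (walk₁ (bb false) (walk (map cc (true ∷ R)) (suc x , 0))))
stack-S3-1 {R} f x
  rewrite walk-ccs {x = suc x} {0} f | walk-ccs {x = suc (suc x)} {0} f | +-suc (length R) (suc x) | +-suc (length R) x = refl

-- Counts the letters whose step treats first coordinate 0 separately. A walk that starts with at
-- least this much never meets that case, so an extra unit of the first coordinate is carried along
-- unchanged.
cost : List Sym → ℕ
cost [] = 0
cost (bb false ∷ w) = suc (cost w)
cost (bb true ∷ w) = cost w
cost (cc false ∷ w) = cost w
cost (cc true ∷ w) = suc (cost w)

cc-commutes : ∀ w σ → cost w ≤ proj₁ σ → walk w (walk₁ (cc false) σ) ≡ walk₁ (cc false) (walk w σ)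
cc-commutes [] σ _ = refl
cc-commutes (bb false ∷ w) (suc x , suc y) (s≤s l) = cc-commutes w (x , suc y) l
cc-commutes (bb false ∷ w) (suc x , zero) (s≤s l) = cc-commutes w (suc x , 1) (≤-trans l (n≤1+n x))
cc-commutes (bb true ∷ w) (x , y) l = cc-commutes w (x , suc y) l
cc-commutes (cc false ∷ w) (x , y) l = cc-commutes w (suc x , y) (≤-trans l (n≤1+n x))
cc-commutes (cc true ∷ w) (suc x , suc y) (s≤s l) = cc-commutes w (suc x , y) (≤-trans l (n≤1+n x))
cc-commutes (cc true ∷ w) (suc x , zero) (s≤s l) = cc-commutes w (suc (suc x) , 0) (≤-trans l (≤-trans (n≤1+n x) (n≤1+n (suc x))))

cc-commutes-at-0 : ∀ w x → cost w ≤ x →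
                   walk (bb false ∷ w) (walk₁ (cc false) (x , 0)) ≡ walk₁ (cc false) (walk (bb false ∷ w) (x , 0))
cc-commutes-at-0 w zero l = cc-commutes w (0 , 1) l
cc-commutes-at-0 w (suc x) l = cc-commutes w (suc x , 1) l

restrict : ℕ → Letter → Maybe Sym
restrict k (lt v ζ) with v ≟ k | v ≟ suc k
... | yes _ | _     = just (bb ζ)
... | no _  | yes _ = just (cc ζ)
... | no _  | no _  = nothing

data Restricted (k : ℕ) : Letter → Maybe Sym → Set where
  is-bb : ∀ {ζ} → Restricted k (lt k ζ) (just (bb ζ))
  is-cc : ∀ {ζ} → Restricted k (lt (suc k) ζ) (just (cc ζ))
  is-no : ∀ {v ζ} → v ≢ k → v ≢ suc k → Restricted k (lt v ζ) nothing

restricted : ∀ k l → Restricted k l (restrict k l)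
restricted k (lt v ζ) with v ≟ k | v ≟ suc k
... | yes refl | _     = is-bb
... | no _  | yes refl = is-cc
... | no n  | no n'    = is-no n n'

walkM : Maybe Sym → Walk → Walk
walkM (just v) σ = walk₁ v σ
walkM nothing σ = σ

wordWalk : ℕ → List Letter → Walk
wordWalk k = foldr (λ l → walkM (restrict k l)) (0 , 0)

Allowed : Maybe Sym → ℕ → Set
Allowed (just (cc _)) d = d ≢ 0
Allowed _ d = ⊤

excess : Maybe Sym → ℕ → ℕ
excess (just (bb false)) d = suc d
excess (just (cc false)) d = d ∸ 1
excess _ d = d

-- a can be read when m_k exceeds m_{k+1} by d.
Safe : ℕ → ℕ → List Letter → Set
Safe k d [] = ⊤
Safe k d (x ∷ a) = Allowed (restrict k x) d × Safe k (excess (restrict k x) d) a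

countU-hit : ∀ k xs → countU k (unp k ∷ xs) ≡ suc (countU k xs)
countU-hit k xs rewrite dec-true (k ≟ k) refl = refl

countU-miss : ∀ {v} k ζ xs → v ≢ k → countU k (lt v ζ ∷ xs) ≡ countU k xs
countU-miss {v} k false xs n rewrite dec-false (v ≟ k) n = refl
countU-miss k true xs n = refl

-- The lattice condition for the pair k, k+1 after mb letters k and mc letters k+1.
Lattice-at : (k mb mc : ℕ) → List Letter → Set
Lattice-at k mb mc a = ∀ j x → j < length a → mc + countU (suc k) (take j a) ≡ mb + countU k (take j a) →
                       nth a j ≡ just x → val x ≢ suc k

shift-at : ∀ {k mb mc mb' mc' x a} → (∀ xs → mc + countU (suc k) (x ∷ xs) ≡ mc' + countU (suc k) xs) →
           (∀ xs → mb + countU k (x ∷ xs) ≡ mb' + countU k xs) → Lattice-at k mb mc (x ∷ a) → Lattice-at k mb' mc' a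
shift-at {a = a} f g L j y l e = L (suc j) y (s≤s l) (trans (f (take j a)) (trans e (sym (g (take j a)))))

unshift-at : ∀ {k mb mc mb' mc' x a} → (∀ xs → mc + countU (suc k) (x ∷ xs) ≡ mc' + countU (suc k) xs) →
             (∀ xs → mb + countU k (x ∷ xs) ≡ mb' + countU k xs) → (mc ≡ mb → val x ≢ suc k) →
             Lattice-at k mb' mc' a → Lattice-at k mb mc (x ∷ a)
unshift-at {mb = mb} {mc} f g h L zero y l e refl = h (trans (sym (+-identityʳ mc)) (trans e (+-identityʳ mb)))
unshift-at {a = a} f g h L (suc j) y (s≤s l) e = L j y l (trans (sym (f (take j a))) (trans e (g (take j a))))

+-move : ∀ a b c → a + suc b + c ≡ a + b + suc c
+-move a b c = trans (cong (_+ c) (+-suc a b)) (sym (+-suc (a + b) c))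

≢-plus : ∀ mc {d} → d ≢ 0 → mc ≢ mc + d
≢-plus mc n e = n (+-cancelˡ-≡ mc _ _ (trans (sym e) (sym (+-identityʳ mc))))

hit-b : ∀ k a d xs → a + d + countU k (unp k ∷ xs) ≡ a + suc d + countU k xs
hit-b k a d xs = trans (cong (a + d +_) (countU-hit k xs)) (sym (+-move a d (countU k xs)))

hit-c : ∀ k a xs → a + countU (suc k) (unp (suc k) ∷ xs) ≡ suc a + countU (suc k) xs
hit-c k a xs = trans (cong (a +_) (countU-hit (suc k) xs)) (+-suc a _)

miss-bc : ∀ k a d xs → a + suc d + countU k (unp (suc k) ∷ xs) ≡ suc a + d + countU k xs
miss-bc k a d xs = trans (cong (a + suc d +_) (countU-miss k false xs (λ e → n≢1+n (sym e)))) (cong (_+ countU k xs) (+-suc a d))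

safe⇒lattice : ∀ k mc d a → Safe k d a → Lattice-at k (mc + d) mc a
safe⇒lattice k mc d [] _ j x ()
safe⇒lattice k mc d (x ∷ a) s with restrict k x | restricted k x
safe⇒lattice k mc d (x ∷ a) (_ , s) | _ | is-bb {false} =
  unshift-at {k} {mc + d} {mc} {mc + suc d} {mc} (λ xs → cong (mc +_) (countU-miss (suc k) false xs n≢1+n)) (hit-b k mc d) (λ _ → n≢1+n)
    (safe⇒lattice k mc (suc d) a s)
safe⇒lattice k mc d (x ∷ a) (_ , s) | _ | is-bb {true} =
  unshift-at {k} {mc + d} {mc} (λ _ → refl) (λ _ → refl) (λ _ → n≢1+n) (safe⇒lattice k mc d a s)
safe⇒lattice k mc zero (x ∷ a) (n , s) | _ | is-cc = ⊥-elim (n refl)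
safe⇒lattice k mc (suc d) (x ∷ a) (n , s) | _ | is-cc {false} =
  unshift-at {k} {mc + suc d} {mc} {suc mc + d} {suc mc} (hit-c k mc) (miss-bc k mc d) (λ e → ⊥-elim (≢-plus mc n e))
    (safe⇒lattice k (suc mc) d a s)
safe⇒lattice k mc (suc d) (x ∷ a) (n , s) | _ | is-cc {true} =
  unshift-at {k} {mc + suc d} {mc} (λ _ → refl) (λ _ → refl) (λ e → ⊥-elim (≢-plus mc n e)) (safe⇒lattice k mc (suc d) a s)
safe⇒lattice k mc d (x ∷ a) (_ , s) | _ | is-no {ζ = ζ} nb nc =
  unshift-at {k} {mc + d} {mc} (λ xs → cong (mc +_) (countU-miss (suc k) ζ xs nc)) (λ xs → cong (mc + d +_) (countU-miss k ζ xs nb))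
    (λ _ → nc) (safe⇒lattice k mc d a s)

lattice⇒safe : ∀ k mc d a → Lattice-at k (mc + d) mc a → Safe k d a
lattice⇒safe k mc d [] _ = tt
lattice⇒safe k mc d (x ∷ a) L with restrict k x | restricted k x
lattice⇒safe k mc d (x ∷ a) L | _ | is-bb {false} = tt , lattice⇒safe k mc (suc d) a
  (shift-at {k} {mc + d} {mc} (λ xs → cong (mc +_) (countU-miss (suc k) false xs n≢1+n)) (hit-b k mc d) L)
lattice⇒safe k mc d (x ∷ a) L | _ | is-bb {true} = tt , lattice⇒safe k mc d a
  (shift-at {k} {mc + d} {mc} (λ _ → refl) (λ _ → refl) L)
lattice⇒safe k mc zero (x ∷ a) L | _ | is-cc = ⊥-elim (L 0 x (s≤s z≤n) (sym (+-identityʳ (mc + 0))) refl refl)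
lattice⇒safe k mc (suc d) (x ∷ a) L | _ | is-cc {false} = (λ ()) , lattice⇒safe k (suc mc) d a
  (shift-at {k} {mc + suc d} {mc} (hit-c k mc) (miss-bc k mc d) L)
lattice⇒safe k mc (suc d) (x ∷ a) L | _ | is-cc {true} = (λ ()) , lattice⇒safe k mc (suc d) a
  (shift-at {k} {mc + suc d} {mc} (λ _ → refl) (λ _ → refl) L)
lattice⇒safe k mc d (x ∷ a) L | _ | is-no {ζ = ζ} nb nc = tt , lattice⇒safe k mc d a
  (shift-at {k} {mc + d} {mc} (λ xs → cong (mc +_) (countU-miss (suc k) ζ xs nc)) (λ xs → cong (mc + d +_) (countU-miss k ζ xs nb)) L)

-- The condition on the excess at the beginning of u û, and the excess at its end.
Fits : (G : ℕ → Set) → ℕ → Walk → Set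
Fits G d (x , y) = x ≤ d × G (d ∸ x + y)

-- A letter v together with its image v̂.
data Mirror : Maybe Sym → Maybe Sym → Set where
  cb : Mirror (just (bb false)) (just (cc true))
  c₀ : Mirror (just (cc false)) nothing
  b₁ : Mirror (just (bb true)) (just (bb false))
  c₁ : Mirror (just (cc true)) (just (cc false))
  n₀ : Mirror nothing nothing
  n₁ : Mirror nothing (just (bb true))

-- Prefixing v to u appends v̂ at the far end. The predicate G stands for the condition on whatever
-- follows, which lets the induction on u work from the outside inwards. That an image such as
-- (k+1)′ needs a nonzero excess accounts for the exceptional clauses of `walk₁`.
mirror-fits : ∀ {s ŝ} (G : ℕ → Set) d σ → Mirror s ŝ →
              (Allowed s d × Fits (λ e → Allowed ŝ e × G (excess ŝ e)) (excess s d) σ → Fits G d (walkM s σ)) ×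
              (Fits G d (walkM s σ) → Allowed s d × Fits (λ e → Allowed ŝ e × G (excess ŝ e)) (excess s d) σ)
mirror-fits G d (zero , y) cb =
  (λ { (_ , _ , _ , g) → z≤n , subst G (sym (+-suc d y)) g }) ,
  (λ { (_ , g) → tt , z≤n , (λ ()) , subst G (+-suc d y) g })
mirror-fits G d (suc x , suc y) cb =
  (λ { (_ , s≤s l , _ , g) → l , g }) ,
  (λ { (l , g) → tt , s≤s l , (λ e → 1+n≢0 (trans (sym (+-suc (d ∸ x) y)) e)) , g })
mirror-fits G d (suc x , zero) cb = to , from
  where
  eq : x < d → d ∸ x + 0 ≡ d ∸ suc x + 1
  eq l = trans (+-identityʳ _) (trans (sym (suc-pred-∸ l)) (+-comm 1 (d ∸ suc x)))
    where
    suc-pred-∸ : ∀ {x d} → x < d → suc (d ∸ suc x) ≡ d ∸ x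
    suc-pred-∸ {zero} {suc d} _ = refl
    suc-pred-∸ {suc x} {suc d} (s≤s l) = suc-pred-∸ l
  to : ⊤ × suc x ≤ suc d × d ∸ x + 0 ≢ 0 × G (d ∸ x + 0) → suc x ≤ d × G (d ∸ suc x + 1)
  to (_ , s≤s l , n , g) = l' , subst G (eq l') g
    where
    l' : x < d
    l' = ≤∧≢⇒< l λ { refl → n (trans (+-identityʳ _) (n∸n≡0 x)) }
  from : suc x ≤ d × G (d ∸ suc x + 1) → ⊤ × suc x ≤ suc d × d ∸ x + 0 ≢ 0 × G (d ∸ x + 0)
  from (l , g) = tt , s≤s (<⇒≤ l) , (λ e → 1+n≢0 (trans (+-comm 1 (d ∸ suc x)) (trans (sym (eq l)) e))) , subst G (sym (eq l)) g
mirror-fits G zero (x , y) c₀ = (λ { (n , _) → ⊥-elim (n refl) }) , (λ { (() , _) })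
mirror-fits G (suc d) (x , y) c₀ = (λ { (_ , l , _ , g) → s≤s l , g }) , (λ { (s≤s l , g) → (λ ()) , l , tt , g })
mirror-fits G d (x , y) b₁ =
  (λ { (_ , l , _ , g) → l , subst G (sym (+-suc (d ∸ x) y)) g }) ,
  (λ { (l , g) → tt , l , tt , subst G (+-suc (d ∸ x) y) g })
mirror-fits G zero (zero , y) c₁ = (λ { (n , _) → ⊥-elim (n refl) }) , (λ { (() , _) })
mirror-fits G (suc d) (zero , y) c₁ = (λ { (_ , _ , _ , g) → s≤s z≤n , g }) , (λ { (_ , g) → (λ ()) , z≤n , (λ ()) , g })
mirror-fits G zero (suc x , y) c₁ = (λ { (n , _) → ⊥-elim (n refl) }) , λ f → ⊥-elim (none y f)
  where
  none : ∀ y → ¬ Fits G zero (walk₁ (cc true) (suc x , y))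
  none zero (() , _)
  none (suc y) (() , _)
mirror-fits G (suc d) (suc x , suc y) c₁ =
  (λ { (_ , l , _ , g) → l , subst (λ t → G (t ∸ 1)) (+-suc (d ∸ x) y) g }) ,
  (λ { (l , g) → (λ ()) , l , (λ e → 1+n≢0 (trans (sym (+-suc (d ∸ x) y)) e)) , subst (λ t → G (t ∸ 1)) (sym (+-suc (d ∸ x) y)) g })
mirror-fits G (suc d) (suc x , zero) c₁ =
  (λ { (_ , s≤s l , n , g) →
       let l' = ≤∧≢⇒< l (λ { refl → n (trans (+-identityʳ _) (n∸n≡0 x)) }) in s≤s l' , subst G (eq x d) g }) ,
  (λ { (s≤s l , g) → (λ ()) , s≤s (<⇒≤ l) , (λ e → m<n⇒n≢0 (m<n⇒0<n∸m l) (trans (sym (+-identityʳ _)) e)) , subst G (sym (eq x d)) g })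
  where
  eq : ∀ x d → d ∸ x + 0 ∸ 1 ≡ d ∸ suc x + 0
  eq x d = trans (cong (_∸ 1) (+-identityʳ (d ∸ x))) (trans (∸-+-assoc d x 1) (trans (cong (d ∸_) (+-comm x 1)) (sym (+-identityʳ _))))
mirror-fits G d (x , y) n₀ = (λ { (_ , l , _ , g) → l , g }) , (λ { (l , g) → tt , l , tt , g })
mirror-fits G d (x , y) n₁ = (λ { (_ , l , _ , g) → l , g }) , (λ { (l , g) → tt , l , tt , g })

mirror : ∀ k l → Mirror (restrict k l) (restrict k (hatLetter l))
mirror k (lt v false) with restrict k (lt v false) | restricted k (lt v false) | restrict k (pr (suc v)) | restricted k (pr (suc v))
... | _ | is-bb | _ | is-cc = cb
... | _ | is-bb | _ | is-no _ n = ⊥-elim (n refl)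
... | _ | is-cc | _ | is-no _ _ = c₀
... | _ | is-no _ _ | _ | is-bb = n₁
... | _ | is-no n _ | _ | is-cc = ⊥-elim (n refl)
... | _ | is-no _ _ | _ | is-no _ _ = n₀
mirror k (lt v true) with restrict k (lt v true) | restricted k (lt v true) | restrict k (unp v) | restricted k (unp v)
... | _ | is-bb | _ | is-bb = b₁
... | _ | is-bb | _ | is-no n _ = ⊥-elim (n refl)
... | _ | is-cc | _ | is-cc = c₁
... | _ | is-cc | _ | is-no _ n = ⊥-elim (n refl)
... | _ | is-no n _ | _ | is-bb = ⊥-elim (n refl)
... | _ | is-no _ n | _ | is-cc = ⊥-elim (n refl)
... | _ | is-no _ _ | _ | is-no _ _ = n₀

hat-∷ : ∀ l u R → (l ∷ u) ++ hat (l ∷ u) ++ R ≡ l ∷ (u ++ hat u ++ (hatLetter l ∷ R))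
hat-∷ l u R = cong (λ t → l ∷ (u ++ t))
  (trans (cong (_++ R) (trans (cong (map hatLetter) (unfold-reverse l u)) (map-++ hatLetter (reverse u) (l ∷ []))))
         (++-assoc (hat u) (hatLetter l ∷ []) R))

safe⇔fits : ∀ k u d R → (Safe k d (u ++ hat u ++ R) → Fits (λ e → Safe k e R) d (wordWalk k u)) ×
                        (Fits (λ e → Safe k e R) d (wordWalk k u) → Safe k d (u ++ hat u ++ R))
safe⇔fits k [] d R = (λ s → z≤n , subst (λ t → Safe k t R) (sym (+-identityʳ d)) s) ,
                     (λ { (_ , s) → subst (λ t → Safe k t R) (+-identityʳ d) s })
safe⇔fits k (l ∷ u) d R
  with mirror-fits (λ e → Safe k e R) d (wordWalk k u) (mirror k l)
     | safe⇔fits k u (excess (restrict k l) d) (hatLetter l ∷ R)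
... | to , from | to' , from' =
  (λ s → let (a , s') = subst (Safe k d) (hat-∷ l u R) s in to (a , to' s')) ,
  (λ f → let (a , f') = from f in subst (Safe k d) (sym (hat-∷ l u R)) (a , from' f'))

-- The excess is 0 at the beginning, so the requirement that it be at least the first coordinate
-- forces that coordinate to vanish.
lattice⇒walk : ∀ w → LatticeProperty w → ∀ k → 1 ≤ k → proj₁ (wordWalk k w) ≡ 0
lattice⇒walk w L k 1≤k = n≤0⇒n≡0 (proj₁ (proj₁ (safe⇔fits k w 0 [])
  (subst (λ t → Safe k 0 (w ++ t)) (sym (++-identityʳ (hat w))) (lattice⇒safe k 0 0 (w ++ hat w)
    λ j x l e → L (suc k) j x (s≤s 1≤k) l e))))

walk⇒lattice : ∀ w → (∀ k → 1 ≤ k → proj₁ (wordWalk k w) ≡ 0) → LatticeProperty w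
walk⇒lattice w h (suc k) j x (s≤s 1≤k) l e =
  safe⇒lattice k 0 0 (w ++ hat w) (subst (λ t → Safe k 0 (w ++ t)) (++-identityʳ (hat w))
    (proj₂ (safe⇔fits k w 0 []) (≤-reflexive (h k 1≤k) , tt))) j x l e

-- Walks of two-letter patterns

add : Maybe Sym → List Sym → List Sym
add (just v) w = v ∷ w
add nothing w = w

-- The letters in the columns lo + 1, …, lo + n of a row.
seg : (ℕ → Maybe Sym) → ℕ → ℕ → List Sym
seg r lo zero = []
seg r lo (suc n) = add (r (suc lo)) (seg r (suc lo) n)

seg-cong : ∀ {r r'} lo n → (∀ c → lo < c → r c ≡ r' c) → seg r lo n ≡ seg r' lo n
seg-cong lo zero f = refl
seg-cong lo (suc n) f = cong₂ add (f (suc lo) ≤-refl) (seg-cong (suc lo) n λ c l → f c (<-trans ≤-refl l))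

seg-cong-≤ : ∀ {r r'} lo n → (∀ c → lo < c → c ≤ lo + n → r c ≡ r' c) → seg r lo n ≡ seg r' lo n
seg-cong-≤ lo zero f = refl
seg-cong-≤ lo (suc n) f = cong₂ add (f (suc lo) ≤-refl (subst (suc lo ≤_) (sym (+-suc lo n)) (s≤s (m≤m+n lo n))))
  (seg-cong-≤ (suc lo) n λ c l u → f c (<-trans ≤-refl l) (subst (c ≤_) (sym (+-suc lo n)) u))

seg-nothing : ∀ lo n → seg (λ _ → nothing) lo n ≡ []
seg-nothing lo zero = refl
seg-nothing lo (suc n) = seg-nothing (suc lo) n

seg-empty : ∀ {r} lo n → (∀ c → lo < c → c ≤ lo + n → r c ≡ nothing) → seg r lo n ≡ []
seg-empty lo n f = trans (seg-cong-≤ lo n f) (seg-nothing lo n)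

add-++ : ∀ m w w' → add m (w ++ w') ≡ add m w ++ w'
add-++ (just v) w w' = refl
add-++ nothing w w' = refl

seg-split : ∀ r lo a b → seg r lo (a + b) ≡ seg r lo a ++ seg r (lo + a) b
seg-split r lo zero b = cong (λ t → seg r t b) (sym (+-identityʳ lo))
seg-split r lo (suc a) b = trans (cong (add (r (suc lo))) (trans (seg-split r (suc lo) a b)
  (cong (λ t → seg r (suc lo) a ++ seg r t b) (sym (+-suc lo a))))) (add-++ (r (suc lo)) _ _)

seg-last : ∀ r lo n → seg r lo (suc n) ≡ seg r lo n ++ add (r (suc (lo + n))) []
seg-last r lo n = trans (cong (seg r lo) (+-comm 1 n)) (seg-split r lo n 1)

walk-++ : ∀ w w' σ → walk (w ++ w') σ ≡ walk w' (walk w σ)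
walk-++ w w' σ = foldl-++ (λ τ v → walk₁ v τ) σ w w'

walk-add : ∀ m w σ → walk (add m w) σ ≡ walk w (walkM m σ)
walk-add (just v) w σ = refl
walk-add nothing w σ = refl

Pattern : Set
Pattern = Box → Maybe Sym

rowWord : Pattern → ℕ → ℕ → List Sym
rowWord G M i = seg (λ j → G (i , j)) 0 M

-- The walk of the rows i + 1, …, i + d, read from the bottom.
rowsWalk : Pattern → ℕ → ℕ → ℕ → Walk
rowsWalk G M i zero = 0 , 0
rowsWalk G M i (suc d) = walk (rowWord G M (suc i)) (rowsWalk G M (suc i) d)

rowsWalk-cong : ∀ {G G'} M i d → (∀ q → i < row q → G q ≡ G' q) → rowsWalk G M i d ≡ rowsWalk G' M i d
rowsWalk-cong M i zero f = refl
rowsWalk-cong M i (suc d) f = cong₂ walk (seg-cong 0 M λ c _ → f (suc i , c) ≤-refl)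
  (rowsWalk-cong M (suc i) d λ q l → f q (<-trans ≤-refl l))

-- Rows are read from the bottom, so walks that agree stay equal through all equal rows above. A
-- slide therefore has to be compared only in the rows that it changes.
rowsWalk-lift : ∀ {G G'} M i e d → (∀ q → row q ≤ i + e → G q ≡ G' q) →
                rowsWalk G M (i + e) d ≡ rowsWalk G' M (i + e) d →
                rowsWalk G M i (e + d) ≡ rowsWalk G' M i (e + d)
rowsWalk-lift {G} {G'} M i zero d f h = subst (λ t → rowsWalk G M t d ≡ rowsWalk G' M t d) (+-identityʳ i) h
rowsWalk-lift {G} {G'} M i (suc e) d f h = cong₂ walk
  (seg-cong 0 M λ c _ → f (suc i , c) (subst (suc i ≤_) (sym (+-suc i e)) (s≤s (m≤m+n i e))))
  (rowsWalk-lift M (suc i) e d (λ q l → f q (subst (row q ≤_) (sym (+-suc i e)) l))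
    (subst (λ t → rowsWalk G M t d ≡ rowsWalk G' M t d) (+-suc i e) h))

NoB NoC : Maybe Sym → Set
NoB m = ∀ ζ → m ≢ just (bb ζ)
NoC m = ∀ ζ → m ≢ just (cc ζ)

walkM-no-bb : ∀ m σ → NoB m → proj₂ σ ≡ 0 → proj₂ (walkM m σ) ≡ 0
walkM-no-bb (just (bb ζ)) σ n _ = ⊥-elim (n ζ refl)
walkM-no-bb (just (cc false)) σ n e = e
walkM-no-bb (just (cc true)) (zero , .0) n refl = refl
walkM-no-bb (just (cc true)) (suc x , .0) n refl = refl
walkM-no-bb nothing σ n e = e

walkM-no-cc : ∀ m σ → NoC m → proj₁ σ ≡ 0 → proj₁ (walkM m σ) ≡ 0
walkM-no-cc (just (cc ζ)) σ n _ = ⊥-elim (n ζ refl)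
walkM-no-cc (just (bb false)) (.0 , y) n refl = refl
walkM-no-cc (just (bb true)) σ n e = e
walkM-no-cc nothing σ n e = e

seg-no-bb : ∀ r lo n σ → (∀ c → NoB (r c)) → proj₂ σ ≡ 0 → proj₂ (walk (seg r lo n) σ) ≡ 0
seg-no-bb r lo zero σ f e = e
seg-no-bb r lo (suc n) σ f e rewrite walk-add (r (suc lo)) (seg r (suc lo) n) σ =
  seg-no-bb r (suc lo) n _ f (walkM-no-bb (r (suc lo)) σ (f (suc lo)) e)

seg-no-cc : ∀ r lo n σ → (∀ c → NoC (r c)) → proj₁ σ ≡ 0 → proj₁ (walk (seg r lo n) σ) ≡ 0
seg-no-cc r lo zero σ f e = e
seg-no-cc r lo (suc n) σ f e rewrite walk-add (r (suc lo)) (seg r (suc lo) n) σ =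
  seg-no-cc r (suc lo) n _ f (walkM-no-cc (r (suc lo)) σ (f (suc lo)) e)

rows-no-bb : ∀ {G} M i d → (∀ q → i < row q → NoB (G q)) → proj₂ (rowsWalk G M i d) ≡ 0
rows-no-bb M i zero f = refl
rows-no-bb {G} M i (suc d) f = seg-no-bb (λ j → G (suc i , j)) 0 M _ (λ c → f (suc i , c) ≤-refl)
  (rows-no-bb M (suc i) d λ q l → f q (<-trans ≤-refl l))

rows-no-cc : ∀ {G} M i d → (∀ q → i < row q → NoC (G q)) → proj₁ (rowsWalk G M i d) ≡ 0
rows-no-cc M i zero f = refl
rows-no-cc {G} M i (suc d) f = seg-no-cc (λ j → G (suc i , j)) 0 M _ (λ c → f (suc i , c) ≤-refl)
  (rows-no-cc M (suc i) d λ q l → f q (<-trans ≤-refl l))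

data Beside : Sym → Sym → Set where
  bc : ∀ {ζ η} → Beside (bb ζ) (cc η)
  bb : ∀ {ζ} → Beside (bb ζ) (bb false)
  cc : ∀ {ζ} → Beside (cc ζ) (cc false)

data Over : Sym → Sym → Set where
  bc : ∀ {ζ η} → Over (bb ζ) (cc η)
  bb : ∀ {η} → Over (bb true) (bb η)
  cc : ∀ {η} → Over (cc true) (cc η)

Filled : Maybe Sym → Set
Filled m = Σ Sym λ v → m ≡ just v

filled? : ∀ m → Filled m ⊎ m ≡ nothing
filled? (just v) = inj₁ (v , refl)
filled? nothing = inj₂ refl

-- A two-letter tableau with a hole z.
record Tab (G : Pattern) (z : Box) : Set where
  field
    inq    : ∀ {p v} → G p ≡ just v → InQ p
    inq-z  : InQ z
    hole   : G z ≡ nothing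
    convex : ∀ {p q r} → Filled (G p) ⊎ p ≡ z → Filled (G r) ⊎ r ≡ z → p ≼ q → q ≼ r → InQ q → q ≢ z → Filled (G q)
    beside : ∀ {i j j' u v} → j < j' → G (i , j) ≡ just u → G (i , j') ≡ just v → Beside u v
    over   : ∀ {i j u v} → G (i , j) ≡ just u → G (suc i , j) ≡ just v → Over u v
    cc-bb  : ∀ {p q ζ η} → G p ≡ just (cc ζ) → G q ≡ just (bb η) → ¬ (p ≼ q)
    diag   : ∀ {i v} → G (i , i) ≡ just v → v ≡ bb false ⊎ v ≡ cc false

-- Columns > j of the rows i and i + 1, when the box (i + 1 , j) is about to move up.
record Ahead (G : Pattern) (i j : ℕ) : Set where
  field
    up       : ∀ {c} → j < c → Filled (G (suc i , c)) → Filled (G (i , c))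
    left     : ∀ {c} → j < c → Filled (G (suc i , suc c)) → Filled (G (suc i , c))
    unprimed : ∀ {c ζ} → j < c → G (i , c) ≡ just (bb ζ) → ζ ≡ false

module _ {G z i j} (T : Tab G z) (A : Ahead G i j) where
  open Tab T
  open Ahead A

  private
    r₀ r₁ : ℕ → Maybe Sym
    r₀ c = G (i , c)
    r₁ c = G (suc i , c)

    empty-right : ∀ lo n → j < lo → r₁ lo ≡ nothing → seg r₁ lo n ≡ []
    empty-right lo zero l e = refl
    empty-right lo (suc n) l e with filled? (r₁ (suc lo))
    ... | inj₂ e' rewrite e' = empty-right (suc lo) n (<-trans l ≤-refl) e'
    ... | inj₁ f = case trans (sym e) (proj₂ (left l f)) of λ ()

    Right : ℕ → Sym → Set
    Right c v = Σ Bool λ ζ → v ≡ cc ζ × (r₀ c ≡ just (bb false) ⊎ (r₀ c ≡ just (cc true) × r₁ (suc c) ≡ nothing))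

    cell₁ : ∀ {c v} → j < c → r₁ c ≡ just v → Right c v
    cell₁ {c} l e with up l (_ , e)
    ... | u , e₀ with over e₀ e
    ...   | bb = case unprimed l e₀ of λ ()
    ...   | bc with unprimed l e₀
    ...     | refl = _ , refl , inj₁ e₀
    cell₁ {c} l e | u , e₀ | cc with filled? (r₁ (suc c))
    ... | inj₂ n = _ , refl , inj₂ (e₀ , n)
    ... | inj₁ (w , f) with up (<-trans l ≤-refl) (w , f)
    ...   | u' , e₀' with beside ≤-refl e₀ e₀'
    ...     | cc with over e₀' f
    ...       | ()

  record Stacked (lo n : ℕ) : Set where
    field
      flags  : List Bool
      right  : seg r₁ lo n ≡ map cc flags
      upper  : Stack flags (seg r₀ lo n)
      shape  : Flags flags
      strict : ∀ {u} → j < lo → r₁ lo ≡ just u → All (_≡ false) flags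

  private
    head-unprimed : ∀ {lo u ζ} → r₁ (suc lo) ≡ just (cc ζ) → j < lo → r₁ lo ≡ just u → ζ ≡ false
    head-unprimed eq l e with beside ≤-refl e eq | cell₁ l e
    ... | cc | _ = refl
    ... | bc | _ , () , _

  -- Above a letter k+1 stands an unprimed k or a (k+1)′. In the second case the run ends there: the
  -- next box would have an unprimed k+1 above a letter k+1.
  stacked : ∀ lo n → j ≤ lo → Stacked lo n
  stacked lo zero l = record { flags = [] ; right = refl ; upper = [] ; shape = [] ; strict = λ _ _ → [] }
  stacked lo (suc n) l = go (filled? (r₁ (suc lo)))
    where
    go : Filled (r₁ (suc lo)) ⊎ r₁ (suc lo) ≡ nothing → Stacked lo (suc n)
    go (inj₂ eq) = record
      { flags = [] ; right = trans (cong (λ t → add t (seg r₁ (suc lo) n)) eq) (empty-right (suc lo) n (s≤s l) eq)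
      ; upper = [] ; shape = [] ; strict = λ _ _ → [] }
    go (inj₁ (v , eq)) with cell₁ (s≤s l) eq | stacked (suc lo) n (m≤n⇒m≤1+n l)
    ... | ζ , refl , inj₁ e₀ | s = record
      { flags = ζ ∷ Stacked.flags s
      ; right = trans (cong (λ t → add t (seg r₁ (suc lo) n)) eq) (cong (cc ζ ∷_) (Stacked.right s))
      ; upper = subst (λ t → Stack (ζ ∷ Stacked.flags s) (add t (seg r₀ (suc lo) n))) (sym e₀) (ζ ∷ Stacked.upper s)
      ; shape = ζ ∷ Stacked.strict s (s≤s l) eq
      ; strict = λ l' e → head-unprimed eq l' e ∷ Stacked.strict s (s≤s l) eq }
    ... | ζ , refl , inj₂ (e₀ , n') | s = record
      { flags = ζ ∷ []
      ; right = trans (cong (λ t → add t (seg r₁ (suc lo) n)) eq) (cong (cc ζ ∷_) (tail n))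
      ; upper = subst (λ t → Stack (ζ ∷ []) (add t (seg r₀ (suc lo) n))) (sym e₀) (last ζ)
      ; shape = ζ ∷ []
      ; strict = λ l' e → head-unprimed eq l' e ∷ [] }
      where
      tail : ∀ n → seg r₁ (suc lo) n ≡ []
      tail zero = refl
      tail (suc n) = trans (cong (λ t → add t (seg r₁ (suc (suc lo)) n)) n')
        (empty-right (suc (suc lo)) n (s≤s (m≤n⇒m≤1+n l)) n')

row-at : ∀ r j n σ → walk (seg r 0 (j + suc n)) σ ≡
         walk (seg r (suc j) n) (walkM (r (suc j)) (walk (seg r 0 j) σ))
row-at r j n σ = trans (cong (λ t → walk t σ) (seg-split r 0 j (suc n)))
  (trans (walk-++ (seg r 0 j) _ σ) (walk-add (r (suc j)) (seg r (suc j) n) _))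

two-rows : ∀ {G G'} M i d → (∀ q → row q ≤ i → G q ≡ G' q) → (∀ q → suc (suc i) < row q → G q ≡ G' q) →
           (let σ = rowsWalk G M (suc (suc i)) d in
            walk (rowWord G M (suc i)) (walk (rowWord G M (suc (suc i))) σ) ≡
            walk (rowWord G' M (suc i)) (walk (rowWord G' M (suc (suc i))) σ)) →
           rowsWalk G M 0 (i + suc (suc d)) ≡ rowsWalk G' M 0 (i + suc (suc d))
two-rows {G} {G'} M i d f g h = rowsWalk-lift M 0 i (suc (suc d)) f (trans h
  (cong (λ σ → walk (rowWord G' M (suc i)) (walk (rowWord G' M (suc (suc i))) σ)) (rowsWalk-cong M (suc (suc i)) d g)))

one-row : ∀ {G G'} M i d → (∀ q → row q ≢ suc i → G q ≡ G' q) →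
          (let σ = rowsWalk G M (suc i) d in walk (rowWord G M (suc i)) σ ≡ walk (rowWord G' M (suc i)) σ) →
          rowsWalk G M 0 (i + suc d) ≡ rowsWalk G' M 0 (i + suc d)
one-row {G} {G'} M i d f h = rowsWalk-lift M 0 i (suc d) (λ q l → f q λ e → <⇒≢ (s≤s l) e)
  (trans h (cong (walk (rowWord G' M (suc i))) (rowsWalk-cong M (suc i) d λ q l → f q λ e → <⇒≢ l (sym e))))

module _ (G : Pattern) (i j n : ℕ) where

  left₀ right₀ left₁ right₁ : List Sym
  left₀ = seg (λ c → G (i , c)) 0 j
  right₀ = seg (λ c → G (i , c)) (suc j) n
  left₁ = seg (λ c → G (suc i , c)) 0 j
  right₁ = seg (λ c → G (suc i , c)) (suc j) n

  -- A letter of row i + 1 in column j + 1 moves up.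
  Lifts : Sym → Sym → Walk → Set
  Lifts v v' σ = walk right₀ (walk left₀ (walk right₁ (walk₁ v (walk left₁ σ)))) ≡
                 walk right₀ (walk₁ v' (walk left₀ (walk right₁ (walk left₁ σ))))

vertical : ∀ {G G'} i d j n {v v'} →
           (∀ q → q ≢ (suc i , suc j) → q ≢ (suc (suc i) , suc j) → G q ≡ G' q) →
           G (suc i , suc j) ≡ nothing → G' (suc i , suc j) ≡ just v' →
           G (suc (suc i) , suc j) ≡ just v → G' (suc (suc i) , suc j) ≡ nothing →
           Lifts G (suc i) j n v v' (rowsWalk G (j + suc n) (suc (suc i)) d) →
           rowsWalk G (j + suc n) 0 (i + suc (suc d)) ≡ rowsWalk G' (j + suc n) 0 (i + suc (suc d))
vertical {G} {G'} i d j n {v} {v'} f gz gz' gx gx' h =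
  two-rows (j + suc n) i d
    (λ q l → f q (λ { refl → <-irrefl refl l }) (λ { refl → <⇒≱ (n≤1+n (suc i)) l }))
    (λ q l → f q (λ { refl → <⇒≱ l (n≤1+n _) }) (λ { refl → <-irrefl refl l }))
    (trans (trans (row-at (λ c → G (suc i , c)) j n _) (cong₂ (λ m τ → walk R₀ (walkM m (walk L₀ τ))) gz
             (trans (row-at (λ c → G (suc (suc i) , c)) j n σ) (cong (λ m → walk R₁ (walkM m (walk L₁ σ))) gx))))
    (trans h
    (sym (trans (row-at (λ c → G' (suc i , c)) j n _)
      (trans (cong₂ (λ m τ → walk (right₀ G' (suc i) j n) (walkM m (walk (left₀ G' (suc i) j n) τ))) gz'
         (trans (row-at (λ c → G' (suc (suc i) , c)) j n σ) (cong (λ m → walk (right₁ G' (suc i) j n) (walkM m (walk (left₁ G' (suc i) j n) σ))) gx')))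
      (sym (lists same₁ same₂ same₃ same₄)))))))
  where
  L₀ R₀ L₁ R₁ : List Sym
  L₀ = left₀ G (suc i) j n
  R₀ = right₀ G (suc i) j n
  L₁ = left₁ G (suc i) j n
  R₁ = right₁ G (suc i) j n
  σ : Walk
  σ = rowsWalk G (j + suc n) (suc (suc i)) d
  lists : ∀ {a a' b b' c c' e e'} → a ≡ a' → b ≡ b' → c ≡ c' → e ≡ e' →
          walk a (walk₁ v' (walk b (walk c (walk e σ)))) ≡ walk a' (walk₁ v' (walk b' (walk c' (walk e' σ))))
  lists refl refl refl refl = refl
  same₁ : R₀ ≡ right₀ G' (suc i) j n
  same₁ = seg-cong (suc j) n λ c l → f _ (λ { refl → <-irrefl refl l }) (λ ())
  same₂ : L₀ ≡ left₀ G' (suc i) j n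
  same₂ = seg-cong-≤ 0 j λ c _ l → f _ (λ { refl → <-irrefl refl l }) (λ ())
  same₃ : R₁ ≡ right₁ G' (suc i) j n
  same₃ = seg-cong (suc j) n λ c l → f _ (λ ()) (λ { refl → <-irrefl refl l })
  same₄ : L₁ ≡ left₁ G' (suc i) j n
  same₄ = seg-cong-≤ 0 j λ c _ l → f _ (λ ()) (λ { refl → <-irrefl refl l })

module _ {G i j} (T : Tab G (i , suc j)) where
  open Tab T

  private
    r₀ r₁ : ℕ → Maybe Sym
    r₀ c = G (i , c)
    r₁ c = G (suc i , c)

  left-filled : ∀ {c} → Filled (r₀ c) → c < j → Filled (r₀ j)
  left-filled f l = convex (inj₁ f) (inj₂ refl) (≤-refl , <⇒≤ l) (≤-refl , n≤1+n j)
    (proj₁ inq-z , ≤-trans (proj₂ (inq (proj₂ f))) (<⇒≤ l)) (λ e → n≢1+n (cong proj₂ e))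

  left-empty : r₀ j ≡ nothing → seg r₀ 0 j ≡ []
  left-empty e = seg-empty 0 j λ c _ c≤j → none c c≤j (filled? (r₀ c))
    where
    none : ∀ c → c ≤ j → Filled (r₀ c) ⊎ r₀ c ≡ nothing → r₀ c ≡ nothing
    none c c≤j (inj₂ n) = n
    none c c≤j (inj₁ f) with m≤n⇒m<n∨m≡n c≤j
    ... | inj₂ refl = e
    ... | inj₁ l = case trans (sym e) (proj₂ (left-filled f l)) of λ ()

  lower-left : ∀ {c v} → r₁ (suc j) ≡ just v → Filled (r₀ c) → c ≤ j → suc i ≤ c → Filled (r₁ c)
  lower-left e f c≤j i<c = convex (inj₁ f) (inj₁ (_ , e)) (n≤1+n _ , ≤-refl) (≤-refl , m≤n⇒m≤1+n c≤j)
    (s≤s z≤n , i<c) (λ ())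

  -- When x stays off the diagonal, the row of the hole contains at most one letter to the left,
  -- and then this is k′ with a letter k below it.
  data Left (σ : Walk) : Set where
    empty : seg r₀ 0 j ≡ [] → Left σ
    one   : seg r₀ 0 j ≡ bb true ∷ [] → (∃ λ ζ → r₁ j ≡ just (bb ζ)) → Ascended (walk (seg r₁ 0 j) σ) → Left σ

  left-one : ∀ {σ} → r₀ j ≡ just (bb true) → (∃ λ ζ → r₁ j ≡ just (bb ζ)) → Left σ
  left-one {σ} e (ζ , e₁) = one (word j e) (ζ , e₁) (up j e₁)
    where
    word : ∀ k → r₀ k ≡ just (bb true) → seg r₀ 0 k ≡ bb true ∷ []
    word zero e = case proj₂ (inq e) of λ i≤0 → ⊥-elim (<⇒≱ (proj₁ inq-z) i≤0)
    word (suc k) e = trans (seg-last r₀ 0 k) (cong₂ _++_ (seg-empty 0 k λ c _ l → none c l (filled? (r₀ c))) (cong (λ t → add t []) e))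
      where
      none : ∀ c → c ≤ k → Filled (r₀ c) ⊎ r₀ c ≡ nothing → r₀ c ≡ nothing
      none c l (inj₂ n) = n
      none c l (inj₁ (_ , f)) with beside (s≤s l) f e
      ... | ()
    up : ∀ k → r₁ k ≡ just (bb ζ) → Ascended (walk (seg r₁ 0 k) σ)
    up zero e = case proj₂ (inq e) of λ ()
    up (suc k) e = subst Ascended (sym (trans (cong (λ t → walk t σ) (trans (seg-last r₁ 0 k) (cong (λ t → seg r₁ 0 k ++ add t []) e)))
      (walk-++ (seg r₁ 0 k) (bb ζ ∷ []) σ))) (bb-ascends ζ _)

  left-bb : ∀ {ξ} σ → r₁ (suc j) ≡ just (bb ξ) → suc i ≤ j → (∀ {p ζ} → G p ≡ just (cc ζ) → ¬ (p ≼ (i , suc j))) → Left σ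
  left-bb {ξ} σ e i<j noC with filled? (r₀ j)
  ... | inj₂ n = empty (left-empty n)
  ... | inj₁ f@(cc _ , e₀) = ⊥-elim (noC e₀ (≤-refl , n≤1+n j))
  ... | inj₁ f@(bb _ , e₀) with lower-left e f ≤-refl i<j
  ...   | cc _ , e₁ = ⊥-elim (cc-bb e₁ e (≤-refl , n≤1+n j))
  ...   | bb ζ , e₁ with over e₀ e₁
  ...     | bb = left-one e₀ (ζ , e₁)

  left-cc′ : ∀ σ → r₁ (suc j) ≡ just (cc true) → suc i ≤ j → Left σ
  left-cc′ σ e i<j with filled? (r₀ j)
  ... | inj₂ n = empty (left-empty n)
  ... | inj₁ f@(_ , e₀) with lower-left e f ≤-refl i<j
  ...   | v , e₁ with beside ≤-refl e₁ e
  ...     | bc with over e₀ e₁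
  ...       | bb = left-one e₀ (_ , e₁)

  lift-bb : ∀ {ξ} n σ → r₁ (suc j) ≡ just (bb ξ) → suc i ≤ j → (∀ {p ζ} → G p ≡ just (cc ζ) → ¬ (p ≼ (i , suc j))) →
            Ahead G i (suc j) → Lifts G i j n (bb ξ) (bb ξ) σ
  lift-bb {ξ} n σ e i<j noC A with stacked T A (suc j) n ≤-refl | left-bb σ e i<j noC
  ... | s | empty e₀ rewrite e₀ | Stacked.right s = stack-move (Stacked.shape s) (Stacked.upper s) ξ _
  ... | s | one e₀ (_ , e₁) a with beside ≤-refl e₁ e
  ...   | bb rewrite e₀ | Stacked.right s = stack-move′ (Stacked.shape s) (Stacked.upper s) _ a

  NoBelow-bb : ℕ → Set
  NoBelow-bb i = ∀ q → i < row q → NoB (G q)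

  private
    right-empty : ∀ n → (∀ c → suc j < c → r₁ c ≡ nothing) → seg r₁ (suc j) n ≡ []
    right-empty n f = seg-empty (suc j) n λ c l _ → f c l

    Reached : Walk → ℕ → Set
    Reached σ n = cost (seg r₀ i n) ≤ proj₁ (walk (seg r₁ i n) σ) ×
                  (cost (seg r₀ i n) ≡ 0 ⊎ ∃ λ c → i < c × c ≤ i + n × ∃ λ ζ → r₁ c ≡ just (cc ζ))

    cost-++ : ∀ w w' → cost (w ++ w') ≡ cost w + cost w'
    cost-++ [] w' = refl
    cost-++ (bb false ∷ w) w' = cong suc (cost-++ w w')
    cost-++ (bb true ∷ w) w' = cost-++ w w'
    cost-++ (cc false ∷ w) w' = cost-++ w w'
    cost-++ (cc true ∷ w) w' = cong suc (cost-++ w w')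

    cc-raises : ∀ ζ τ → proj₁ τ ≤ proj₁ (walk₁ (cc ζ) τ) × 1 ≤ proj₁ (walk₁ (cc ζ) τ)
    cc-raises false τ = n≤1+n _ , s≤s z≤n
    cc-raises true (zero , y) = z≤n , s≤s z≤n
    cc-raises true (suc x , zero) = n≤1+n _ , s≤s z≤n
    cc-raises true (suc x , suc y) = ≤-refl , s≤s z≤n

    module _ (e : r₁ (suc j) ≡ just (cc false)) where

      -- The letters k and (k + 1)′ to the left of the hole lie above letters k + 1.
      reached : ∀ σ n → i + n ≤ j → Reached σ n
      reached σ zero _ = z≤n , inj₁ refl
      reached σ (suc n) le = go (filled? (r₀ c)) (filled? (r₁ c)) (reached σ n (≤-trans (+-monoʳ-≤ i (n≤1+n n)) le))
        where
        c : ℕ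
        c = suc (i + n)
        c≤ : c ≤ j
        c≤ = subst (_≤ j) (+-suc i n) le
        τ : Walk
        τ = walk (seg r₁ i n) σ
        k : ℕ
        k = cost (seg r₀ i n)
        walk-last : proj₁ (walk (seg r₁ i (suc n)) σ) ≡ proj₁ (walkM (r₁ c) τ)
        walk-last = cong proj₁ (trans (cong (λ t → walk t σ) (seg-last r₁ i n))
          (trans (walk-++ (seg r₁ i n) _ σ) (walk-add (r₁ c) [] τ)))
        cost-last : cost (seg r₀ i (suc n)) ≡ k + cost (add (r₀ c) [])
        cost-last = trans (cong cost (seg-last r₀ i n)) (cost-++ (seg r₀ i n) _)
        build : ∀ {m s} → cost (add (r₀ c) []) ≡ m → proj₁ (walkM (r₁ c) τ) ≡ s → k + m ≤ s →
                (k + m ≡ 0 ⊎ ∃ λ c' → i < c' × c' ≤ i + suc n × ∃ λ ζ → r₁ c' ≡ just (cc ζ)) → Reached σ (suc n)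
        build refl refl l w = subst₂ _≤_ (sym cost-last) (sym walk-last) l ,
          (case w of λ { (inj₁ z) → inj₁ (trans cost-last z) ; (inj₂ x) → inj₂ x })
        grow : (∃ λ c' → i < c' × c' ≤ i + n × ∃ λ ζ → r₁ c' ≡ just (cc ζ)) →
               ∃ λ c' → i < c' × c' ≤ i + suc n × ∃ λ ζ → r₁ c' ≡ just (cc ζ)
        grow (c' , l , u , x) = c' , l , ≤-trans u (+-monoʳ-≤ i (n≤1+n n)) , x
        found : ∀ {ζ} → r₁ c ≡ just (cc ζ) → ∃ λ c' → i < c' × c' ≤ i + suc n × ∃ λ ζ → r₁ c' ≡ just (cc ζ)
        found e₁ = c , s≤s (m≤m+n i n) , ≤-reflexive (sym (+-suc i n)) , _ , e₁
        first : ∀ {v} → r₁ c ≡ just v → (∀ {ζ} → ¬ Beside (cc ζ) v) → Reached σ n → k ≡ 0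
        first e₁ n' (_ , inj₁ z) = z
        first e₁ n' (_ , inj₂ (c' , _ , u , ζ , e')) = ⊥-elim (n' (beside (s≤s u) e' e₁))
        go : Filled (r₀ c) ⊎ r₀ c ≡ nothing → Filled (r₁ c) ⊎ r₁ c ≡ nothing → Reached σ n → Reached σ (suc n)
        same : cost (add (r₀ c) []) ≡ 0 → Filled (r₁ c) ⊎ r₁ c ≡ nothing → Reached σ n → Reached σ (suc n)
        same z (inj₂ e₁) (l , w) = build z (cong (λ m → proj₁ (walkM m τ)) e₁) (subst (_≤ proj₁ τ) (sym (+-identityʳ k)) l)
          (case w of λ { (inj₁ k0) → inj₁ (trans (+-identityʳ k) k0) ; (inj₂ x) → inj₂ (grow x) })
        same z (inj₁ (bb ζ , e₁)) R with first e₁ (λ ()) R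
        ... | k0 = build z refl (subst (_≤ proj₁ (walkM (r₁ c) τ)) (sym (trans (+-identityʳ k) k0)) z≤n) (inj₁ (trans (+-identityʳ k) k0))
        same z (inj₁ (cc ζ , e₁)) (l , w) = build z (cong (λ m → proj₁ (walkM m τ)) e₁)
          (subst (_≤ proj₁ (walk₁ (cc ζ) τ)) (sym (+-identityʳ k)) (≤-trans l (proj₁ (cc-raises ζ τ)))) (inj₂ (found e₁))
        more : ∀ ζ → cost (add (r₀ c) []) ≡ 1 → r₁ c ≡ just (cc ζ) → Reached σ n → Reached σ (suc n)
        more false z e₁ (l , w) = build z (cong (λ m → proj₁ (walkM m τ)) e₁)
          (subst (_≤ suc (proj₁ τ)) (+-comm 1 k) (s≤s l)) (inj₂ (found e₁))
        more true z e₁ R with first e₁ (λ ()) R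
        ... | k0 = build z (cong (λ m → proj₁ (walkM m τ)) e₁)
          (subst (_≤ proj₁ (walk₁ (cc true) τ)) (cong (_+ 1) (sym k0)) (proj₂ (cc-raises true τ))) (inj₂ (found e₁))
        go (inj₂ e₀) f₁ R = same (cong (λ m → cost (add m [])) e₀) f₁ R
        go (inj₁ (u , e₀)) _ R with lower-left e (u , e₀) c≤ (s≤s (m≤m+n i n))
        ... | v , e₁ with over e₀ e₁
        go (inj₁ (bb true , e₀)) _ R | v , e₁ | _ = same (cong (λ m → cost (add m [])) e₀) (inj₁ (v , e₁)) R
        go (inj₁ (bb false , e₀)) _ R | _ , e₁ | bc = more _ (cong (λ m → cost (add m [])) e₀) e₁ R
        go (inj₁ (cc true , e₀)) _ R | _ , e₁ | cc = more _ (cong (λ m → cost (add m [])) e₀) e₁ R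

      diag-right : suc i ≤ j → Filled (r₀ i) → Filled (r₀ (suc i)) × Filled (r₁ (suc i))
      diag-right i<j f = right , lower-left e right i<j ≤-refl
        where
        right : Filled (r₀ (suc i))
        right = convex (inj₁ f) (inj₂ refl) (≤-refl , n≤1+n i) (≤-refl , m≤n⇒m≤1+n i<j) (proj₁ inq-z , n≤1+n i)
          (λ { refl → <-irrefl refl i<j })

      diag-cc : suc i ≤ j → r₀ i ≢ just (cc false)
      diag-cc i<j e₀ with diag-right i<j (_ , e₀)
      ... | (_ , a) , (_ , b) with beside ≤-refl e₀ a
      ...   | cc with over a b
      ...     | ()

      diag-bb : suc i ≤ j → r₀ i ≡ just (bb false) → NoBelow-bb i
      diag-bb i<j e₀ (r , c) l ζ eq with inq eq
      ... | _ , r≤c with diag-right i<j (_ , e₀)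
      ...   | (u , a) , (v , b) with beside ≤-refl e₀ a
      ...     | bb = case over a b of λ { bc → cc-bb b eq (l , ≤-trans l r≤c) }
      ...     | bc = cc-bb a eq (<⇒≤ l , ≤-trans l r≤c)

  -- The moving letter has to be exchanged with the letters to the left of the hole. For (k+1)′
  -- there is at most one such letter. For an unprimed k+1, `reached` shows that the row below
  -- supplies enough of the first coordinate for `cc-commutes`.
  lift-cc : ∀ {ξ} n σ → r₁ (suc j) ≡ just (cc ξ) → suc i ≤ j → (∀ c → suc j < c → r₁ c ≡ nothing) →
            (NoBelow-bb (suc i) → proj₂ σ ≡ 0) → Lifts G i j n (cc ξ) (cc ξ) σ
  lift-cc {true} n σ e i<j re _ rewrite right-empty n re with left-cc′ σ e i<j
  ... | empty e₀ rewrite e₀ = refl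
  ... | one e₀ _ a rewrite e₀ = cong (walk (seg r₀ (suc j) n)) (sym (cc-bb′ true _ a))
  lift-cc {false} n σ e i<j re low rewrite right-empty n re =
    cong (walk (seg r₀ (suc j) n)) (commute (j ∸ i) (m+[n∸m]≡n (<⇒≤ i<j)) i refl (proj₁ inq-z))
    where
    τ : Walk
    τ = walk (seg r₁ 0 j) σ
    commute : ∀ m → i + m ≡ j → ∀ i' → i' ≡ i → 1 ≤ i' →
              walk (seg r₀ 0 j) (walk₁ (cc false) τ) ≡ walk₁ (cc false) (walk (seg r₀ 0 j) τ)
    commute m im (suc i') ii _ = trans (cong (λ w → walk w (walk₁ (cc false) τ)) word)
      (trans (go (filled? (r₀ i))) (cong (λ w → walk₁ (cc false) (walk w τ)) (sym word)))
      where
      W : List Sym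
      W = seg r₀ i m
      word : seg r₀ 0 j ≡ add (r₀ i) W
      word = trans (cong (seg r₀ 0) (sym im)) (trans (seg-split r₀ 0 i m)
        (trans (cong (_++ W) (trans (cong (seg r₀ 0) (sym ii)) (trans (seg-last r₀ 0 i')
          (cong₂ _++_ (seg-empty 0 i' λ c _ l → none c l (filled? (r₀ c))) (cong (λ t → add (r₀ t) []) ii)))))
          (sym (add-++ (r₀ i) [] W))))
        where
        none : ∀ c → c ≤ i' → Filled (r₀ c) ⊎ r₀ c ≡ nothing → r₀ c ≡ nothing
        none c l (inj₂ n) = n
        none c l (inj₁ (_ , f)) = ⊥-elim (<⇒≱ (subst (c <_) ii (s≤s l)) (proj₂ (inq f)))
      bound : cost W ≤ proj₁ τ
      bound = subst (cost W ≤_) (cong proj₁ (sym τ≡)) (proj₁ (reached e σ m (≤-reflexive im)))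
        where
        τ≡ : τ ≡ walk (seg r₁ i m) σ
        τ≡ = trans (cong (λ t → walk (seg r₁ 0 t) σ) (sym im)) (trans (cong (λ t → walk t σ) (seg-split r₁ 0 i m))
          (trans (walk-++ (seg r₁ 0 i) _ σ) (cong (λ t → walk (seg r₁ i m) (walk t σ)) (seg-empty 0 i λ c _ l → none c l (filled? (r₁ c))))))
          where
          none : ∀ c → c ≤ i → Filled (r₁ c) ⊎ r₁ c ≡ nothing → r₁ c ≡ nothing
          none c l (inj₂ n) = n
          none c l (inj₁ (_ , f)) = ⊥-elim (<⇒≱ (s≤s l) (proj₂ (inq f)))
      go : Filled (r₀ i) ⊎ r₀ i ≡ nothing →
           walk (add (r₀ i) W) (walk₁ (cc false) τ) ≡ walk₁ (cc false) (walk (add (r₀ i) W) τ)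
      go (inj₂ n) rewrite n = cc-commutes W τ bound
      -- The diagonal letter has nothing below it and escapes `reached`. If it is k, no k lies
      -- below, the second coordinate is 0, and then the step of k leaves the first coordinate
      -- alone.
      go (inj₁ (v , eq)) with diag eq
      ... | inj₂ refl = ⊥-elim (diag-cc e i<j eq)
      ... | inj₁ refl = trans (cong (λ t → walk (add t W) (walk₁ (cc false) τ)) eq)
        (trans (subst (λ ρ → walk (bb false ∷ W) (walk₁ (cc false) ρ) ≡ walk₁ (cc false) (walk (bb false ∷ W) ρ))
                  (cong (proj₁ τ ,_) (sym flat)) (cc-commutes-at-0 W (proj₁ τ) bound))
               (cong (λ t → walk₁ (cc false) (walk (add t W) τ)) (sym eq)))
        where
        nb : NoBelow-bb i
        nb = diag-bb e i<j eq
        flat : proj₂ τ ≡ 0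
        flat = seg-no-bb r₁ 0 j σ (λ c → nb (suc i , c) ≤-refl) (low λ q l → nb q (<-trans ≤-refl l))

horizontal : ∀ {G G'} i d j n {v v'} →
             (∀ q → q ≢ (suc i , suc j) → q ≢ (suc i , suc (suc j)) → G q ≡ G' q) →
             G (suc i , suc j) ≡ nothing → G' (suc i , suc j) ≡ just v' →
             G (suc i , suc (suc j)) ≡ just v → G' (suc i , suc (suc j)) ≡ nothing →
             (let τ = walk (left₀ G (suc i) j n) (rowsWalk G (j + suc (suc n)) (suc i) d) in walk₁ v τ ≡ walk₁ v' τ) →
             rowsWalk G (j + suc (suc n)) 0 (i + suc d) ≡ rowsWalk G' (j + suc (suc n)) 0 (i + suc d)
horizontal {G} {G'} i d j n {v} {v'} f gz gz' gx gx' h =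
  one-row (j + suc (suc n)) i d
    (λ q l → f q (λ { refl → l refl }) (λ { refl → l refl }))
    (trans (row-at (λ c → G (suc i , c)) j (suc n) σ)
    (trans (cong (λ m → walk (seg (λ c → G (suc i , c)) (suc j) (suc n)) (walkM m τ)) gz)
    (trans (cong (λ m → walk (add m R) τ) gx)
    (trans (cong (walk R) h)
    (sym (trans (row-at (λ c → G' (suc i , c)) j (suc n) σ)
    (trans (cong (λ m → walk (seg (λ c → G' (suc i , c)) (suc j) (suc n)) (walkM m (walk (left₀ G' (suc i) j n) σ))) gz')
    (trans (cong (λ m → walk (add m R') (walk₁ v' (walk (left₀ G' (suc i) j n) σ))) gx')
           (cong₂ (λ a b → walk a (walk₁ v' (walk b σ))) (sym same₁) (sym same₂))))))))))
  where
  σ τ : Walk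
  σ = rowsWalk G (j + suc (suc n)) (suc i) d
  τ = walk (left₀ G (suc i) j n) σ
  R R' : List Sym
  R = seg (λ c → G (suc i , c)) (suc (suc j)) n
  R' = seg (λ c → G' (suc i , c)) (suc (suc j)) n
  same₁ : R ≡ R'
  same₁ = seg-cong (suc (suc j)) n λ c l → f _ (λ { refl → <⇒≱ l (n≤1+n _) }) (λ { refl → <-irrefl refl l })
  same₂ : left₀ G (suc i) j n ≡ left₀ G' (suc i) j n
  same₂ = seg-cong-≤ 0 j λ c _ l → f _ (λ { refl → <-irrefl refl l }) (λ { refl → <⇒≱ (n≤1+n (suc j)) l })

-- Holes next to the diagonal

module _ {G z} (T : Tab G z) where
  open Tab T

  below-diag-empty : ∀ i j → j < i → seg (λ c → G (i , c)) 0 j ≡ []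
  below-diag-empty i j l = seg-empty 0 j λ c _ c≤ → none c c≤ (filled? (G (i , c)))
    where
    none : ∀ c → c ≤ j → Filled (G (i , c)) ⊎ G (i , c) ≡ nothing → G (i , c) ≡ nothing
    none c c≤ (inj₂ n) = n
    none c c≤ (inj₁ (_ , f)) = ⊥-elim (<⇒≱ (≤-<-trans c≤ l) (proj₂ (inq f)))

  module _ {i d v} (e : G (suc i , suc i) ≡ just d) (z-above : row z ≤ i) {p} (f : G p ≡ just v) (below : suc i < row p) where

      private
        p-inq : InQ p
        p-inq = inq f
        r≢ : ∀ {r} → i < r → r ≢ row z
        r≢ l refl = <⇒≱ l z-above
        next : Filled (G (suc (suc i) , suc (suc i)))
        next = convex (inj₁ (_ , e)) (inj₁ (_ , f)) (n≤1+n _ , n≤1+n _) (below , ≤-trans below (proj₂ p-inq)) (s≤s z≤n , ≤-refl)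
          (λ eq → r≢ (s≤s (n≤1+n i)) (cong row eq))
        above : Filled (G (suc i , suc (suc i)))
        above = convex (inj₁ (_ , e)) (inj₁ next) (≤-refl , n≤1+n _) (n≤1+n _ , ≤-refl) (s≤s z≤n , n≤1+n _)
          (λ eq → r≢ ≤-refl (cong row eq))

      next-diag : Filled (G (suc (suc i) , suc (suc i)))
      next-diag = next

      -- By convexity the next diagonal box and the box above it are occupied. Both would have to
      -- contain k or k′; but beside the diagonal k only an unprimed k can stand, and it cannot
      -- stand over another letter of the strip.
      no-bb-below : d ≡ bb false → ∀ ζ → v ≢ bb ζ
      no-bb-below refl ζ refl with next | above
      ... | cc _ , a | _ = cc-bb a f (below , ≤-trans below (proj₂ p-inq))
      ... | bb _ , a | cc _ , b = cc-bb b a (n≤1+n _ , ≤-refl)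
      ... | bb _ , a | bb _ , b with beside ≤-refl e b
      ...   | bb with over b a
      ...     | ()

      no-cc-below : d ≡ cc false → ∀ ζ → v ≢ cc ζ
      no-cc-below refl ζ refl with next | above
      ... | bb _ , a | _ = cc-bb e a (n≤1+n _ , n≤1+n _)
      ... | cc _ , a | bb _ , b = cc-bb e b (≤-refl , n≤1+n _)
      ... | cc _ , a | cc _ , b with beside ≤-refl e b
      ...   | cc with over b a
      ...     | ()

  module _ {i} (z-above : row z ≤ i) where

    rows-bb : ∀ M d → G (suc i , suc i) ≡ just (bb false) → proj₂ (rowsWalk G M (suc i) d) ≡ 0
    rows-bb M d e = rows-no-bb M (suc i) d λ q l ζ f →
      no-bb-below e z-above f l refl ζ refl

    rows-cc : ∀ M d → G (suc i , suc i) ≡ just (cc false) → proj₁ (rowsWalk G M (suc i) d) ≡ 0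
    rows-cc M d e = rows-no-cc M (suc i) d λ q l ζ f →
      no-cc-below e z-above f l refl ζ refl

    rows-cc-bb : ∀ M d → G (suc i , suc i) ≡ just (cc false) → proj₂ (rowsWalk G M (suc i) d) ≡ 0
    rows-cc-bb M d e = rows-no-bb M (suc i) d λ q l ζ f → cc-bb e f (<⇒≤ l , ≤-trans (<⇒≤ l) (proj₂ (inq f)))

-- The hole (i , i + 1) is filled from the diagonal box below it.
module _ {G i} (T : Tab G (i , suc i)) where
  open Tab T

  private
    1≤i : 1 ≤ i
    1≤i = proj₁ inq-z
    L₁ : seg (λ c → G (suc i , c)) 0 i ≡ []
    L₁ = below-diag-empty T (suc i) i ≤-refl

  -- The prime ξ may change here as in (S2′) and (S6′). No letter of the k-strip lies below, so the
  -- second coordinate is 0, where k and k′ make the same step. In `enter-cc` the first coordinate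
  -- plays this part.
  enter-bb : ∀ n M d ξ → G (suc i , suc i) ≡ just (bb false) → G (i , i) ≡ nothing → Ahead G i (suc i) →
             Lifts G i i n (bb false) (bb ξ) (rowsWalk G M (suc i) d)
  enter-bb n M d ξ e w A with stacked T A (suc i) n ≤-refl
  ... | s rewrite L₁ | left-empty T w | Stacked.right s =
    stack-bb-at-0 (Stacked.shape s) (Stacked.upper s) false ξ _ (rows-bb T ≤-refl M d e)

  enter-cc : ∀ n M d ξ → G (suc i , suc i) ≡ just (cc false) → (∀ ζ → G (i , i) ≢ just (cc ζ)) →
             (∀ c → suc i < c → G (suc i , c) ≡ nothing) → Lifts G i i n (cc false) (cc ξ) (rowsWalk G M (suc i) d)
  enter-cc n M d ξ e w re
    rewrite L₁ | seg-empty {λ c → G (suc i , c)} (suc i) n (λ c l _ → re c l) = cong (walk (right₀ G i i n)) (go (filled? (G (i , i))))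
    where
    σ : Walk
    σ = rowsWalk G M (suc i) d
    go : Filled (G (i , i)) ⊎ G (i , i) ≡ nothing →
         walk (left₀ G i i n) (walk₁ (cc false) σ) ≡ walk₁ (cc ξ) (walk (left₀ G i i n) σ)
    go (inj₂ e₀) rewrite left-empty T e₀ = cc-free false ξ σ (rows-cc T ≤-refl M d e)
    go (inj₁ (v , e₀)) with diag e₀
    ... | inj₂ refl = ⊥-elim (w false e₀)
    ... | inj₁ refl = trans (cong₂ (λ w' ρ → walk w' (walk₁ (cc false) ρ)) word origin)
                      (trans (value ξ) (sym (cong₂ (λ w' ρ → walk₁ (cc ξ) (walk w' ρ)) word origin)))
      where
      origin : σ ≡ (0 , 0)
      origin = cong₂ _,_ (rows-cc T ≤-refl M d e) (rows-cc-bb T ≤-refl M d e)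
      word : left₀ G i i n ≡ bb false ∷ []
      word = diag-word i refl 1≤i
        where
        diag-word : ∀ i' → i' ≡ i → 1 ≤ i' → seg (λ c → G (i , c)) 0 i ≡ bb false ∷ []
        diag-word (suc i') refl _ = trans (seg-last (λ c → G (i , c)) 0 i')
          (cong₂ _++_ (below-diag-empty T i i' ≤-refl) (cong (λ m → add m []) e₀))
      value : ∀ ξ → walk₁ (bb false) (walk₁ (cc false) (0 , 0)) ≡ walk₁ (cc ξ) (walk₁ (bb false) (0 , 0))
      value false = refl
      value true = refl

-- The hole (i , i) is filled from (i , i + 1).
module _ {G i} (T : Tab G (i , i)) where
  open Tab T

  private
    1≤i : 1 ≤ i
    1≤i = proj₁ inq-z

    corner : ∀ {v p} → G (i , suc i) ≡ just v → Filled (G p) → i < row p → Filled (G (suc i , suc i))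
    corner e f l = convex (inj₁ (_ , e)) (inj₁ f) (n≤1+n i , ≤-refl) (l , ≤-trans l (proj₂ (inq (proj₂ f)))) (s≤s z≤n , ≤-refl) (λ ())

  -- A k or k′ below row i would force the corner (i+1, i+1) to be occupied: by a letter of the
  -- k-strip, which is excluded, or by a k+1, which cannot lie north-west of it. So the second
  -- coordinate is 0 and the prime is immaterial.
  leave-bb : ∀ M d ξ → G (i , suc i) ≡ just (bb ξ) → NoB (G (suc i , suc i)) →
             walk₁ (bb ξ) (rowsWalk G M i d) ≡ walk₁ (bb false) (rowsWalk G M i d)
  leave-bb M d ξ e n = bb-free ξ false _ (rows-no-bb M i d none)
    where
    none : ∀ q → i < row q → NoB (G q)
    none q l ζ f with corner e (_ , f) l
    ... | bb η , e' = n η e'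
    ... | cc η , e' = cc-bb e' f (l , ≤-trans l (proj₂ (inq f)))

  leave-cc : ∀ M d ξ → G (i , suc i) ≡ just (cc ξ) → NoC (G (suc i , suc i)) →
             walk₁ (cc ξ) (rowsWalk G M i d) ≡ walk₁ (cc false) (rowsWalk G M i d)
  leave-cc M d ξ e n = cc-free ξ false _ (rows-no-cc M i d none)
    where
    none : ∀ q → i < row q → NoC (G q)
    none q l ζ f with corner e (_ , f) l
    ... | cc η , e' = n η e'
    ... | bb η , e' = cc-bb e e' (n≤1+n i , ≤-refl)

  -- The two rows of a switch (S3), before and after, up to their common right part.
  S3-bb : ∀ M d n → suc i + n ≡ M → (∀ {p v} → G p ≡ just v → col p ≤ M) →
          G (i , suc i) ≡ just (bb true) → G (suc i , suc i) ≡ just (bb false) → (let σ = rowsWalk G M (suc i) d in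
          walk (right₀ G i i n) (walk₁ (bb true) (walk (right₁ G i i n) (walk₁ (bb false) σ))) ≡
          walk (right₀ G i i n) (walk₁ (bb false) (walk₁ (bb false) (walk (right₁ G i i n) σ))))
  S3-bb M d n Mn bound ea ed = go (filled? (G (suc (suc i) , suc (suc i)))) (stacked T A (suc i) n ≤-refl)
    where
    A : Ahead G i (suc i)
    A = record
      { up = λ l f → convex (inj₁ (_ , ea)) (inj₁ f) (≤-refl , <⇒≤ l) (n≤1+n i , ≤-refl)
                       (1≤i , ≤-trans (n≤1+n i) (<⇒≤ l)) (λ { refl → <⇒≱ l (n≤1+n _) })
      ; left = λ l f → convex (inj₁ (_ , ed)) (inj₁ f) (≤-refl , <⇒≤ l) (≤-refl , n≤1+n _) (s≤s z≤n , <⇒≤ l) (λ ())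
      ; unprimed = λ l e → case beside l ea e of λ { bb → refl } }
    σ : Walk
    σ = rowsWalk G M (suc i) d
    flat : proj₂ σ ≡ 0
    flat = rows-bb T ≤-refl M d ed
    Goal : Walk → Set
    Goal σ = walk (right₀ G i i n) (walk₁ (bb true) (walk (right₁ G i i n) (walk₁ (bb false) σ))) ≡
             walk (right₀ G i i n) (walk₁ (bb false) (walk₁ (bb false) (walk (right₁ G i i n) σ)))
    -- If (i+2, i+2) is empty, so are all rows from there on, and the walk starts at (0, 0).
    -- Otherwise it contains k+1 with a (k+1)′ above it. This (k+1)′ is the first letter to the
    -- right in row i+1 and makes the two sides agree for a positive first coordinate.
    go : Filled (G (suc (suc i) , suc (suc i))) ⊎ G (suc (suc i) , suc (suc i)) ≡ nothing → Stacked T A (suc i) n → Goal σ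
    go (inj₂ none) s = subst Goal (sym (cong₂ _,_ (rows-no-cc M (suc i) d λ q l ζ f → vacant f l) flat)) at-0
      where
      vacant : ∀ {q v} → G q ≡ just v → ¬ (suc i < row q)
      vacant f l = case trans (sym none) (proj₂ (next-diag T ed ≤-refl f l)) of λ ()
      at-0 : Goal (0 , 0)
      at-0 rewrite Stacked.right s = stack-S3-0 (Stacked.shape s) (Stacked.upper s)
    go (inj₁ (v , e)) s = subst Goal (cong (proj₁ σ ,_) (sym flat)) (at (proj₁ σ))
      where
      above : Filled (G (suc i , suc (suc i)))
      above = convex (inj₁ (_ , ed)) (inj₁ (_ , e)) (≤-refl , n≤1+n _) (n≤1+n _ , ≤-refl) (s≤s z≤n , n≤1+n _) (λ ())
      v≡ : v ≡ cc false
      v≡ with diag e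
      ... | inj₂ c = c
      ... | inj₁ refl = ⊥-elim (no-bb-below T ed ≤-refl e ≤-refl refl false refl)
      start : ∀ n → suc i + n ≡ M → ∀ {fl} → seg (λ c → G (suc i , c)) (suc i) n ≡ map cc fl → Flags fl →
              ∃ λ R → fl ≡ true ∷ R × All (_≡ false) R
      start zero eq _ _ = ⊥-elim (<⇒≱ ≤-refl (subst (suc (suc i) ≤_) (trans (sym eq) (+-identityʳ (suc i))) (bound e)))
      start (suc n) eq {fl} r sh with proj₁ above | proj₂ above
      ... | u | eu with over eu (trans e (cong just v≡)) | trans (cong (λ m → add m (seg (λ c → G (suc i , c)) (suc (suc i)) n)) (sym eu)) r
      start (suc n) eq {ζ ∷ R} r (ζ ∷ fs) | .(cc true) | eu | cc | r' = R , cong (_∷ R) (head r') , fs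
        where
        head : ∀ {w w' : List Sym} → _≡_ {A = List Sym} (cc true ∷ w) (cc ζ ∷ w') → ζ ≡ true
        head refl = refl
      start (suc n) eq {ζ ∷ R} r (ζ ∷ fs) | .(bb _) | eu | bc | ()
      at : ∀ x → Goal (x , 0)
      at zero rewrite Stacked.right s = stack-S3-0 (Stacked.shape s) (Stacked.upper s)
      at (suc x) with start n Mn (Stacked.right s) (Stacked.shape s)
      ... | R , eq , fs rewrite trans (Stacked.right s) (cong (map cc) eq) = stack-S3-1 {R' = right₀ G i i n} fs x

  S3-cc : ∀ M d n → G (i , suc i) ≡ just (cc true) → G (suc i , suc i) ≡ just (cc false) → (let σ = rowsWalk G M (suc i) d in
          walk (right₀ G i i n) (walk₁ (cc true) (walk (right₁ G i i n) (walk₁ (cc false) σ))) ≡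
          walk (right₀ G i i n) (walk₁ (cc false) (walk₁ (cc false) (walk (right₁ G i i n) σ))))
  S3-cc M d n ea ed =
    trans (cong₂ (λ w τ → walk (right₀ G i i n) (walk₁ (cc true) (walk w (walk₁ (cc false) τ)))) free origin)
          (sym (cong₂ (λ w τ → walk (right₀ G i i n) (walk₁ (cc false) (walk₁ (cc false) (walk w τ)))) free origin))
    where
    none : ∀ c → suc i < c → Filled (G (suc i , c)) ⊎ G (suc i , c) ≡ nothing → G (suc i , c) ≡ nothing
    none c l (inj₂ n) = n
    none c l (inj₁ (v , f)) with convex {q = i , c} (inj₁ (_ , ea)) (inj₁ (_ , f)) (≤-refl , <⇒≤ l) (n≤1+n i , ≤-refl)
                                   (1≤i , ≤-trans (n≤1+n i) (<⇒≤ l)) (λ { refl → <⇒≱ l (n≤1+n _) })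
    ... | u , e with beside l ea e
    ...   | cc with over e f
    ...     | ()
    free : right₁ G i i n ≡ []
    free = seg-empty (suc i) n λ c l _ → none c l (filled? (G (suc i , c)))
    origin : rowsWalk G M (suc i) d ≡ (0 , 0)
    origin = cong₂ _,_ (rows-cc T ≤-refl M d ed) (rows-cc-bb T ≤-refl M d ed)

-- A hole sliding through two strips

-- The two strips that the hole traverses one after the other.
data Phase : Set where
  𝐁 𝐂 : Phase

tag opp : Phase → Bool → Sym
tag 𝐁 = bb
tag 𝐂 = cc
opp 𝐁 = cc
opp 𝐂 = bb

tag-inj : ∀ ph {ζ η} → tag ph ζ ≡ tag ph η → ζ ≡ η
tag-inj 𝐁 refl = refl
tag-inj 𝐂 refl = refl

tag≢opp : ∀ ph {ζ η} → tag ph ζ ≢ opp ph η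
tag≢opp 𝐁 ()
tag≢opp 𝐂 ()

front back : Phase → List Marked → List Marked
front 𝐁 O = []
front 𝐂 O = O
back 𝐁 O = O
back 𝐂 O = []

chain-convex : ∀ {K L e f q} → Ideal K → Chain K L → e ∈ L → f ∈ L → pos e ≼ q → q ≼ pos f → InQ q →
               Σ Bool λ ζ → (q , ζ) ∈ L
chain-convex {K} {L} {e} {f} {q} ideal ch me mf le lf inq = inside (⊕-∈⁻ {K} (reverse L) (down idealL inq (proj₁ (chain-∉ ch mf)) lf (⊕-∈ {K} (Any-reverse⁺ mf))))
  where
  idealL : Ideal (K ⊕ reverse L)
  idealL = ideal-⊕ ideal (proj₁ (unzip (reverse L) {[]} (subst (Chain K) (sym (trans (reverse-ʳ++ L []) (++-identityʳ L))) ch)))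

  inside : K q ⊎ Σ Bool (λ ζ → (q , ζ) ∈ reverse L) → Σ Bool λ ζ → (q , ζ) ∈ L
  inside (inj₁ k) = ⊥-elim (proj₂ (chain-∉ ch me) (down ideal (proj₁ (chain-∉ ch me)) inq le k))
  inside (inj₂ (ζ , m)) = ζ , Any-reverse⁻ m

put : Box → Maybe Sym → Pattern → Pattern
put p m G q = if does (q ≟B p) then m else G q

put-same : ∀ p m G → put p m G p ≡ m
put-same p m G rewrite dec-true (p ≟B p) refl = refl

put-other : ∀ p m G {q} → q ≢ p → put p m G q ≡ G q
put-other p m G {q} n rewrite dec-false (q ≟B p) n = refl

fill : Box → Sym → Box → Pattern → Pattern
fill z v x G = put z (just v) (put x nothing G)

fill-z : ∀ z v x G → fill z v x G z ≡ just v
fill-z z v x G = put-same z (just v) (put x nothing G)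

fill-x : ∀ z v x G → x ≢ z → fill z v x G x ≡ nothing
fill-x z v x G n = trans (put-other z (just v) (put x nothing G) n) (put-same x nothing G)

fill-other : ∀ z v x G {q} → q ≢ z → q ≢ x → fill z v x G q ≡ G q
fill-other z v x G nz nx = trans (put-other z (just v) (put x nothing G) nz) (put-other x nothing G nx)

-- The hole z has passed P₁ (in reverse order), and P₂ is still ahead; O is the other strip.
record Mid (ph : Phase) (M : ℕ) (K : Region) (O : List Marked) (z : Marked) (P₁ P₂ : List Marked) (G : Pattern) : Set where
  field
    ideal  : Ideal K
    chain  : Chain K (front ph O ++ (P₁ ʳ++ (z ∷ P₂ ++ back ph O)))
    pwP    : AllPairs PW (P₁ ʳ++ P₂)
    pwO    : AllPairs PW O
    dP     : All Diag0 (P₁ ʳ++ P₂)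
    dO     : All Diag0 O
    soundP : ∀ {p ζ} → G p ≡ just (tag ph ζ) → (p , ζ) ∈ P₁ ⊎ (p , ζ) ∈ P₂
    coverP : ∀ {p ζ} → (p , ζ) ∈ P₁ ⊎ (p , ζ) ∈ P₂ → G p ≡ just (tag ph ζ)
    soundO : ∀ {p ζ} → G p ≡ just (opp ph ζ) → (p , ζ) ∈ O
    coverO : ∀ {p ζ} → (p , ζ) ∈ O → G p ≡ just (opp ph ζ)
    bound  : ∀ {p v} → G p ≡ just v → row p ≤ M × col p ≤ M

  private
    line : List Marked
    line = front ph O ++ (P₁ ʳ++ (z ∷ P₂ ++ back ph O))

    split : ∀ ph → AllPairs Later (front ph O ++ (P₁ ʳ++ (z ∷ P₂ ++ back ph O))) →
            (∀ {e} → e ∈ P₁ → Later e z) × (∀ {e} → e ∈ P₂ → Later z e) × AllPairs Later (P₁ ʳ++ P₂) × AllPairs Later O ×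
            (∀ {e o} → ph ≡ 𝐁 → e ∈ P₁ ⊎ e ∈ P₂ → o ∈ O → Later e o) × (∀ {o} → ph ≡ 𝐁 → o ∈ O → Later z o) ×
            (∀ {e o} → ph ≡ 𝐂 → e ∈ P₁ ⊎ e ∈ P₂ → o ∈ O → Later o e) × (∀ {o} → ph ≡ 𝐂 → o ∈ O → Later o z)
    split 𝐁 a with pairs-++⁻ (reverse P₁) (subst (AllPairs Later) (ʳ++-defn P₁) a)
    ... | a₁ , (z< ∷ a₂) , c with pairs-++⁻ P₂ a₂
    ...   | a₃ , a₄ , c' =
      (λ m → c (Any-reverse⁺ m) (here refl)) , (λ m → All.lookup z< (∈-++⁺ˡ m)) ,
      subst (AllPairs Later) (sym (ʳ++-defn P₁)) (AllPairs.++⁺ a₁ a₃ (All.tabulate λ m → All.tabulate λ m' → c m (there (∈-++⁺ˡ m')))) , a₄ ,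
      (λ { _ (inj₁ m) m' → c (Any-reverse⁺ m) (there (∈-++⁺ʳ P₂ m')) ; _ (inj₂ m) m' → c' m m' }) ,
      (λ _ m → All.lookup z< (∈-++⁺ʳ P₂ m)) , (λ ()) , (λ ())
    split 𝐂 a with pairs-++⁻ O a
    ... | aO , a' , cO with pairs-++⁻ (reverse P₁) (subst (AllPairs Later) (ʳ++-defn P₁) a')
    ...   | a₁ , (z< ∷ a₂) , c =
      (λ m → c (Any-reverse⁺ m) (here refl)) , (λ m → All.lookup z< (∈-++⁺ˡ m)) ,
      subst (AllPairs Later) (sym (ʳ++-defn P₁)) (AllPairs.++⁺ a₁ (subst (AllPairs Later) (++-identityʳ P₂) a₂)
        (All.tabulate λ m → All.tabulate λ m' → c m (there (∈-++⁺ˡ m')))) , aO ,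
      (λ ()) , (λ ()) ,
      (λ { _ (inj₁ m) m' → cO m' (∈-ʳ++⁺ˡ P₁ m) ; _ (inj₂ m) m' → cO m' (∈-ʳ++⁺ʳ P₁ (there (∈-++⁺ˡ m))) }) ,
      (λ _ m → cO m (∈-ʳ++⁺ʳ P₁ (here refl)))

    parts : _
    parts = split ph (chain-later ideal chain)

  behind : ∀ {e} → e ∈ P₁ → ¬ (pos z ≼ pos e)
  behind = proj₁ parts

  ahead : ∀ {e} → e ∈ P₂ → ¬ (pos e ≼ pos z)
  ahead = proj₁ (proj₂ parts)

  laterP : AllPairs Later (P₁ ʳ++ P₂)
  laterP = proj₁ (proj₂ (proj₂ parts))

  laterO : AllPairs Later O
  laterO = proj₁ (proj₂ (proj₂ (proj₂ parts)))

  crossB : ∀ {e o} → ph ≡ 𝐁 → e ∈ P₁ ⊎ e ∈ P₂ → o ∈ O → Later e o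
  crossB = proj₁ (proj₂ (proj₂ (proj₂ (proj₂ parts))))

  crossBz : ∀ {o} → ph ≡ 𝐁 → o ∈ O → ¬ (pos o ≼ pos z)
  crossBz = proj₁ (proj₂ (proj₂ (proj₂ (proj₂ (proj₂ parts)))))

  crossC : ∀ {e o} → ph ≡ 𝐂 → e ∈ P₁ ⊎ e ∈ P₂ → o ∈ O → Later o e
  crossC = proj₁ (proj₂ (proj₂ (proj₂ (proj₂ (proj₂ (proj₂ parts))))))

  crossCz : ∀ {o} → ph ≡ 𝐂 → o ∈ O → ¬ (pos z ≼ pos o)
  crossCz = proj₂ (proj₂ (proj₂ (proj₂ (proj₂ (proj₂ (proj₂ parts))))))

  private
    toLine : ∀ {e} → e ∈ P₁ ⊎ e ∈ P₂ → e ∈ line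
    toLine (inj₁ m) = ∈-++⁺ʳ (front ph O) (∈-ʳ++⁺ˡ P₁ m)
    toLine (inj₂ m) = ∈-++⁺ʳ (front ph O) (∈-ʳ++⁺ʳ P₁ (there (∈-++⁺ˡ m)))

    O-line : ∀ ph {e} → e ∈ O → e ∈ front ph O ++ (P₁ ʳ++ (z ∷ P₂ ++ back ph O))
    O-line 𝐁 m = ∈-ʳ++⁺ʳ P₁ (there (∈-++⁺ʳ P₂ m))
    O-line 𝐂 m = ∈-++⁺ˡ m

    z-line : z ∈ line
    z-line = ∈-++⁺ʳ (front ph O) (∈-ʳ++⁺ʳ P₁ (here refl))

    front⊆ : ∀ ph {e} → e ∈ front ph O ⊎ e ∈ back ph O → e ∈ O
    front⊆ 𝐁 (inj₂ m) = m
    front⊆ 𝐂 (inj₁ m) = m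

    fromLine : ∀ {q ζ} → (q , ζ) ∈ line → q ≢ pos z → Filled (G q)
    fromLine m n with ∈-++⁻ (front ph O) m
    ... | inj₁ m' = _ , coverO (front⊆ ph (inj₁ m'))
    ... | inj₂ m' with ∈-ʳ++⁻ P₁ m'
    ...   | inj₁ m″ = _ , coverP (inj₁ m″)
    ...   | inj₂ (here refl) = ⊥-elim (n refl)
    ...   | inj₂ (there m″) with ∈-++⁻ P₂ m″
    ...     | inj₁ i = _ , coverP (inj₂ i)
    ...     | inj₂ i = _ , coverO (front⊆ ph (inj₂ i))

    data Kind (p : Box) : Sym → Set where
      isP : ∀ {ζ} → (p , ζ) ∈ P₁ ⊎ (p , ζ) ∈ P₂ → Kind p (tag ph ζ)
      isO : ∀ {ζ} → (p , ζ) ∈ O → Kind p (opp ph ζ)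

    kind : ∀ {p} v → G p ≡ just v → Kind p v
    kind v e = go ph refl v e
      where
      go : ∀ ph' → ph ≡ ph' → ∀ {p} v → G p ≡ just v → Kind p v
      go 𝐁 refl (bb ζ) e = isP (soundP e)
      go 𝐁 refl (cc ζ) e = isO (soundO e)
      go 𝐂 refl (cc ζ) e = isP (soundP e)
      go 𝐂 refl (bb ζ) e = isO (soundO e)

    onLine : ∀ {p v} → G p ≡ just v → Σ Bool λ ζ → (p , ζ) ∈ line
    onLine {v = v} e with kind v e
    ... | isP m = _ , toLine m
    ... | isO m = _ , O-line ph m

    onLine′ : ∀ {p} → Filled (G p) ⊎ p ≡ pos z → Σ Bool λ ζ → (p , ζ) ∈ line
    onLine′ (inj₁ (_ , e)) = onLine e
    onLine′ (inj₂ refl) = mark z , z-line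

  inP : ∀ {e} → e ∈ P₁ ⊎ e ∈ P₂ → e ∈ P₁ ʳ++ P₂
  inP (inj₁ m) = ∈-ʳ++⁺ˡ P₁ m
  inP (inj₂ m) = ∈-ʳ++⁺ʳ P₁ m

  data Order (p q : Box) : Sym → Sym → Set where
    bc  : ∀ {ζ η} → Order p q (bb ζ) (cc η)
    bb  : ∀ {ζ η} → PW (p , ζ) (q , η) → Order p q (bb ζ) (bb η)
    cc  : ∀ {ζ η} → PW (p , ζ) (q , η) → Order p q (cc ζ) (cc η)

  order : ∀ {p q u v} → G p ≡ just u → G q ≡ just v → p ≼ q → p ≢ q → Order p q u v
  order {p} {q} {u} {v} e f le ne = go ph refl (kind u e) (kind v f)
    where
    both : ∀ {ζ η L} → AllPairs PW L → AllPairs Later L → (p , ζ) ∈ L → (q , η) ∈ L → PW (p , ζ) (q , η)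
    both a b m m' with pairs-compare (AP.zip (a , b)) m m'
    ... | inj₁ refl = ⊥-elim (ne refl)
    ... | inj₂ (inj₁ (pw , _)) = pw
    ... | inj₂ (inj₂ (_ , lat)) = ⊥-elim (lat le)
    go : ∀ ph' → ph ≡ ph' → ∀ {u v} → Kind p u → Kind q v → Order p q u v
    go 𝐁 refl (isP m) (isP m') = bb (both pwP laterP (inP m) (inP m'))
    go 𝐁 refl (isP m) (isO m') = bc
    go 𝐁 refl (isO m) (isP m') = ⊥-elim (crossB refl m' m le)
    go 𝐁 refl (isO m) (isO m') = cc (both pwO laterO m m')
    go 𝐂 refl (isP m) (isP m') = cc (both pwP laterP (inP m) (inP m'))
    go 𝐂 refl (isO m) (isP m') = bc
    go 𝐂 refl (isP m) (isO m') = ⊥-elim (crossC refl m m' le)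
    go 𝐂 refl (isO m) (isO m') = bb (both pwO laterO m m')

  z∉ : ∀ {v} → G (pos z) ≢ just v
  z∉ {v} e with kind v e
  ... | isP (inj₁ m) = behind m (≤-refl , ≤-refl)
  ... | isP (inj₂ m) = ahead m (≤-refl , ≤-refl)
  ... | isO m = go ph refl
    where
    go : ∀ ph' → ph ≡ ph' → ⊥
    go 𝐁 refl = crossBz refl m (≤-refl , ≤-refl)
    go 𝐂 refl = crossCz refl m (≤-refl , ≤-refl)

  tab : Tab G (pos z)
  tab = record
    { inq = λ e → proj₁ (chain-∉ chain (proj₂ (onLine e)))
    ; inq-z = proj₁ (chain-∉ chain z-line)
    ; hole = vacant (G (pos z)) refl
    ; convex = λ a b l l' i n → fromLine (proj₂ (chain-convex ideal chain (proj₂ (onLine′ a)) (proj₂ (onLine′ b)) l l' i)) n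
    ; beside = λ l e f → case order e f (≤-refl , <⇒≤ l) (λ { refl → <-irrefl refl l }) of
        λ { bc → bc ; (bb (tt r)) → ⊥-elim (<-irrefl refl r) ; (bb tf) → bb ; (bb (ff _)) → bb
          ; (cc (tt r)) → ⊥-elim (<-irrefl refl r) ; (cc tf) → cc ; (cc (ff _)) → cc }
    ; over = λ e f → case order e f (n≤1+n _ , ≤-refl) (λ ()) of
        λ { bc → bc ; (bb (tt _)) → bb ; (bb tf) → bb ; (bb (ff c)) → ⊥-elim (<-irrefl refl c)
          ; (cc (tt _)) → cc ; (cc tf) → cc ; (cc (ff c)) → ⊥-elim (<-irrefl refl c) }
    ; cc-bb = ccbb
    ; diag = λ {i} {v} e → dg v (kind v e)
    }
    where
    ccbb : ∀ {p q ζ η} → G p ≡ just (cc ζ) → G q ≡ just (bb η) → ¬ (p ≼ q)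
    ccbb {p} {q} e f le with p ≟B q
    ... | yes refl = case trans (sym e) f of λ ()
    ... | no n with order e f le n
    ...   | ()
    vacant : ∀ m → G (pos z) ≡ m → G (pos z) ≡ nothing
    vacant nothing e = e
    vacant (just v) e = ⊥-elim (z∉ e)
    dg : ∀ {i} v → Kind (i , i) v → v ≡ bb false ⊎ v ≡ cc false
    dg v (isP m) with All.lookup dP (inP m) refl
    ... | refl = go ph refl
      where
      go : ∀ ph' → ph ≡ ph' → tag ph false ≡ bb false ⊎ tag ph false ≡ cc false
      go 𝐁 refl = inj₁ refl
      go 𝐂 refl = inj₂ refl
    dg v (isO m) with All.lookup dO m refl
    ... | refl = go ph refl
      where
      go : ∀ ph' → ph ≡ ph' → opp ph false ≡ bb false ⊎ opp ph false ≡ cc false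
      go 𝐁 refl = inj₂ refl
      go 𝐂 refl = inj₁ refl

inside : ∀ {K F P₁ X Y} → Ideal K → Chain K (F ++ (P₁ ʳ++ X)) → (∀ {K'} → Chain K' X → Chain K' Y) →
         Chain K (F ++ (P₁ ʳ++ Y))
inside {F = F} {P₁} ideal ch f with context-++ F ideal ch
... | c with unzip P₁ (Context.here′ c)
...   | rc , ch' = Context.plug c (rezip rc (f ch'))

data WhereIs (p z x : Box) : Set where
  atZ  : p ≡ z → WhereIs p z x
  atX  : p ≡ x → WhereIs p z x
  off′ : p ≢ z → p ≢ x → WhereIs p z x

whereIs : ∀ p z x → WhereIs p z x
whereIs p z x with p ≟B z | p ≟B x
... | yes e | _ = atZ e
... | no _ | yes e = atX e
... | no n | no n' = off′ n n'

PW-retreat : ∀ {x x' f ξ} → x' ≼ x → PW (x , ξ) f → PW (x' , ξ) f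
PW-retreat l (tt r) = tt (≤-<-trans (proj₁ l) r)
PW-retreat l tf = tf
PW-retreat l (ff c) = ff (≤-<-trans (proj₂ l) c)

module _ {ph M K O z x P₁ P₂ G} (D : Mid ph M K O z P₁ (x ∷ P₂) G) where
  open Mid D

  x-after : ∀ {f} → f ∈ P₂ → PW x f
  x-after m with pairs-++⁻ (reverse P₁) (subst (AllPairs PW) (ʳ++-defn P₁) pwP)
  ... | _ , (p ∷ _) , _ = All.lookup p m

  x-later : ∀ {f} → f ∈ P₂ → ¬ (pos f ≼ pos x)
  x-later m with pairs-++⁻ (reverse P₁) (subst (AllPairs Later) (ʳ++-defn P₁) laterP)
  ... | _ , (p ∷ _) , _ = All.lookup p m

  P₁-x : ∀ {e} → e ∈ P₁ → ¬ (pos x ≼ pos e)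
  P₁-x m with pairs-++⁻ (reverse P₁) (subst (AllPairs Later) (ʳ++-defn P₁) laterP)
  ... | _ , _ , c = c (Any-reverse⁺ m) (here refl)

  P₂-pairs : AllPairs PW P₂ × AllPairs Later P₂
  P₂-pairs with pairs-++⁻ (reverse P₁) (subst (AllPairs PW) (ʳ++-defn P₁) pwP)
              | pairs-++⁻ (reverse P₁) (subst (AllPairs Later) (ʳ++-defn P₁) laterP)
  ... | _ , (_ ∷ a) , _ | _ , (_ ∷ b) , _ = a , b

  Gx : G (pos x) ≡ just (tag ph (mark x))
  Gx = coverP (inj₂ (here refl))

  Gf : ∀ {f} → f ∈ P₂ → G (pos f) ≡ just (tag ph (mark f))
  Gf m = coverP (inj₂ (there m))

  x≢z : pos x ≢ pos z
  x≢z e = z∉ {tag ph (mark x)} (subst (λ p → G p ≡ just (tag ph (mark x))) e Gx)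

  -- The box (i+1, i+1) lies between x and f, hence is occupied, and by a letter of the same strip.
  -- On the diagonal it is unprimed, and f is this box or comes after it.
  corner-unprimed : ∀ {i ξ f} → pos z ≡ (i , i) → x ≡ ((i , suc i) , ξ) → f ∈ P₂ → i < row (pos f) → mark f ≡ false
  corner-unprimed {i} {f = f} refl refl m l with All.lookup dP (inP (inj₂ (there m))) | Gf m
  ... | d | e with Tab.convex tab {q = suc i , suc i} (inj₁ (_ , Gx)) (inj₁ (_ , e)) (n≤1+n i , ≤-refl)
                     (l , ≤-trans l (proj₂ (Tab.inq tab e))) (s≤s z≤n , ≤-refl) (λ ())
  ...   | v , e' with Tab.diag tab e' | pos f ≟B (suc i , suc i)
  ...     | _ | yes refl = d refl
  ...     | v≡ | no n = go ph refl e e' v≡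
    where
    le : (suc i , suc i) ≼ pos f
    le = l , ≤-trans l (proj₂ (Tab.inq tab e))
    go : ∀ ph' → ph ≡ ph' → ∀ {v} → G (pos f) ≡ just (tag ph' (mark f)) → G (suc i , suc i) ≡ just v → v ≡ bb false ⊎ v ≡ cc false →
         mark f ≡ false
    go 𝐁 refl e e' (inj₂ refl) = ⊥-elim (Tab.cc-bb tab e' e le)
    go 𝐁 refl e e' (inj₁ refl) with order e' e le (λ eq → n (sym eq))
    ... | bb (ff _) = refl
    go 𝐂 refl e e' (inj₁ refl) = ⊥-elim (Tab.cc-bb tab Gx e' (n≤1+n i , ≤-refl))
    go 𝐂 refl e e' (inj₂ refl) with order e' e le (λ eq → n (sym eq))
    ... | cc (ff _) = refl

  -- In the middle of a row the strip consists of switched boxes, x' and unswitched boxes. The order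
  -- of the finished strip covers only the former; this covers x' against the latter.
  x'-before : ∀ {m f x' z₁ g e} → Cross m f z x x' z₁ g → e ∈ P₂ → PW x' e
  x'-before (non _ _) m = x-after m
  x'-before (mv a _ _) m = PW-retreat (⋖⇒≼ a) (x-after m)
  x'-before (en {ξ' = true} _) m with x-after m
  ... | ff c = tf
  x'-before (en {ξ' = false} _) m with x-after m
  ... | ff c = ff c
  x'-before {e = e} (lv {i} _) m with x-after m
  ... | ff c = ff (≤-trans (n≤1+n _) c)
  ... | tt r = case corner-unprimed refl refl m r of λ ()
  ... | tf = ff (≰⇒> λ c≤i → ahead (there m) (≤-trans (proj₂ (Tab.inq tab (Gf m))) c≤i , c≤i))

  module _ {m f x' z₁ g P₂'} (k : Cross m f z x x' z₁ g) (final : AllPairs PW (P₁ ʳ++ (x' ∷ P₂'))) where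

    private
      pw′ : AllPairs PW (P₁ ʳ++ (x' ∷ P₂))
      pw′ with pairs-++⁻ (reverse P₁) (subst (AllPairs PW) (ʳ++-defn P₁) pwP)
             | pairs-++⁻ (reverse P₁) (subst (AllPairs PW) (ʳ++-defn P₁) final)
      ... | a , (_ ∷ b) , c | _ , _ , c' = subst (AllPairs PW) (sym (ʳ++-defn P₁))
        (AllPairs.++⁺ a (All.tabulate (x'-before k) ∷ b)
          (All.tabulate λ m → c' m (here refl) ∷ All.tabulate λ m' → c m (there m')))

      d′ : All Diag0 (P₁ ʳ++ (x' ∷ P₂))
      d′ = All.tabulate λ m → case ∈-ʳ++⁻ P₁ m of
        λ { (inj₁ i) → All.lookup dP (inP (inj₁ i))
          ; (inj₂ (here refl)) → cell-diag0-P k (All.lookup dP (inP (inj₂ (here refl))))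
          ; (inj₂ (there i)) → All.lookup dP (inP (inj₂ (there i))) }

      chain′ : Chain K (front ph O ++ (P₁ ʳ++ (x' ∷ z₁ ∷ P₂ ++ back ph O)))
      chain′ = inside {F = front ph O} {P₁} ideal chain (cell-chain k)

    mid-still : x' ≡ x → z₁ ≡ z → Mid ph M K O z₁ (x' ∷ P₁) P₂ G
    mid-still refl refl = record
      { ideal = ideal ; chain = chain′ ; pwP = pw′ ; pwO = pwO ; dP = d′ ; dO = dO
      ; soundP = λ e → case soundP e of λ { (inj₁ m) → inj₁ (there m) ; (inj₂ (here e')) → inj₁ (here e') ; (inj₂ (there m)) → inj₂ m }
      ; coverP = λ { (inj₁ (here e)) → coverP (inj₂ (here e)) ; (inj₁ (there m)) → coverP (inj₁ m) ; (inj₂ m) → coverP (inj₂ (there m)) }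
      ; soundO = soundO ; coverO = coverO ; bound = bound }

    mid-fill : pos x' ≡ pos z → pos z ≼ pos x →
               Mid ph M K O z₁ (x' ∷ P₁) P₂ (fill (pos z) (tag ph (mark x')) (pos x) G)
    mid-fill ex zx = record
      { ideal = ideal ; chain = chain′ ; pwP = pw′ ; pwO = pwO ; dP = d′ ; dO = dO
      ; soundP = sP ; coverP = cP ; soundO = sO ; coverO = cO ; bound = bd }
      where
      G' : Pattern
      G' = fill (pos z) (tag ph (mark x')) (pos x) G
      at-z : G' (pos z) ≡ just (tag ph (mark x'))
      at-z = fill-z (pos z) (tag ph (mark x')) (pos x) G
      at-x : G' (pos x) ≡ nothing
      at-x = fill-x (pos z) (tag ph (mark x')) (pos x) G x≢z
      off : ∀ {q} → q ≢ pos z → q ≢ pos x → G' q ≡ G q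
      off = fill-other (pos z) (tag ph (mark x')) (pos x) G
      sP : ∀ {p ζ} → G' p ≡ just (tag ph ζ) → (p , ζ) ∈ x' ∷ P₁ ⊎ (p , ζ) ∈ P₂
      sP {p} e with whereIs p (pos z) (pos x)
      ... | atZ refl = inj₁ (here (cong₂ _,_ (sym ex) (tag-inj ph (sym (just-injective (trans (sym at-z) e))))))
      ... | atX refl = case trans (sym at-x) e of λ ()
      ... | off′ nz nx with soundP (trans (sym (off nz nx)) e)
      ...   | inj₁ m = inj₁ (there m)
      ...   | inj₂ (here refl) = ⊥-elim (nx refl)
      ...   | inj₂ (there m) = inj₂ m
      cP : ∀ {p ζ} → (p , ζ) ∈ x' ∷ P₁ ⊎ (p , ζ) ∈ P₂ → G' p ≡ just (tag ph ζ)
      cP (inj₁ (here refl)) = trans (cong G' ex) at-z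
      cP (inj₁ (there m)) = trans (off (λ { refl → behind m (≤-refl , ≤-refl) }) (λ { refl → P₁-x m (≤-refl , ≤-refl) })) (coverP (inj₁ m))
      cP (inj₂ m) = trans (off (λ { refl → ahead (there m) (≤-refl , ≤-refl) }) (λ { refl → x-later m (≤-refl , ≤-refl) })) (coverP (inj₂ (there m)))
      sO : ∀ {p ζ} → G' p ≡ just (opp ph ζ) → (p , ζ) ∈ O
      sO {p} e with whereIs p (pos z) (pos x)
      ... | atZ refl = ⊥-elim (tag≢opp ph (just-injective (trans (sym at-z) e)))
      ... | atX refl = case trans (sym at-x) e of λ ()
      ... | off′ nz nx = soundO (trans (sym (off nz nx)) e)
      cO : ∀ {p ζ} → (p , ζ) ∈ O → G' p ≡ just (opp ph ζ)
      cO m = trans (off (λ { refl → z∉ (coverO m) }) (λ { refl → tag≢opp ph (just-injective (trans (sym Gx) (coverO m))) })) (coverO m)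
      bd : ∀ {p v} → G' p ≡ just v → row p ≤ M × col p ≤ M
      bd {p} e with whereIs p (pos z) (pos x)
      ... | atZ refl = ≤-trans (proj₁ zx) (proj₁ (bound Gx)) , ≤-trans (proj₂ zx) (proj₂ (bound Gx))
      ... | atX refl = case trans (sym at-x) e of λ ()
      ... | off′ nz nx = bound (trans (sym (off nz nx)) e)

split₁ : ∀ a {b} → suc a ≤ b → ∃ λ n → b ≡ a + suc n
split₁ zero (s≤s {n = n} _) = n , refl
split₁ (suc a) (s≤s l) with split₁ a l
... | n , e = n , cong suc e

split₂ : ∀ a {b} → suc (suc a) ≤ b → ∃ λ n → b ≡ a + suc (suc n)
split₂ zero (s≤s (s≤s {n = n} _)) = n , refl
split₂ (suc a) (s≤s l) with split₂ a l
... | n , e = n , cong suc e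

Same : ℕ → Pattern → Pattern → Set
Same M G G' = rowsWalk G M 0 M ≡ rowsWalk G' M 0 M

same-at : ∀ {G G' M a b} → M ≡ a → M ≡ b → rowsWalk G a 0 b ≡ rowsWalk G' a 0 b → Same M G G'
same-at refl refl e = e

module _ {ph : Phase} {M : ℕ} {K : Region} {O : List Marked} {ζ : Bool} {x : Box} {ξ : Bool} {P₁ P₂ : List Marked} {G : Pattern} where

  same-E : ∀ {i j} → Mid ph M K O ((i , j) , ζ) P₁ ((x , ξ) ∷ P₂) G → x ≡ (i , suc j) → ∀ ξ' →
           (∀ n d → suc (j ∸ 1) ≡ j → walk₁ (tag ph ξ) (walk (left₀ G i (j ∸ 1) n) (rowsWalk G M i d)) ≡
                  walk₁ (tag ph ξ') (walk (left₀ G i (j ∸ 1) n) (rowsWalk G M i d))) →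
           Same M G (fill (i , j) (tag ph ξ') x G)
  same-E {i} {j} D refl ξ' h with Tab.inq-z (Mid.tab D)
  same-E {suc i} {suc j} D refl ξ' h | _ , _
    with split₂ j (proj₂ (Mid.bound D (Gx D))) | split₁ i (proj₁ (Mid.bound D (Gx D)))
  ... | n , Mn | d , Md = same-at Mn Md
    (horizontal i d j n (λ q nz nx → sym (fill-other z v x G nz nx)) (Tab.hole (Mid.tab D)) (fill-z z v x G) (Gx D)
      (fill-x z v x G (λ e → n≢1+n (cong proj₂ (sym e))))
      (subst (λ m → walk₁ (tag ph ξ) (walk (left₀ G (suc i) j n) (rowsWalk G m (suc i) d)) ≡
                    walk₁ v (walk (left₀ G (suc i) j n) (rowsWalk G m (suc i) d))) Mn (h n d refl)))
    where
    z : Box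
    z = suc i , suc j
    v : Sym
    v = tag ph ξ'

  same-S : ∀ {i j} → Mid ph M K O ((i , j) , ζ) P₁ ((x , ξ) ∷ P₂) G → x ≡ (suc i , j) → ∀ ξ' →
           (∀ n d → suc (j ∸ 1) ≡ j → Lifts G i (j ∸ 1) n (tag ph ξ) (tag ph ξ') (rowsWalk G M (suc i) d)) →
           Same M G (fill (i , j) (tag ph ξ') x G)
  same-S {i} {j} D refl ξ' h with Tab.inq-z (Mid.tab D)
  same-S {suc i} {suc j} D refl ξ' h | _ , _
    with split₁ j (proj₂ (Mid.bound D (Gx D))) | split₂ i (proj₁ (Mid.bound D (Gx D)))
  ... | n , Mn | d , Md = same-at Mn Md
    (vertical i d j n (λ q nz nx → sym (fill-other z v x G nz nx)) (Tab.hole (Mid.tab D)) (fill-z z v x G) (Gx D)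
      (fill-x z v x G (λ e → n≢1+n (cong proj₁ (sym e))))
      (subst (λ m → Lifts G (suc i) j n (tag ph ξ) (tag ph ξ') (rowsWalk G m (suc (suc i)) d)) Mn (h n d refl)))
    where
    z : Box
    z = suc i , suc j
    v : Sym
    v = tag ph ξ'

record Shown (ph : Phase) (M : ℕ) (P O : List Marked) (G : Pattern) : Set where
  field
    soundP : ∀ {p ζ} → G p ≡ just (tag ph ζ) → (p , ζ) ∈ P
    coverP : ∀ {p ζ} → (p , ζ) ∈ P → G p ≡ just (tag ph ζ)
    soundO : ∀ {p ζ} → G p ≡ just (opp ph ζ) → (p , ζ) ∈ O
    coverO : ∀ {p ζ} → (p , ζ) ∈ O → G p ≡ just (opp ph ζ)
    bound  : ∀ {p v} → G p ≡ just v → row p ≤ M × col p ≤ M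

mid-shown : ∀ {ph M K O z P₁ G} → Mid ph M K O z P₁ [] G → Shown ph M (P₁ ʳ++ []) O G
mid-shown {P₁ = P₁} D = record
  { soundP = λ e → Mid.inP D (Mid.soundP D e)
  ; coverP = λ m → case ∈-ʳ++⁻ P₁ m of λ { (inj₁ i) → Mid.coverP D (inj₁ i) }
  ; soundO = Mid.soundO D ; coverO = Mid.coverO D ; bound = Mid.bound D }

-- Excludes the state half way through (S3), with (i, i) already filled and (i+1, i+1) about to
-- move. The walks are not compared there, but only before and after the whole switch.
NoCorner : Marked → List Marked → List Marked → Set
NoCorner z P₁ P₂ = ∀ {i ζ ξ} → pos z ≡ (i , suc i) → ((i , i) , ζ) ∈ P₁ → ¬ (((suc i , suc i) , ξ) ∈ P₂)

module _ {ph M K O ζ ξ P₁ P₂ G i j} (D : Mid ph M K O ((i , j) , ζ) P₁ (((suc i , j) , ξ) ∷ P₂) G) where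
  open Mid D

  private
    module T = Tab tab

    i<j : suc i ≤ j
    i<j = proj₂ (T.inq (Gx D))

    up : ∀ {c} → j < c → Filled (G (suc i , c)) → Filled (G (i , c))
    up l f = T.convex (inj₂ refl) (inj₁ f) (≤-refl , <⇒≤ l) (n≤1+n i , ≤-refl)
      (proj₁ T.inq-z , ≤-trans (≤-trans (n≤1+n i) i<j) (<⇒≤ l)) (λ { refl → <-irrefl refl l })

    unprimed : ∀ {c η} → j < c → ((i , c) , η) ∈ P₁ ⊎ ((i , c) , η) ∈ ((suc i , j) , ξ) ∷ P₂ → η ≡ false
    unprimed l (inj₁ m) = ⊥-elim (behind m (≤-refl , <⇒≤ l))
    unprimed l (inj₂ (there m)) with x-after D m
    ... | tt r = ⊥-elim (<⇒≱ r (n≤1+n i))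
    ... | tf = refl
    ... | ff _ = refl

  south-ahead : ph ≡ 𝐁 → Ahead G i j
  south-ahead refl = record
    { up = up
    ; left = λ l f → T.convex (inj₁ (_ , Gx D)) (inj₁ f) (≤-refl , <⇒≤ l) (≤-refl , n≤1+n _) (s≤s z≤n , ≤-trans i<j (<⇒≤ l)) (λ ())
    ; unprimed = λ l e → unprimed l (soundP e) }

  -- By convexity the box above a letter k+1 further to the right would be occupied. It cannot
  -- belong to the k-strip, which lies in front of the hole, and an unprimed k+1 cannot stand over
  -- another letter of its strip.
  south-last : ph ≡ 𝐂 → ∀ c → j < c → G (suc i , c) ≡ nothing
  south-last refl c l = go (filled? (G (suc i , c)))
    where
    go : Filled (G (suc i , c)) ⊎ G (suc i , c) ≡ nothing → G (suc i , c) ≡ nothing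
    go (inj₂ n) = n
    go (inj₁ (v , f)) with up l (v , f) | T.beside l (Gx D) f
    ... | bb _ , e | _ = ⊥-elim (crossCz refl (soundO e) (≤-refl , <⇒≤ l))
    ... | cc _ , e | cc with T.over e f
    ...   | cc = case unprimed l (soundP e) of λ ()

  same-south : ∀ ph' → ph ≡ ph' → j ≢ suc i → Same M G (fill (i , j) (tag ph ξ) (suc i , j) G)
  same-south 𝐁 refl n = same-S D refl ξ λ { n' d e → go n' d (j ∸ 1) e }
    where
    go : ∀ n' d j' → suc j' ≡ j → Lifts G i j' n' (bb ξ) (bb ξ) (rowsWalk G M (suc i) d)
    go n' d j' refl = lift-bb tab n' _ (Gx D) (≤-pred (≤∧≢⇒< i<j (λ e → n (sym e)))) (λ e → crossBz refl (soundO e)) (south-ahead refl)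
  same-south 𝐂 refl n = same-S D refl ξ λ { n' d e → go n' d (j ∸ 1) e }
    where
    go : ∀ n' d j' → suc j' ≡ j → Lifts G i j' n' (cc ξ) (cc ξ) (rowsWalk G M (suc i) d)
    go n' d j' refl = lift-cc tab n' _ (Gx D) (≤-pred (≤∧≢⇒< i<j (λ e → n (sym e)))) (south-last refl)
      (λ nb → rows-no-bb M (suc i) d nb)

same-enter : ∀ {ph M K O ζ P₁ P₂ G i} (D : Mid ph M K O ((i , suc i) , ζ) P₁ (((suc i , suc i) , false) ∷ P₂) G) →
             NoCorner ((i , suc i) , ζ) P₁ (((suc i , suc i) , false) ∷ P₂) → ∀ ξ' ph' → ph ≡ ph' →
             Same M G (fill (i , suc i) (tag ph ξ') (suc i , suc i) G)
same-enter {M = M} {P₁ = P₁} {P₂} {G} {i} D nc ξ' ph' e = go ph' e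
  where
  open Mid D
  notP : ∀ {ζ} → ((i , i) , ζ) ∈ P₁ ⊎ ((i , i) , ζ) ∈ ((suc i , suc i) , false) ∷ P₂ → ⊥
  notP (inj₁ m) = nc refl m (here refl)
  notP (inj₂ m) = ahead m (≤-refl , n≤1+n i)
  go : ∀ ph' → _ ≡ ph' → Same M G (fill (i , suc i) (tag _ ξ') (suc i , suc i) G)
  go 𝐁 refl = same-S D refl ξ' λ n d _ → enter-bb tab n M d ξ' (Gx D) (none (filled? (G (i , i)))) (south-ahead D refl)
    where
    none : Filled (G (i , i)) ⊎ G (i , i) ≡ nothing → G (i , i) ≡ nothing
    none (inj₂ n) = n
    none (inj₁ (bb _ , e)) = ⊥-elim (notP (soundP e))
    none (inj₁ (cc _ , e)) = ⊥-elim (crossBz refl (soundO e) (≤-refl , n≤1+n i))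
  go 𝐂 refl = same-S D refl ξ' λ n d _ → enter-cc tab n M d ξ' (Gx D) (λ _ e → notP (soundP e)) (south-last D refl)

same-leave : ∀ {ph M K O ξ P₁ P₂ G i} (D : Mid ph M K O ((i , i) , false) P₁ (((i , suc i) , ξ) ∷ P₂) G) →
             (∀ {η} → ¬ (((suc i , suc i) , η) ∈ P₂)) → ∀ ph' → ph ≡ ph' →
             Same M G (fill (i , i) (tag ph false) (i , suc i) G)
same-leave {M = M} {ξ = ξ} {P₁} {P₂} {G} {i} D nc ph' e = go ph' e
  where
  open Mid D
  notP : ∀ {η} → ((suc i , suc i) , η) ∈ P₁ ⊎ ((suc i , suc i) , η) ∈ ((i , suc i) , ξ) ∷ P₂ → ⊥
  notP (inj₁ m) = behind m (n≤1+n i , n≤1+n i)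
  notP (inj₂ (there m)) = nc m
  clear : ∀ {ph'} n d → suc (i ∸ 1) ≡ i → walk₁ (tag ph' ξ) (rowsWalk G M i d) ≡ walk₁ (tag ph' false) (rowsWalk G M i d) →
          walk₁ (tag ph' ξ) (walk (left₀ G i (i ∸ 1) n) (rowsWalk G M i d)) ≡
          walk₁ (tag ph' false) (walk (left₀ G i (i ∸ 1) n) (rowsWalk G M i d))
  clear n d e h rewrite below-diag-empty tab i (i ∸ 1) (≤-reflexive e) = h
  go : ∀ ph' → _ ≡ ph' → Same M G (fill (i , i) (tag _ false) (i , suc i) G)
  go 𝐁 refl = same-E D refl false λ n d e → clear {𝐁} n d e (leave-bb tab M d ξ (Gx D) λ _ f → notP (soundP f))
  go 𝐂 refl = same-E D refl false λ n d e → clear {𝐂} n d e (leave-cc tab M d ξ (Gx D) λ _ f → notP (soundP f))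

diag-rows : ∀ {H} i n σ → (∀ c → c ≤ i → H (suc i , c) ≡ nothing) → (∀ c → c ≤ suc i → H (suc (suc i) , c) ≡ nothing) →
            walk (rowWord H (i + suc (suc n)) (suc i)) (walk (rowWord H (i + suc (suc n)) (suc (suc i))) σ) ≡
            walk (right₀ H (suc i) (suc i) n) (walkM (H (suc i , suc (suc i))) (walkM (H (suc i , suc i))
              (walk (right₁ H (suc i) (suc i) n) (walkM (H (suc (suc i) , suc (suc i))) σ))))
diag-rows {H} i n σ f g =
  trans (row-at (λ c → H (suc i , c)) i (suc n) _)
  (trans (cong (λ w → walk (seg (λ c → H (suc i , c)) (suc i) (suc n)) (walkM (H (suc i , suc i)) (walk w τ)))
           (seg-empty 0 i λ c _ l → f c l))
  (trans (walk-add (H (suc i , suc (suc i))) (right₀ H (suc i) (suc i) n) _)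
  (cong (λ ρ → walk (right₀ H (suc i) (suc i) n) (walkM (H (suc i , suc (suc i))) (walkM (H (suc i , suc i)) ρ)))
    (trans (cong (λ m → walk (rowWord H m (suc (suc i))) σ) (+-suc i (suc n)))
    (trans (row-at (λ c → H (suc (suc i) , c)) (suc i) n σ)
           (cong (λ w → walk (right₁ H (suc i) (suc i) n) (walkM (H (suc (suc i) , suc (suc i))) (walk w σ)))
             (seg-empty 0 (suc i) λ c _ l → g c l)))))))
  where
  τ : Walk
  τ = walk (rowWord H (i + suc (suc n)) (suc (suc i))) σ

module _ {ph M K O ξ P₁ P₂ G i} (D : Mid ph M K O ((i , i) , false) P₁ (((i , suc i) , ξ) ∷ ((suc i , suc i) , false) ∷ P₂) G) where
  open Mid D

  private
    G₁ G₂ : Pattern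
    G₁ = fill (i , i) (tag ph false) (i , suc i) G
    G₂ = fill (i , suc i) (tag ph false) (suc i , suc i) G₁

    ξ≡ : ξ ≡ true
    ξ≡ with x-after D (here refl)
    ... | tf = refl
    ... | ff c = ⊥-elim (<-irrefl refl c)

    off : ∀ q → q ≢ (i , i) → q ≢ (i , suc i) → q ≢ (suc i , suc i) → G q ≡ G₂ q
    off q a b c = sym (trans (fill-other (i , suc i) (tag ph false) (suc i , suc i) G₁ {q} b c) (fill-other (i , i) (tag ph false) (i , suc i) G {q} a b))

    after-z : G₂ (i , i) ≡ just (tag ph false)
    after-z = trans (fill-other (i , suc i) (tag ph false) (suc i , suc i) G₁ {i , i} (λ ()) (λ ())) (fill-z (i , i) (tag ph false) (i , suc i) G)

    after-x : G₂ (i , suc i) ≡ just (tag ph false)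
    after-x = fill-z (i , suc i) (tag ph false) (suc i , suc i) G₁

    after-y : G₂ (suc i , suc i) ≡ nothing
    after-y = fill-x (i , suc i) (tag ph false) (suc i , suc i) G₁ (λ ())

    before-y : G (suc i , suc i) ≡ just (tag ph false)
    before-y = Gf D (here refl)

    S3 : ∀ ph' → ph ≡ ph' → ∀ d n → suc i + n ≡ M → (let σ = rowsWalk G M (suc i) d in
         walk (right₀ G i i n) (walk₁ (tag ph ξ) (walk (right₁ G i i n) (walk₁ (tag ph false) σ))) ≡
         walk (right₀ G i i n) (walk₁ (tag ph false) (walk₁ (tag ph false) (walk (right₁ G i i n) σ))))
    S3 𝐁 refl d n e rewrite ξ≡ = S3-bb tab M d n e (λ eq → proj₂ (bound eq)) (trans (Gx D) (cong (λ t → just (bb t)) ξ≡)) before-y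
    S3 𝐂 refl d n e rewrite ξ≡ = S3-cc tab M d n (trans (Gx D) (cong (λ t → just (cc t)) ξ≡)) before-y

    upper-clear : ∀ c → c ≤ i → c < i → G (i , c) ≡ nothing
    upper-clear c _ l = clear (filled? (G (i , c)))
      where
      clear : Filled (G (i , c)) ⊎ G (i , c) ≡ nothing → G (i , c) ≡ nothing
      clear (inj₂ n) = n
      clear (inj₁ (_ , e)) = ⊥-elim (<⇒≱ l (proj₂ (Tab.inq tab e)))

    lower-clear : ∀ c → c < suc i → G (suc i , c) ≡ nothing
    lower-clear c l = clear (filled? (G (suc i , c)))
      where
      clear : Filled (G (suc i , c)) ⊎ G (suc i , c) ≡ nothing → G (suc i , c) ≡ nothing
      clear (inj₂ n) = n
      clear (inj₁ (_ , e)) = ⊥-elim (<⇒≱ l (proj₂ (Tab.inq tab e)))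

  same-S3 : ∀ i' → i ≡ suc i' → Same M G G₂
  same-S3 i' refl with split₂ i' (proj₂ (bound (Gx D))) | split₂ i' (proj₁ (bound before-y))
  ... | n , Mn | d , Md = same-at Mn Md (subst (λ m → rowsWalk G m 0 (i' + suc (suc d)) ≡ rowsWalk G₂ m 0 (i' + suc (suc d))) Mn
    (two-rows M i' d (λ q l → off q (λ { refl → <-irrefl refl l }) (λ { refl → <-irrefl refl l }) (λ { refl → <⇒≱ (n≤1+n _) l }))
      (λ q l → off q (λ { refl → <⇒≱ l (n≤1+n _) }) (λ { refl → <⇒≱ l (n≤1+n _) }) (λ { refl → <-irrefl refl l }))
      (subst (λ m → walk (rowWord G m i) (walk (rowWord G m (suc i)) σ) ≡ walk (rowWord G₂ m i) (walk (rowWord G₂ m (suc i)) σ)) (sym Mn)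
        (trans (diag-rows {G} i' n σ (λ c l → upper-clear c (m≤n⇒m≤1+n l) (s≤s l)) (λ c l → lower-clear c (s≤s l)))
        (trans (values {G} (Tab.hole tab) (Gx D) before-y refl refl)
        (trans (S3 ph refl d n (sym (trans Mn (trans (+-suc i' (suc n)) (cong suc (+-suc i' n))))))
        (trans (sym (values′ {G₂} after-z after-x after-y same₀ same₁))
        (sym (diag-rows {G₂} i' n σ
          (λ c l → trans (sym (off (i , c) (λ { refl → <-irrefl refl l }) (λ { refl → <⇒≱ (n≤1+n _) l }) (λ ()))) (upper-clear c (m≤n⇒m≤1+n l) (s≤s l)))
          (λ c l → trans (sym (off (suc i , c) (λ ()) (λ ()) (λ { refl → <-irrefl refl l }))) (lower-clear c (s≤s l))))))))))))
    where
    σ : Walk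
    σ = rowsWalk G M (suc i) d
    R₀ R₁ : List Sym
    R₀ = right₀ G i i n
    R₁ = right₁ G i i n
    same₀ : right₀ G₂ i i n ≡ R₀
    same₀ = seg-cong (suc i) n λ c l → sym (off (i , c) (λ { refl → <⇒≱ l (n≤1+n _) }) (λ { refl → <-irrefl refl l }) (λ ()))
    same₁ : right₁ G₂ i i n ≡ R₁
    same₁ = seg-cong (suc i) n λ c l → sym (off (suc i , c) (λ ()) (λ ()) (λ { refl → <-irrefl refl l }))
    values : ∀ {H} → H (i , i) ≡ nothing → H (i , suc i) ≡ just (tag ph ξ) → H (suc i , suc i) ≡ just (tag ph false) →
             right₀ H i i n ≡ R₀ → right₁ H i i n ≡ R₁ →
             walk (right₀ H i i n) (walkM (H (i , suc i)) (walkM (H (i , i)) (walk (right₁ H i i n) (walkM (H (suc i , suc i)) σ)))) ≡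
             walk R₀ (walk₁ (tag ph ξ) (walk R₁ (walk₁ (tag ph false) σ)))
    values a b c d e rewrite a | b | c | d | e = refl
    values′ : ∀ {H} → H (i , i) ≡ just (tag ph false) → H (i , suc i) ≡ just (tag ph false) → H (suc i , suc i) ≡ nothing →
             right₀ H i i n ≡ R₀ → right₁ H i i n ≡ R₁ →
             walk (right₀ H i i n) (walkM (H (i , suc i)) (walkM (H (i , i)) (walk (right₁ H i i n) (walkM (H (suc i , suc i)) σ)))) ≡
             walk R₀ (walk₁ (tag ph false) (walk₁ (tag ph false) (walk R₁ σ)))
    values′ a b c d e rewrite a | b | c | d | e = refl

Slid : Phase → ℕ → List Marked → List Marked → Pattern → Set
Slid ph M P O G = Σ Pattern λ G' → Shown ph M P O G' × Same M G G'

after-same : ∀ {ph M P O G G'} → Same M G G' → Slid ph M P O G' → Slid ph M P O G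
after-same e (G″ , s , e') = G″ , s , trans e e'

corner-next : ∀ {ph M K O P₁ ξ y P₂ G i} → Mid ph M K O ((i , i) , false) P₁ (((i , suc i) , ξ) ∷ y ∷ P₂) G →
              ∀ {η} → ¬ (((suc i , suc i) , η) ∈ P₂)
corner-next {i = i} D m with x-after D (there m) | x-after D (here refl) | P₂-pairs D
... | ff c | _ | _ = <-irrefl refl c
... | tt _ | tt r | _ , (l ∷ _) = All.lookup l m (r , ≤-trans r (proj₂ (Tab.inq (Mid.tab D) (Gf D (here refl)))))
... | tf | tt r | _ , (l ∷ _) = All.lookup l m (r , ≤-trans r (proj₂ (Tab.inq (Mid.tab D) (Gf D (here refl)))))
... | _ | tf | (p ∷ _) , _ with All.lookup p m
...   | ff c' = Mid.ahead D (there (here refl)) (≤-trans (proj₂ (Tab.inq (Mid.tab D) (Gf D (here refl)))) (≤-pred c') , ≤-pred c')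

-- Every cell is one slide of a letter into the hole, except that `lv` followed by `en`, which is
-- (S3), is compared as a whole by `same-S3`. The remaining clauses for `lv` check that (i+1, i+1)
-- is not in the strip ahead.
slide : ∀ {ph M K O m f z P₁ P₂ P₂' z' G} → Row m f z P₂ P₂' z' → Mid ph M K O z P₁ P₂ G → AllPairs PW (P₁ ʳ++ P₂') →
        NoCorner z P₁ P₂ → Slid ph M (P₁ ʳ++ P₂') O G
slide [] D final nc = _ , mid-shown D , refl
slide {z = z} {P₁} {x ∷ P₂} (non a b ∷ r) D final nc =
  slide r (mid-still D (non {m = false} {f = false} a b) final refl refl) final nc'
  where
  nc' : NoCorner z (x ∷ P₁) P₂
  nc' refl (here refl) _ = Mid.ahead D (here refl) (≤-refl , n≤1+n _)
  nc' e (there m) m' = nc e m (there m')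
slide {ph} {M} {P₁ = P₁} {(x , ξ) ∷ P₂} {G = G} (mv {z} {ζ = ζ} a nz nx ∷ r) D final nc =
  after-same (same a) (slide r (mid-fill D c final refl (⋖⇒≼ a)) final nc')
  where
  c : Cross false false (z , ζ) (x , ξ) (z , ξ) (x , ζ) false
  c = mv a nz nx
  same : z ⋖ x → Same M G (fill z (tag ph ξ) x G)
  same E = same-E D refl ξ λ _ _ _ → refl
  same S = same-south D ph refl nx
  nc' : NoCorner (x , ζ) ((z , ξ) ∷ P₁) P₂
  nc' e (here refl) _ = nz refl
  nc' refl (there m) m' with pairs-++⁻ (reverse P₁) (subst (AllPairs PW) (ʳ++-defn P₁) (Mid.pwP D))
                           | All.lookup (Mid.dP D) (Mid.inP D (inj₁ m)) refl
  ... | _ , _ , g | refl with g (Any-reverse⁺ m) (here refl) | x-after D m'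
  ...   | ff _ | ff l = <-irrefl refl l
slide {ph} {M} {P₁ = P₁} {x ∷ P₂} {G = G} (lv {i} e ∷ []) D final nc =
  after-same (same-leave D (λ ()) ph refl) (slide {m = false} {f = true} [] (mid-fill D c final refl (≤-refl , n≤1+n i)) final λ _ _ ())
  where
  c : Cross _ false ((i , i) , false) x ((i , i) , false) ((i , suc i) , _) true
  c = lv e
slide {ph} {M} {P₁ = P₁} {(x , ξ) ∷ _ ∷ P₂} {G = G} (lv {i} {ζ' = ζ'} e ∷ en refl ∷ r) D final nc =
  after-same (same-S3 D _ (sym (positive (proj₁ (Tab.inq-z (Mid.tab D))))))
    (slide r (mid-fill D' c' final refl (n≤1+n i , ≤-refl)) final λ ())
  where
  positive : ∀ {i} → 1 ≤ i → suc (i ∸ 1) ≡ i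
  positive (s≤s _) = refl
  c : Cross _ false ((i , i) , false) (x , ξ) ((i , i) , false) ((i , suc i) , ζ') true
  c = lv e
  D' : _
  D' = mid-fill D c final refl (≤-refl , n≤1+n i)
  c' : Cross false true ((i , suc i) , ζ') ((suc i , suc i) , false) ((i , suc i) , false) ((suc i , suc i) , false) false
  c' = en refl
slide {ph} {M} {P₁ = P₁} {(x , ξ) ∷ y ∷ P₂} {G = G} (lv {i} e ∷ r@(non a _ ∷ _)) D final nc =
  after-same (same-leave D off ph refl) (slide r (mid-fill D (lv {f = false} e) final refl (≤-refl , n≤1+n i)) final λ { refl _ → off })
  where
  off : ∀ {η} → ¬ (((suc i , suc i) , η) ∈ (y ∷ P₂))
  off (here refl) = a S
  off (there m) = corner-next D m
slide {ph} {M} {P₁ = P₁} {(x , ξ) ∷ y ∷ P₂} {G = G} (lv {i} e ∷ r@(mv _ _ n ∷ _)) D final nc =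
  after-same (same-leave D off ph refl) (slide r (mid-fill D (lv {f = false} e) final refl (≤-refl , n≤1+n i)) final λ { refl _ → off })
  where
  off : ∀ {η} → ¬ (((suc i , suc i) , η) ∈ (y ∷ P₂))
  off (here refl) = n refl
  off (there m) = corner-next D m
slide {ph} {M} {P₁ = P₁} {_ ∷ P₂} {G = G} (en {i} {ξ' = ξ'} e ∷ r) D final nc =
  after-same (same-enter D nc ξ' ph refl) (slide r (mid-fill D c final refl (n≤1+n i , ≤-refl)) final λ ())
  where
  c : Cross false _ _ _ ((i , suc i) , ξ') ((suc i , suc i) , false) false
  c = en {f = _} e

module _ {M : ℕ} {P O : List Marked} {G : Pattern} where

  other-phase : Shown 𝐁 M P O G → Shown 𝐂 M O P G
  other-phase s = record { soundP = soundO ; coverP = coverO ; soundO = soundP ; coverO = coverP ; bound = bound }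
    where open Shown s

  other-phase′ : Shown 𝐂 M O P G → Shown 𝐁 M P O G
  other-phase′ s = record { soundP = soundO ; coverP = coverO ; soundO = soundP ; coverO = coverP ; bound = bound }
    where open Shown s

start : ∀ {ph M K O z P G} → Ideal K → Chain K (front ph O ++ (z ∷ P ++ back ph O)) → Good P → Good O → Shown ph M P O G →
        Mid ph M K O z [] P G
start ideal ch (pwP , dP) (pwO , dO) s = record
  { ideal = ideal ; chain = ch ; pwP = pwP ; pwO = pwO ; dP = dP ; dO = dO
  ; soundP = λ e → inj₂ (soundP e) ; coverP = λ { (inj₂ m) → coverP m } ; soundO = soundO ; coverO = coverO ; bound = bound }
  where open Shown s

grid-suffix : ∀ {Z P D P' A'} → Grid Z P D P' A' → Σ (List Marked) λ X → A' ≡ X ++ D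
grid-suffix [] = [] , refl
grid-suffix {D = D} (_∷_ {z' = z'} _ g) with grid-suffix g
... | X , e = X ++ z' ∷ [] , trans e (sym (++-assoc X (z' ∷ []) D))

-- Each hole passes B and then C.
two-strips : ∀ {M K Z B C D D₂ B' C' A₂ A₃ G} X → Ideal K → RChain K Z → Chain (K ⊕ Z) (B ++ C) → Good B → Good C →
             Grid Z B D B' A₂ → A₂ ≡ X ++ D → Grid (reverse X) C D₂ C' A₃ → Shown 𝐁 M B C G →
             Σ Pattern λ G' → Shown 𝐁 M B' C' G' × Same M G G'
two-strips {D = D} X ideal rc ch gB gC [] e h s with ++-cancelʳ D [] X e
two-strips .[] ideal rc ch gB gC [] e [] s | refl = _ , s , refl
two-strips {M} {K} {z ∷ Z} {B} {C} {D} X ideal (a ∷ rc) ch gB gC (_∷_ {P₁ = B₁} {z' = z'} r g) e h s with grid-suffix g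
... | X' , e' with ++-cancelʳ D X (X' ++ z' ∷ []) (trans (sym e) (trans e' (sym (++-assoc X' (z' ∷ []) D))))
-- The second grid again starts with the last box of its strip, and this is z', which has just
-- passed B. So the two grids can be interleaved hole by hole.
...   | refl with subst (λ Y → Grid Y C _ _ _) (reverse-++ X' (z' ∷ [])) h
...     | _∷_ {P₁ = C₁} {z' = z″} r₂ h' =
  let G₁ , s₁ , e₁ = slide r (start idealZ chB gB gC s) pwB₁ (λ _ ())
      G₂ , s₂ , e₂ = slide r₂ (start idealZ (subst (λ L → Chain (K ⊕ Z) (B₁ ++ z' ∷ L)) (sym (++-identityʳ C)) chC) gC (pwB₁ , dB₁) (other-phase s₁))
                       pwC₁ (λ _ ())
      G₃ , s₃ , e₃ = two-strips X' ideal rc (chain-prefix (B₁ ++ C₁) (subst (Chain (K ⊕ Z)) (sym (++-assoc B₁ C₁ (z″ ∷ []))) chD))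
                       (pwB₁ , dB₁) (pwC₁ , row-diag0-P r₂ (proj₂ gC)) g e' h' (other-phase′ s₂)
  in G₃ , s₃ , trans e₁ (trans e₂ e₃)
  where
  idealZ : Ideal (K ⊕ Z)
  idealZ = ideal-⊕ ideal rc
  chB : Chain (K ⊕ Z) (z ∷ B ++ C)
  chB = a ∷ ch
  chC : Chain (K ⊕ Z) (B₁ ++ z' ∷ C)
  chC = row-chain r chB
  inner : Context (K ⊕ Z) (B₁ ++_) (z' ∷ C)
  inner = context-++ B₁ idealZ chC
  pwB₁ : AllPairs PW B₁
  pwB₁ = row-PW idealZ (chain-prefix (z ∷ B) chB) (proj₁ gB) r
  dB₁ : All Diag0 B₁
  dB₁ = row-diag0-P r (proj₂ gB)
  pwC₁ : AllPairs PW C₁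
  pwC₁ = row-PW (Context.ideal inner) (Context.here′ inner) (proj₁ gC) r₂
  chD : Chain (K ⊕ Z) (B₁ ++ C₁ ++ z″ ∷ [])
  chD = Context.plug inner (row-chain r₂ (subst (λ L → Chain (Context.K' inner) (z' ∷ L)) (sym (++-identityʳ C)) (Context.here′ inner)))

two-cells : ∀ {M K A B B' A₁ C C' A₂ R G} → Ideal K → Chain K (A ++ B ++ C ++ R) → Good B → Good C →
            Switched A B B' A₁ → Switched A₁ C C' A₂ → Shown 𝐁 M B C G →
            Σ Pattern λ G' → Shown 𝐁 M B' C' G' × Same M G G'
two-cells {K = K} {A} {B} {C = C} {R = R} ideal ch gB gC g h s
  with unzip (reverse A) {B ++ C ++ R} (subst (Chain K) (sym (reverse-ʳ++ A (B ++ C ++ R))) ch)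
... | rc , ch' = two-strips _ ideal rc (chain-prefix (B ++ C) (subst (Chain _) (sym (++-assoc B C R)) ch')) gB gC g (sym (++-identityʳ _)) h s

cols-same : ∀ {M K TB TB' A A' R G} n {k} → Ideal K → Cols TB TB' A n A' → Chain K (A ++ stack TB n R) →
            (∀ {j} → InRange n j → Good (TB j)) → 1 ≤ k → suc k ≤ n → Shown 𝐁 M (TB k) (TB (suc k)) G →
            Σ Pattern λ G' → Shown 𝐁 M (TB' k) (TB' (suc k)) G' × Same M G G'
cols-same {TB = TB} (suc n) {k} ideal (c ∷ x) ch good 1≤k k<n s with m≤n⇒m<n∨m≡n k<n
... | inj₁ l = cols-same n ideal c ch (λ { (l , u) → good (l , m≤n⇒m≤1+n u) }) 1≤k (≤-pred l) s
cols-same {TB = TB} (suc (suc n)) ideal (_∷_ (_∷_ {A₁ = A₁} c (cell _ g)) (cell _ h)) ch good 1≤k k<n s | inj₂ refl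
  with context n ideal (cols-chain n ideal c ch)
... | k = two-cells {A = A₁} (Context.ideal k) (Context.here′ k) (good (s≤s z≤n , n≤1+n _)) (good (s≤s z≤n , ≤-refl)) g h s
cols-same {TB = TB} (suc zero) ideal (c ∷ x) ch good () k<n s | inj₂ refl

rows-same : ∀ {M K n SA SA' TB TB' R G} m {k} → Ideal K → Rows n SA SA' TB m TB' → Chain K (stack SA m (stack TB n R)) →
            (∀ {j} → InRange m j → Good (SA j)) → (∀ {j} → InRange n j → Good (TB j)) → 1 ≤ k → suc k ≤ n →
            Shown 𝐁 M (TB k) (TB (suc k)) G → Σ Pattern λ G' → Shown 𝐁 M (TB' k) (TB' (suc k)) G' × Same M G G'
rows-same zero {k} ideal ([] f) ch gS gT 1≤k k<n s =
  _ , subst₂ (λ B C → Shown 𝐁 _ B C _) (f (1≤k , <⇒≤ k<n)) (f (s≤s z≤n , k<n)) s , refl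
rows-same {n = n} (suc m) ideal (c ∷ r) ch gS gT 1≤k k<n s with context m ideal ch
... | x with cols-same n (Context.ideal x) c (Context.here′ x) gT 1≤k k<n s
...   | G₁ , s₁ , e₁ with rows-same m ideal r (Context.plug x (cols-chain n (Context.ideal x) c (Context.here′ x)))
                              (λ { (l , u) → gS (l , m≤n⇒m≤1+n u) }) (proj₁ (cols-good n c (gS (s≤s z≤n , ≤-refl)))) 1≤k k<n s₁
...     | G₂ , s₂ , e₂ = G₂ , s₂ , trans e₁ e₂

-- Reading words

trace : ℕ → Filling → Pattern
trace k F p = maybe (restrict k) nothing (F p)

unrestrict : ℕ → Sym → Letter
unrestrict k (bb ζ) = lt k ζ
unrestrict k (cc ζ) = lt (suc k) ζ

restrict⁻ : ∀ k l {v} → restrict k l ≡ just v → l ≡ unrestrict k v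
restrict⁻ k l e with restrict k l | restricted k l
restrict⁻ k l refl | _ | is-bb = refl
restrict⁻ k l refl | _ | is-cc = refl

restrict⁺ : ∀ k v → restrict k (unrestrict k v) ≡ just v
restrict⁺ k (bb ζ) with restrict k (lt k ζ) | restricted k (lt k ζ)
... | _ | is-bb = refl
... | _ | is-no n _ = ⊥-elim (n refl)
restrict⁺ k (cc ζ) with restrict k (lt (suc k) ζ) | restricted k (lt (suc k) ζ)
... | _ | is-cc = refl
... | _ | is-no _ n = ⊥-elim (n refl)

trace⁻ : ∀ k F p {v} → trace k F p ≡ just v → F p ≡ just (unrestrict k v)
trace⁻ k F p e with F p
... | just l = cong just (restrict⁻ k l e)

trace⁺ : ∀ k F p {v} → F p ≡ just (unrestrict k v) → trace k F p ≡ just v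
trace⁺ k F p {v} e = trans (cong (maybe (restrict k) nothing) e) (restrict⁺ k v)

module _ (k : ℕ) (F : Filling) where

  private
    read : Letter → Walk → Walk
    read l = walkM (restrict k l)

  row-walk : ∀ i n σ → foldr read σ (mapMaybe (λ j → F (i , j)) (reverse (map suc (upTo n)))) ≡
             walk (rowWord (trace k F) n i) σ
  row-walk i zero σ = refl
  row-walk i (suc n) σ = trans (cong (λ L → foldr read σ (mapMaybe (λ j → F (i , j)) L)) suffix)
    (trans (rightmost (F (i , suc n)) refl)
    (trans (cong (walkM (trace k F (i , suc n))) (row-walk i n σ))
    (sym (trans (cong (λ w → walk w σ) (seg-last (λ j → trace k F (i , j)) 0 n))
         (trans (walk-++ (seg (λ j → trace k F (i , j)) 0 n) _ σ) (walk-add (trace k F (i , suc n)) [] _))))))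
    where
    L : List ℕ
    L = reverse (map suc (upTo n))
    suffix : reverse (map suc (upTo (suc n))) ≡ suc n ∷ L
    suffix = trans (cong (λ t → reverse (map suc t)) (sym (upTo-∷ʳ n)))
      (trans (cong reverse (map-++ suc (upTo n) (n ∷ []))) (reverse-++ (map suc (upTo n)) (suc n ∷ [])))
    rightmost : ∀ m → F (i , suc n) ≡ m → foldr read σ (mapMaybe (λ j → F (i , j)) (suc n ∷ L)) ≡
            walkM (trace k F (i , suc n)) (foldr read σ (mapMaybe (λ j → F (i , j)) L))
    rightmost nothing e rewrite e = refl
    rightmost (just l) e rewrite e = refl

  rows-walk : ∀ N f i d → (∀ x → f x ≡ suc (i + x)) →
              foldr read (0 , 0) (concatMap (λ i → mapMaybe (λ j → F (i , j)) (reverse (map suc (upTo N)))) (applyUpTo f d)) ≡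
              rowsWalk (trace k F) N i d
  rows-walk N f i zero h = refl
  rows-walk N f i (suc d) h =
    trans (foldr-++ read (0 , 0) (mapMaybe (λ j → F (f 0 , j)) (reverse (map suc (upTo N)))) _)
    (trans (row-walk (f 0) N _)
      (cong₂ (λ r σ → walk (rowWord (trace k F) N r) σ) (trans (h 0) (cong suc (+-identityʳ i)))
        (rows-walk N (λ x → f (suc x)) (suc i) d λ x → trans (h (suc x)) (cong suc (+-suc i x)))))

  reading-walk : ∀ N → wordWalk k (readingWord N F) ≡ rowsWalk (trace k F) N 0 N
  reading-walk N = trans (cong (λ L → wordWalk k (concatMap (λ i → mapMaybe (λ j → F (i , j)) (reverse (map suc (upTo N)))) L)) (map-upTo suc N))
    (rows-walk N suc 0 N λ _ → refl)

trace-bound : ∀ {k F M p v} → BoundedBy M F → trace k F p ≡ just v → row p ≤ M × col p ≤ M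
trace-bound {k} {F} {p = i , j} b e = b i j (is-just⁺ (trace⁻ k F (i , j) e))

module _ {n : ℕ} {X : Family} {F : Filling} {M k : ℕ} (L : Lists n X F) (b : BoundedBy M F) where

  trace-shown : 1 ≤ k → suc k ≤ n → Shown 𝐁 M (X k) (X (suc k)) (trace k F)
  trace-shown 1≤k k<n = record
    { soundP = λ {p} e → proj₂ (Lists.sound L (trace⁻ k F p e))
    ; coverP = λ {p} m → trace⁺ k F p (Lists.cover L (1≤k , <⇒≤ k<n) m)
    ; soundO = λ {p} e → proj₂ (Lists.sound L (trace⁻ k F p e))
    ; coverO = λ {p} m → trace⁺ k F p (Lists.cover L (s≤s z≤n , k<n) m)
    ; bound = λ {p} → trace-bound {k} {F} {p = p} b }

shown-unique : ∀ {M M' P O G G'} → Shown 𝐁 M P O G → Shown 𝐁 M' P O G' → ∀ p → G p ≡ G' p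
shown-unique {G = G} {G'} s s' p = go (G p) (G' p) refl refl
  where
  module U = Shown s
  module V = Shown s'
  go : ∀ m m' → G p ≡ m → G' p ≡ m' → G p ≡ G' p
  go (just (bb ζ)) m' e _ = trans e (sym (V.coverP (U.soundP e)))
  go (just (cc ζ)) m' e _ = trans e (sym (V.coverO (U.soundO e)))
  go nothing nothing e e' = trans e (sym e')
  go nothing (just (bb ζ)) e e' = trans (U.coverP (V.soundP e')) (sym e')
  go nothing (just (cc ζ)) e e' = trans (U.coverO (V.soundO e')) (sym e')

module _ {G : Pattern} {N : ℕ} (b : ∀ p {v} → G p ≡ just v → row p ≤ N × col p ≤ N) where

  private
    vacant : ∀ p → ¬ (row p ≤ N × col p ≤ N) → G p ≡ nothing
    vacant p n with filled? (G p)
    ... | inj₁ (_ , e) = ⊥-elim (n (b p e))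
    ... | inj₂ e = e

    columns : ∀ e i d → rowsWalk G (N + e) i d ≡ rowsWalk G N i d
    columns e i zero = refl
    columns e i (suc d) = cong₂ walk
      (trans (seg-split (λ j → G (suc i , j)) 0 N e)
        (trans (cong (seg (λ j → G (suc i , j)) 0 N ++_) (seg-empty N e λ c l _ → vacant (suc i , c) λ { (_ , u) → <⇒≱ l u })) (++-identityʳ _)))
      (columns e (suc i) d)

    empty-rows : ∀ e i → N ≤ i → rowsWalk G N i e ≡ (0 , 0)
    empty-rows e i l = cong₂ _,_ (rows-no-cc N i e none) (rows-no-bb N i e none′)
      where
      none : ∀ q → i < row q → NoC (G q)
      none q l' _ f = <⇒≱ (≤-<-trans l l') (proj₁ (b q f))
      none′ : ∀ q → i < row q → NoB (G q)
      none′ q l' _ f = <⇒≱ (≤-<-trans l l') (proj₁ (b q f))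

    lower-rows : ∀ d e i → N ≤ i + d → rowsWalk G N i (d + e) ≡ rowsWalk G N i d
    lower-rows zero e i l = empty-rows e i (subst (N ≤_) (+-identityʳ i) l)
    lower-rows (suc d) e i l = cong (walk (rowWord G N (suc i))) (lower-rows d e (suc i) (subst (N ≤_) (+-suc i d) l))

  rowsWalk-bound : ∀ {M} → N ≤ M → rowsWalk G M 0 M ≡ rowsWalk G N 0 N
  rowsWalk-bound {M} l = subst (λ M → rowsWalk G M 0 M ≡ rowsWalk G N 0 N) (m+[n∸m]≡n l)
    (trans (columns (M ∸ N) 0 (N + (M ∸ N))) (lower-rows N (M ∸ N) 0 ≤-refl))

bounded : ∀ {T} → IsSSYT T → Σ ℕ λ M → BoundedBy M T
bounded (((l , μ , _ , _ , _ , sh) , _) , _) = size l , λ i j e →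
  let r , c = InS-bound l (proj₁ (proj₁ (sh (i , j)) e)) in proj₂ r , proj₂ c

-- The lattice property is demanded for every bound N of F', which need not bound F. Since the walk
-- is independent of the bound, a common larger one can be used.
same-lattice : ∀ {F F'} → IsSSYT F →
               (∀ M → BoundedBy M F → BoundedBy M F' → ∀ k → 1 ≤ k → proj₁ (wordWalk k (readingWord M F)) ≡ proj₁ (wordWalk k (readingWord M F'))) →
               (∀ N → BoundedBy N F → LatticeProperty (readingWord N F)) → ∀ N → BoundedBy N F' → LatticeProperty (readingWord N F')
same-lattice {F} {F'} s h lat N b = walk⇒lattice (readingWord N F') λ k 1≤k →
  trans (cong proj₁ (trans (reading-walk k F' N)
    (trans (sym (rowsWalk-bound {trace k F'} (λ p → trace-bound {k} {F'} {p = p} b) (m≤m+n N _))) (sym (reading-walk k F' M)))))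
  (trans (sym (h M bF bF' k 1≤k)) (lattice⇒walk (readingWord M F) (lat M bF) k 1≤k))
  where
  M : ℕ
  M = N + proj₁ (bounded s)
  bF : BoundedBy M F
  bF i j e = let r , c = proj₂ (bounded s) i j e in ≤-trans r (m≤n+m _ N) , ≤-trans c (m≤n+m _ N)
  bF' : BoundedBy M F'
  bF' i j e = let r , c = b i j e in ≤-trans r (m≤m+n N _) , ≤-trans c (m≤m+n N _)

switching-walk : ∀ {U T T̃ Ũ} → Switching U T T̃ Ũ → ∀ M → BoundedBy M T → BoundedBy M T̃ → ∀ k → 1 ≤ k →
                 proj₁ (wordWalk k (readingWord M T)) ≡ proj₁ (wordWalk k (readingWord M T̃))
switching-walk {U} {T} {T̃} w M b b̃ k 1≤k =
  trans (cong proj₁ (reading-walk k T M)) (trans (go (suc k ≤? n)) (sym (cong proj₁ (reading-walk k T̃ M))))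
  where
  open Switching w
  -- Without letters k+1 and (k+1)′ nothing raises the first coordinate, so for k ≥ n both walks end
  -- at 0.
  flat : ∀ {F X} → Lists n X F → ¬ suc k ≤ n → proj₁ (rowsWalk (trace k F) M 0 M) ≡ 0
  flat {F} L k≮n = rows-no-cc M 0 M λ p _ ζ e → k≮n (proj₂ (proj₁ (Lists.sound L (trace⁻ k F p e))))
  go : Dec (suc k ≤ n) → proj₁ (rowsWalk (trace k T) M 0 M) ≡ proj₁ (rowsWalk (trace k T̃) M 0 M)
  go (no k≮n) = trans (flat listsT k≮n) (sym (flat listsT̃ k≮n))
  go (yes k<n) with rows-same m (InS-ideal sν) rows chain goodS goodT 1≤k k<n (trace-shown listsT b 1≤k k<n)
  ... | G' , s , e = cong proj₁ (trans e (rowsWalk-cong M 0 M λ q _ → sym (shown-unique (trace-shown listsT̃ b̃ 1≤k k<n) s q)))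

theorem6p7 : (S T : Filling) → IsSSYT S → IsSSYT T → Extends T S →
    (T̃ S̃ : Filling) → MSTS S T T̃ S̃ →
    MSTS T̃ S̃ S T × (IsModifiedLRS T → IsModifiedLRS T̃) × (IsModifiedLRS S → IsModifiedLRS S̃)
theorem6p7 U V sU sV ext Ṽ Ũ run =
  Switching.reverse-MSTS w ,
  (λ { (_ , lat) → switching-T̃ w , same-lattice sV (switching-walk w) lat }) ,
  (λ { (_ , lat) → switching-S̃ w , same-lattice sU (λ M b b' k 1≤k → sym (switching-walk w⁻ M b' b k 1≤k)) lat })
  where
  w : Switching U V Ṽ Ũ
  w = switching sU sV ext run
  w⁻ : Switching Ṽ Ũ U V
  w⁻ = switching (switching-T̃ w) (switching-S̃ w) (switching-extends w) (Switching.reverse-MSTS w)
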